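{- The 5-tuple $(\mathfrak D,\ \sqcup\!\sqcup,\ u,\ \Delta,\ \epsilon)$ is a connected graded Hopf algebra of finite type over $\mathbb F_q$, where the grading is by weight: $\mathfrak D=\bigoplus_{n\ge 0}\mathfrak D_n$ with $\mathfrak D_n$ the $\mathbb F_q$-span of the words of weight $n$.
   Context: Let $q$ be a prime power, $\mathbb F_q$ the field with $q$ elements, $\mathbb N=\{1,2,\dots\}$. Let $\Gamma=\{x_{n,\varepsilon}: n\in\mathbb N,\ \varepsilon\in\mathbb F_q^*\}$ be an alphabet; the letter $x_{n,\varepsilon}$ has weight $n$. A word is a finite string of letters; the empty word is denoted $1$. The depth of a word is its number of letters, its weight the sum of the weights of its letters. Let $\mathfrak D$ be the $\mathbb F_q$-vector space with basis the set $\langle\Gamma\rangle$ of all words; concatenation is extended bilinearly. A nonempty word is written $\mathfrak a=x_{a,\alpha}\mathfrak a_-$ with $x_{a,\alpha}$ its first letter. Write $x_j:=x_{j,1}$. For positive integers $r,s,j$ put $\Delta^j_{r,s}=(-1)^{r-1}\binom{j-1}{r-1}+(-1)^{s-1}\binom{j-1}{s-1}\in\mathbb F_q$ if $(q-1)\mid j$ and $\Delta^j_{r,s}=0$ otherwise. The diamond product $\diamond$ and shuffle product $\sqcup\!\sqcup$ are the $\mathbb F_q$-bilinear maps $\mathfrak D\times\mathfrak D\to\mathfrak D$ defined recursively by $1\diamond\mathfrak a=\mathfrak a\diamond 1=\mathfrak a$, $1\sqcup\!\sqcup\mathfrak a=\mathfrak a\sqcup\!\sqcup 1=\mathfrak a$,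 and for nonempty words $\mathfrak a=x_{a,\alpha}\mathfrak a_-$, $\mathfrak b=x_{b,\beta}\mathfrak b_-$: $\mathfrak a\diamond\mathfrak b=x_{a+b,\alpha\beta}(\mathfrak a_-\sqcup\!\sqcup\mathfrak b_-)+\sum_{i+j=a+b}\Delta^j_{a,b}\,x_{i,\alpha\beta}\big(x_{j,1}\sqcup\!\sqcup(\mathfrak a_-\sqcup\!\sqcup\mathfrak b_-)\big)$ (sum over positive integers $i,j$), and $\mathfrak a\sqcup\!\sqcup\mathfrak b=x_{a,\alpha}(\mathfrak a_-\sqcup\!\sqcup\mathfrak b)+x_{b,\beta}(\mathfrak a\sqcup\!\sqcup\mathfrak b_-)+\mathfrak a\diamond\mathfrak b$. The unit $u:\mathbb F_q\to\mathfrak D$ sends $1$ to the empty word; the counit $\epsilon:\mathfrak D\to\mathbb F_q$ is linear with $\epsilon(1)=1$ and $\epsilon(\mathfrak u)=0$ for nonempty words $\mathfrak u$. On $\mathfrak D\otimes\mathfrak D$, $\sqcup\!\sqcup$ acts componentwise: $(a\otimes b)\sqcup\!\sqcup(c\otimes d)=(a\sqcup\!\sqcup c)\otimes(b\sqcup\!\sqcup d)$. For a (possibly empty) word $\mathfrak a=x_{i_1,1}\cdots x_{i_m,1}$ all of whose letters have character $1$, define $[\mathfrak a]=(-1)^m\Delta^{i_1}_{1,w(\mathfrak a)+1}\cdots\Delta^{i_m}_{1,w(\mathfrak a)+1}\,x_{i_1,1}\sqcup\!\sqcup\cdots\sqcup\!\sqcup x_{i_m,1}$, with $[1]=1$. The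 coproduct $\Delta:\mathfrak D\to\mathfrak D\otimes\mathfrak D$ is the linear map defined on words by induction on depth: $\Delta(1)=1\otimes 1$; for a letter, $\Delta(x_{n,\varepsilon})=1\otimes x_{n,\varepsilon}+\sum_{r\in\mathbb N,\ \mathfrak a,\ r+w(\mathfrak a)=n}\binom{r+\operatorname{depth}(\mathfrak a)-2}{\operatorname{depth}(\mathfrak a)}\,x_{r,\varepsilon}\otimes[\mathfrak a]$, where $\mathfrak a$ runs over words (including the empty word) whose letters all have character $1$, and $\binom{a}{b}=a(a-1)\cdots(a-b+1)/b!$ for integers $a$ and $b\ge 0$ (read in $\mathbb F_q$); for a word $\mathfrak u=x_{u,\varepsilon}\mathfrak v$ with $\mathfrak v$ nonempty, writing $\Delta(x_{u,\varepsilon})=1\otimes x_{u,\varepsilon}+\sum a_{u,\varepsilon}\otimes b_{u,\varepsilon}$ as in the previous formula (so each $a_{u,\varepsilon}$ is a letter) and $\Delta(\mathfrak v)=\sum a_{\mathfrak v}\otimes b_{\mathfrak v}$, set $\Delta(\mathfrak u)=1\otimes\mathfrak u+\sum (a_{u,\varepsilon}a_{\mathfrak v})\otimes(b_{u,\varepsilon}\sqcup\!\sqcup b_{\mathfrak v})$ (concatenation in the left factor). -}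

module Defs where

open import Data.Nat as ℕ using (ℕ; zero; suc; _∸_)
open import Data.Nat.Divisibility using (_∣_; _∣?_)
open import Data.Nat.Combinatorics using (_C_)
open import Data.Nat.Primality using (Prime)
open import Data.Integer as ℤ using (ℤ; +_; -[1+_])
open import Data.Fin using (Fin)
open import Data.List using (List; []; _∷_; _++_; map; concatMap; foldr; length; upTo)
open import Data.List.Membership.Propositional using (_∈_)
open import Data.Product using (Σ; ∃; _×_; _,_; proj₁; proj₂)
open import Data.Empty using (⊥)
open import Relation.Nullary using (¬_; Dec; yes; no)
open import Relation.Binary.PropositionalEquality using (_≡_; _≢_; refl; sym; trans; cong; cong₂)
open import Relation.Binary.Definitions using (DecidableEquality)
open import Algebra.Structures using (IsCommutativeRing)
open import Function.Bundles using (_↔_)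

IsPrimePower : ℕ → Set
IsPrimePower q = Σ ℕ λ p → Σ ℕ λ k → Prime p × q ≡ p ℕ.^ suc k

record FiniteField (q : ℕ) : Set₁ where
  infixl 6 _+_
  infixl 7 _*_
  field
    Carrier : Set
    _+_ _*_ : Carrier → Carrier → Carrier
    -_      : Carrier → Carrier
    0# 1#   : Carrier
    isCommutativeRing : IsCommutativeRing _≡_ _+_ _*_ -_ 0# 1#
    _≟_     : DecidableEquality Carrier
    0≢1     : 0# ≢ 1#
    inverse : ∀ x → x ≢ 0# → Σ Carrier λ y → x * y ≡ 1#
    card    : Fin q ↔ Carrier

module Construction (q : ℕ) (𝔽 : FiniteField q) where
  open FiniteField 𝔽 public
  open IsCommutativeRing isCommutativeRing
    using (*-assoc; *-identityʳ; zeroˡ)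

  *-nz : ∀ {x y} → x ≢ 0# → y ≢ 0# → x * y ≢ 0#
  *-nz {x} {y} hx hy e with inverse y hy
  ... | y' , yy' = hx (trans (sym (*-identityʳ x))
                      (trans (cong (x *_) (sym yy'))
                      (trans (sym (*-assoc x y y'))
                      (trans (cong (_* y') e) (zeroˡ y')))))

  1≢0 : 1# ≢ 0#
  1≢0 e = 0≢1 (sym e)

  fromℕ : ℕ → Carrier
  fromℕ zero    = 0#
  fromℕ (suc n) = 1# + fromℕ n

  sgn : ℕ → Carrier
  sgn zero    = 1#
  sgn (suc k) = - sgn k

  -- binomial coefficient binom(a, b) for a ∈ ℤ, b ≥ 0, read in 𝔽:
  -- a(a-1)...(a-b+1)/b!, i.e. (-1)^b binom(n+b, b) for a = -(n+1)
  binomℤ : ℤ → ℕ → Carrier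
  binomℤ (+ n)     b = fromℕ (n C b)
  binomℤ -[1+ n ]  b = sgn b * fromℕ ((n ℕ.+ b) C b)

  -- Δ^j_{r,s} (for positive integers r, s, j)
  Δc : ℕ → ℕ → ℕ → Carrier
  Δc j r s with (q ∸ 1) ∣? j
  ... | yes _ = sgn (r ∸ 1) * fromℕ ((j ∸ 1) C (r ∸ 1))
              + sgn (s ∸ 1) * fromℕ ((j ∸ 1) C (s ∸ 1))
  ... | no  _ = 0#

  -- Letters and words.  A letter x_{n,ε} is stored with pw = n - 1
  -- (so its weight n = suc pw is positive) and character ε ∈ 𝔽*.

  record Letter : Set where
    constructor letter
    field
      pw  : ℕ
      ch  : Carrier
      .nz : ch ≢ 0#
  open Letter public

  lwt : Letter → ℕ
  lwt l = suc (pw l)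

  Word : Set
  Word = List Letter

  weight : Word → ℕ
  weight []      = 0
  weight (l ∷ w) = lwt l ℕ.+ weight w

  depth : Word → ℕ
  depth = length

  -- x_j := x_{j,1}, for j = suc j'
  xₛ : ℕ → Letter
  xₛ j' = letter j' 1# 1≢0

  _≟L_ : DecidableEquality Letter
  letter n a _ ≟L letter m b _ with n ℕ.≟ m | a ≟ b
  ... | yes refl | yes refl = yes refl
  ... | no ne    | _        = no λ e → ne (cong pw e)
  ... | yes _    | no ne    = no λ e → ne (cong ch e)

  _≟W_ : DecidableEquality Word
  [] ≟W [] = yes refl
  [] ≟W (_ ∷ _) = no λ ()
  (_ ∷ _) ≟W [] = no λ ()
  (x ∷ v) ≟W (y ∷ w) with x ≟L y | v ≟W w
  ... | yes refl | yes refl = yes refl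
  ... | no ne    | _        = no λ e → ne (cong (λ { [] → x ; (z ∷ _) → z }) e)
  ... | yes _    | no ne    = no λ e → ne (cong (λ { [] → v ; (_ ∷ z) → z }) e)

  -- 𝔇: finite formal 𝔽-linear combinations of words, 𝔇⊗𝔇 and 𝔇⊗𝔇⊗𝔇:
  -- formal combinations of pairs / triples of words.  Two
  -- representatives are equal iff all coefficients agree.

  𝔇 : Set
  𝔇 = List (Carrier × Word)

  𝔇² : Set
  𝔇² = List (Carrier × Word × Word)

  𝔇³ : Set
  𝔇³ = List (Carrier × Word × Word × Word)

  sumF : List Carrier → Carrier
  sumF = foldr _+_ 0#

  coeff : Word → 𝔇 → Carrier
  coeff w d = sumF (map (λ { (c , v) → pick (v ≟W w) c }) d)
    where
    pick : ∀ {P : Set} → Dec P → Carrier → Carrier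
    pick (yes _) c = c
    pick (no _)  _ = 0#

  coeff² : Word → Word → 𝔇² → Carrier
  coeff² w₁ w₂ d = sumF (map (λ { (c , v₁ , v₂) → pick (v₁ ≟W w₁) (v₂ ≟W w₂) c }) d)
    where
    pick : ∀ {P Q : Set} → Dec P → Dec Q → Carrier → Carrier
    pick (yes _) (yes _) c = c
    pick _ _ _ = 0#

  coeff³ : Word → Word → Word → 𝔇³ → Carrier
  coeff³ w₁ w₂ w₃ d =
    sumF (map (λ { (c , v₁ , v₂ , v₃) → pick (v₁ ≟W w₁) (v₂ ≟W w₂) (v₃ ≟W w₃) c }) d)
    where
    pick : ∀ {P Q R : Set} → Dec P → Dec Q → Dec R → Carrier → Carrier
    pick (yes _) (yes _) (yes _) c = c
    pick _ _ _ _ = 0#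

  infix 4 _≈_ _≈²_ _≈³_
  _≈_ : 𝔇 → 𝔇 → Set
  a ≈ b = ∀ w → coeff w a ≡ coeff w b

  _≈²_ : 𝔇² → 𝔇² → Set
  a ≈² b = ∀ w₁ w₂ → coeff² w₁ w₂ a ≡ coeff² w₁ w₂ b

  _≈³_ : 𝔇³ → 𝔇³ → Set
  a ≈³ b = ∀ w₁ w₂ w₃ → coeff³ w₁ w₂ w₃ a ≡ coeff³ w₁ w₂ w₃ b

  ⟦_⟧ : Word → 𝔇
  ⟦ w ⟧ = (1# , w) ∷ []

  scale : Carrier → 𝔇 → 𝔇
  scale c = map (λ { (d , w) → (c * d , w) })

  pre : Letter → 𝔇 → 𝔇
  pre x = map (λ { (c , w) → (c , x ∷ w) })

  -- Shuffle and diamond products on words.  The natural-number argument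
  -- is fuel; it is always called with fuel ≥ total depth, which is
  -- enough for the recursion never to hit the (unreachable) zero case.

  mutual
    shN : ℕ → Word → Word → 𝔇
    shN _ [] b = ⟦ b ⟧
    shN _ (x ∷ a) [] = ⟦ x ∷ a ⟧
    shN zero (_ ∷ _) (_ ∷ _) = []
    shN (suc n) (x ∷ a) (y ∷ b) =
      pre x (shN n a (y ∷ b)) ++ pre y (shN n (x ∷ a) b) ++ dmN n x a y b

    -- 𝔞 ⋄ 𝔟 for 𝔞 = x a, 𝔟 = y b
    dmN : ℕ → Letter → Word → Letter → Word → 𝔇
    dmN n (letter a' α hα) a (letter b' β hβ) b =
      pre (letter (suc (a' ℕ.+ b')) (α * β) (*-nz hα hβ)) (shN n a b)
      ++ concatMap term (upTo (suc (a' ℕ.+ b')))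
      where
      -- i = suc i', j = suc j' with i + j = a + b
      term : ℕ → 𝔇
      term i' = let j' = a' ℕ.+ b' ∸ i' in
        scale (Δc (suc j') (suc a') (suc b'))
          (pre (letter i' (α * β) (*-nz hα hβ))
               (concatMap (λ { (c , w) → scale c (shN n (xₛ j' ∷ []) w) })
                          (shN n a b)))

  infixl 7 _⧢_
  _⧢_ : 𝔇 → 𝔇 → 𝔇
  a ⧢ b = concatMap (λ { (c , v) → concatMap (λ { (d , w) →
            scale (c * d) (shN (length v ℕ.+ length w) v w) }) b }) a

  _⋄_ : 𝔇 → 𝔇 → 𝔇
  a ⋄ b = concatMap (λ { (c , v) → concatMap (λ { (d , w) →
            scale (c * d) (dm v w) }) b }) a
    where
    dm : Word → Word → 𝔇
    dm [] w = ⟦ w ⟧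
    dm (x ∷ v) [] = ⟦ x ∷ v ⟧
    dm (x ∷ v) (y ∷ w) = dmN (length v ℕ.+ length w) x v y w

  _⊗_ : 𝔇 → 𝔇 → 𝔇²
  a ⊗ b = concatMap (λ { (c , v) → map (λ { (d , w) → (c * d , v , w) }) b }) a

  _⧢²_ : 𝔇² → 𝔇² → 𝔇²
  a ⧢² b = concatMap (λ { (c , a₁ , a₂) → concatMap (λ { (d , b₁ , b₂) →
             map (λ { (e , w₁ , w₂) → (c * d * e , w₁ , w₂) })
                 (( ⟦ a₁ ⟧ ⧢ ⟦ b₁ ⟧) ⊗ (⟦ a₂ ⟧ ⧢ ⟦ b₂ ⟧)) }) b }) a

  u : Carrier → 𝔇
  u c = (c , []) ∷ []

  εw : Word → Carrier
  εw []      = 1#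
  εw (_ ∷ _) = 0#

  ε : 𝔇 → Carrier
  ε d = sumF (map (λ { (c , w) → c * εw w }) d)

  -- compositions of m (ordered lists of positive integers summing to m);
  -- these are the weight sequences of words of weight m all of whose
  -- letters have character 1.
  compsS : ℕ → List (List ℕ)          -- compositions of suc m
  compsS zero    = (1 ∷ []) ∷ []
  compsS (suc m) = concatMap (λ c → (1 ∷ c) ∷ bump c ∷ []) (compsS m)
    where
    bump : List ℕ → List ℕ
    bump []      = []
    bump (k ∷ c) = suc k ∷ c

  comps : ℕ → List (List ℕ)
  comps zero    = [] ∷ []
  comps (suc m) = compsS m

  charOneWord : List ℕ → Word
  charOneWord = map (λ i → xₛ (i ∸ 1))

  prodF : List Carrier → Carrier
  prodF = foldr _*_ 1#

  bracket : List ℕ → 𝔇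
  bracket is =
    scale (sgn (length is) * prodF (map (λ i → Δc i 1 (weight (charOneWord is) ℕ.+ 1)) is))
          (foldr (λ i acc → ⟦ xₛ (i ∸ 1) ∷ [] ⟧ ⧢ acc) ⟦ [] ⟧ is)

  -- the terms of Δ(x_{n,ε}) other than 1 ⊗ x_{n,ε}: r ranges over 1..n,
  -- 𝔞 over character-1 words of weight n - r
  ΔletterRest : Letter → List (Carrier × Letter × 𝔇)
  ΔletterRest (letter n' e he) =
    concatMap (λ r' → map (λ is →
        ( binomℤ (+ suc r' ℤ.+ + length is ℤ.- + 2) (length is)
        , letter r' e he
        , bracket is))
      (comps (n' ∸ r')))
      (upTo (suc n'))

  Δw : Word → 𝔇²
  Δw [] = (1# , [] , []) ∷ []
  Δw (x ∷ v) = (1# , [] , x ∷ v) ∷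
    concatMap (λ { (c , l , bx) → concatMap (λ { (c' , av , bv) →
        map (λ { (e , w) → (c * c' * e , l ∷ av , w) }) (bx ⧢ ⟦ bv ⟧) })
      (Δw v) }) (ΔletterRest x)

  Δ : 𝔇 → 𝔇²
  Δ d = concatMap (λ { (c , w) → map (λ { (e , w₁ , w₂) → (c * e , w₁ , w₂) }) (Δw w) }) d

  Δ⊗id : 𝔇² → 𝔇³
  Δ⊗id = concatMap (λ { (c , w₁ , w₂) →
    map (λ { (e , a , b) → (c * e , a , b , w₂) }) (Δw w₁) })

  id⊗Δ : 𝔇² → 𝔇³
  id⊗Δ = concatMap (λ { (c , w₁ , w₂) →
    map (λ { (e , a , b) → (c * e , w₁ , a , b) }) (Δw w₂) })

  ε⊗id : 𝔇² → 𝔇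
  ε⊗id = map (λ { (c , w₁ , w₂) → (c * εw w₁ , w₂) })

  id⊗ε : 𝔇² → 𝔇
  id⊗ε = map (λ { (c , w₁ , w₂) → (c * εw w₂ , w₁) })

  linExt : (Word → 𝔇) → 𝔇 → 𝔇
  linExt f = concatMap (λ { (c , w) → scale c (f w) })

  mult∘⊗ : (Word → 𝔇) → (Word → 𝔇) → 𝔇² → 𝔇
  mult∘⊗ f g = concatMap (λ { (c , w₁ , w₂) → scale c (f w₁ ⧢ g w₂) })

  record IsConnectedGradedHopfAlgebraOfFiniteType : Set where
    field
      ⧢-assoc     : ∀ a b c → (a ⧢ b) ⧢ c ≈ a ⧢ (b ⧢ c)
      ⧢-identityˡ : ∀ a → u 1# ⧢ a ≈ a
      ⧢-identityʳ : ∀ a → a ⧢ u 1# ≈ a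
      Δ-coassoc   : ∀ a → Δ⊗id (Δ a) ≈³ id⊗Δ (Δ a)
      ε-counitˡ   : ∀ a → ε⊗id (Δ a) ≈ a
      ε-counitʳ   : ∀ a → id⊗ε (Δ a) ≈ a
      Δ-⧢         : ∀ a b → Δ (a ⧢ b) ≈² Δ a ⧢² Δ b
      Δ-unit      : Δ (u 1#) ≈² u 1# ⊗ u 1#
      ε-⧢         : ∀ a b → ε (a ⧢ b) ≡ ε a * ε b
      ε-unit      : ε (u 1#) ≡ 1#
      antipode    : Σ (Word → 𝔇) λ S →
                      (∀ a → mult∘⊗ S ⟦_⟧ (Δ a) ≈ u (ε a))
                    × (∀ a → mult∘⊗ ⟦_⟧ S (Δ a) ≈ u (ε a))
      ⧢-graded    : ∀ v w x → coeff x (⟦ v ⟧ ⧢ ⟦ w ⟧) ≢ 0#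
                      → weight x ≡ weight v ℕ.+ weight w
      Δ-graded    : ∀ w x₁ x₂ → coeff² x₁ x₂ (Δw w) ≢ 0#
                      → weight x₁ ℕ.+ weight x₂ ≡ weight w
      ε-graded    : ∀ w → εw w ≢ 0# → weight w ≡ 0
      connected   : ∀ w → weight w ≡ 0 → w ≡ []
      finiteType  : ∀ n → Σ (List Word) λ L → ∀ w → weight w ≡ n → w ∈ L

{-# OPTIONS --safe #-}
-- Put P(t) = 1 + Σ x_j t^j over the positive multiples j of q − 1, and X(s) = Σ x_{n,ε} s^{n-1}.
-- On letters the product rule reads (s − t) X(s) ⋄ X(t) = (X(s) − X(t)) P(s − t), the
-- coefficients Δ^j being those of a partial fraction expansion, and associativity reduces to
-- letters, where it follows from
--   (a + b) P(a) P(b) = b P(a + b) P(a) + a P(a + b) P(b),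
-- that is, from the additivity of E(t) = t / P(t).  The latter holds because the power sums
-- Σ (b − μ a)^(l−1) over μ ∈ 𝔽 are invariant under b ↦ b + a.  The coproduct is
-- Δ(x_n) = 1 ⊗ x_n + Σ_r x_r ⊗ [t^(n−1)] E(t)^(r−1), the substitution X(s) ↦ X(E(s)).  Hence
-- multiplicativity is the product rule with E(s), E(t) substituted for s, t, and coassociativity
-- is Δ(E) = E ∘ E.  The antipode is a convolution inverse found by recursion on the weight.
module Submission where

open import Defs
open import Level using (0ℓ)
open import Algebra.Bundles using (CommutativeRing; RawRing; CommutativeMonoid)
open import Algebra.Structures using (IsCommutativeRing)
open import Algebra.Solver.Ring.AlmostCommutativeRing using (fromCommutativeRing; _-Raw-AlmostCommutative⟶_)
import Algebra.Solver.Ring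
import Algebra.Properties.Ring
import Algebra.Properties.AbelianGroup
import Algebra.Properties.Group
import Algebra.Properties.Semiring.Exp
import Algebra.Properties.CommutativeSemiring.Exp
import Algebra.Properties.Semiring.Mult
import Algebra.Properties.CommutativeMonoid.Sum
import Relation.Binary.Reasoning.Setoid
open import Data.Nat as ℕ using (ℕ; zero; suc; _∸_)
import Data.Nat.Properties as ℕₚ
open import Data.Nat.Divisibility using (_∣_; _∣?_; divides)
import Data.Nat.Divisibility as ∣
open import Data.Nat.DivMod using (_%_; m%n<n; m≡m%n+[m/n]*n)
open import Data.Nat.Combinatorics using (_C_; nCk≡nC[n∸k]; nCk+nC[k+1]≡[n+1]C[k+1])
open import Data.Nat.Combinatorics.Specification using (k>n⇒nCk≡0)
open import Data.Nat.Solver using (module +-*-Solver)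
open import Data.Integer as ℤ using (ℤ; +_)
open import Data.Fin as Fin using (Fin)
import Data.Fin.Properties as Finₚ
open import Data.Fin.Permutation using (Permutation; permutation)
open import Data.List using (List; []; _∷_; _++_; map; concatMap; foldr; length; upTo; applyUpTo; allFin)
open import Data.List.Membership.Propositional using (_∈_)
open import Data.List.Membership.Propositional.Properties using (∈-map⁺; ∈-++⁺ˡ; ∈-++⁺ʳ; ∈-allFin; ∈-upTo⁺)
open import Data.List.Relation.Unary.Any using (here; there)
open import Data.List.Relation.Unary.All as All using (All; []; _∷_)
import Data.List.Relation.Unary.All.Properties as Allₚ
open import Data.Maybe using (Maybe; just; nothing)
open import Data.Product using (_×_; _,_; proj₁; proj₂)
open import Data.Empty using (⊥-elim-irr)
open import Function using (_∘_; id)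
open import Function.Bundles using (Inverse)
open import Relation.Nullary using (¬_; Dec; yes; no; contradiction)
open import Relation.Binary.PropositionalEquality using (_≡_; _≢_; refl; sym; trans; cong; cong₂; subst; module ≡-Reasoning)
import Relation.Binary.Definitions
import Data.List.Properties as Listₚ

-- Formal combinations are lists, compared by their values on every functional on the basis.
-- Bilinear maps then become nested sums, regrouping becomes an exchange of summations, and no
-- normal forms occur. The order of the argument is the main obstacle: additivity of E is needed for
-- associativity, that is, before the shuffle product is known to make `𝔇` a ring. The identity for
-- P is therefore proved for a table of elements `T`, `θ` of an arbitrary commutative 𝔽-algebra that
-- obeys the multiplication table of letters, and is then applied through linear images of `𝔇`. Only
-- afterwards does `𝔇` itself serve as a coefficient ring, for the coproduct. The generating
-- identities carry factors such as s - t. Since `𝔇` is not shown to be a domain, division is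
-- replaced by cancellation of non-zero-divisors in iterated power series rings, where a series with
-- regular constant term is regular. All identities are homogeneous and are stated degree by degree,
-- as sums over i + j = n. Characters only multiply along, so the generating functions involve the
-- weights alone.

module IntegerSolver (R : CommutativeRing 0ℓ 0ℓ) where
  open CommutativeRing R renaming (refl to ≈-refl; sym to ≈-sym; trans to ≈-trans)
  open Algebra.Properties.Semiring.Mult semiring using (×-homo-+; ×1-homo-*) renaming (_×_ to _·_)
  open Algebra.Properties.Ring ring
  open Algebra.Properties.AbelianGroup +-abelianGroup using (⁻¹-∙-comm)
  open Relation.Binary.Reasoning.Setoid setoid

  private
    -- Integers as differences of naturals, kept in lowest terms so that equal
    -- coefficients are syntactically equal in normal forms.
    norm : ℕ × ℕ → ℕ × ℕ
    norm (suc a , suc b) = norm (a , b)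
    norm p               = p

    infixl 6 _⊕_
    infixl 7 _⊛_
    _⊕_ _⊛_ : ℕ × ℕ → ℕ × ℕ → ℕ × ℕ
    (a , b) ⊕ (c , d) = norm (a ℕ.+ c , b ℕ.+ d)
    (a , b) ⊛ (c , d) = norm (a ℕ.* c ℕ.+ b ℕ.* d , a ℕ.* d ℕ.+ b ℕ.* c)

    neg : ℕ × ℕ → ℕ × ℕ
    neg (a , b) = b , a

    ν : ℕ → Carrier
    ν n = n · 1#

    val : ℕ × ℕ → Carrier
    val (a , b) = ν a - ν b

    +-interchange : ∀ a b c d → (a + c) - (b + d) ≈ (a - b) + (c - d)
    +-interchange a b c d = begin
      (a + c) + - (b + d)     ≈⟨ +-congˡ (≈-sym (⁻¹-∙-comm b d)) ⟩
      (a + c) + (- b + - d)   ≈⟨ +-assoc a c _ ⟩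
      a + (c + (- b + - d))   ≈⟨ +-congˡ (≈-sym (+-assoc c _ _)) ⟩
      a + ((c + - b) + - d)   ≈⟨ +-congˡ (+-congʳ (+-comm c _)) ⟩
      a + ((- b + c) + - d)   ≈⟨ +-congˡ (+-assoc _ c _) ⟩
      a + (- b + (c + - d))   ≈⟨ +-assoc a _ _ ⟨
      (a - b) + (c - d)       ∎

    val-norm : ∀ p → val (norm p) ≈ val p
    val-norm (zero , b)      = ≈-refl
    val-norm (suc a , zero)  = ≈-refl
    val-norm (suc a , suc b) = begin
      val (norm (a , b))            ≈⟨ val-norm (a , b) ⟩
      ν a - ν b                     ≈⟨ +-identityˡ _ ⟨
      0# + (ν a - ν b)              ≈⟨ +-congʳ (-‿inverseʳ 1#) ⟨
      (1# - 1#) + (ν a - ν b)       ≈⟨ +-interchange 1# 1# (ν a) (ν b) ⟨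
      (1# + ν a) - (1# + ν b)       ∎

    val-⊕ : ∀ p r → val (p ⊕ r) ≈ val p + val r
    val-⊕ (a , b) (c , d) = begin
      val (norm (a ℕ.+ c , b ℕ.+ d))  ≈⟨ val-norm (a ℕ.+ c , b ℕ.+ d) ⟩
      ν (a ℕ.+ c) - ν (b ℕ.+ d)       ≈⟨ +-cong (×-homo-+ 1# a c) (-‿cong (×-homo-+ 1# b d)) ⟩
      (ν a + ν c) - (ν b + ν d)       ≈⟨ +-interchange (ν a) (ν b) (ν c) (ν d) ⟩
      (ν a - ν b) + (ν c - ν d)       ∎

    val-⊛ : ∀ p r → val (p ⊛ r) ≈ val p * val r
    val-⊛ (a , b) (c , d) = begin
      val (norm (a ℕ.* c ℕ.+ b ℕ.* d , a ℕ.* d ℕ.+ b ℕ.* c))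
        ≈⟨ val-norm (a ℕ.* c ℕ.+ b ℕ.* d , a ℕ.* d ℕ.+ b ℕ.* c) ⟩
      ν (a ℕ.* c ℕ.+ b ℕ.* d) - ν (a ℕ.* d ℕ.+ b ℕ.* c)
        ≈⟨ +-cong (sum-of-products a c b d) (-‿cong (sum-of-products a d b c)) ⟩
      (ν a * ν c + ν b * ν d) - (ν a * ν d + ν b * ν c)
        ≈⟨ +-congˡ (-‿cong (+-comm _ _)) ⟩
      (ν a * ν c + ν b * ν d) - (ν b * ν c + ν a * ν d)
        ≈⟨ +-interchange _ _ _ _ ⟩
      (ν a * ν c - ν b * ν c) + (ν b * ν d - ν a * ν d)
        ≈⟨ +-cong (≈-sym ([y-z]x≈yx-zx (ν c) (ν a) (ν b))) (≈-sym ([y-z]x≈yx-zx (ν d) (ν b) (ν a))) ⟩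
      (ν a - ν b) * ν c + (ν b - ν a) * ν d
        ≈⟨ +-congˡ (*-congʳ (≈-sym (negated (ν a) (ν b)))) ⟩
      (ν a - ν b) * ν c + (- (ν a - ν b)) * ν d
        ≈⟨ +-congˡ (≈-trans (≈-sym (-‿distribˡ-* _ _)) (-‿distribʳ-* _ _)) ⟩
      (ν a - ν b) * ν c + (ν a - ν b) * - ν d
        ≈⟨ distribˡ _ _ _ ⟨
      (ν a - ν b) * (ν c - ν d) ∎
      where
      sum-of-products : ∀ a c b d → ν (a ℕ.* c ℕ.+ b ℕ.* d) ≈ ν a * ν c + ν b * ν d
      sum-of-products a c b d = ≈-trans (×-homo-+ 1# (a ℕ.* c) (b ℕ.* d)) (+-cong (×1-homo-* a c) (×1-homo-* b d))
      negated : ∀ x y → - (x - y) ≈ y - x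
      negated x y = begin
        - (x + - y)     ≈⟨ ⁻¹-∙-comm x (- y) ⟨
        - x + - - y     ≈⟨ +-congˡ (-‿involutive y) ⟩
        - x + y         ≈⟨ +-comm _ _ ⟩
        y - x           ∎

    val-neg : ∀ p → val (neg p) ≈ - val p
    val-neg (a , b) = begin
      ν b - ν a        ≈⟨ +-comm _ _ ⟩
      - ν a + ν b      ≈⟨ +-congˡ (-‿involutive _) ⟨
      - ν a + - - ν b  ≈⟨ ⁻¹-∙-comm _ _ ⟩
      - (ν a - ν b)    ∎

    -- Makes the constants 0 and 1 evaluate to 0# and 1# on the nose.
    val₀ : ℕ × ℕ → Carrier
    val₀ (0 , 0) = 0#
    val₀ (1 , 0) = 1#
    val₀ p       = val p

    val₀≈val : ∀ p → val₀ p ≈ val p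
    val₀≈val (0 , 0)           = ≈-sym (-‿inverseʳ 0#)
    val₀≈val (1 , 0)           = ≈-sym (≈-trans (+-cong (+-identityʳ 1#) (≈-trans (≈-sym (+-identityˡ _)) (-‿inverseʳ 0#))) (+-identityʳ 1#))
    val₀≈val (0 , suc _)       = ≈-refl
    val₀≈val (1 , suc _)       = ≈-refl
    val₀≈val (suc (suc _) , _) = ≈-refl

    coefficients : RawRing 0ℓ 0ℓ
    coefficients = record
      { Carrier = ℕ × ℕ ; _≈_ = _≡_ ; _+_ = _⊕_ ; _*_ = _⊛_ ; -_ = neg ; 0# = 0 , 0 ; 1# = 1 , 0 }

    morphism : coefficients -Raw-AlmostCommutative⟶ fromCommutativeRing R
    morphism = record
      { ⟦_⟧ = val₀
      ; +-homo = λ p r → ≈-trans (val₀≈val (p ⊕ r)) (≈-trans (val-⊕ p r) (≈-sym (+-cong (val₀≈val p) (val₀≈val r))))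
      ; *-homo = λ p r → ≈-trans (val₀≈val (p ⊛ r)) (≈-trans (val-⊛ p r) (≈-sym (*-cong (val₀≈val p) (val₀≈val r))))
      ; -‿homo = λ p → ≈-trans (val₀≈val (neg p)) (≈-trans (val-neg p) (≈-sym (-‿cong (val₀≈val p))))
      ; 0-homo = ≈-refl
      ; 1-homo = ≈-refl }

    val≟ : ∀ p r → Maybe (val₀ p ≈ val₀ r)
    val≟ (a , b) (c , d) with a ℕ.≟ c | b ℕ.≟ d
    ... | yes refl | yes refl = just ≈-refl
    ... | _        | _        = nothing

  open Algebra.Solver.Ring coefficients (fromCommutativeRing R) morphism val≟ public
    using (Polynomial; solve; _:=_; _:+_; _:*_; _:-_; :-_; con)

  :1 :0 : ∀ {n} → Polynomial n
  :1 = con (1 , 0)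
  :0 = con (0 , 0)

-- Sums over the antidiagonal i + j = n.

module Antidiagonal (R : CommutativeRing 0ℓ 0ℓ) where
  open CommutativeRing R renaming (refl to ≈-refl; sym to ≈-sym; trans to ≈-trans)
  open Algebra.Properties.Ring ring
  open IntegerSolver R
  open Relation.Binary.Reasoning.Setoid setoid

  -- Both indices are passed to the summand, so that no truncated subtraction `n ∸ i` occurs and the
  -- roles of `i` and `j` stay symmetric.
  conv : ℕ → (ℕ → ℕ → Carrier) → Carrier
  conv zero    f = f 0 0
  conv (suc n) f = f 0 (suc n) + conv n (λ i j → f (suc i) j)

  conv-cong : ∀ n {f g} → (∀ i j → i ℕ.+ j ≡ n → f i j ≈ g i j) → conv n f ≈ conv n g
  conv-cong zero    h = h 0 0 refl
  conv-cong (suc n) h = +-cong (h 0 (suc n) refl) (conv-cong n λ i j e → h (suc i) j (cong suc e))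

  conv-ext : ∀ n {f g} → (∀ i j → f i j ≈ g i j) → conv n f ≈ conv n g
  conv-ext n h = conv-cong n λ i j _ → h i j

  conv-zero : ∀ n {f} → (∀ i j → i ℕ.+ j ≡ n → f i j ≈ 0#) → conv n f ≈ 0#
  conv-zero zero    h = h 0 0 refl
  conv-zero (suc n) h =
    ≈-trans (+-cong (h 0 (suc n) refl) (conv-zero n λ i j e → h (suc i) j (cong suc e))) (+-identityˡ 0#)

  conv-+ : ∀ n f g → conv n (λ i j → f i j + g i j) ≈ conv n f + conv n g
  conv-+ zero    f g = ≈-refl
  conv-+ (suc n) f g = ≈-trans (+-congˡ (conv-+ n _ _))
    (solve 4 (λ a b c d → (a :+ b) :+ (c :+ d) := (a :+ c) :+ (b :+ d)) ≈-refl _ _ _ _)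

  conv-*ˡ : ∀ n c f → c * conv n f ≈ conv n (λ i j → c * f i j)
  conv-*ˡ zero    c f = ≈-refl
  conv-*ˡ (suc n) c f = ≈-trans (distribˡ _ _ _) (+-congˡ (conv-*ˡ n c _))

  conv-*ʳ : ∀ n c f → conv n f * c ≈ conv n (λ i j → f i j * c)
  conv-*ʳ n c f = ≈-trans (*-comm _ _) (≈-trans (conv-*ˡ n c f) (conv-ext n λ i j → *-comm _ _))

  conv-neg : ∀ n f → - conv n f ≈ conv n (λ i j → - f i j)
  conv-neg n f = ≈-trans (≈-sym (-1*x≈-x _)) (≈-trans (conv-*ˡ n _ f) (conv-ext n λ i j → -1*x≈-x _))

  conv-last : ∀ n f → conv (suc n) f ≈ conv n (λ i j → f i (suc j)) + f (suc n) 0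
  conv-last zero    f = ≈-refl
  conv-last (suc n) f = ≈-trans (+-congˡ (conv-last n λ i j → f (suc i) j)) (≈-sym (+-assoc _ _ _))

  conv-comm : ∀ n f → conv n f ≈ conv n (λ i j → f j i)
  conv-comm zero    f = ≈-refl
  conv-comm (suc n) f = begin
    f 0 (suc n) + conv n (λ i j → f (suc i) j)  ≈⟨ +-comm _ _ ⟩
    conv n (λ i j → f (suc i) j) + f 0 (suc n)  ≈⟨ +-congʳ (conv-comm n _) ⟩
    conv n (λ i j → f (suc j) i) + f 0 (suc n)  ≈⟨ conv-last n (λ i j → f j i) ⟨
    conv (suc n) (λ i j → f j i)                ∎

  conv-swap : ∀ n m (f : ℕ → ℕ → ℕ → ℕ → Carrier) →
    conv n (λ i j → conv m (λ k l → f i j k l)) ≈ conv m (λ k l → conv n (λ i j → f i j k l))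
  conv-swap zero    m f = ≈-refl
  conv-swap (suc n) m f = ≈-trans (+-congˡ (conv-swap n m _)) (≈-sym (conv-+ m _ _))

  -- Both sides run over i + j + k = n; this is what makes the Cauchy product associative.
  conv-assoc : ∀ n (f : ℕ → ℕ → ℕ → Carrier) →
    conv n (λ i q → conv q (λ j k → f i j k)) ≈ conv n (λ p k → conv p (λ i j → f i j k))
  conv-assoc zero    f = ≈-refl
  conv-assoc (suc n) f = begin
    (f 0 0 (suc n) + conv n (λ j k → f 0 (suc j) k)) + conv n (λ i q → conv q (λ j k → f (suc i) j k))
      ≈⟨ +-congˡ (conv-assoc n λ i → f (suc i)) ⟩
    (f 0 0 (suc n) + conv n (λ j k → f 0 (suc j) k)) + conv n (λ p k → conv p (λ i j → f (suc i) j k))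
      ≈⟨ +-assoc _ _ _ ⟩
    f 0 0 (suc n) + (conv n (λ j k → f 0 (suc j) k) + conv n (λ p k → conv p (λ i j → f (suc i) j k)))
      ≈⟨ +-congˡ (≈-sym (conv-+ n _ _)) ⟩
    f 0 0 (suc n) + conv n (λ p k → f 0 (suc p) k + conv p (λ i j → f (suc i) j k)) ∎

  conv-rotate : ∀ n (f : ℕ → ℕ → ℕ → Carrier) →
    conv n (λ p k → conv p (λ i j → f i j k)) ≈ conv n (λ j q → conv q (λ i k → f i j k))
  conv-rotate n f = begin
    conv n (λ p k → conv p (λ i j → f i j k))  ≈⟨ conv-ext n (λ p k → conv-comm p _) ⟩
    conv n (λ p k → conv p (λ j i → f i j k))  ≈⟨ conv-assoc n (λ j i k → f i j k) ⟨
    conv n (λ j q → conv q (λ i k → f i j k))  ∎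

  -- Four indices of total n are grouped as (l + h) + (l′ + h′) or as (l + l′) + (h + h′). This is
  -- the regrouping that occurs when tensors are multiplied factor by factor.
  conv-interchange : ∀ n (f : ℕ → ℕ → ℕ → ℕ → Carrier) →
    conv n (λ i j → conv i (λ l h → conv j (λ l′ h′ → f l h l′ h′)))
      ≈ conv n (λ L H → conv L (λ l l′ → conv H (λ h h′ → f l h l′ h′)))
  conv-interchange n f = begin
    conv n (λ i j → conv i (λ l h → conv j (λ l′ h′ → f l h l′ h′)))
      ≈⟨ conv-assoc n (λ l h j → conv j (λ l′ h′ → f l h l′ h′)) ⟨
    conv n (λ l q → conv q (λ h j → conv j (λ l′ h′ → f l h l′ h′)))
      ≈⟨ conv-ext n (λ l q → ≈-trans (conv-assoc q (λ h l′ h′ → f l h l′ h′)) (conv-rotate q (λ h l′ h′ → f l h l′ h′))) ⟩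
    conv n (λ l q → conv q (λ l′ H → conv H (λ h h′ → f l h l′ h′)))
      ≈⟨ conv-assoc n (λ l l′ H → conv H (λ h h′ → f l h l′ h′)) ⟩
    conv n (λ L H → conv L (λ l l′ → conv H (λ h h′ → f l h l′ h′))) ∎

  conv-single : ∀ n k l (f : ℕ → ℕ → Carrier) → k ℕ.+ l ≡ n →
    (∀ i j → i ≢ k → f i j ≈ 0#) → conv n f ≈ f k l
  conv-single zero    zero    zero    f e z = ≈-refl
  conv-single (suc n) zero    l       f refl z =
    ≈-trans (+-congˡ (conv-zero n λ i j _ → z (suc i) j λ ())) (+-identityʳ _)
  conv-single (suc n) (suc k) l       f e z = ≈-trans (+-cong (z 0 (suc n) λ ())
    (conv-single n k l _ (ℕₚ.suc-injective e) λ i j i≢k → z (suc i) j (λ p → i≢k (ℕₚ.suc-injective p)))) (+-identityˡ _)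

-- Sums and products over all elements of the finite field.

module FieldSums (q : ℕ) (𝔽 : FiniteField q) (M : CommutativeMonoid 0ℓ 0ℓ) where
  open FiniteField 𝔽 using () renaming (Carrier to K)
  open Inverse (FiniteField.card 𝔽) using (to; from; strictlyInverseˡ; strictlyInverseʳ)
  open CommutativeMonoid M using (_≈_; _∙_; ∙-cong; identityˡ; identityʳ)
    renaming (Carrier to A; ε to 𝟘; refl to ≈-refl; sym to ≈-sym; trans to ≈-trans; reflexive to ≈-reflexive)
  open Algebra.Properties.CommutativeMonoid.Sum M

  -- The target is any commutative monoid, so that one development serves sums in an algebra and
  -- products in the field.
  total : (K → A) → A
  total g = sum (g ∘ to)

  total-cong : ∀ {f g} → (∀ x → f x ≈ g x) → total f ≈ total g
  total-cong h = sum-cong-≋ (λ i → h (to i))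

  total-∙ : ∀ f g → total (λ x → f x ∙ g x) ≈ total f ∙ total g
  total-∙ f g = ∑-distrib-+ (f ∘ to) (g ∘ to)

  total-permute : ∀ (π π⁻ : K → K) → (∀ x → π (π⁻ x) ≡ x) → (∀ x → π⁻ (π x) ≡ x) →
    ∀ g → total g ≈ total (g ∘ π)
  total-permute π π⁻ ππ⁻ π⁻π g = ≈-trans (∑-permute (g ∘ to) perm)
      (sum-cong-≋ λ i → ≈-reflexive (cong g (strictlyInverseˡ (π (to i)))))
    where
    perm : Permutation q q
    perm = permutation (λ i → from (π (to i))) (λ i → from (π⁻ (to i)))
      (λ i → trans (cong (from ∘ π) (strictlyInverseˡ _)) (trans (cong from (ππ⁻ (to i))) (strictlyInverseʳ i)))
      (λ i → trans (cong (from ∘ π⁻) (strictlyInverseˡ _)) (trans (cong from (π⁻π (to i))) (strictlyInverseʳ i)))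

  sum-zero : ∀ {n} (t : Fin n → A) → (∀ i → t i ≈ 𝟘) → sum t ≈ 𝟘
  sum-zero {n} t z = ≈-trans (sum-cong-≋ z) (sum-replicate-zero n)

  sum-single : ∀ {n} (t : Fin n → A) i → (∀ j → j ≢ i → t j ≈ 𝟘) → sum t ≈ t i
  sum-single t Fin.zero    z = ≈-trans (∙-cong ≈-refl (sum-zero (t ∘ Fin.suc) λ j → z (Fin.suc j) λ ())) (identityʳ _)
  sum-single t (Fin.suc i) z = ≈-trans
    (∙-cong (z Fin.zero λ ()) (sum-single (t ∘ Fin.suc) i λ j j≢i → z (Fin.suc j) (j≢i ∘ Finₚ.suc-injective)))
    (identityˡ _)

  total-single : ∀ g a → (∀ x → x ≢ a → g x ≈ 𝟘) → total g ≈ g a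
  total-single g a z = ≈-trans
    (sum-single (g ∘ to) (from a) λ j j≢ → z (to j) λ e → j≢ (trans (sym (strictlyInverseʳ j)) (cong from e)))
    (≈-reflexive (cong g (strictlyInverseˡ a)))

-- Fermat's theorem and roots of polynomials over the finite field.

module FieldFacts (q : ℕ) (𝔽 : FiniteField q) where
  open Construction q 𝔽 using (sgn; *-nz; 1≢0)
  open FiniteField 𝔽 using (_≟_; inverse; 0≢1; card)
  open Inverse card using (to; from; strictlyInverseˡ; strictlyInverseʳ)

  𝔽-ring : CommutativeRing 0ℓ 0ℓ
  𝔽-ring = record { isCommutativeRing = FiniteField.isCommutativeRing 𝔽 }

  open CommutativeRing 𝔽-ring
    using (_+_; _*_; -_; _-_; 0#; 1#; +-identityˡ; +-identityʳ; *-identityˡ; *-identityʳ; *-assoc; *-comm; +-assoc; +-comm;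
           zeroˡ; zeroʳ; distribˡ; -‿inverseʳ; -‿inverseˡ; semiring; ring; *-commutativeMonoid; +-commutativeMonoid; commutativeSemiring)
    renaming (Carrier to K)
  open Algebra.Properties.Semiring.Exp semiring using (_^_; ^-assocʳ)
  open Algebra.Properties.Ring ring
  open IntegerSolver 𝔽-ring
  open ≡-Reasoning
  private
    module Sum  = FieldSums q 𝔽 +-commutativeMonoid
    module Prod = FieldSums q 𝔽 *-commutativeMonoid

  m : ℕ
  m = q ∸ 1

  q≡1+m : q ≡ suc m
  q≡1+m = helper q (from 0#)
    where
    helper : ∀ n → Fin n → n ≡ suc (n ∸ 1)
    helper (suc n) _ = refl

  -- With fewer than two elements the enumeration would identify 0 and 1.
  0<m : 0 ℕ.< m
  0<m = helper q to λ e → 0≢1 (trans (sym (strictlyInverseˡ 0#)) (trans (e (from 0#) (from 1#)) (strictlyInverseˡ 1#)))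
    where
    helper : ∀ n (t : Fin n → K) → ¬ (∀ i j → t i ≡ t j) → 0 ℕ.< n ∸ 1
    helper zero          t h = contradiction (λ ()) h
    helper (suc zero)    t h = contradiction (λ { Fin.zero Fin.zero → refl }) h
    helper (suc (suc n)) t h = ℕ.s≤s ℕ.z≤n

  *-cancel : ∀ x y → x ≢ 0# → x * y ≡ 0# → y ≡ 0#
  *-cancel x y x≢0 e with y ≟ 0#
  ... | yes y≡0 = y≡0
  ... | no  y≢0 = contradiction e (*-nz x≢0 y≢0)

  -- Compare the product of all nonzero elements with its rescaling by κ.
  fermat : ∀ κ → κ ≢ 0# → κ ^ m ≡ 1#
  fermat κ κ≢0 = minus-zero (*-cancel κ _ κ≢0 (begin
      κ * (κ ^ m - 1#)           ≡⟨ solve 2 (λ k p → k :* (p :- :1) := k :* p :- k) refl κ (κ ^ m) ⟩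
      κ ^ suc m - κ              ≡⟨ cong (λ n → κ ^ n - κ) q≡1+m ⟨
      κ ^ q - κ                  ≡⟨ cong (_- κ) κ^q ⟩
      κ - κ                      ≡⟨ -‿inverseʳ κ ⟩
      0# ∎))
    where
    minus-zero : ∀ {x y} → x - y ≡ 0# → x ≡ y
    minus-zero {x} {y} e = begin
      x            ≡⟨ solve 2 (λ x y → x := (x :- y) :+ y) refl x y ⟩
      (x - y) + y  ≡⟨ cong (_+ y) e ⟩
      0# + y       ≡⟨ +-identityˡ y ⟩
      y ∎
    -- The products run over the whole field, so 0 must be given a harmless factor: `unit` replaces
    -- 0 by 1, `off` puts κ at every nonzero element, and `on` supplies the one κ at 0 that is still
    -- missing from κ^q.
    off on unit : K → K → K
    off c x with x ≟ 0#
    ... | yes _ = 1#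
    ... | no  _ = c
    on c x with x ≟ 0#
    ... | yes _ = c
    ... | no  _ = 1#
    unit _ x = off x x
    unit≢0 : ∀ x → unit κ x ≢ 0#
    unit≢0 x with x ≟ 0#
    ... | yes _  = 1≢0
    ... | no x≢0 = x≢0
    prod≢0 : ∀ n (t : Fin n → K) → (∀ i → t i ≢ 0#) →
      Algebra.Properties.CommutativeMonoid.Sum.sum *-commutativeMonoid t ≢ 0#
    prod≢0 zero    t h = 1≢0
    prod≢0 (suc n) t h = *-nz (h Fin.zero) (prod≢0 n (t ∘ Fin.suc) (h ∘ Fin.suc))
    κ⁻¹ = proj₁ (inverse κ κ≢0)
    κκ⁻¹ = proj₂ (inverse κ κ≢0)
    rescale : ∀ x → unit κ (κ * x) ≡ off κ x * unit κ x
    rescale x with x ≟ 0# | (κ * x) ≟ 0#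
    ... | yes _    | yes _  = sym (*-identityˡ _)
    ... | yes refl | no ne  = contradiction (zeroʳ κ) ne
    ... | no ne    | yes e  = contradiction (*-cancel κ x κ≢0 e) ne
    ... | no _     | no _   = refl
    prod-off : Prod.total (off κ) ≡ 1#
    prod-off = minus-zero (*-cancel _ _ (prod≢0 q (unit κ ∘ to) (unit≢0 ∘ to)) (begin
      Prod.total (unit κ) * (Prod.total (off κ) - 1#)
        ≡⟨ solve 2 (λ p o → p :* (o :- :1) := o :* p :- p) refl (Prod.total (unit κ)) (Prod.total (off κ)) ⟩
      Prod.total (off κ) * Prod.total (unit κ) - Prod.total (unit κ)
        ≡⟨ cong (_- Prod.total (unit κ)) (Prod.total-∙ (off κ) (unit κ)) ⟨
      Prod.total (λ x → off κ x * unit κ x) - Prod.total (unit κ)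
        ≡⟨ cong (_- Prod.total (unit κ)) (Prod.total-cong rescale) ⟨
      Prod.total (λ x → unit κ (κ * x)) - Prod.total (unit κ)
        ≡⟨ cong (_- Prod.total (unit κ)) (Prod.total-permute (κ *_) (κ⁻¹ *_) (λ x → inv x κκ⁻¹) (λ x → inv x (trans (*-comm _ _) κκ⁻¹)) (unit κ)) ⟨
      Prod.total (unit κ) - Prod.total (unit κ)
        ≡⟨ -‿inverseʳ _ ⟩
      0# ∎))
      where
      inv : ∀ {a b} x → a * b ≡ 1# → a * (b * x) ≡ x
      inv x e = trans (sym (*-assoc _ _ _)) (trans (cong (_* x) e) (*-identityˡ x))
    on-off : ∀ x → κ ≡ off κ x * on κ x
    on-off x with x ≟ 0#
    ... | yes _ = sym (*-identityˡ κ)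
    ... | no  _ = sym (*-identityʳ κ)
    on-0 : on κ 0# ≡ κ
    on-0 with 0# ≟ 0#
    ... | yes _ = refl
    ... | no ne = contradiction refl ne
    on-≢0 : ∀ x → x ≢ 0# → on κ x ≡ 1#
    on-≢0 x x≢0 with x ≟ 0#
    ... | yes e = contradiction e x≢0
    ... | no  _ = refl
    constant : ∀ n → Algebra.Properties.CommutativeMonoid.Sum.sum *-commutativeMonoid {n} (λ _ → κ) ≡ κ ^ n
    constant zero    = refl
    constant (suc n) = cong (κ *_) (constant n)
    κ^q : κ ^ q ≡ κ
    κ^q = begin
      κ ^ q                                    ≡⟨ constant q ⟨
      Prod.total (λ _ → κ)                     ≡⟨ Prod.total-cong on-off ⟩
      Prod.total (λ x → off κ x * on κ x)      ≡⟨ Prod.total-∙ (off κ) (on κ) ⟩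
      Prod.total (off κ) * Prod.total (on κ)   ≡⟨ cong₂ _*_ prod-off (trans (Prod.total-single (on κ) 0# on-≢0) on-0) ⟩
      1# * κ                                   ≡⟨ *-identityˡ κ ⟩
      κ ∎

  zero^ : ∀ n → 0# ^ suc n ≡ 0#
  zero^ n = zeroˡ _

  1^ : ∀ n → 1# ^ n ≡ 1#
  1^ zero    = refl
  1^ (suc n) = trans (*-identityˡ _) (1^ n)

  fermat-∣ : ∀ κ → κ ≢ 0# → ∀ {j} → m ∣ j → κ ^ j ≡ 1#
  fermat-∣ κ κ≢0 (divides c refl) = begin
    κ ^ (c ℕ.* m)  ≡⟨ cong (κ ^_) (ℕₚ.*-comm c m) ⟩
    κ ^ (m ℕ.* c)  ≡⟨ ^-assocʳ κ m c ⟨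
    (κ ^ m) ^ c    ≡⟨ cong (_^ c) (fermat κ κ≢0) ⟩
    1# ^ c         ≡⟨ 1^ c ⟩
    1# ∎

  fermat-q : ∀ x → x ^ q ≡ x
  fermat-q x with x ≟ 0#
  ... | yes refl = trans (cong (0# ^_) q≡1+m) (zero^ m)
  ... | no x≢0   = begin
    x ^ q      ≡⟨ cong (x ^_) q≡1+m ⟩
    x * x ^ m  ≡⟨ cong (x *_) (fermat x x≢0) ⟩
    x * 1#     ≡⟨ *-identityʳ x ⟩
    x ∎

  sgn-* : ∀ a b → sgn (a ℕ.+ b) ≡ sgn a * sgn b
  sgn-* zero    b = sym (*-identityˡ _)
  sgn-* (suc a) b = trans (cong -_ (sgn-* a b)) (-‿distribˡ-* _ _)

  -- Fermat's theorem at -1 settles every characteristic at once: for even q the exponent may be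
  -- odd, but then -1 = 1.
  sgn-∣ : ∀ {j} → m ∣ j → sgn j ≡ 1#
  sgn-∣ {j} d = trans (sgn-^ j) (fermat-∣ (- 1#) -1≢0 d)
    where
    sgn-^ : ∀ n → sgn n ≡ (- 1#) ^ n
    sgn-^ zero    = refl
    sgn-^ (suc n) = trans (cong -_ (sgn-^ n)) (sym (-1*x≈-x _))
    -1≢0 : - 1# ≢ 0#
    -1≢0 e = 1≢0 (begin
      1#         ≡⟨ -‿involutive 1# ⟨
      - - 1#     ≡⟨ cong -_ e ⟩
      - 0#       ≡⟨ -0#≈0# ⟩
      0# ∎)

  eval : List K → K → K
  eval []      x = 0#
  eval (c ∷ p) x = c + x * eval p x

  -- Synthetic division: the coefficients of (p(T) - p(a)) / (T - a) are the partial values of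
  -- Horner's scheme at `a`.
  quot : K → List K → List K
  quot a []          = []
  quot a (c ∷ [])    = []
  quot a (c ∷ d ∷ p) = eval (d ∷ p) a ∷ quot a (d ∷ p)

  quot-eval : ∀ a p x → eval p x - eval p a ≡ (x - a) * eval (quot a p) x
  quot-eval a []          x = trans (-‿inverseʳ 0#) (sym (zeroʳ _))
  quot-eval a (c ∷ [])    x = solve 3 (λ x a c → (c :+ x :* :0) :- (c :+ a :* :0) := (x :- a) :* :0) refl x a c
  quot-eval a (c ∷ d ∷ p) x = begin
    (c + x * P x) - (c + a * P a)         ≡⟨ solve 5 (λ c x a s t → (c :+ x :* s) :- (c :+ a :* t) := (x :- a) :* t :+ x :* (s :- t)) refl c x a (P x) (P a) ⟩
    (x - a) * P a + x * (P x - P a)       ≡⟨ cong (λ z → (x - a) * P a + x * z) (quot-eval a (d ∷ p) x) ⟩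
    (x - a) * P a + x * ((x - a) * Q)     ≡⟨ solve 4 (λ x a t k → (x :- a) :* t :+ x :* ((x :- a) :* k) := (x :- a) :* (t :+ x :* k)) refl x a (P a) Q ⟩
    (x - a) * (P a + x * Q)               ∎
    where
    P = eval (d ∷ p)
    Q = eval (quot a (d ∷ p)) x

  quot-length : ∀ a c p → length (quot a (c ∷ p)) ≡ length p
  quot-length a c []      = refl
  quot-length a c (d ∷ p) = cong suc (quot-length a d p)

  eval-zero : ∀ p x → All (_≡ 0#) p → eval p x ≡ 0#
  eval-zero []      x []         = refl
  eval-zero (c ∷ p) x (refl ∷ z) = trans (+-identityˡ _) (trans (cong (x *_) (eval-zero p x z)) (zeroʳ x))

  constant-term : ∀ c p x → All (_≡ 0#) p → eval (c ∷ p) x ≡ 0# → c ≡ 0#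
  constant-term c p x z e = begin
    c                  ≡⟨ +-identityʳ c ⟨
    c + 0#             ≡⟨ cong (_+_ c) (trans (cong (x *_) (eval-zero p x z)) (zeroʳ x)) ⟨
    c + x * eval p x   ≡⟨ e ⟩
    0# ∎

  -- The entries of the quotient are values at `a` of tails of the polynomial. Once the later
  -- coefficients are known to vanish, such a value is just the constant term of its tail.
  quot-zero : ∀ a c p → All (_≡ 0#) (quot a (c ∷ p)) → All (_≡ 0#) p
  quot-zero a c []      z       = []
  quot-zero a c (d ∷ p) (e ∷ z) = constant-term d p a ih e ∷ ih
    where ih = quot-zero a d p z

  -- Each root splits off a linear factor, and the other points remain roots of the quotient because
  -- their distance to the first one is nonzero. The constant coefficient is recovered last. A list
  -- of length at most n has degree below n.
  roots : ∀ n (r : Fin n → K) → (∀ i j → r i ≡ r j → i ≡ j) →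
    ∀ p → length p ℕ.≤ n → (∀ i → eval p (r i) ≡ 0#) → All (_≡ 0#) p
  roots n       r inj []      le         z = []
  roots (suc n) r inj (c ∷ p) (ℕ.s≤s le) z = constant-term c p (r Fin.zero) ih (z Fin.zero) ∷ ih
    where
    a = r Fin.zero
    root-of-quot : ∀ i → eval (quot a (c ∷ p)) (r (Fin.suc i)) ≡ 0#
    root-of-quot i = *-cancel (r (Fin.suc i) - a) _ distinct (begin
        (r (Fin.suc i) - a) * eval (quot a (c ∷ p)) (r (Fin.suc i))  ≡⟨ quot-eval a (c ∷ p) _ ⟨
        eval (c ∷ p) (r (Fin.suc i)) - eval (c ∷ p) a               ≡⟨ cong₂ _-_ (z (Fin.suc i)) (z Fin.zero) ⟩
        0# - 0#                                                     ≡⟨ -‿inverseʳ 0# ⟩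
        0# ∎)
      where
      distinct : r (Fin.suc i) - a ≢ 0#
      distinct e with inj (Fin.suc i) Fin.zero (x∙y⁻¹≈ε⇒x≈y _ _ e)
      ... | ()
    ih : All (_≡ 0#) p
    ih = quot-zero a c p (roots n (r ∘ Fin.suc) (λ i j e → Finₚ.suc-injective (inj _ _ e)) (quot a (c ∷ p))
      (ℕₚ.≤-trans (ℕₚ.≤-reflexive (quot-length a c p)) le) root-of-quot)

  vanishing : ∀ p → length p ℕ.≤ q → (∀ x → eval p x ≡ 0#) → All (_≡ 0#) p
  vanishing p le z = roots q to (λ i j e → trans (sym (strictlyInverseʳ i)) (trans (cong from e) (strictlyInverseʳ j))) p le (z ∘ to)

-- Power sums over the field and binomial coefficients in it.

module PowerSums (q : ℕ) (𝔽 : FiniteField q) where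
  open Construction q 𝔽 using (fromℕ; sgn; 1≢0)
  open FiniteField 𝔽 using (_≟_; inverse)
  open FieldFacts q 𝔽
  open CommutativeRing 𝔽-ring
    using (_+_; _*_; -_; _-_; 0#; 1#; +-identityˡ; +-identityʳ; *-identityˡ; *-identityʳ; *-assoc; *-comm; +-assoc; +-comm;
           zeroˡ; zeroʳ; distribˡ; -‿inverseʳ; -‿inverseˡ; semiring; ring; +-commutativeMonoid; commutativeSemiring)
    renaming (Carrier to K)
  open Algebra.Properties.Semiring.Exp semiring using (_^_; ^-homo-*)
  open Algebra.Properties.CommutativeSemiring.Exp commutativeSemiring using (^-distrib-*)
  open Algebra.Properties.Ring ring
  open IntegerSolver 𝔽-ring
  open Antidiagonal 𝔽-ring
  open FieldSums q 𝔽 +-commutativeMonoid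
  open ≡-Reasoning

  total-*ˡ : ∀ c f → total (λ x → c * f x) ≡ c * total f
  total-*ˡ c f = go q _
    where
    open Algebra.Properties.CommutativeMonoid.Sum +-commutativeMonoid using (sum)
    go : ∀ n (t : Fin n → K) → sum (λ i → c * t i) ≡ c * sum t
    go zero    t = sym (zeroʳ c)
    go (suc n) t = trans (cong (_+_ (c * t Fin.zero)) (go n (t ∘ Fin.suc))) (sym (distribˡ _ _ _))

  x+y≡x⇒y≡0 : ∀ {x y} → x ≡ x + y → y ≡ 0#
  x+y≡x⇒y≡0 {x} {y} e = begin
    y             ≡⟨ solve 2 (λ x y → y := (x :+ y) :- x) refl x y ⟩
    (x + y) - x   ≡⟨ cong (_- x) e ⟨
    x - x         ≡⟨ -‿inverseʳ x ⟩
    0# ∎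

  -- The shift x ↦ x + 1 permutes the field, so Σ x = Σ x + Σ 1.
  power-sum-0 : total (λ _ → 1#) ≡ 0#
  power-sum-0 = x+y≡x⇒y≡0 (trans
    (total-permute (_+ 1#) (_- 1#)
      (λ x → solve 1 (λ x → (x :- :1) :+ :1 := x) refl x)
      (λ x → solve 1 (λ x → (x :+ :1) :- :1 := x) refl x) id)
    (total-∙ id (λ _ → 1#)))

  -- Every nonzero x contributes 1, and 0 contributes 0 because the exponent is positive. Adding the
  -- indicator `δ₀` of 0 completes the sum to Σ 1 = 0.
  power-sum-∣ : ∀ j → m ∣ suc j → total (_^ suc j) ≡ - 1#
  power-sum-∣ j m∣j = begin
    total (_^ suc j)
      ≡⟨ solve 2 (λ s d → s := (s :+ d) :- d) refl _ _ ⟩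
    (total (_^ suc j) + total δ₀) - total δ₀
      ≡⟨ cong₂ _-_ (trans (sym (total-∙ (_^ suc j) δ₀)) (trans (total-cong all-one) power-sum-0))
                   (trans (total-single δ₀ 0# δ₀-≢0) δ₀-0) ⟩
    0# - 1#
      ≡⟨ +-identityˡ _ ⟩
    - 1# ∎
    where
    δ₀ : K → K
    δ₀ x with x ≟ 0#
    ... | yes _ = 1#
    ... | no  _ = 0#
    δ₀-0 : δ₀ 0# ≡ 1#
    δ₀-0 with 0# ≟ 0#
    ... | yes _ = refl
    ... | no ne = contradiction refl ne
    δ₀-≢0 : ∀ x → x ≢ 0# → δ₀ x ≡ 0#
    δ₀-≢0 x x≢0 with x ≟ 0#
    ... | yes e = contradiction e x≢0
    ... | no  _ = refl
    all-one : ∀ x → x ^ suc j + δ₀ x ≡ 1#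
    all-one x with x ≟ 0#
    ... | yes refl = trans (cong (_+ 1#) (zero^ j)) (+-identityˡ 1#)
    ... | no x≢0   = trans (+-identityʳ _) (fermat-∣ x x≢0 m∣j)

  -- If every nonzero κ had κ^j = 1 with m ∤ j, then T^(r+1) − T with r = j mod m
  -- would have more roots than its degree.
  power-sum-∤ : ∀ j → ¬ (m ∣ j) → total (_^ j) ≡ 0#
  power-sum-∤ j m∤j with total (_^ j) ≟ 0#
  ... | yes e  = e
  ... | no S≢0 = contradiction all-one (too-many-roots (j % m) refl)
    where
    instance
      m-nonZero : ℕ.NonZero m
      m-nonZero = ℕ.>-nonZero 0<m
    S = total (_^ j)
    -- Rescaling the summation variable by g multiplies S by g^j, so a nonzero S forces g^j = 1.
    all-one : ∀ g → g ≢ 0# → g ^ j ≡ 1#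
    all-one g g≢0 = x∙y⁻¹≈ε⇒x≈y _ _ (*-cancel S _ S≢0 (begin
        S * (g ^ j - 1#)    ≡⟨ solve 2 (λ s g → s :* (g :- :1) := g :* s :- s) refl S (g ^ j) ⟩
        g ^ j * S - S       ≡⟨ cong (_- S) (trans (sym (total-*ˡ (g ^ j) (_^ j))) (total-cong λ x → sym (^-distrib-* g x j))) ⟩
        total (λ x → (g * x) ^ j) - S
                            ≡⟨ cong (_- S) (total-permute (g *_) (g⁻¹ *_) (λ x → inv x gg⁻¹) (λ x → inv x (trans (*-comm _ _) gg⁻¹)) (_^ j)) ⟨
        S - S               ≡⟨ -‿inverseʳ S ⟩
        0# ∎))
      where
      g⁻¹ = proj₁ (inverse g g≢0)
      gg⁻¹ = proj₂ (inverse g g≢0)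
      inv : ∀ {a b} x → a * b ≡ 1# → a * (b * x) ≡ x
      inv x e = trans (sym (*-assoc _ _ _)) (trans (cong (_* x) e) (*-identityˡ x))
    too-many-roots : ∀ r → r ≡ j % m → ¬ (∀ g → g ≢ 0# → g ^ j ≡ 1#)
    too-many-roots zero    e _ = m∤j (∣.m%n≡0⇒n∣m j m (sym e))
    too-many-roots (suc r) e h with vanishing (0# ∷ - 1# ∷ monomial r) short root
      where
      monomial : ℕ → List K
      monomial zero    = 1# ∷ []
      monomial (suc n) = 0# ∷ monomial n
      eval-monomial : ∀ n x → eval (monomial n) x ≡ x ^ n
      eval-monomial zero    x = trans (cong (_+_ 1#) (zeroʳ x)) (+-identityʳ 1#)
      eval-monomial (suc n) x = trans (+-identityˡ _) (cong (x *_) (eval-monomial n x))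
      length-monomial : ∀ n → length (monomial n) ≡ suc n
      length-monomial zero    = refl
      length-monomial (suc n) = cong suc (length-monomial n)
      -- The degree is r + 2, which is at most m = q - 1 because `suc r` is a remainder modulo m.
      short : length (0# ∷ - 1# ∷ monomial r) ℕ.≤ q
      short = subst (length (0# ∷ - 1# ∷ monomial r) ℕ.≤_) (sym q≡1+m)
        (subst (λ z → suc (suc z) ℕ.≤ suc m) (sym (length-monomial r)) (ℕ.s≤s (subst (ℕ._< m) (sym e) (m%n<n j m))))
      reduce : ∀ x → x ≢ 0# → x ^ suc r ≡ 1#
      reduce x x≢0 = begin
        x ^ suc r                           ≡⟨ cong (x ^_) e ⟩
        x ^ (j % m)                         ≡⟨ *-identityʳ _ ⟨
        x ^ (j % m) * 1#                    ≡⟨ cong (x ^ (j % m) *_) (fermat-∣ x x≢0 (∣.n∣m*n (j ℕ./ m))) ⟨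
        x ^ (j % m) * x ^ (j ℕ./ m ℕ.* m)   ≡⟨ ^-homo-* x (j % m) _ ⟨
        x ^ (j % m ℕ.+ j ℕ./ m ℕ.* m)       ≡⟨ cong (x ^_) (m≡m%n+[m/n]*n j m) ⟨
        x ^ j                               ≡⟨ h x x≢0 ⟩
        1# ∎
      root : ∀ x → eval (0# ∷ - 1# ∷ monomial r) x ≡ 0#
      root x with x ≟ 0#
      ... | yes refl = trans (+-identityˡ _) (zeroˡ _)
      ... | no x≢0   = begin
        0# + x * (- 1# + x * eval (monomial r) x)  ≡⟨ +-identityˡ _ ⟩
        x * (- 1# + x * eval (monomial r) x)       ≡⟨ cong (λ z → x * (- 1# + x * z)) (eval-monomial r x) ⟩
        x * (- 1# + x * x ^ r)                     ≡⟨ cong (λ z → x * (- 1# + z)) (reduce x x≢0) ⟩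
        x * (- 1# + 1#)                            ≡⟨ cong (x *_) (-‿inverseˡ 1#) ⟩
        x * 0#                                     ≡⟨ zeroʳ x ⟩
        0# ∎
    ... | _ ∷ -1≡0 ∷ _ = 1≢0 (begin
      1#       ≡⟨ -‿involutive 1# ⟨
      - - 1#   ≡⟨ cong -_ -1≡0 ⟩
      - 0#     ≡⟨ -0#≈0# ⟩
      0# ∎)

  fromℕ-+ : ∀ a b → fromℕ (a ℕ.+ b) ≡ fromℕ a + fromℕ b
  fromℕ-+ zero    b = sym (+-identityˡ _)
  fromℕ-+ (suc a) b = trans (cong (_+_ 1#) (fromℕ-+ a b)) (sym (+-assoc _ _ _))

  abstract
    -- Kept abstract so that `_C_` never unfolds inside larger terms; Pascal's rule, symmetry and
    -- the boundary values are the interface.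
    bin : ℕ → ℕ → K
    bin n k = fromℕ (n C k)

    bin-def : ∀ n k → bin n k ≡ fromℕ (n C k)
    bin-def n k = refl

    bin-pascal : ∀ n k → bin (suc n) (suc k) ≡ bin n k + bin n (suc k)
    bin-pascal n k = trans (cong fromℕ (sym (nCk+nC[k+1]≡[n+1]C[k+1] n k))) (fromℕ-+ (n C k) _)

    bin-> : ∀ {n k} → n ℕ.< k → bin n k ≡ 0#
    bin-> n<k = cong fromℕ (k>n⇒nCk≡0 n<k)

    bin-symmetric : ∀ i j → bin (i ℕ.+ j) i ≡ bin (i ℕ.+ j) j
    bin-symmetric i j = cong fromℕ (trans (nCk≡nC[n∸k] (ℕₚ.m≤m+n i j)) (cong ((i ℕ.+ j) C_) (ℕₚ.m+n∸m≡n i j)))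

    bin-0 : ∀ n → bin n 0 ≡ 1#
    bin-0 n = +-identityʳ 1#

  sgn² : ∀ n → sgn n * sgn n ≡ 1#
  sgn² zero    = *-identityˡ 1#
  sgn² (suc n) = trans (solve 1 (λ s → (:- s) :* (:- s) := s :* s) refl (sgn n)) (sgn² n)

  -- The coefficient of x_{i+1} x_l in x_{a+1} ⋄ x_{b+1} when i + l = a + b + 1 and
  -- (q − 1) ∣ l; for l = 0 it is the coefficient of the single letter x_{i+1}.
  κ : ℕ → ℕ → ℕ → K
  κ a b zero    = 1#
  κ a b (suc l) = sgn a * bin l a + sgn b * bin l b

  -- The polynomial Σ f i j T^i over i + j = n, listed by ascending powers as `eval` expects.
  antidiagonal-list : ℕ → (ℕ → ℕ → K) → List K
  antidiagonal-list zero    f = f 0 0 ∷ []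
  antidiagonal-list (suc n) f = f 0 (suc n) ∷ antidiagonal-list n (λ i j → f (suc i) j)

  antidiagonal-list-length : ∀ n f → length (antidiagonal-list n f) ≡ suc n
  antidiagonal-list-length zero    f = refl
  antidiagonal-list-length (suc n) f = cong suc (antidiagonal-list-length n _)

  antidiagonal-list-eval : ∀ n f x → eval (antidiagonal-list n f) x ≡ conv n (λ i j → f i j * x ^ i)
  antidiagonal-list-eval zero    f x = solve 2 (λ c x → c :+ x :* :0 := c :* :1) refl (f 0 0) x
  antidiagonal-list-eval (suc n) f x = cong₂ _+_ (sym (*-identityʳ _)) (begin
    x * eval (antidiagonal-list n (λ i j → f (suc i) j)) x
      ≡⟨ cong (x *_) (antidiagonal-list-eval n _ x) ⟩
    x * conv n (λ i j → f (suc i) j * x ^ i)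
      ≡⟨ conv-*ˡ n x _ ⟩
    conv n (λ i j → x * (f (suc i) j * x ^ i))
      ≡⟨ conv-ext n (λ i j → solve 3 (λ x f p → x :* (f :* p) := f :* (x :* p)) refl x (f (suc i) j) (x ^ i)) ⟩
    conv n (λ i j → f (suc i) j * x ^ suc i) ∎)

  antidiagonal-list-zero : ∀ n f → All (_≡ 0#) (antidiagonal-list n f) → ∀ i j → i ℕ.+ j ≡ n → f i j ≡ 0#
  antidiagonal-list-zero zero    f (e ∷ _) zero    zero    refl = e
  antidiagonal-list-zero (suc n) f (e ∷ _) zero    (suc j) refl = e
  antidiagonal-list-zero (suc n) f (_ ∷ z) (suc i) j       p    =
    antidiagonal-list-zero n _ z i j (ℕₚ.suc-injective p)

-- The identities are needed over 𝔽 itself, over the shuffle algebra, and over iterated power series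
-- rings above either of them; hence an arbitrary commutative 𝔽-algebra as the setting.
record 𝔽-Algebra (q : ℕ) (𝔽 : FiniteField q) : Set₁ where
  private module K = FiniteField 𝔽
  field
    commutativeRing : CommutativeRing 0ℓ 0ℓ
  open CommutativeRing commutativeRing public
  field
    ι   : K.Carrier → Carrier
    ι-+ : ∀ a b → ι (a K.+ b) ≈ ι a + ι b
    ι-* : ∀ a b → ι (a K.* b) ≈ ι a * ι b
    ι-0 : ι K.0# ≈ 0#
    ι-1 : ι K.1# ≈ 1#

  ι-neg : ∀ a → ι (K.- a) ≈ - ι a
  ι-neg a = Algebra.Properties.Group.inverseʳ-unique +-group (ι a) (ι (K.- a))
    (CommutativeRing.trans commutativeRing (CommutativeRing.sym commutativeRing (ι-+ a (K.- a)))
      (CommutativeRing.trans commutativeRing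
        (CommutativeRing.reflexive commutativeRing (cong ι (IsCommutativeRing.-‿inverseʳ K.isCommutativeRing a))) ι-0))

-- Binomial identities and the product rule over an 𝔽-algebra.

module BinomialTheorem (q : ℕ) (𝔽 : FiniteField q) (A : 𝔽-Algebra q 𝔽) where
  private module K = FiniteField 𝔽
  open FieldFacts q 𝔽 using (𝔽-ring)
  open PowerSums q 𝔽
    using (bin; bin-pascal; bin->; bin-0; κ; power-sum-0; power-sum-∣; power-sum-∤; sgn²;
           antidiagonal-list; antidiagonal-list-length; antidiagonal-list-eval; antidiagonal-list-zero)
  open 𝔽-Algebra A renaming (Carrier to R; refl to ≈-refl; sym to ≈-sym; trans to ≈-trans; reflexive to ≈-reflexive)
  open Algebra.Properties.Semiring.Exp semiring using (_^_)
  open Algebra.Properties.Ring ring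
  open IntegerSolver commutativeRing
  open Antidiagonal commutativeRing
  open Relation.Binary.Reasoning.Setoid setoid
  private
    module KR = CommutativeRing 𝔽-ring
    module KP = Algebra.Properties.Ring KR.ring
    module KS = IntegerSolver 𝔽-ring
    module KC = Antidiagonal 𝔽-ring
    module KE = Algebra.Properties.Semiring.Exp KR.semiring

  ι-cong : ∀ {a b} → a ≡ b → ι a ≈ ι b
  ι-cong e = ≈-reflexive (cong ι e)

  binomial : ∀ n v w → (v + w) ^ n ≈ conv n (λ i j → ι (bin n i) * (v ^ i * w ^ j))
  binomial zero    v w = ≈-sym (≈-trans (*-cong (≈-trans (ι-cong (bin-0 0)) ι-1) (*-identityˡ _)) (*-identityˡ _))
  binomial (suc n) v w = begin
    (v + w) * (v + w) ^ n
      ≈⟨ *-congˡ (binomial n v w) ⟩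
    (v + w) * conv n f
      ≈⟨ distribʳ _ v w ⟩
    v * conv n f + w * conv n f
      ≈⟨ +-cong (conv-*ˡ n v f) (conv-*ˡ n w f) ⟩
    conv n (λ i j → v * f i j) + conv n (λ i j → w * f i j)
      ≈⟨ +-congˡ (conv-ext n λ i j → solve 4 (λ w c p r → w :* (c :* (p :* r)) := c :* (p :* (w :* r))) ≈-refl w (ι (bin n i)) (v ^ i) (w ^ j)) ⟩
    conv n (λ i j → v * f i j) + conv n (λ i j → g i (suc j))
      ≈⟨ +-congˡ (≈-sym (≈-trans (+-congˡ (≈-trans (*-congʳ (≈-trans (ι-cong (bin-> (ℕₚ.n<1+n n))) ι-0)) (zeroˡ _))) (+-identityʳ _))) ⟩
    conv n (λ i j → v * f i j) + (conv n (λ i j → g i (suc j)) + g (suc n) 0)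
      ≈⟨ +-congˡ (conv-last n g) ⟨
    conv n (λ i j → v * f i j) + (g 0 (suc n) + conv n (λ i j → g (suc i) j))
      ≈⟨ solve 3 (λ a b c → a :+ (b :+ c) := b :+ (a :+ c)) ≈-refl _ _ _ ⟩
    g 0 (suc n) + (conv n (λ i j → v * f i j) + conv n (λ i j → g (suc i) j))
      ≈⟨ +-cong (*-congʳ (ι-cong (trans (bin-0 n) (sym (bin-0 (suc n)))))) (≈-trans (≈-sym (conv-+ n _ _)) (conv-ext n pascal)) ⟩
    conv (suc n) (λ i j → ι (bin (suc n) i) * (v ^ i * w ^ j)) ∎
    where
    f g : ℕ → ℕ → R
    f i j = ι (bin n i) * (v ^ i * w ^ j)
    g i j = ι (bin n i) * (v ^ i * w ^ j)
    pascal : ∀ i j → v * f i j + g (suc i) j ≈ ι (bin (suc n) (suc i)) * (v ^ suc i * w ^ j)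
    pascal i j = begin
      v * (ι (bin n i) * (v ^ i * w ^ j)) + ι (bin n (suc i)) * (v * v ^ i * w ^ j)
        ≈⟨ solve 5 (λ v c d p r → v :* (c :* (p :* r)) :+ d :* (v :* p :* r) := (c :+ d) :* (v :* p :* r)) ≈-refl v (ι (bin n i)) (ι (bin n (suc i))) (v ^ i) (w ^ j) ⟩
      (ι (bin n i) + ι (bin n (suc i))) * (v * v ^ i * w ^ j)
        ≈⟨ *-congʳ (≈-trans (≈-sym (ι-+ _ _)) (ι-cong (sym (bin-pascal n i)))) ⟩
      ι (bin (suc n) (suc i)) * (v ^ suc i * w ^ j) ∎

module BinomialModQ (q : ℕ) (𝔽 : FiniteField q) where
  open FieldFacts q 𝔽 using (𝔽-ring; fermat-q; vanishing; eval; 1^)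
  open PowerSums q 𝔽
  open CommutativeRing 𝔽-ring hiding (refl; sym; trans)
  open Algebra.Properties.Semiring.Exp semiring using (_^_)
  open Antidiagonal 𝔽-ring
  open IntegerSolver 𝔽-ring
  open ≡-Reasoning

  𝔽-self : 𝔽-Algebra q 𝔽
  𝔽-self = record { commutativeRing = 𝔽-ring ; ι = id ; ι-+ = λ _ _ → refl ; ι-* = λ _ _ → refl ; ι-0 = refl ; ι-1 = refl }

  open BinomialTheorem q 𝔽 𝔽-self using (binomial)

  bin-n : ∀ n → bin n n ≡ 1#
  bin-n zero    = bin-0 0
  bin-n (suc n) = trans (bin-pascal n n) (trans (cong₂ _+_ (bin-n n) (bin-> (ℕₚ.n<1+n n))) (+-identityʳ _))

  -- The polynomial (1 + T)^q − 1 − T^q has degree < q and vanishes on 𝔽.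
  bin-q : ∀ i j → 0 ℕ.< i → 0 ℕ.< j → i ℕ.+ j ≡ q → bin q i ≡ 0#
  bin-q (suc i) (suc j) _ _ e =
    antidiagonal-list-zero n f (All.tail (vanishing (0# ∷ antidiagonal-list n f) short root)) i j refl
    where
    n = i ℕ.+ j
    q≡ : suc (suc n) ≡ q
    q≡ = trans (cong suc (sym (ℕₚ.+-suc i j))) e
    f : ℕ → ℕ → Carrier
    f i j = bin q (suc i)
    short : length (0# ∷ antidiagonal-list n f) ℕ.≤ q
    short = ℕₚ.≤-reflexive (trans (cong suc (antidiagonal-list-length n f)) q≡)
    root : ∀ x → eval (0# ∷ antidiagonal-list n f) x ≡ 0#
    root x = begin
      0# + x * eval (antidiagonal-list n f) x
        ≡⟨ trans (+-identityˡ _) (cong (x *_) (antidiagonal-list-eval n f x)) ⟩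
      x * S
        ≡⟨ solve 3 (λ x a p → a := ((:1 :+ a) :+ p) :- (p :+ :1)) refl x (x * S) (x ^ q) ⟩
      ((1# + x * S) + x ^ q) - (x ^ q + 1#)
        ≡⟨ cong₂ _-_ expand (cong (_+ 1#) (fermat-q x)) ⟩
      (x + 1#) ^ q - (x + 1#)
        ≡⟨ cong (_- (x + 1#)) (fermat-q (x + 1#)) ⟩
      (x + 1#) - (x + 1#)
        ≡⟨ -‿inverseʳ _ ⟩
      0# ∎
      where
      S = conv n (λ i j → f i j * x ^ i)
      g : ℕ → ℕ → Carrier
      g i j = bin (suc (suc n)) i * (x ^ i * 1# ^ j)
      expand : (1# + x * S) + x ^ q ≡ (x + 1#) ^ q
      expand = sym (begin
        (x + 1#) ^ q
          ≡⟨ cong (λ z → (x + 1#) ^ z) q≡ ⟨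
        (x + 1#) ^ suc (suc n)
          ≡⟨ trans (binomial (suc (suc n)) x 1#) (cong (_+_ (g 0 (suc (suc n)))) (conv-last n (λ i j → g (suc i) j))) ⟩
        g 0 (suc (suc n)) + (conv n (λ i j → g (suc i) (suc j)) + g (suc (suc n)) 0)
          ≡⟨ cong₂ _+_ (trans (cong₂ _*_ (bin-0 (suc (suc n))) (trans (*-identityˡ _) (1^ (suc (suc n))))) (*-identityˡ 1#))
               (cong₂ _+_ (trans (conv-ext n λ i j → trans (cong (bin _ (suc i) *_) (trans (cong (x ^ suc i *_) (1^ (suc j))) (*-identityʳ _)))
                                   (trans (solve 3 (λ b x p → b :* (x :* p) := x :* (b :* p)) refl (bin (suc (suc n)) (suc i)) x (x ^ i))
                                          (cong (λ z → x * (bin z (suc i) * x ^ i)) q≡)))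
                                 (sym (conv-*ˡ n x _)))
                 (trans (cong₂ _*_ (bin-n (suc (suc n))) (*-identityʳ _)) (*-identityˡ _))) ⟩
        1# + (x * S + x ^ suc (suc n))
          ≡⟨ cong (λ z → 1# + (x * S + x ^ z)) q≡ ⟩
        1# + (x * S + x ^ q)
          ≡⟨ +-assoc _ _ _ ⟨
        (1# + x * S) + x ^ q ∎)

module AlgebraIdentities (q : ℕ) (𝔽 : FiniteField q) (A : 𝔽-Algebra q 𝔽) where
  open Construction q 𝔽 using (sgn)
  private module K = FiniteField 𝔽
  open FieldFacts q 𝔽 using (𝔽-ring; m; 0<m; q≡1+m; sgn-∣)
  open PowerSums q 𝔽
    using (bin; bin-pascal; bin->; bin-0; κ; power-sum-0; power-sum-∣; power-sum-∤; sgn²;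
           antidiagonal-list; antidiagonal-list-length; antidiagonal-list-eval; antidiagonal-list-zero)
  open 𝔽-Algebra A renaming (Carrier to R; refl to ≈-refl; sym to ≈-sym; trans to ≈-trans; reflexive to ≈-reflexive)
  open Algebra.Properties.Semiring.Exp semiring using (_^_; ^-congˡ)
  open Algebra.Properties.Ring ring
  open BinomialTheorem q 𝔽 A public
  open BinomialModQ q 𝔽 using (bin-n; bin-q)
  open IntegerSolver commutativeRing
  open Antidiagonal commutativeRing
  open Relation.Binary.Reasoning.Setoid setoid
  private
    module KR = CommutativeRing 𝔽-ring
    module KP = Algebra.Properties.Ring KR.ring
    module KS = IntegerSolver 𝔽-ring
    module KC = Antidiagonal 𝔽-ring
    module KE = Algebra.Properties.Semiring.Exp KR.semiring

  ι-conv : ∀ n f → ι (KC.conv n f) ≈ conv n (λ i j → ι (f i j))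
  ι-conv zero    f = ≈-refl
  ι-conv (suc n) f = ≈-trans (ι-+ _ _) (+-congˡ (ι-conv n λ i j → f (suc i) j))

  -- Only k ≤ l contributes, and then j ≥ i, so that v^i can be taken out of every remaining term.
  conv-shift : ∀ i l (f : ℕ → K.Carrier) → (∀ k → l ℕ.< k → f k ≡ K.0#) → ∀ v w →
    conv (i ℕ.+ l) (λ j k → ι (f k) * (v ^ j * w ^ k)) ≈ v ^ i * conv l (λ j k → ι (f k) * (v ^ j * w ^ k))
  conv-shift zero    l f z v w = ≈-sym (*-identityˡ _)
  conv-shift (suc i) l f z v w = begin
    ι (f (suc (i ℕ.+ l))) * (1# * w ^ suc (i ℕ.+ l)) + conv (i ℕ.+ l) (λ j k → ι (f k) * (v ^ suc j * w ^ k))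
      ≈⟨ +-cong (≈-trans (*-congʳ (≈-trans (ι-cong (z _ (ℕ.s≤s (ℕₚ.m≤n+m l i)))) ι-0)) (zeroˡ _))
                (conv-ext (i ℕ.+ l) λ j k → solve 4 (λ c v p r → c :* (v :* p :* r) := v :* (c :* (p :* r))) ≈-refl (ι (f k)) v (v ^ j) (w ^ k)) ⟩
    0# + conv (i ℕ.+ l) (λ j k → v * (ι (f k) * (v ^ j * w ^ k)))
      ≈⟨ ≈-trans (+-identityˡ _) (≈-sym (conv-*ˡ (i ℕ.+ l) v _)) ⟩
    v * conv (i ℕ.+ l) (λ j k → ι (f k) * (v ^ j * w ^ k))
      ≈⟨ *-congˡ (conv-shift i l f z v w) ⟩
    v * (v ^ i * conv l _)
      ≈⟨ *-assoc _ _ _ ⟨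
    v ^ suc i * conv l _ ∎

  neg^ : ∀ n w → (- w) ^ n ≈ ι (sgn n) * w ^ n
  neg^ zero    w = ≈-sym (≈-trans (*-congʳ ι-1) (*-identityˡ _))
  neg^ (suc n) w = begin
    - w * (- w) ^ n              ≈⟨ *-congˡ (neg^ n w) ⟩
    - w * (ι (sgn n) * w ^ n)    ≈⟨ solve 3 (λ w s p → :- w :* (s :* p) := (:- s) :* (w :* p)) ≈-refl w (ι (sgn n)) (w ^ n) ⟩
    - ι (sgn n) * w ^ suc n      ≈⟨ *-congʳ (≈-sym (ι-neg (sgn n))) ⟩
    ι (sgn (suc n)) * w ^ suc n  ∎

  -- This is the evenness of P, whose exponents are all divisible by q - 1.
  neg^-∣ : ∀ {l} → m ∣ l → ∀ w → (- w) ^ l ≈ w ^ l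
  neg^-∣ {l} d w = ≈-trans (neg^ l w) (≈-trans (*-congʳ (≈-trans (ι-cong (sgn-∣ d)) ι-1)) (*-identityˡ _))

  difference^ : ∀ l v w → (v - w) ^ l ≈ conv l (λ j k → ι (sgn k K.* bin l k) * (v ^ j * w ^ k))
  difference^ l v w = begin
    (v - w) ^ l                                             ≈⟨ ^-congˡ l (+-comm v (- w)) ⟩
    (- w + v) ^ l                                           ≈⟨ binomial l (- w) v ⟩
    conv l (λ k j → ι (bin l k) * ((- w) ^ k * v ^ j))      ≈⟨ conv-comm l _ ⟩
    conv l (λ j k → ι (bin l k) * ((- w) ^ k * v ^ j))      ≈⟨ conv-ext l (λ j k → term j k) ⟩
    conv l (λ j k → ι (sgn k K.* bin l k) * (v ^ j * w ^ k)) ∎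
    where
    term : ∀ j k → ι (bin l k) * ((- w) ^ k * v ^ j) ≈ ι (sgn k K.* bin l k) * (v ^ j * w ^ k)
    term j k = begin
      ι (bin l k) * ((- w) ^ k * v ^ j)              ≈⟨ *-congˡ (*-congʳ (neg^ k w)) ⟩
      ι (bin l k) * ((ι (sgn k) * w ^ k) * v ^ j)    ≈⟨ solve 4 (λ b s p r → b :* ((s :* p) :* r) := (s :* b) :* (r :* p)) ≈-refl (ι (bin l k)) (ι (sgn k)) (w ^ k) (v ^ j) ⟩
      (ι (sgn k) * ι (bin l k)) * (v ^ j * w ^ k)    ≈⟨ *-congʳ (≈-sym (ι-* _ _)) ⟩
      ι (sgn k K.* bin l k) * (v ^ j * w ^ k)        ∎

  geometric : ∀ n v w → (v - w) * conv n (λ i j → v ^ i * w ^ j) ≈ v ^ suc n - w ^ suc n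
  geometric zero    v w = solve 2 (λ v w → (v :- w) :* (:1 :* :1) := v :* :1 :- w :* :1) ≈-refl v w
  geometric (suc n) v w = begin
    (v - w) * (1# * w ^ suc n + conv n (λ i j → v ^ suc i * w ^ j))
      ≈⟨ *-congˡ (+-congˡ (≈-trans (conv-ext n λ i j → *-assoc v _ _) (≈-sym (conv-*ˡ n v _)))) ⟩
    (v - w) * (1# * w ^ suc n + v * conv n (λ i j → v ^ i * w ^ j))
      ≈⟨ solve 4 (λ v w p s → (v :- w) :* (:1 :* p :+ v :* s) := (v :- w) :* p :+ v :* ((v :- w) :* s)) ≈-refl v w (w ^ suc n) (conv n (λ i j → v ^ i * w ^ j)) ⟩
    (v - w) * w ^ suc n + v * ((v - w) * conv n (λ i j → v ^ i * w ^ j))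
      ≈⟨ +-congˡ (*-congˡ (geometric n v w)) ⟩
    (v - w) * w ^ suc n + v * (v ^ suc n - w ^ suc n)
      ≈⟨ solve 4 (λ v w p s → (v :- w) :* p :+ v :* (s :- p) := v :* s :- w :* p) ≈-refl v w (w ^ suc n) (v ^ suc n) ⟩
    v ^ suc (suc n) - w ^ suc (suc n) ∎

  -- (s − t) X(s) ⋄ X(t) = (X(s) − X(t)) P(s − t), coefficientwise.
  κ-generating : ∀ n k l → k ℕ.+ l ≡ suc n → m ∣ l → ∀ v w →
    (v - w) * conv n (λ a b → ι (κ a b l) * (v ^ a * w ^ b)) ≈ (v ^ k - w ^ k) * (v - w) ^ l
  κ-generating n k zero e _ v w rewrite trans (sym (ℕₚ.+-identityʳ k)) e = begin
    (v - w) * conv n (λ a b → ι K.1# * (v ^ a * w ^ b))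
      ≈⟨ *-congˡ (conv-ext n λ a b → ≈-trans (*-congʳ ι-1) (*-identityˡ _)) ⟩
    (v - w) * conv n (λ a b → v ^ a * w ^ b)  ≈⟨ geometric n v w ⟩
    v ^ suc n - w ^ suc n                     ≈⟨ *-identityʳ _ ⟨
    (v ^ suc n - w ^ suc n) * 1#              ∎
  κ-generating n k (suc l) e m∣l v w with ℕₚ.suc-injective (trans (sym (ℕₚ.+-suc k l)) e)
  ... | refl = begin
    (v - w) * conv n (λ a b → ι (κ a b (suc l)) * (v ^ a * w ^ b))
      ≈⟨ *-congˡ (≈-trans (conv-ext n λ a b → ≈-trans (*-congʳ (ι-+ _ _)) (distribʳ _ _ _)) (conv-+ n _ _)) ⟩
    (v - w) * (conv n (λ a b → ι (c a) * (v ^ a * w ^ b)) + conv n (λ a b → ι (c b) * (v ^ a * w ^ b)))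
      ≈⟨ *-congˡ (+-cong (≈-trans (conv-comm n _) (≈-trans (conv-ext n λ a b → *-congˡ (*-comm _ _)) (half w v))) (half v w)) ⟩
    (v - w) * (w ^ k * (w - v) ^ l + v ^ k * (v - w) ^ l)
      ≈⟨ solve 6 (λ v w a b c d → (v :- w) :* (a :* b :+ c :* d) := c :* ((v :- w) :* d) :- a :* ((w :- v) :* b)) ≈-refl v w (w ^ k) ((w - v) ^ l) (v ^ k) ((v - w) ^ l) ⟩
    v ^ k * (v - w) ^ suc l - w ^ k * (w - v) ^ suc l
      -- Divisibility enters here: evenness turns (w - v)^(l+1) into (v - w)^(l+1), so that both
      -- halves share one factor.
      ≈⟨ +-congˡ (-‿cong (*-congˡ (≈-trans (^-congˡ (suc l) (solve 2 (λ v w → w :- v := :- (v :- w)) ≈-refl v w)) (neg^-∣ m∣l (v - w))))) ⟩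
    v ^ k * (v - w) ^ suc l - w ^ k * (v - w) ^ suc l
      ≈⟨ [y-z]x≈yx-zx _ _ _ ⟨
    (v ^ k - w ^ k) * (v - w) ^ suc l ∎
    where
    c : ℕ → K.Carrier
    c b = sgn b K.* bin l b
    half : ∀ v w → conv (k ℕ.+ l) (λ a b → ι (c b) * (v ^ a * w ^ b)) ≈ v ^ k * (v - w) ^ l
    half v w = ≈-trans (conv-shift k l c (λ j l<j → trans (cong (sgn j K.*_) (bin-> l<j)) (KR.zeroʳ _)) v w)
      (*-congˡ (≈-sym (difference^ l v w)))

  -- The middle binomials vanish by `bin-q`, which comes from counting roots; the characteristic
  -- itself never has to be named.
  frobenius : ∀ v w → (v + w) ^ q ≈ v ^ q + w ^ q
  frobenius v w = subst (λ q′ → (v + w) ^ q′ ≈ v ^ q′ + w ^ q′) q≡ (begin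
    (v + w) ^ suc (suc n)
      ≈⟨ ≈-trans (binomial (suc (suc n)) v w) (+-congˡ (conv-last n (λ i j → g (suc i) j))) ⟩
    g 0 (suc (suc n)) + (conv n (λ i j → g (suc i) (suc j)) + g (suc (suc n)) 0)
      ≈⟨ +-cong (≈-trans (*-congʳ (≈-trans (ι-cong (bin-0 _)) ι-1)) (≈-trans (*-identityˡ _) (*-identityˡ _)))
          (+-cong (conv-zero n λ i j e → ≈-trans (*-congʳ (≈-trans (ι-cong (middle i j e)) ι-0)) (zeroˡ _))
                  (≈-trans (*-congʳ (≈-trans (ι-cong (bin-n (suc (suc n)))) ι-1)) (≈-trans (*-identityˡ _) (*-identityʳ _)))) ⟩
    w ^ suc (suc n) + (0# + v ^ suc (suc n))
      ≈⟨ solve 2 (λ v w → w :+ (:0 :+ v) := v :+ w) ≈-refl (v ^ suc (suc n)) (w ^ suc (suc n)) ⟩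
    v ^ suc (suc n) + w ^ suc (suc n) ∎)
    where
    n = m ∸ 1
    q≡ : suc (suc n) ≡ q
    q≡ = trans (cong suc (ℕₚ.m+[n∸m]≡n 0<m)) (sym q≡1+m)
    g : ℕ → ℕ → R
    g i j = ι (bin (suc (suc n)) i) * (v ^ i * w ^ j)
    middle : ∀ i j → i ℕ.+ j ≡ n → bin (suc (suc n)) (suc i) ≡ K.0#
    middle i j e = trans (cong (λ z → bin z (suc i)) q≡)
      (bin-q (suc i) (suc j) (ℕ.s≤s ℕ.z≤n) (ℕ.s≤s ℕ.z≤n) (trans (cong suc (trans (ℕₚ.+-suc i j) (cong suc e))) q≡))

-- The polynomials behind the additivity of E.

module Additivity (q : ℕ) (𝔽 : FiniteField q) (A : 𝔽-Algebra q 𝔽) where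
  open Construction q 𝔽 using (sgn)
  private module K = FiniteField 𝔽
  open FieldFacts q 𝔽 using (𝔽-ring; m; 0<m; q≡1+m; sgn-∣; sgn-*)
  open PowerSums q 𝔽 using (bin; power-sum-0; power-sum-∣; power-sum-∤; sgn²)
  open BinomialModQ q 𝔽 using (bin-n)
  open 𝔽-Algebra A renaming (Carrier to R; refl to ≈-refl; sym to ≈-sym; trans to ≈-trans; reflexive to ≈-reflexive)
  open Algebra.Properties.Semiring.Exp semiring using (_^_; ^-homo-*; ^-congˡ)
  open Algebra.Properties.CommutativeSemiring.Exp commutativeSemiring using (^-distrib-*)
  open Algebra.Properties.Ring ring
  open AlgebraIdentities q 𝔽 A
  open IntegerSolver commutativeRing
  open Antidiagonal commutativeRing
  open FieldSums q 𝔽 +-commutativeMonoid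
  open Relation.Binary.Reasoning.Setoid setoid
  private
    module KR = CommutativeRing 𝔽-ring
    module KP = Algebra.Properties.Ring KR.ring
    module KS = IntegerSolver 𝔽-ring
    module KE = Algebra.Properties.Semiring.Exp KR.semiring
    module KΣ = FieldSums q 𝔽 KR.+-commutativeMonoid

  dvd : ℕ → K.Carrier
  dvd j with m ∣? j
  ... | yes _ = K.1#
  ... | no  _ = K.0#

  dvd-yes : ∀ {j} → m ∣ j → dvd j ≡ K.1#
  dvd-yes {j} d with m ∣? j
  ... | yes _ = refl
  ... | no ¬d = contradiction d ¬d

  dvd-no : ∀ {j} → ¬ (m ∣ j) → dvd j ≡ K.0#
  dvd-no {j} ¬d with m ∣? j
  ... | yes d = contradiction d ¬d
  ... | no _  = refl

  dvd-complement : ∀ {n} → m ∣ n → ∀ i j → i ℕ.+ j ≡ n → dvd i ≡ dvd j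
  dvd-complement {n} d i j e with m ∣? j
  ... | yes dj = dvd-yes (∣.∣m+n∣m⇒∣n (subst (m ∣_) (trans (sym e) (ℕₚ.+-comm i j)) d) dj)
  ... | no ¬dj = dvd-no λ di → ¬dj (∣.∣m+n∣m⇒∣n (subst (m ∣_) (sym e) d) di)

  conv-skip : ∀ k n f → (∀ i j → i ℕ.< k → f i j ≈ 0#) → conv (k ℕ.+ n) f ≈ conv n (λ i j → f (k ℕ.+ i) j)
  conv-skip zero    n f z = ≈-refl
  conv-skip (suc k) n f z = ≈-trans (+-cong (z 0 _ (ℕ.s≤s ℕ.z≤n)) (conv-skip k n _ λ i j i<k → z (suc i) j (ℕ.s≤s i<k))) (+-identityˡ _)

  -- For m ∣ n this is the complete homogeneous symmetric polynomial of degree n/m in v^m and w^m.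
  H : ℕ → R → R → R
  H n v w = conv n (λ j k → ι (dvd j) * (v ^ j * w ^ k))

  H-comm : ∀ {n} → m ∣ n → ∀ v w → H n v w ≈ H n w v
  H-comm {n} d v w = ≈-trans (conv-comm n _) (conv-cong n λ j k e →
    *-cong (ι-cong (dvd-complement d k j (trans (ℕₚ.+-comm k j) e))) (*-comm _ _))

  H-step : ∀ n v w → H (m ℕ.+ n) v w ≈ w ^ (m ℕ.+ n) + v ^ m * H n v w
  H-step n v w = subst (λ m′ → conv (m′ ℕ.+ n) f ≈ w ^ (m′ ℕ.+ n) + v ^ m * H n v w) 1+m∸1
    (+-cong (≈-trans (*-congʳ (≈-trans (ι-cong (dvd-yes (m ∣.∣0))) ι-1)) (≈-trans (*-identityˡ _) (*-identityˡ _))) (begin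
      conv (m ∸ 1 ℕ.+ n) (λ i j → f (suc i) j)
        ≈⟨ conv-skip (m ∸ 1) n _ (λ i j i< → ≈-trans (*-congʳ (≈-trans (ι-cong (dvd-no (not-divisible i i<))) ι-0)) (zeroˡ _)) ⟩
      conv n (λ i j → f (suc (m ∸ 1 ℕ.+ i)) j)
        ≈⟨ conv-ext n (λ i j → ≈-reflexive (cong (λ m′ → f (m′ ℕ.+ i) j) 1+m∸1)) ⟩
      conv n (λ i j → f (m ℕ.+ i) j)
        ≈⟨ conv-ext n (λ i j → *-cong (ι-cong (dvd-m+ i)) (≈-trans (*-congʳ (^-homo-* v m i)) (*-assoc _ _ _))) ⟩
      conv n (λ i j → ι (dvd i) * (v ^ m * (v ^ i * w ^ j)))
        ≈⟨ conv-ext n (λ i j → solve 3 (λ c p x → c :* (p :* x) := p :* (c :* x)) ≈-refl (ι (dvd i)) (v ^ m) (v ^ i * w ^ j)) ⟩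
      conv n (λ i j → v ^ m * (ι (dvd i) * (v ^ i * w ^ j)))
        ≈⟨ conv-*ˡ n (v ^ m) _ ⟨
      v ^ m * H n v w ∎))
    where
    f : ℕ → ℕ → R
    f j k = ι (dvd j) * (v ^ j * w ^ k)
    1+m∸1 : suc (m ∸ 1) ≡ m
    1+m∸1 = ℕₚ.m+[n∸m]≡n 0<m
    not-divisible : ∀ i → i ℕ.< m ∸ 1 → ¬ (m ∣ suc i)
    not-divisible i i< d = ℕₚ.<⇒≱ (subst (suc i ℕ.<_) 1+m∸1 (ℕ.s≤s i<)) (∣.∣⇒≤ d)
    dvd-m+ : ∀ i → dvd (m ℕ.+ i) ≡ dvd i
    dvd-m+ i with m ∣? i
    ... | yes d = dvd-yes (∣.∣m∣n⇒∣m+n ∣.∣-refl d)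
    ... | no ¬d = dvd-no λ d → ¬d (∣.∣m+n∣m⇒∣n d ∣.∣-refl)

  -- By symmetry, `H-step` for (v, w) and for (w, v) compute the same polynomial; their difference
  -- is the formula for a geometric sum in v^m and w^m.
  H-difference : ∀ {n} → m ∣ n → ∀ v w → (w ^ m - v ^ m) * H n v w ≈ w ^ (m ℕ.+ n) - v ^ (m ℕ.+ n)
  H-difference {n} d v w = begin
    (w ^ m - v ^ m) * X
      ≈⟨ solve 5 (λ p r x a b → (p :- r) :* x := (a :- b) :+ ((b :+ p :* x) :- (a :+ r :* x))) ≈-refl (w ^ m) (v ^ m) X w′ v′ ⟩
    (w′ - v′) + ((v′ + w ^ m * X) - (w′ + v ^ m * X))
      ≈⟨ +-congˡ (+-cong (+-congˡ (*-congˡ (H-comm d v w))) (-‿cong (≈-sym (H-step n v w)))) ⟩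
    (w′ - v′) + ((v′ + w ^ m * H n w v) - H (m ℕ.+ n) v w)
      ≈⟨ +-congˡ (+-cong (≈-sym (H-step n w v)) (-‿cong (H-comm (∣.∣m∣n⇒∣m+n ∣.∣-refl d) v w))) ⟩
    (w′ - v′) + (H (m ℕ.+ n) w v - H (m ℕ.+ n) w v)
      ≈⟨ ≈-trans (+-congˡ (-‿inverseʳ _)) (+-identityʳ _) ⟩
    w′ - v′ ∎
    where
    X = H n v w
    w′ = w ^ (m ℕ.+ n)
    v′ = v ^ (m ℕ.+ n)

  ^q : ∀ v → v ^ q ≈ v * v ^ m
  ^q v = ≈-reflexive (cong (v ^_) q≡1+m)

  -- Induction on n/m along `H-step`. The discrepancy between the two sides is removed by
  -- `H-difference`, and `sγ`, which is (a + b)^q = a^q + b^q, brings the factor (a + b)^m into the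
  -- induction hypothesis.
  H-additive : ∀ {n} → m ∣ n → ∀ a b → (a + b) * H n a b ≈ b * H n (a + b) a + a * H n (a + b) b
  H-additive (divides c refl) a b = go c
    where
    s = a + b
    α = a ^ m
    β = b ^ m
    γ = s ^ m
    sγ : s * γ ≈ a * α + b * β
    sγ = ≈-trans (≈-sym (^q s)) (≈-trans (frobenius a b) (+-cong (^q a) (^q b)))
    go : ∀ c → s * H (c ℕ.* m) a b ≈ b * H (c ℕ.* m) s a + a * H (c ℕ.* m) s b
    go zero = begin
      s * (ι (dvd 0) * (1# * 1#))  ≈⟨ solve 3 (λ a b h → (a :+ b) :* h := b :* h :+ a :* h) ≈-refl a b _ ⟩
      b * (ι (dvd 0) * (1# * 1#)) + a * (ι (dvd 0) * (1# * 1#)) ∎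
    go (suc c) = begin
      s * H (m ℕ.+ n) a b
        ≈⟨ *-congˡ (H-step n a b) ⟩
      s * (β′ + α * X)
        ≈⟨ solve 7 (λ a b x y p r z → (a :+ b) :* (y :+ p :* z) :=
             (b :* x :+ a :* y :+ (a :* p :+ b :* r) :* z) :+ b :* ((y :- x) :- (r :- p) :* z)) ≈-refl a b α′ β′ α β X ⟩
      (b * α′ + a * β′ + (a * α + b * β) * X) + b * ((β′ - α′) - (β - α) * X)
        ≈⟨ +-congˡ (≈-trans (*-congˡ (≈-trans (+-congˡ (-‿cong (H-difference (divides c refl) a b))) (-‿inverseʳ _))) (zeroʳ b)) ⟩
      (b * α′ + a * β′ + (a * α + b * β) * X) + 0#
        ≈⟨ ≈-trans (+-identityʳ _) (+-congˡ (*-congʳ (≈-sym sγ))) ⟩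
      b * α′ + a * β′ + (s * γ) * X
        ≈⟨ +-congˡ (solve 3 (λ s g x → (s :* g) :* x := g :* (s :* x)) ≈-refl s γ X) ⟩
      b * α′ + a * β′ + γ * (s * X)
        ≈⟨ +-congˡ (*-congˡ (go c)) ⟩
      b * α′ + a * β′ + γ * (b * Y + a * Z)
        ≈⟨ solve 7 (λ a b x y g k l → b :* x :+ a :* y :+ g :* (b :* k :+ a :* l) := b :* (x :+ g :* k) :+ a :* (y :+ g :* l)) ≈-refl a b α′ β′ γ Y Z ⟩
      b * (α′ + γ * Y) + a * (β′ + γ * Z)
        ≈⟨ +-cong (*-congˡ (H-step n s a)) (*-congˡ (H-step n s b)) ⟨
      b * H (m ℕ.+ n) s a + a * H (m ℕ.+ n) s b ∎
      where
      n = c ℕ.* m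
      X = H n a b
      Y = H n s a
      Z = H n s b
      α′ = a ^ (m ℕ.+ n)
      β′ = b ^ (m ℕ.+ n)

  Ω : ℕ → R → R → R
  Ω l v w = total (λ μ → (w - ι μ * v) ^ l)

  Ω-shift : ∀ l a b → Ω l a b ≈ Ω l a (a + b)
  Ω-shift l a b = ≈-sym (≈-trans
    (total-permute (KR._+ K.1#) (KR._- K.1#)
      (λ x → KS.solve 1 (λ x → (x KS.:- KS.:1) KS.:+ KS.:1 KS.:= x) refl x)
      (λ x → KS.solve 1 (λ x → (x KS.:+ KS.:1) KS.:- KS.:1 KS.:= x) refl x) (λ μ → ((a + b) - ι μ * a) ^ l))
    (total-cong λ μ → ^-congˡ l (≈-trans (+-congˡ (-‿cong (*-congʳ (≈-trans (ι-+ μ K.1#) (+-congˡ ι-1)))))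
      (solve 3 (λ a b μ → (a :+ b) :- (μ :+ :1) :* a := b :- μ :* a) ≈-refl a b (ι μ)))))

  total-neg : ∀ f → total (λ x → - f x) ≈ - total f
  total-neg f = ≈-trans (≈-sym (≈-trans (+-congˡ (-‿inverseʳ (total f))) (+-identityʳ _)))
    (≈-trans (≈-sym (+-assoc _ _ _)) (≈-trans (+-congʳ (≈-trans (≈-sym (total-∙ (λ x → - f x) f))
      (≈-trans (total-cong {g = λ _ → 0#} λ x → -‿inverseˡ (f x)) (sum-zero {q} (λ _ → 0#) λ _ → ≈-refl)))) (+-identityˡ _)))

  -- The substitution μ ↦ 1 - μ turns a - μ(a + b) into -(b - μ(a + b)), and (-1)^l = -1 because q -
  -- 1 divides l + 1.
  Ω-antisymmetric : ∀ l → m ∣ suc l → ∀ a b → Ω l (a + b) a ≈ - Ω l (a + b) b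
  Ω-antisymmetric l d a b = ≈-trans
    (total-permute (λ x → K.1# KR.- x) (λ x → K.1# KR.- x) involution involution (λ μ → (a - ι μ * (a + b)) ^ l))
    (≈-trans (total-cong λ μ → ≈-trans (^-congˡ l (≈-trans
         (+-congˡ (-‿cong (*-congʳ (≈-trans (ι-+ K.1# (KR.- μ)) (+-cong ι-1 (ι-neg μ))))))
         (solve 3 (λ a b μ → a :- (:1 :- μ) :* (a :+ b) := :- (b :- μ :* (a :+ b))) ≈-refl a b (ι μ))))
       (≈-trans (neg^ l _) (≈-trans (*-congʳ sgn-l) (-1*x≈-x _))))
     (total-neg (λ μ → (b - ι μ * (a + b)) ^ l)))
    where
    involution : ∀ x → K.1# KR.- (K.1# KR.- x) ≡ x
    involution x = KS.solve 1 (λ x → KS.:1 KS.:- (KS.:1 KS.:- x) KS.:= x) refl x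
    sgn-l : ι (sgn l) ≈ - 1#
    sgn-l = ≈-trans (ι-cong (trans (sym (KP.-‿involutive (sgn l))) (cong K.-_ (sgn-∣ d))))
      (≈-trans (ι-neg K.1#) (-‿cong ι-1))

  total-conv : ∀ n (f : K.Carrier → ℕ → ℕ → R) → total (λ μ → conv n (f μ)) ≈ conv n (λ i j → total (λ μ → f μ i j))
  total-conv zero    f = ≈-refl
  total-conv (suc n) f = ≈-trans (total-∙ (λ μ → f μ 0 (suc n)) (λ μ → conv n (λ i → f μ (suc i)))) (+-congˡ (total-conv n λ μ i → f μ (suc i)))

  total-ι : ∀ c (f : K.Carrier → K.Carrier) x → total (λ μ → ι (c K.* f μ) * x) ≈ ι (c K.* KΣ.total f) * x
  total-ι c f x = go q _
    where
    open Algebra.Properties.CommutativeMonoid.Sum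
    go : ∀ n (t : Fin n → K.Carrier) →
      sum +-commutativeMonoid (λ i → ι (c K.* t i) * x) ≈ ι (c K.* sum KR.+-commutativeMonoid t) * x
    go zero    t = ≈-sym (≈-trans (*-congʳ (≈-trans (ι-cong (KR.zeroʳ c)) ι-0)) (zeroˡ x))
    go (suc n) t = ≈-trans (+-congˡ (go n (t ∘ Fin.suc)))
      (≈-trans (≈-sym (distribʳ _ _ _)) (*-congʳ (≈-trans (≈-sym (ι-+ _ _)) (ι-cong (sym (KR.distribˡ c _ _))))))

  -- After binomial expansion the power sums over μ select the exponents j divisible by q - 1. As q
  -- - 1 divides l + 1 = j + (k + 1), the condition may be read on k + 1, where it has the shape of
  -- the coefficients of the diamond product.
  Ω-expand : ∀ l → m ∣ suc l → ∀ v w →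
    Ω l v w ≈ w ^ l + conv l (λ j k → ι (dvd (suc k) K.* (sgn k K.* bin l k)) * (v ^ j * w ^ k))
  Ω-expand l d v w = begin
    total (λ μ → (w - ι μ * v) ^ l)
      ≈⟨ total-cong (λ μ → ≈-trans (difference^ l w (ι μ * v)) (≈-trans (conv-comm l _) (conv-ext l (term μ)))) ⟩
    total (λ μ → conv l (λ j k → ι ((sgn j K.* bin l j) K.* μ KE.^ j) * (v ^ j * w ^ k)))
      ≈⟨ ≈-trans (total-conv l (λ μ j k → ι ((sgn j K.* bin l j) K.* μ KE.^ j) * (v ^ j * w ^ k))) (conv-ext l λ j k → total-ι (sgn j K.* bin l j) (KE._^ j) _) ⟩
    conv l (λ j k → ι ((sgn j K.* bin l j) K.* S j) * (v ^ j * w ^ k))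
      ≈⟨ conv-cong l (λ j k e → ≈-trans (*-congʳ (≈-trans (ι-cong (coefficient j k e)) (ι-+ _ _))) (distribʳ _ _ _)) ⟩
    conv l (λ j k → ι (δ j) * (v ^ j * w ^ k) + ι (dvd (suc k) K.* (sgn k K.* bin l k)) * (v ^ j * w ^ k))
      ≈⟨ conv-+ l _ _ ⟩
    conv l (λ j k → ι (δ j) * (v ^ j * w ^ k)) + _
      ≈⟨ +-congʳ (≈-trans (conv-single l 0 l (λ j k → ι (δ j) * (v ^ j * w ^ k)) refl λ { zero _ ne → contradiction refl ne ; (suc j) _ _ → ≈-trans (*-congʳ ι-0) (zeroˡ _) })
                          (≈-trans (*-congʳ ι-1) (≈-trans (*-identityˡ _) (*-identityˡ _)))) ⟩
    w ^ l + conv l (λ j k → ι (dvd (suc k) K.* (sgn k K.* bin l k)) * (v ^ j * w ^ k)) ∎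
    where
    S : ℕ → K.Carrier
    S j = KΣ.total (KE._^ j)
    -- A correction at j = 0: there the power sum is 0, while the uniform formula gives -1. It
    -- accounts for the separate term w^l.
    δ : ℕ → K.Carrier
    δ zero    = K.1#
    δ (suc _) = K.0#
    ι-^ : ∀ μ j → ι μ ^ j ≈ ι (μ KE.^ j)
    ι-^ μ zero    = ≈-sym ι-1
    ι-^ μ (suc j) = ≈-trans (*-congˡ (ι-^ μ j)) (≈-sym (ι-* _ _))
    term : ∀ μ j k → ι (sgn j K.* bin l j) * (w ^ k * (ι μ * v) ^ j) ≈ ι ((sgn j K.* bin l j) K.* μ KE.^ j) * (v ^ j * w ^ k)
    term μ j k = begin
      ι (sgn j K.* bin l j) * (w ^ k * (ι μ * v) ^ j)
        ≈⟨ *-congˡ (*-congˡ (≈-trans (^-distrib-* (ι μ) v j) (*-congʳ (ι-^ μ j)))) ⟩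
      ι (sgn j K.* bin l j) * (w ^ k * (ι (μ KE.^ j) * v ^ j))
        ≈⟨ solve 4 (λ c w p v → c :* (w :* (p :* v)) := (c :* p) :* (v :* w)) ≈-refl (ι (sgn j K.* bin l j)) (w ^ k) (ι (μ KE.^ j)) (v ^ j) ⟩
      (ι (sgn j K.* bin l j) * ι (μ KE.^ j)) * (v ^ j * w ^ k)
        ≈⟨ *-congʳ (≈-sym (ι-* _ _)) ⟩
      ι ((sgn j K.* bin l j) K.* μ KE.^ j) * (v ^ j * w ^ k) ∎
    sgn-l : sgn l ≡ K.- K.1#
    sgn-l = trans (sym (KP.-‿involutive (sgn l))) (cong K.-_ (sgn-∣ d))
    bin-sym : ∀ j k → j ℕ.+ k ≡ l → bin l j ≡ bin l k
    bin-sym j k refl = PowerSums.bin-symmetric q 𝔽 j k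
    coefficient : ∀ j k → j ℕ.+ k ≡ l →
      (sgn j K.* bin l j) K.* S j ≡ δ j K.+ dvd (suc k) K.* (sgn k K.* bin l k)
    coefficient zero k refl = trans (trans (cong ((sgn 0 K.* bin k 0) K.*_) power-sum-0) (KR.zeroʳ _)) (sym
      (trans (cong (K._+_ K.1#) (trans (cong₂ K._*_ (dvd-yes d) (trans (cong₂ K._*_ sgn-l (bin-n k)) (KR.*-identityʳ _))) (KR.*-identityˡ _)))
             (KR.-‿inverseʳ K.1#)))
    coefficient (suc j) k e with m ∣? suc k
    ... | no ¬d = trans (trans (cong ((sgn (suc j) K.* bin l (suc j)) K.*_) (power-sum-∤ (suc j) λ dj → ¬d (∣.∣m+n∣m⇒∣n (subst (m ∣_) (sym (trans (ℕₚ.+-suc (suc j) k) (cong suc e))) d) dj)))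
                               (KR.zeroʳ _))
                        (sym (trans (KR.+-identityˡ _) (KR.zeroˡ _)))
    ... | yes dk = trans (cong₂ (λ x y → (sgn (suc j) K.* x) K.* y) (bin-sym (suc j) k e)
                            (power-sum-∣ j (∣.∣m+n∣m⇒∣n (subst (m ∣_) (sym (trans (ℕₚ.+-comm (suc k) (suc j)) (trans (ℕₚ.+-suc (suc j) k) (cong suc e)))) d) dk)))
                   (trans (KS.solve 2 (λ s b → (s KS.:* b) KS.:* (KS.:- KS.:1) KS.:= (KS.:- s) KS.:* b) refl (sgn (suc j)) (bin l k))
                   (trans (cong (K._* bin l k) sgn-k) (sym (trans (KR.+-identityˡ _) (KR.*-identityˡ _)))))
      where
      sgn-k : K.- sgn (suc j) ≡ sgn k
      sgn-k = trans (cong K.-_ (sym (KR.*-identityʳ _))) (trans (cong (λ z → K.- (sgn (suc j) K.* z)) (sym (sgn² k)))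
        (trans (KS.solve 2 (λ a b → KS.:- (a KS.:* (b KS.:* b)) KS.:= (KS.:- (a KS.:* b)) KS.:* b) refl (sgn (suc j)) (sgn k))
        (trans (cong (λ z → K.- z K.* sgn k) (trans (sym (sgn-* (suc j) k)) (trans (cong sgn e) sgn-l)))
        (trans (cong (K._* sgn k) (KP.-‿involutive K.1#)) (KR.*-identityˡ _)))))

-- The identity for the product P(v) P(w), from the multiplication table of letters.

module AdditivityTheorem (q : ℕ) (𝔽 : FiniteField q) (A : 𝔽-Algebra q 𝔽) where
  open Construction q 𝔽 using (sgn)
  private module K = FiniteField 𝔽
  open FieldFacts q 𝔽 using (𝔽-ring; m)
  open PowerSums q 𝔽 using (bin; bin->; κ)
  open 𝔽-Algebra A renaming (Carrier to R; refl to ≈-refl; sym to ≈-sym; trans to ≈-trans; reflexive to ≈-reflexive)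
  open Algebra.Properties.Semiring.Exp semiring using (_^_)
  open AlgebraIdentities q 𝔽 A
  open Additivity q 𝔽 A
  open IntegerSolver commutativeRing
  open Antidiagonal commutativeRing
  open Relation.Binary.Reasoning.Setoid setoid
  private module KR = CommutativeRing 𝔽-ring

  -- The coefficient of θ i l in the product P(v) P(w).
  φ : ℕ → ℕ → R → R → R
  φ i zero    v w = H (suc i) v w
  φ i (suc l) v w = v ^ suc i * w * Ω l v w + w ^ suc i * v * Ω l w v

  -- For l = 0 this is the identity for `H`. Otherwise the shift replaces Ω(a, b) by Ω(a, a + b),
  -- and the terms with (a + b)^(i+1) on the right cancel by antisymmetry.
  φ-additive : ∀ i l → m ∣ suc (i ℕ.+ l) → m ∣ l → ∀ a b →
    (a + b) * φ i l a b ≈ b * φ i l (a + b) a + a * φ i l (a + b) b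
  φ-additive i zero    d _ a b = H-additive (subst (λ z → m ∣ suc z) (ℕₚ.+-identityʳ i) d) a b
  φ-additive i (suc l) _ d a b = begin
    s * (a ^ suc i * b * X + b ^ suc i * a * Y)
      ≈⟨ solve 8 (λ a b p r t X Y Z → (a :+ b) :* (p :* b :* X :+ r :* a :* Y) :=
           b :* (t :* a :* (:- Z) :+ p :* (a :+ b) :* X) :+ a :* (t :* b :* Z :+ r :* (a :+ b) :* Y))
           ≈-refl a b (a ^ suc i) (b ^ suc i) (s ^ suc i) X Y Z ⟩
    b * (s ^ suc i * a * (- Z) + a ^ suc i * s * X) + a * (s ^ suc i * b * Z + b ^ suc i * s * Y)
      ≈⟨ +-cong (*-congˡ (+-cong (*-congˡ (≈-sym (Ω-antisymmetric l d a b))) (*-congˡ (Ω-shift l a b))))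
                (*-congˡ (+-congˡ (*-congˡ (≈-trans (Ω-shift l b a) (Ω-cong (+-comm b a)))))) ⟩
    b * (s ^ suc i * a * Ω l s a + a ^ suc i * s * Ω l a s) + a * (s ^ suc i * b * Ω l s b + b ^ suc i * s * Ω l b s) ∎
    where
    open Algebra.Properties.Semiring.Exp semiring using (^-congˡ)
    open FieldSums q 𝔽 +-commutativeMonoid using (total-cong)
    s = a + b
    X = Ω l a b
    Y = Ω l b a
    Z = Ω l s b
    Ω-cong : ∀ {v w w′} → w ≈ w′ → Ω l v w ≈ Ω l v w′
    Ω-cong {v} {w} {w′} e = total-cong {f = λ μ → (w - ι μ * v) ^ l} {g = λ μ → (w′ - ι μ * v) ^ l} λ μ → ^-congˡ l (+-congʳ e)

  -- `T j k` stands for P_j ⧢ P_k and `θ i l` for the letter x_{i+1} followed by P_l. The hypotheses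
  -- are the shuffle product of two letters and the vanishing off multiples of q - 1; being a mere
  -- table, they can be met before the shuffle product is known to be associative.
  module _ (T θ : ℕ → ℕ → R)
    (T-0ˡ : ∀ k → m ∣ suc k → T 0 (suc k) ≈ θ k 0)
    (T-0ʳ : ∀ j → m ∣ suc j → T (suc j) 0 ≈ θ j 0)
    (T-suc : ∀ j k → m ∣ suc j → m ∣ suc k →
      T (suc j) (suc k) ≈ θ j (suc k) + θ k (suc j) + conv (suc (j ℕ.+ k)) (λ i l → ι (κ j k l) * θ i l))
    (T-∤ˡ : ∀ {j} k → ¬ (m ∣ j) → T j k ≈ 0#)
    (T-∤ʳ : ∀ j {k} → ¬ (m ∣ k) → T j k ≈ 0#)
    (θ-∤ : ∀ i {l} → ¬ (m ∣ l) → θ i l ≈ 0#)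
    where

    Ψ : ℕ → R → R → R
    Ψ n v w = conv n (λ j k → T j k * (v ^ j * w ^ k))

    θ-dvd : ∀ i l → ι (dvd l) * θ i l ≈ θ i l
    θ-dvd i l with m ∣? l
    ... | yes _ = ≈-trans (*-congʳ ι-1) (*-identityˡ _)
    ... | no ¬d = ≈-trans (*-congʳ ι-0) (≈-trans (zeroˡ _) (≈-sym (θ-∤ i ¬d)))

    T-dvd : ∀ n → m ∣ suc (suc n) → ∀ j k → j ℕ.+ k ≡ n → T (suc j) (suc k) ≈
      ι (dvd (suc j)) * (θ j (suc k) + θ k (suc j) + conv (suc n) (λ i l → ι (κ j k l) * θ i l))
    T-dvd n d j k refl with m ∣? suc j
    ... | no ¬dj = ≈-trans (T-∤ˡ (suc k) ¬dj) (≈-sym (≈-trans (*-congʳ ι-0) (zeroˡ _)))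
    ... | yes dj = ≈-trans (T-suc j k dj (∣.∣m+n∣m⇒∣n (subst (m ∣_) (sym (ℕₚ.+-suc (suc j) k)) d) dj))
                     (≈-sym (≈-trans (*-congʳ ι-1) (*-identityˡ _)))

    -- For each `θ i l` three contributions are collected: two from the words in which either letter
    -- comes first, and `Z` from the diamond product. `combine` recognises their sum as `φ` by means
    -- of `Ω-expand`.
    Ψ-expand : ∀ n → m ∣ suc n → ∀ v w → Ψ (suc n) v w ≈ conv n (λ i l → θ i l * φ i l v w)
    Ψ-expand zero d v w = begin
      T 0 1 * (1# * (w * 1#)) + T 1 0 * ((v * 1#) * 1#)
        ≈⟨ +-cong (*-congʳ (T-0ˡ 0 d)) (*-congʳ (T-0ʳ 0 d)) ⟩
      θ 0 0 * (1# * (w * 1#)) + θ 0 0 * ((v * 1#) * 1#)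
        ≈⟨ +-cong (*-congˡ (≈-sym (≈-trans (*-congʳ (≈-trans (ι-cong (dvd-yes (m ∣.∣0))) ι-1)) (*-identityˡ _))))
                  (*-congˡ (≈-sym (≈-trans (*-congʳ (≈-trans (ι-cong (dvd-yes d)) ι-1)) (*-identityˡ _)))) ⟩
      θ 0 0 * (ι (dvd 0) * (1# * (w * 1#))) + θ 0 0 * (ι (dvd 1) * ((v * 1#) * 1#))
        ≈⟨ distribˡ _ _ _ ⟨
      θ 0 0 * H 1 v w ∎
    Ψ-expand (suc n) d v w = begin
      T 0 (suc (suc n)) * (1# * w ^ suc (suc n)) + conv (suc n) (λ j k → T (suc j) k * (v ^ suc j * w ^ k))
        ≈⟨ +-cong (*-congʳ (T-0ˡ (suc n) d)) (conv-last n λ j k → T (suc j) k * (v ^ suc j * w ^ k)) ⟩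
      θ₀ * (1# * w ^ suc (suc n)) + (conv n (λ j k → T (suc j) (suc k) * VW j k) + T (suc (suc n)) 0 * (v ^ suc (suc n) * 1#))
        ≈⟨ +-congˡ (+-cong middle (*-congʳ (T-0ʳ (suc n) d))) ⟩
      θ₀ * (1# * w ^ suc (suc n)) + (((M₁ + M₂) + (M₃ + θ₀ * Z 0)) + θ₀ * (v ^ suc (suc n) * 1#))
        ≈⟨ solve 7 (λ t w v x y z o → t :* (:1 :* w) :+ (((x :+ y) :+ (z :+ t :* o)) :+ t :* (v :* :1)) :=
             (x :+ y :+ z) :+ t :* (w :+ (o :+ v)))
             ≈-refl θ₀ (w ^ suc (suc n)) (v ^ suc (suc n)) M₁ M₂ M₃ (Z 0) ⟩
      (M₁ + M₂ + M₃) + θ₀ * (w ^ suc (suc n) + (Z 0 + v ^ suc (suc n)))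
        ≈⟨ +-cong (≈-trans (≈-sym (≈-trans (conv-+ n _ _) (+-congʳ (conv-+ n _ _)))) (conv-cong n combine)) (*-congˡ (≈-sym leading)) ⟩
      conv n (λ i l → θ i (suc l) * φ i (suc l) v w) + θ₀ * φ (suc n) 0 v w
        ≈⟨ conv-last n (λ i l → θ i l * φ i l v w) ⟨
      conv (suc n) (λ i l → θ i l * φ i l v w) ∎
      where
      θ₀ = θ (suc n) 0
      VW : ℕ → ℕ → R
      VW j k = v ^ suc j * w ^ suc k
      -- The share of the diamond terms in the factor of `θ i l`. One indicator suffices: since m
      -- divides (j + 1) + (k + 1), the condition on j + 1 implies the one on k + 1.
      Z : ℕ → R
      Z l = conv n (λ j k → ι (dvd (suc j)) * ι (κ j k l) * VW j k)
      M₁ = conv n (λ i l → θ i (suc l) * VW i l)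
      M₂ = conv n (λ i l → θ i (suc l) * (w ^ suc i * v ^ suc l))
      M₃ = conv n (λ i l → θ i (suc l) * Z (suc l))
      dvd-swap : ∀ j k → j ℕ.+ k ≡ n → dvd (suc j) ≡ dvd (suc k)
      dvd-swap j k e = dvd-complement d (suc j) (suc k) (trans (ℕₚ.+-suc (suc j) k) (cong (suc ∘ suc) e))

      middle : conv n (λ j k → T (suc j) (suc k) * VW j k) ≈ (M₁ + M₂) + (M₃ + θ₀ * Z 0)
      middle = begin
        conv n (λ j k → T (suc j) (suc k) * VW j k)
          ≈⟨ conv-cong n (λ j k e → ≈-trans (*-congʳ (T-dvd n d j k e))
               (≈-trans (solve 5 (λ i x y z u → i :* (x :+ y :+ z) :* u := (i :* x :* u :+ i :* y :* u) :+ i :* z :* u)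
                          ≈-refl (ι (dvd (suc j))) (θ j (suc k)) (θ k (suc j)) _ (VW j k))
                 (+-congʳ (+-cong (*-congʳ (≈-trans (*-congʳ (ι-cong (dvd-swap j k e))) (θ-dvd j (suc k)))) (*-congʳ (θ-dvd k (suc j))))))) ⟩
        conv n (λ j k → (θ j (suc k) * VW j k + θ k (suc j) * VW j k)
          + ι (dvd (suc j)) * conv (suc n) (λ i l → ι (κ j k l) * θ i l) * VW j k)
          ≈⟨ ≈-trans (conv-+ n _ _) (+-cong (conv-+ n _ _) ≈-refl) ⟩
        (M₁ + conv n (λ j k → θ k (suc j) * VW j k))
          + conv n (λ j k → ι (dvd (suc j)) * conv (suc n) (λ i l → ι (κ j k l) * θ i l) * VW j k)
          ≈⟨ +-cong (+-congˡ (≈-trans (conv-comm n _) (conv-ext n λ i l → *-congˡ (*-comm _ _)))) exchange ⟩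
        (M₁ + M₂) + conv (suc n) (λ i l → θ i l * Z l)
          ≈⟨ +-congˡ (conv-last n λ i l → θ i l * Z l) ⟩
        (M₁ + M₂) + (M₃ + θ₀ * Z 0) ∎
        where
        exchange : conv n (λ j k → ι (dvd (suc j)) * conv (suc n) (λ i l → ι (κ j k l) * θ i l) * VW j k)
          ≈ conv (suc n) (λ i l → θ i l * Z l)
        exchange = begin
          conv n (λ j k → ι (dvd (suc j)) * conv (suc n) (λ i l → ι (κ j k l) * θ i l) * VW j k)
            ≈⟨ conv-ext n (λ j k → ≈-trans (solve 3 (λ i s u → i :* s :* u := (i :* u) :* s) ≈-refl (ι (dvd (suc j))) _ (VW j k)) (conv-*ˡ (suc n) _ λ i l → ι (κ j k l) * θ i l)) ⟩
          conv n (λ j k → conv (suc n) (λ i l → (ι (dvd (suc j)) * VW j k) * (ι (κ j k l) * θ i l)))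
            ≈⟨ conv-swap n (suc n) (λ j k i l → (ι (dvd (suc j)) * VW j k) * (ι (κ j k l) * θ i l)) ⟩
          conv (suc n) (λ i l → conv n (λ j k → (ι (dvd (suc j)) * VW j k) * (ι (κ j k l) * θ i l)))
            ≈⟨ conv-ext (suc n) {g = λ i l → θ i l * Z l} (λ i l → ≈-trans (conv-ext n λ j k → solve 4 (λ i u c t → (i :* u) :* (c :* t) := t :* (i :* c :* u)) ≈-refl (ι (dvd (suc j))) (VW j k) (ι (κ j k l)) (θ i l))
                 (≈-sym (conv-*ˡ n (θ i l) _))) ⟩
          conv (suc n) (λ i l → θ i l * Z l) ∎

      -- The two products with P_0 = 1 and the single-letter diamond terms together fill up the
      -- whole sum `H`.
      leading : H (suc (suc n)) v w ≈ w ^ suc (suc n) + (Z 0 + v ^ suc (suc n))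
      leading = +-cong (≈-trans (*-congʳ (≈-trans (ι-cong (dvd-yes (m ∣.∣0))) ι-1)) (≈-trans (*-identityˡ _) (*-identityˡ _)))
        (≈-trans (conv-last n λ j k → ι (dvd (suc j)) * (v ^ suc j * w ^ k)) (+-cong
          (conv-ext n λ j k → *-congʳ (≈-sym (≈-trans (*-congˡ ι-1) (*-identityʳ _))))
          (≈-trans (*-congʳ (≈-trans (ι-cong (dvd-yes d)) ι-1)) (≈-trans (*-identityˡ _) (*-identityʳ _)))))

      combine : ∀ i l → i ℕ.+ l ≡ n →
        θ i (suc l) * VW i l + θ i (suc l) * (w ^ suc i * v ^ suc l) + θ i (suc l) * Z (suc l) ≈ θ i (suc l) * φ i (suc l) v w
      combine i l refl with m ∣? suc l
      ... | no ¬dl = ≈-trans (solve 4 (λ t a b c → t :* a :+ t :* b :+ t :* c := t :* (a :+ b :+ c)) ≈-refl _ _ _ _)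
                       (≈-trans (≈-trans (*-congʳ (θ-∤ i ¬dl)) (zeroˡ _)) (≈-sym (≈-trans (*-congʳ (θ-∤ i ¬dl)) (zeroˡ _))))
      ... | yes dl = ≈-trans (solve 4 (λ t a b c → t :* a :+ t :* b :+ t :* c := t :* (a :+ b :+ c)) ≈-refl _ _ _ _) (*-congˡ (begin
          VW i l + w ^ suc i * v ^ suc l + Z (suc l)
            ≈⟨ +-congˡ Z-split ⟩
          VW i l + w ^ suc i * v ^ suc l + (w * v * (w ^ i * D w v) + v * w * (v ^ i * D v w))
            ≈⟨ solve 8 (λ v w vi wi vl wl x y → v :* vi :* (w :* wl) :+ w :* wi :* (v :* vl) :+ (w :* v :* (wi :* x) :+ v :* w :* (vi :* y)) :=
                 v :* vi :* w :* (wl :+ y) :+ w :* wi :* v :* (vl :+ x)) ≈-refl v w (v ^ i) (w ^ i) (v ^ l) (w ^ l) (D w v) (D v w) ⟩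
          v ^ suc i * w * (w ^ l + D v w) + w ^ suc i * v * (v ^ l + D w v)
            ≈⟨ +-cong (*-congˡ (≈-sym (Ω-expand l dl v w))) (*-congˡ (≈-sym (Ω-expand l dl w v))) ⟩
          φ i (suc l) v w ∎))
        where
        g : ℕ → K.Carrier
        g k = dvd (suc k) K.* (sgn k K.* bin l k)
        D : R → R → R
        D v w = conv l (λ j k → ι (g k) * (v ^ j * w ^ k))
        half : ∀ v w → conv (i ℕ.+ l) (λ j k → ι (g k) * (v ^ suc j * w ^ suc k)) ≈ v * w * (v ^ i * D v w)
        half v w = begin
          conv (i ℕ.+ l) (λ j k → ι (g k) * (v ^ suc j * w ^ suc k))
            ≈⟨ conv-ext (i ℕ.+ l) (λ j k → solve 5 (λ c v w p r → c :* (v :* p :* (w :* r)) := v :* w :* (c :* (p :* r))) ≈-refl (ι (g k)) v w (v ^ j) (w ^ k)) ⟩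
          conv (i ℕ.+ l) (λ j k → v * w * (ι (g k) * (v ^ j * w ^ k)))
            ≈⟨ conv-*ˡ (i ℕ.+ l) (v * w) _ ⟨
          v * w * conv (i ℕ.+ l) (λ j k → ι (g k) * (v ^ j * w ^ k))
            ≈⟨ *-congˡ (conv-shift i l g (λ k l<k → trans (cong (λ z → dvd (suc k) K.* (sgn k K.* z)) (bin-> l<k)) (trans (cong (dvd (suc k) K.*_) (KR.zeroʳ _)) (KR.zeroʳ _))) v w) ⟩
          v * w * (v ^ i * D v w) ∎
        Z-split : Z (suc l) ≈ w * v * (w ^ i * D w v) + v * w * (v ^ i * D v w)
        Z-split = begin
          conv (i ℕ.+ l) (λ j k → ι (dvd (suc j)) * ι (sgn j K.* bin l j K.+ sgn k K.* bin l k) * VW j k)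
            ≈⟨ conv-cong (i ℕ.+ l) (λ j k e → ≈-trans (*-congʳ (≈-trans (≈-sym (ι-* _ _)) (≈-trans (ι-cong (trans (KR.distribˡ _ _ _)
                  (cong (λ z → g j K.+ z K.* (sgn k K.* bin l k)) (dvd-swap j k e)))) (ι-+ _ _)))) (distribʳ _ _ _)) ⟩
          conv (i ℕ.+ l) (λ j k → ι (g j) * VW j k + ι (g k) * VW j k)
            ≈⟨ conv-+ (i ℕ.+ l) _ _ ⟩
          conv (i ℕ.+ l) (λ j k → ι (g j) * VW j k) + conv (i ℕ.+ l) (λ j k → ι (g k) * VW j k)
            ≈⟨ +-cong (≈-trans (conv-comm (i ℕ.+ l) _) (≈-trans (conv-ext (i ℕ.+ l) λ j k → *-congˡ (*-comm _ _)) (half w v))) (half v w) ⟩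
          w * v * (w ^ i * D w v) + v * w * (v ^ i * D v w) ∎

    Ψ-additive : ∀ n a b → (a + b) * Ψ n a b ≈ b * Ψ n (a + b) a + a * Ψ n (a + b) b
    Ψ-additive zero a b = solve 3 (λ a b t → (a :+ b) :* (t :* (:1 :* :1)) := b :* (t :* (:1 :* :1)) :+ a :* (t :* (:1 :* :1))) ≈-refl a b (T 0 0)
    Ψ-additive (suc n) a b with m ∣? suc n
    ... | no ¬d = begin
        (a + b) * Ψ (suc n) a b                ≈⟨ *-congˡ (vanish a b) ⟩
        (a + b) * 0#                           ≈⟨ solve 2 (λ a b → (a :+ b) :* :0 := b :* :0 :+ a :* :0) ≈-refl a b ⟩
        b * 0# + a * 0#                        ≈⟨ +-cong (*-congˡ (vanish _ a)) (*-congˡ (vanish _ b)) ⟨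
        b * Ψ (suc n) (a + b) a + a * Ψ (suc n) (a + b) b ∎
      where
      zeroT : ∀ j k → j ℕ.+ k ≡ suc n → T j k ≈ 0#
      zeroT j k e with m ∣? j | m ∣? k
      ... | no ¬dj | _      = T-∤ˡ k ¬dj
      ... | yes _  | no ¬dk = T-∤ʳ j ¬dk
      ... | yes dj | yes dk = contradiction (subst (m ∣_) e (∣.∣m∣n⇒∣m+n dj dk)) ¬d
      vanish : ∀ v w → Ψ (suc n) v w ≈ 0#
      vanish v w = conv-zero (suc n) {f = λ j k → T j k * (v ^ j * w ^ k)} λ j k e → ≈-trans (*-congʳ (zeroT j k e)) (zeroˡ _)
    ... | yes d = begin
        s * Ψ (suc n) a b
          ≈⟨ ≈-trans (*-congˡ (Ψ-expand n d a b)) (conv-*ˡ n s _) ⟩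
        conv n (λ i l → s * (θ i l * φ i l a b))
          ≈⟨ conv-cong n (λ i l e → term i l e) ⟩
        conv n (λ i l → b * (θ i l * φ i l s a) + a * (θ i l * φ i l s b))
          ≈⟨ conv-+ n _ _ ⟩
        conv n (λ i l → b * (θ i l * φ i l s a)) + conv n (λ i l → a * (θ i l * φ i l s b))
          ≈⟨ +-cong (≈-trans (*-congˡ (Ψ-expand n d s a)) (conv-*ˡ n b _)) (≈-trans (*-congˡ (Ψ-expand n d s b)) (conv-*ˡ n a _)) ⟨
        b * Ψ (suc n) s a + a * Ψ (suc n) s b ∎
      where
      s = a + b
      term : ∀ i l → i ℕ.+ l ≡ n → s * (θ i l * φ i l a b) ≈ b * (θ i l * φ i l s a) + a * (θ i l * φ i l s b)
      term i l refl with m ∣? l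
      ... | yes dl = begin
        s * (θ i l * φ i l a b)
          ≈⟨ solve 3 (λ s t x → s :* (t :* x) := t :* (s :* x)) ≈-refl s (θ i l) (φ i l a b) ⟩
        θ i l * (s * φ i l a b)
          ≈⟨ *-congˡ (φ-additive i l d dl a b) ⟩
        θ i l * (b * φ i l s a + a * φ i l s b)
          ≈⟨ solve 5 (λ t a b x y → t :* (b :* x :+ a :* y) := b :* (t :* x) :+ a :* (t :* y)) ≈-refl (θ i l) a b (φ i l s a) (φ i l s b) ⟩
        b * (θ i l * φ i l s a) + a * (θ i l * φ i l s b) ∎
      ... | no ¬dl = begin
        s * (θ i l * φ i l a b)
          ≈⟨ ≈-trans (*-congˡ (≈-trans (*-congʳ (θ-∤ i ¬dl)) (zeroˡ _))) (zeroʳ _) ⟩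
        0#
          ≈⟨ solve 2 (λ a b → :0 := b :* :0 :+ a :* :0) ≈-refl a b ⟩
        b * 0# + a * 0#
          ≈⟨ +-cong (*-congˡ (≈-trans (*-congʳ (θ-∤ i ¬dl)) (zeroˡ _))) (*-congˡ (≈-trans (*-congʳ (θ-∤ i ¬dl)) (zeroˡ _))) ⟨
        b * (θ i l * φ i l s a) + a * (θ i l * φ i l s b) ∎

-- Formal combinations and their values on functionals.

module Pairing (q : ℕ) (𝔽 : FiniteField q) where
  open FieldFacts q 𝔽 using (𝔽-ring)
  open CommutativeRing 𝔽-ring hiding (refl; sym; trans) renaming (Carrier to K)
  open IntegerSolver 𝔽-ring
  open Antidiagonal 𝔽-ring
  open ≡-Reasoning

  -- Formal combinations, tested against arbitrary functionals on the basis.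
  FM : Set → Set
  FM B = List (K × B)

  private variable
    B C D : Set

  ∫ : FM B → (B → K) → K
  ∫ []            φ = 0#
  ∫ ((c , b) ∷ d) φ = c * φ b + ∫ d φ

  ∫₂ : FM (B × C) → (B → C → K) → K
  ∫₂ d φ = ∫ d (λ p → φ (proj₁ p) (proj₂ p))

  ∫-cong : ∀ (d : FM B) {φ ψ} → (∀ b → φ b ≡ ψ b) → ∫ d φ ≡ ∫ d ψ
  ∫-cong []            h = refl
  ∫-cong ((c , b) ∷ d) h = cong₂ _+_ (cong (c *_) (h b)) (∫-cong d h)

  ∫-congAll : ∀ {P : B → Set} (d : FM B) {φ ψ} → All (P ∘ proj₂) d → (∀ b → P b → φ b ≡ ψ b) → ∫ d φ ≡ ∫ d ψ
  ∫-congAll []            []       h = refl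
  ∫-congAll ((c , b) ∷ d) (p ∷ ps) h = cong₂ _+_ (cong (c *_) (h b p)) (∫-congAll d ps h)

  ∫-++ : ∀ (d e : FM B) φ → ∫ (d ++ e) φ ≡ ∫ d φ + ∫ e φ
  ∫-++ []            e φ = sym (+-identityˡ _)
  ∫-++ ((c , b) ∷ d) e φ = trans (cong (_+_ (c * φ b)) (∫-++ d e φ)) (sym (+-assoc _ _ _))

  ∫-map : ∀ (f : B → C) (g : K × B → K × C) → (∀ p → g p ≡ (proj₁ p , f (proj₂ p))) →
    ∀ d φ → ∫ (map g d) φ ≡ ∫ d (φ ∘ f)
  ∫-map f g h []            φ = refl
  ∫-map f g h ((c , b) ∷ d) φ rewrite h (c , b) = cong (_+_ (c * φ (f b))) (∫-map f g h d φ)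

  ∫-map-scale : ∀ k (f : B → C) (g : K × B → K × C) → (∀ p → g p ≡ (k * proj₁ p , f (proj₂ p))) →
    ∀ d φ → ∫ (map g d) φ ≡ k * ∫ d (φ ∘ f)
  ∫-map-scale k f g h []            φ = sym (zeroʳ k)
  ∫-map-scale k f g h ((c , b) ∷ d) φ rewrite h (c , b) =
    trans (cong₂ _+_ (*-assoc k c _) (∫-map-scale k f g h d φ)) (sym (distribˡ k _ _))

  ∫-concatMap : ∀ (f : K × B → FM C) (g : B → K) φ → (∀ c b → ∫ (f (c , b)) φ ≡ c * g b) →
    ∀ d → ∫ (concatMap f d) φ ≡ ∫ d g
  ∫-concatMap f g φ h []            = refl
  ∫-concatMap f g φ h ((c , b) ∷ d) =
    trans (∫-++ (f (c , b)) _ φ) (cong₂ _+_ (h c b) (∫-concatMap f g φ h d))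

  ∫-concatMap-applyUpTo : ∀ n (g : ℕ → FM B) (f : ℕ → ℕ) φ →
    ∫ (concatMap g (applyUpTo f (suc n))) φ ≡ conv n (λ i _ → ∫ (g (f i)) φ)
  ∫-concatMap-applyUpTo zero    g f φ = trans (∫-++ (g (f 0)) [] φ) (+-identityʳ _)
  ∫-concatMap-applyUpTo (suc n) g f φ =
    trans (∫-++ (g (f 0)) _ φ) (cong (_+_ (∫ (g (f 0)) φ)) (∫-concatMap-applyUpTo n g (f ∘ suc) φ))

  ∫-concatMap-upTo : ∀ n (g : ℕ → FM B) φ (h : ℕ → ℕ → K) → (∀ i j → i ℕ.+ j ≡ n → ∫ (g i) φ ≡ h i j) →
    ∫ (concatMap g (upTo (suc n))) φ ≡ conv n h
  ∫-concatMap-upTo n g φ h e = trans (∫-concatMap-applyUpTo n g id φ) (conv-cong n e)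

  -- The list `upTo (suc n)` evaluates to its first entry followed by `applyUpTo suc n`; this
  -- variant fits the form to which the sum in `dmN` reduces.
  ∫-head-concatMap : ∀ n (d : FM B) (g : ℕ → FM B) φ (h : ℕ → ℕ → K) → ∫ d φ ≡ h 0 n →
    (∀ i j → suc i ℕ.+ j ≡ n → ∫ (g (suc i)) φ ≡ h (suc i) j) →
    ∫ (d ++ concatMap g (applyUpTo suc n)) φ ≡ conv n h
  ∫-head-concatMap zero    d g φ h e₀ e = trans (∫-++ d [] φ) (trans (+-identityʳ _) e₀)
  ∫-head-concatMap (suc n) d g φ h e₀ e = trans (∫-++ d _ φ) (cong₂ _+_ e₀
    (trans (∫-concatMap-applyUpTo n g suc φ) (conv-cong n λ i j p → e i j (cong suc p))))

  ∫-zero : ∀ (d : FM B) {φ} → (∀ b → φ b ≡ 0#) → ∫ d φ ≡ 0#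
  ∫-zero []            h = refl
  ∫-zero ((c , b) ∷ d) h = trans (cong₂ _+_ (trans (cong (c *_) (h b)) (zeroʳ c)) (∫-zero d h)) (+-identityˡ 0#)

  ∫-+ : ∀ (d : FM B) φ ψ → ∫ d (λ b → φ b + ψ b) ≡ ∫ d φ + ∫ d ψ
  ∫-+ []            φ ψ = sym (+-identityˡ 0#)
  ∫-+ ((c , b) ∷ d) φ ψ = trans (cong (_+_ (c * (φ b + ψ b))) (∫-+ d φ ψ))
    (solve 5 (λ c x y s t → c :* (x :+ y) :+ (s :+ t) := (c :* x :+ s) :+ (c :* y :+ t)) refl c (φ b) (ψ b) (∫ d φ) (∫ d ψ))

  ∫-* : ∀ (d : FM B) k φ → ∫ d (λ b → k * φ b) ≡ k * ∫ d φ
  ∫-* []            k φ = sym (zeroʳ k)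
  ∫-* ((c , b) ∷ d) k φ = trans (cong (_+_ (c * (k * φ b))) (∫-* d k φ))
    (solve 4 (λ c k x s → c :* (k :* x) :+ k :* s := k :* (c :* x :+ s)) refl c k (φ b) (∫ d φ))

  ∫-*ʳ : ∀ (d : FM B) k φ → ∫ d (λ b → φ b * k) ≡ ∫ d φ * k
  ∫-*ʳ d k φ = trans (∫-cong d λ b → *-comm _ _) (trans (∫-* d k φ) (*-comm _ _))

  ∫-swap : ∀ (d : FM B) (e : FM C) (φ : B → C → K) → ∫ d (λ b → ∫ e (φ b)) ≡ ∫ e (λ c → ∫ d (λ b → φ b c))
  ∫-swap []            e φ = sym (∫-zero e λ _ → refl)
  ∫-swap ((k , b) ∷ d) e φ = trans (cong₂ _+_ (sym (∫-* e k (φ b))) (∫-swap d e φ)) (sym (∫-+ e _ _))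

  ∫-conv : ∀ (d : FM B) n (φ : ℕ → ℕ → B → K) → ∫ d (λ b → conv n (λ i j → φ i j b)) ≡ conv n (λ i j → ∫ d (φ i j))
  ∫-conv d zero    φ = refl
  ∫-conv d (suc n) φ = trans (∫-+ d _ _) (cong (_+_ (∫ d (φ 0 (suc n)))) (∫-conv d n (λ i → φ (suc i))))

  ∫-single : ∀ (b : B) φ → ∫ ((1# , b) ∷ []) φ ≡ φ b
  ∫-single b φ = trans (+-identityʳ _) (*-identityˡ _)

-- The shuffle and diamond products as operations on functionals.

module Shuffle (q : ℕ) (𝔽 : FiniteField q) where
  open Construction q 𝔽 using (Letter; letter; Word; weight; lwt; xₛ; 𝔇; scale; pre; shN; dmN; Δc; *-nz; _⧢_)
  open FieldFacts q 𝔽 using (𝔽-ring)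
  open CommutativeRing 𝔽-ring hiding (refl; sym; trans) renaming (Carrier to K)
  open IntegerSolver 𝔽-ring
  open Antidiagonal 𝔽-ring
  open Pairing q 𝔽
  open ≡-Reasoning

  infixr 5 _◁_
  -- The transpose of prefixing a letter.
  _◁_ : Letter → (Word → K) → (Word → K)
  (x ◁ φ) w = φ (x ∷ w)

  ∫-pre : ∀ x d φ → ∫ (pre x d) φ ≡ ∫ d (x ◁ φ)
  ∫-pre x d φ = ∫-map (x ∷_) _ (λ _ → refl) d φ

  ∫-scale : ∀ c d φ → ∫ (scale c d) φ ≡ c * ∫ d φ
  ∫-scale c d φ = ∫-map-scale c id _ (λ _ → refl) d φ

  _·L_ : Letter → Letter → Letter
  letter a α hα ·L letter b β hβ = letter (suc (a ℕ.+ b)) (α * β) (*-nz hα hβ)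

  -- The letter x_{i+1} carrying the product of the characters of two given letters.
  withWeight : ℕ → Letter → Letter → Letter
  withWeight i (letter a α hα) (letter b β hβ) = letter i (α * β) (*-nz hα hβ)

  open Construction q 𝔽 using (pw)

  ∫-dmN : ∀ n x a y b φ → ∫ (dmN n x a y b) φ ≡ ∫ (shN n a b) ((x ·L y) ◁ φ)
    + conv (pw x ℕ.+ pw y) (λ i j → Δc (suc j) (suc (pw x)) (suc (pw y)) *
        ∫ (shN n a b) (λ w → ∫ (shN n (xₛ j ∷ []) w) (withWeight i x y ◁ φ)))
  ∫-dmN n x@(letter a′ α hα) a y@(letter b′ β hβ) b φ = trans (∫-++ (pre (x ·L y) (shN n a b)) _ φ)
    (cong₂ _+_ (∫-pre (x ·L y) (shN n a b) φ)
      (∫-head-concatMap (a′ ℕ.+ b′) (scale (Δc (suc (a′ ℕ.+ b′)) (suc a′) (suc b′)) (pre (withWeight 0 x y) (concatMap _ (shN n a b))))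
        _ φ h (summand 0 (a′ ℕ.+ b′) refl _ (λ _ _ → refl)) λ i j e → summand (suc i) j e _ (λ _ _ → refl)))
    where
    h : ℕ → ℕ → K
    h i j = Δc (suc j) (suc a′) (suc b′) * ∫ (shN n a b) (λ w → ∫ (shN n (xₛ j ∷ []) w) (withWeight i x y ◁ φ))
    summand : ∀ i j → i ℕ.+ j ≡ a′ ℕ.+ b′ → (f : K × Word → 𝔇) →
      (∀ c w → f (c , w) ≡ scale c (shN n (xₛ (a′ ℕ.+ b′ ∸ i) ∷ []) w)) →
      ∫ (scale (Δc (suc (a′ ℕ.+ b′ ∸ i)) (suc a′) (suc b′)) (pre (withWeight i x y) (concatMap f (shN n a b)))) φ ≡ h i j
    summand i j e f f≡ = trans
      (trans (∫-scale (Δc (suc (a′ ℕ.+ b′ ∸ i)) (suc a′) (suc b′)) (pre (withWeight i x y) (concatMap f (shN n a b))) φ)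
        (cong (Δc (suc (a′ ℕ.+ b′ ∸ i)) (suc a′) (suc b′) *_)
          (trans (∫-pre (withWeight i x y) (concatMap f (shN n a b)) φ)
            (∫-concatMap f _ (withWeight i x y ◁ φ)
              (λ c w → trans (cong (λ d → ∫ d (withWeight i x y ◁ φ)) (f≡ c w)) (∫-scale c (shN n (xₛ (a′ ℕ.+ b′ ∸ i) ∷ []) w) _)) (shN n a b)))))
      (cong (h i) (trans (cong (_∸ i) (sym e)) (ℕₚ.m+n∸m≡n i j)))

  -- The length is only bounded, since diamond terms shorten words; it serves the fuel argument. The
  -- exact weight serves the grading.
  Homogeneous : ℕ → ℕ → K × Word → Set
  Homogeneous len wt (_ , z) = length z ℕ.≤ len × weight z ≡ wt

  All-scale : ∀ {len wt} c d → All (Homogeneous len wt) d → All (Homogeneous len wt) (scale c d)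
  All-scale c []      []       = []
  All-scale c (_ ∷ d) (p ∷ ps) = p ∷ All-scale c d ps

  All-pre : ∀ {len wt} x d → All (Homogeneous len wt) d → All (Homogeneous (suc len) (lwt x ℕ.+ wt)) (pre x d)
  All-pre x []      []             = []
  All-pre x (_ ∷ d) ((l , w) ∷ ps) = (ℕ.s≤s l , cong (lwt x ℕ.+_) w) ∷ All-pre x d ps

  All-concatMap : ∀ {X Y : Set} {P : X → Set} {Q : Y → Set} (f : X → List Y) xs → All P xs → (∀ x → P x → All Q (f x)) →
    All Q (concatMap f xs)
  All-concatMap f []       []       h = []
  All-concatMap f (x ∷ xs) (p ∷ ps) h = Allₚ.++⁺ (h x p) (All-concatMap f xs ps h)

  All-mono : ∀ {len len′ wt wt′ d} → len ℕ.≤ len′ → wt ≡ wt′ → All (Homogeneous len wt) d → All (Homogeneous len′ wt′) d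
  All-mono le e = All.map λ (l , w) → ℕₚ.≤-trans l le , trans w e

  upTo-< : ∀ n → All (ℕ._< n) (upTo n)
  upTo-< n = Allₚ.applyUpTo⁺₁ id n id

  mutual
    shN-homogeneous : ∀ n v w → All (Homogeneous (length v ℕ.+ length w) (weight v ℕ.+ weight w)) (shN n v w)
    shN-homogeneous n       []      w       = (ℕₚ.≤-refl , refl) ∷ []
    shN-homogeneous n       (x ∷ v) []      = (ℕₚ.≤-reflexive (sym (ℕₚ.+-identityʳ _)) , sym (ℕₚ.+-identityʳ _)) ∷ []
    shN-homogeneous zero    (x ∷ v) (y ∷ w) = []
    shN-homogeneous (suc n) (x ∷ v) (y ∷ w) = Allₚ.++⁺
      (All-mono ℕₚ.≤-refl (sym (ℕₚ.+-assoc (lwt x) (weight v) _)) (All-pre x (shN n v (y ∷ w)) (shN-homogeneous n v (y ∷ w))))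
      (Allₚ.++⁺
        (All-mono (ℕₚ.≤-reflexive (sym (ℕₚ.+-suc (suc (length v)) (length w)))) (weights (lwt x) (weight v) (lwt y) (weight w))
           (All-pre y (shN n (x ∷ v) w) (shN-homogeneous n (x ∷ v) w)))
        (All-mono (ℕₚ.≤-reflexive (cong suc (sym (ℕₚ.+-suc (length v) (length w))))) refl (dmN-homogeneous n x v y w)))
      where
      open +-*-Solver renaming (solve to solveℕ; _:=_ to _≔_; _:+_ to _⊞_)
      weights : ∀ a b c d → c ℕ.+ ((a ℕ.+ b) ℕ.+ d) ≡ (a ℕ.+ b) ℕ.+ (c ℕ.+ d)
      weights = solveℕ 4 (λ a b c d → c ⊞ ((a ⊞ b) ⊞ d) ≔ (a ⊞ b) ⊞ (c ⊞ d)) refl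

    dmN-homogeneous : ∀ n x v y w →
      All (Homogeneous (suc (suc (length v ℕ.+ length w))) (weight (x ∷ v) ℕ.+ weight (y ∷ w))) (dmN n x v y w)
    dmN-homogeneous n x@(letter a α hα) v y@(letter b β hβ) w = Allₚ.++⁺
      (All-mono (ℕₚ.n≤1+n _) (first a b (weight v) (weight w)) (All-pre (x ·L y) (shN n v w) (shN-homogeneous n v w)))
      (All-concatMap _ (upTo (suc (a ℕ.+ b))) (upTo-< _) λ i i< →
        All-scale _ _ (All-mono ℕₚ.≤-refl (second i (a ℕ.+ b ∸ i) (ℕₚ.m+[n∸m]≡n (ℕₚ.≤-pred i<)) (weight v) (weight w))
          (All-pre (withWeight i x y) _
          (All-concatMap _ (shN n v w) (shN-homogeneous n v w) λ (c , z) (l , e) →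
            All-scale c _ (All-mono (ℕ.s≤s l) (cong (suc (a ℕ.+ b ∸ i ℕ.+ 0) ℕ.+_) e) (shN-homogeneous n (xₛ (a ℕ.+ b ∸ i) ∷ []) z))))))
      where
      open +-*-Solver renaming (solve to solveℕ; _:=_ to _≔_; _:+_ to _⊞_; con to conℕ)
      first : ∀ a b v w → suc (suc (a ℕ.+ b)) ℕ.+ (v ℕ.+ w) ≡ (suc a ℕ.+ v) ℕ.+ (suc b ℕ.+ w)
      first = solveℕ 4 (λ a b v w → (conℕ 2 ⊞ (a ⊞ b)) ⊞ (v ⊞ w) ≔ ((conℕ 1 ⊞ a) ⊞ v) ⊞ ((conℕ 1 ⊞ b) ⊞ w)) refl
      second : ∀ i j → i ℕ.+ j ≡ a ℕ.+ b → ∀ v w → suc i ℕ.+ (suc (j ℕ.+ 0) ℕ.+ (v ℕ.+ w)) ≡ (suc a ℕ.+ v) ℕ.+ (suc b ℕ.+ w)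
      second i j e v w = trans (solveℕ 4 (λ i j v w → (conℕ 1 ⊞ i) ⊞ ((conℕ 1 ⊞ (j ⊞ conℕ 0)) ⊞ (v ⊞ w)) ≔ (conℕ 2 ⊞ (i ⊞ j)) ⊞ (v ⊞ w)) refl i j v w)
        (trans (cong (λ s → suc (suc s) ℕ.+ (v ℕ.+ w)) e) (first a b v w))

  -- The result of the recursion does not depend on the fuel.
  shN-fuel : ∀ n n′ v w → length v ℕ.+ length w ℕ.≤ n → length v ℕ.+ length w ℕ.≤ n′ →
    ∀ φ → ∫ (shN n v w) φ ≡ ∫ (shN n′ v w) φ
  shN-fuel n       n′       []      w       _ _ φ = refl
  shN-fuel n       n′       (x ∷ v) []      _ _ φ = refl
  shN-fuel (suc n) (suc n′) (x ∷ v) (y ∷ w) (ℕ.s≤s l) (ℕ.s≤s l′) φ = begin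
    ∫ (pre x (shN n v (y ∷ w)) ++ pre y (shN n (x ∷ v) w) ++ dmN n x v y w) φ
      ≡⟨ split n ⟩
    ∫ (shN n v (y ∷ w)) (x ◁ φ) + (∫ (shN n (x ∷ v) w) (y ◁ φ) + ∫ (dmN n x v y w) φ)
      ≡⟨ cong₂ _+_ (shN-fuel n n′ v (y ∷ w) l l′ _) (cong₂ _+_ (shN-fuel n n′ (x ∷ v) w (drop l) (drop l′) _) diamond) ⟩
    ∫ (shN n′ v (y ∷ w)) (x ◁ φ) + (∫ (shN n′ (x ∷ v) w) (y ◁ φ) + ∫ (dmN n′ x v y w) φ)
      ≡⟨ split n′ ⟨
    ∫ (pre x (shN n′ v (y ∷ w)) ++ pre y (shN n′ (x ∷ v) w) ++ dmN n′ x v y w) φ ∎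
    where
    split : ∀ n → ∫ (pre x (shN n v (y ∷ w)) ++ pre y (shN n (x ∷ v) w) ++ dmN n x v y w) φ
      ≡ ∫ (shN n v (y ∷ w)) (x ◁ φ) + (∫ (shN n (x ∷ v) w) (y ◁ φ) + ∫ (dmN n x v y w) φ)
    split n = trans (∫-++ (pre x (shN n v (y ∷ w))) _ φ) (cong₂ _+_ (∫-pre x (shN n v (y ∷ w)) φ)
      (trans (∫-++ (pre y (shN n (x ∷ v) w)) _ φ) (cong (_+ ∫ (dmN n x v y w) φ) (∫-pre y (shN n (x ∷ v) w) φ))))
    drop : ∀ {n} → length v ℕ.+ suc (length w) ℕ.≤ n → suc (length v ℕ.+ length w) ℕ.≤ n
    drop {n} = subst (ℕ._≤ n) (ℕₚ.+-suc (length v) (length w))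
    drop₂ : ∀ {n} → length v ℕ.+ suc (length w) ℕ.≤ n → length v ℕ.+ length w ℕ.≤ n
    drop₂ l = ℕₚ.<⇒≤ (drop l)
    diamond : ∫ (dmN n x v y w) φ ≡ ∫ (dmN n′ x v y w) φ
    diamond = trans (∫-dmN n x v y w φ) (trans
      (cong₂ _+_ (shN-fuel n n′ v w (drop₂ l) (drop₂ l′) _) (conv-ext (pw x ℕ.+ pw y) λ i j → cong (Δc (suc j) (suc (pw x)) (suc (pw y)) *_)
        (trans (shN-fuel n n′ v w (drop₂ l) (drop₂ l′) _)
               (∫-congAll (shN n′ v w) (shN-homogeneous n′ v w) λ z (le , _) →
                 shN-fuel n n′ (xₛ j ∷ []) z (ℕₚ.≤-trans (ℕ.s≤s le) (drop l)) (ℕₚ.≤-trans (ℕ.s≤s le) (drop l′)) _))))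
      (sym (∫-dmN n′ x v y w φ)))

  sh : Word → Word → 𝔇
  sh v w = shN (length v ℕ.+ length w) v w

  sh-homogeneous : ∀ v w → All (Homogeneous (length v ℕ.+ length w) (weight v ℕ.+ weight w)) (sh v w)
  sh-homogeneous v w = shN-homogeneous _ v w

  -- x ⋄ y for letters, recording each x_i x_j as the pair of x_i and the word x_j.
  dl-term : Letter → Letter → ℕ → FM (Letter × Word)
  dl-term x y i = (Δc (suc (n ∸ i)) (suc (pw x)) (suc (pw y)) , withWeight i x y , xₛ (n ∸ i) ∷ []) ∷ []
    where n = pw x ℕ.+ pw y

  dl : Letter → Letter → FM (Letter × Word)
  dl x y = (1# , x ·L y , []) ∷ concatMap (dl-term x y) (upTo (suc (pw x ℕ.+ pw y)))

  ∫-dl : ∀ x y (φ : Letter → Word → K) → ∫₂ (dl x y) φ ≡ φ (x ·L y) []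
    + conv (pw x ℕ.+ pw y) (λ i j → Δc (suc j) (suc (pw x)) (suc (pw y)) * φ (withWeight i x y) (xₛ j ∷ []))
  ∫-dl x y φ = cong₂ _+_ (*-identityˡ _) (∫-concatMap-upTo n (dl-term x y) (λ p → φ (proj₁ p) (proj₂ p)) h λ i j e →
      trans (+-identityʳ _) (cong (h i) (trans (cong (_∸ i) (sym e)) (ℕₚ.m+n∸m≡n i j))))
    where
    n = pw x ℕ.+ pw y
    h : ℕ → ℕ → K
    h i j = Δc (suc j) (suc (pw x)) (suc (pw y)) * φ (withWeight i x y) (xₛ j ∷ [])

  S : Word → Word → (Word → K) → K
  S v w φ = ∫ (sh v w) φ

  S-[]ˡ : ∀ w φ → S [] w φ ≡ φ w
  S-[]ˡ w φ = ∫-single w φ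

  S-[]ʳ : ∀ v φ → S v [] φ ≡ φ v
  S-[]ʳ []      φ = ∫-single [] φ
  S-[]ʳ (x ∷ v) φ = ∫-single (x ∷ v) φ

  S-cong : ∀ v w {φ ψ} → (∀ z → φ z ≡ ψ z) → S v w φ ≡ S v w ψ
  S-cong v w = ∫-cong (sh v w)

  S-congLength : ∀ v w {φ ψ} → (∀ z → length z ℕ.≤ length v ℕ.+ length w → φ z ≡ ψ z) → S v w φ ≡ S v w ψ
  S-congLength v w h = ∫-congAll (sh v w) (sh-homogeneous v w) λ z (l , _) → h z l

  ⋄-term : Letter → Letter → (Word → K) → Word → K
  ⋄-term x y φ w = ∫₂ (dl x y) (λ l r → S r w (l ◁ φ))

  -- The diamond product of two words is that of their first letters, with the tail r of x ⋄ y
  -- shuffled into v ⧢ w. The recursion is thus expressed through letters, and the fuel disappears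
  -- from view.
  S-∷∷ : ∀ x v y w φ → S (x ∷ v) (y ∷ w) φ ≡
    S v (y ∷ w) (x ◁ φ) + (S (x ∷ v) w (y ◁ φ) + S v w (⋄-term x y φ))
  S-∷∷ x v y w φ = begin
    ∫ (shN (suc n) (x ∷ v) (y ∷ w)) φ
      ≡⟨ trans (∫-++ (pre x (shN n v (y ∷ w))) _ φ) (cong₂ _+_ (∫-pre x (shN n v (y ∷ w)) φ)
           (trans (∫-++ (pre y (shN n (x ∷ v) w)) _ φ) (cong₂ _+_ (∫-pre y (shN n (x ∷ v) w) φ) (∫-dmN n x v y w φ)))) ⟩
    ∫ (shN n v (y ∷ w)) (x ◁ φ) + (∫ (shN n (x ∷ v) w) (y ◁ φ) +
      (∫ (shN n v w) ((x ·L y) ◁ φ) + conv (pw x ℕ.+ pw y) (λ i j → Δc (suc j) (suc (pw x)) (suc (pw y)) *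
        ∫ (shN n v w) (λ z → ∫ (shN n (xₛ j ∷ []) z) (withWeight i x y ◁ φ)))))
      ≡⟨ cong (_+_ (S v (y ∷ w) (x ◁ φ))) (cong₂ _+_ (shN-fuel n _ (x ∷ v) w n≥ ℕₚ.≤-refl _) (cong₂ _+_ (shN-fuel n _ v w n≥₂ ℕₚ.≤-refl _)
           (conv-ext (pw x ℕ.+ pw y) λ i j → cong (Δc (suc j) (suc (pw x)) (suc (pw y)) *_)
             (trans (shN-fuel n _ v w n≥₂ ℕₚ.≤-refl _) (S-congLength v w λ z l →
               shN-fuel n _ (xₛ j ∷ []) z (ℕₚ.≤-trans (ℕ.s≤s l) n≥) ℕₚ.≤-refl _))))) ⟩
    S v (y ∷ w) (x ◁ φ) + (S (x ∷ v) w (y ◁ φ) +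
      (S v w ((x ·L y) ◁ φ) + conv (pw x ℕ.+ pw y) (λ i j → Δc (suc j) (suc (pw x)) (suc (pw y)) *
        S v w (λ z → S (xₛ j ∷ []) z (withWeight i x y ◁ φ)))))
      ≡⟨ cong (_+_ (S v (y ∷ w) (x ◁ φ))) (cong (_+_ (S (x ∷ v) w (y ◁ φ))) (sym expand)) ⟩
    S v (y ∷ w) (x ◁ φ) + (S (x ∷ v) w (y ◁ φ) + S v w (⋄-term x y φ)) ∎
    where
    n = length v ℕ.+ suc (length w)
    n≥ : suc (length v ℕ.+ length w) ℕ.≤ n
    n≥ = ℕₚ.≤-reflexive (sym (ℕₚ.+-suc (length v) (length w)))
    n≥₂ : length v ℕ.+ length w ℕ.≤ n
    n≥₂ = ℕₚ.<⇒≤ n≥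
    h : ℕ → ℕ → Word → K
    h i j z = S (xₛ j ∷ []) z (withWeight i x y ◁ φ)
    c : ℕ → K
    c j = Δc (suc j) (suc (pw x)) (suc (pw y))
    expand : S v w (⋄-term x y φ) ≡ S v w ((x ·L y) ◁ φ) + conv (pw x ℕ.+ pw y) (λ i j → c j * S v w (h i j))
    expand = begin
      S v w (⋄-term x y φ)
        ≡⟨ S-cong v w (λ z → trans (∫-dl x y λ l r → S r z (l ◁ φ))
             (cong (_+ conv (pw x ℕ.+ pw y) (λ i j → c j * h i j z)) (S-[]ˡ z ((x ·L y) ◁ φ)))) ⟩
      S v w (λ z → ((x ·L y) ◁ φ) z + conv (pw x ℕ.+ pw y) (λ i j → c j * h i j z))
        ≡⟨ ∫-+ (sh v w) ((x ·L y) ◁ φ) (λ z → conv (pw x ℕ.+ pw y) (λ i j → c j * h i j z)) ⟩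
      S v w ((x ·L y) ◁ φ) + S v w (λ z → conv (pw x ℕ.+ pw y) (λ i j → c j * h i j z))
        ≡⟨ cong (_+_ (S v w ((x ·L y) ◁ φ))) (trans (∫-conv (sh v w) (pw x ℕ.+ pw y) (λ i j z → c j * h i j z))
             (conv-ext (pw x ℕ.+ pw y) λ i j → ∫-* (sh v w) (c j) (h i j))) ⟩
      S v w ((x ·L y) ◁ φ) + conv (pw x ℕ.+ pw y) (λ i j → c j * S v w (h i j)) ∎

  ∫-⧢ : ∀ d e φ → ∫ (d ⧢ e) φ ≡ ∫ d (λ v → ∫ e (λ w → S v w φ))
  ∫-⧢ d e φ = ∫-concatMap _ _ φ (λ c v → trans
    (∫-concatMap _ (λ w → c * S v w φ) φ (λ k w → trans (∫-scale (c * k) (sh v w) φ)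
       (solve 3 (λ c k s → c :* k :* s := k :* (c :* s)) refl c k (S v w φ))) e)
    (∫-* e c _)) d

-- Commutativity, and the reduction of associativity to letters.

module ShuffleLaws (q : ℕ) (𝔽 : FiniteField q) where
  open Construction q 𝔽 using (Letter; letter; Word; xₛ; Δc; pw)
  open FieldFacts q 𝔽 using (𝔽-ring)
  open CommutativeRing 𝔽-ring hiding (refl; sym; trans) renaming (Carrier to K)
  open IntegerSolver 𝔽-ring
  open Antidiagonal 𝔽-ring
  open Pairing q 𝔽
  open Shuffle q 𝔽
  open ≡-Reasoning

  letter-cong : ∀ {i j α β} .{hα : α ≢ 0#} .{hβ : β ≢ 0#} → i ≡ j → α ≡ β → letter i α hα ≡ letter j β hβ
  letter-cong refl refl = refl

  Δc-comm : ∀ j r s → Δc j r s ≡ Δc j s r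
  Δc-comm j r s with (q ∸ 1) ∣? j
  ... | yes _ = +-comm _ _
  ... | no  _ = refl

  withWeight-comm : ∀ i x y → withWeight i x y ≡ withWeight i y x
  withWeight-comm i (letter a α _) (letter b β _) = letter-cong refl (*-comm α β)

  ·L-comm : ∀ x y → x ·L y ≡ y ·L x
  ·L-comm (letter a α _) (letter b β _) = letter-cong (cong suc (ℕₚ.+-comm a b)) (*-comm α β)

  dl-comm : ∀ x y φ → ∫₂ (dl x y) φ ≡ ∫₂ (dl y x) φ
  dl-comm x y φ = begin
    ∫₂ (dl x y) φ
      ≡⟨ ∫-dl x y φ ⟩
    φ (x ·L y) [] + conv (pw x ℕ.+ pw y) (h x y)
      ≡⟨ cong₂ _+_ (cong (λ l → φ l []) (·L-comm x y)) (trans (cong (λ n → conv n (h x y)) (ℕₚ.+-comm (pw x) (pw y)))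
           (conv-ext (pw y ℕ.+ pw x) λ i j → cong₂ (λ c l → c * φ l (xₛ j ∷ [])) (Δc-comm (suc j) (suc (pw x)) (suc (pw y))) (withWeight-comm i x y))) ⟩
    φ (y ·L x) [] + conv (pw y ℕ.+ pw x) (h y x)
      ≡⟨ ∫-dl y x φ ⟨
    ∫₂ (dl y x) φ ∎
    where
    h : Letter → Letter → ℕ → ℕ → K
    h x y i j = Δc (suc j) (suc (pw x)) (suc (pw y)) * φ (withWeight i x y) (xₛ j ∷ [])

  dl-length : ∀ x y → All (λ p → length (proj₂ (proj₂ p)) ℕ.≤ 1) (dl x y)
  dl-length x y = ℕ.z≤n ∷ All-concatMap (dl-term x y) (upTo (suc (pw x ℕ.+ pw y))) (upTo-< _) λ _ _ → ℕ.s≤s ℕ.z≤n ∷ []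

  ⋄-term-comm : ∀ x y φ w → ⋄-term x y φ w ≡ ⋄-term y x φ w
  ⋄-term-comm x y φ w = dl-comm x y (λ l r → S r w (l ◁ φ))

  S-comm : ∀ v w φ → S v w φ ≡ S w v φ
  S-comm []      w       φ = trans (S-[]ˡ w φ) (sym (S-[]ʳ w φ))
  S-comm (x ∷ v) []      φ = trans (S-[]ʳ (x ∷ v) φ) (sym (S-[]ˡ (x ∷ v) φ))
  S-comm (x ∷ v) (y ∷ w) φ = begin
    S (x ∷ v) (y ∷ w) φ
      ≡⟨ S-∷∷ x v y w φ ⟩
    S v (y ∷ w) (x ◁ φ) + (S (x ∷ v) w (y ◁ φ) + S v w (⋄-term x y φ))
      ≡⟨ cong₂ _+_ (S-comm v (y ∷ w) (x ◁ φ)) (cong₂ _+_ (S-comm (x ∷ v) w (y ◁ φ))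
           (trans (S-cong v w (⋄-term-comm x y φ)) (S-comm v w (⋄-term y x φ)))) ⟩
    S (y ∷ w) v (x ◁ φ) + (S w (x ∷ v) (y ◁ φ) + S w v (⋄-term y x φ))
      ≡⟨ solve 3 (λ a b c → a :+ (b :+ c) := b :+ (a :+ c)) refl _ _ _ ⟩
    S w (x ∷ v) (y ◁ φ) + (S (y ∷ w) v (x ◁ φ) + S w v (⋄-term y x φ))
      ≡⟨ S-∷∷ y w x v φ ⟨
    S (y ∷ w) (x ∷ v) φ ∎

  -- (x ⋄ y) ⋄ z for letters, as a combination of a first letter and a tail.
  Triple : Letter → Letter → Letter → (Letter → Word → K) → K
  Triple x y z ψ = ∫₂ (dl x y) λ l r → ∫₂ (dl l z) λ l′ r′ → S r′ r (ψ l′)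

  -- Associativity reduces to letters: with commutativity it says that (u ⧢ v) ⧢ w is
  -- invariant under cyclic rotation, which is visible on its expansion.
  module _ (Triple-rotate : ∀ x y z ψ → Triple x y z ψ ≡ Triple y z x ψ) where

    L : Word → Word → Word → (Word → K) → K
    L u v w φ = S u v (λ p → S p w φ)

    Rotation : ℕ → Set
    Rotation n = ∀ u v w → length u ℕ.+ length v ℕ.+ length w ℕ.≤ n → ∀ φ → L u v w φ ≡ L v w u φ

    rotation⇒assoc : ∀ {n} → Rotation n → ∀ u v w → length u ℕ.+ length v ℕ.+ length w ℕ.≤ n →
      ∀ φ → L u v w φ ≡ S v w (λ p → S u p φ)
    rotation⇒assoc rot u v w le φ = trans (rot u v w le φ) (S-cong v w λ p → S-comm p u φ)

    -- Sorted by how the first letter arises: from one of the three letters, from a diamond product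
    -- of two, or from all three. In this form a rotation of the three words permutes the terms of
    -- each kind, up to commutativity and the symmetry of `Triple`.
    L-expand : ∀ n → Rotation n → ∀ x a y b z c → suc (suc (length a ℕ.+ length b ℕ.+ length c)) ℕ.≤ n → ∀ φ →
      L (x ∷ a) (y ∷ b) (z ∷ c) φ ≡
        (L a (y ∷ b) (z ∷ c) (x ◁ φ) + L (x ∷ a) b (z ∷ c) (y ◁ φ) + L (x ∷ a) (y ∷ b) c (z ◁ φ))
        + (L a (y ∷ b) c (⋄-term x z φ) + L (x ∷ a) b c (⋄-term y z φ) + L a b (z ∷ c) (⋄-term x y φ))
        + L a b c (λ e → Triple x y z (λ l f → S f e (l ◁ φ)))
    L-expand n rot x a y b z c le φ = begin
      S (x ∷ a) (y ∷ b) (λ p → S p (z ∷ c) φ)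
        ≡⟨ S-∷∷ x a y b _ ⟩
      S a (y ∷ b) (λ p → S (x ∷ p) (z ∷ c) φ) + (S (x ∷ a) b (λ p → S (y ∷ p) (z ∷ c) φ) + S a b (⋄-term x y (λ p → S p (z ∷ c) φ)))
        ≡⟨ cong₂ _+_ (split a (y ∷ b) x) (cong₂ _+_ (split (x ∷ a) b y) diamond) ⟩
      (L a (y ∷ b) (z ∷ c) (x ◁ φ) + (zx + L a (y ∷ b) c (⋄-term x z φ)))
        + ((L (x ∷ a) b (z ∷ c) (y ◁ φ) + (zy + L (x ∷ a) b c (⋄-term y z φ)))
        + (L a b (z ∷ c) (⋄-term x y φ) + (zxy + T)))
        ≡⟨ solve 9 (λ p₁ p₂ d₁ d₂ d₃ t z₁ z₂ z₃ → (p₁ :+ (z₁ :+ d₁)) :+ ((p₂ :+ (z₂ :+ d₂)) :+ (d₃ :+ (z₃ :+ t)))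
             := (p₁ :+ p₂ :+ (z₁ :+ (z₂ :+ z₃))) :+ (d₁ :+ d₂ :+ d₃) :+ t) refl
             (L a (y ∷ b) (z ∷ c) (x ◁ φ)) (L (x ∷ a) b (z ∷ c) (y ◁ φ)) (L a (y ∷ b) c (⋄-term x z φ))
             (L (x ∷ a) b c (⋄-term y z φ)) (L a b (z ∷ c) (⋄-term x y φ)) T zx zy zxy ⟩
      (L a (y ∷ b) (z ∷ c) (x ◁ φ) + L (x ∷ a) b (z ∷ c) (y ◁ φ) + (zx + (zy + zxy)))
        + (L a (y ∷ b) c (⋄-term x z φ) + L (x ∷ a) b c (⋄-term y z φ) + L a b (z ∷ c) (⋄-term x y φ)) + T
        -- The three terms in which z comes first reassemble to a product of the full words x a and
        -- y b with c, by the recursion read backwards.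
        ≡⟨ cong (λ s → (L a (y ∷ b) (z ∷ c) (x ◁ φ) + L (x ∷ a) b (z ∷ c) (y ◁ φ) + s)
             + (L a (y ∷ b) c (⋄-term x z φ) + L (x ∷ a) b c (⋄-term y z φ) + L a b (z ∷ c) (⋄-term x y φ)) + T)
             (S-∷∷ x a y b (λ p → S p c (z ◁ φ))) ⟨
      _ ∎
      where
      T = L a b c (λ e → Triple x y z (λ l f → S f e (l ◁ φ)))
      zx = S a (y ∷ b) (λ p → S (x ∷ p) c (z ◁ φ))
      zy = S (x ∷ a) b (λ p → S (y ∷ p) c (z ◁ φ))
      zxy = S a b (⋄-term x y (λ p → S p c (z ◁ φ)))

      split : ∀ u v x → S u v (λ p → S (x ∷ p) (z ∷ c) φ) ≡
        L u v (z ∷ c) (x ◁ φ) + (S u v (λ p → S (x ∷ p) c (z ◁ φ)) + L u v c (⋄-term x z φ))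
      split u v x = trans (S-cong u v λ p → S-∷∷ x p z c φ)
        (trans (∫-+ (sh u v) _ _) (cong (_+_ (L u v (z ∷ c) (x ◁ φ))) (∫-+ (sh u v) _ _)))

      ⋄-rest : Word → K
      ⋄-rest w = ∫₂ (dl x y) (λ l r → S r w (λ t → S t c (⋄-term l z φ)))

      -- A diamond product of two letters consumes both and leaves a tail of at most one letter
      -- besides the new first letter, so the induction hypothesis covers products with that tail.
      short : ∀ {r w} → length r ℕ.≤ 1 → length w ℕ.≤ length a ℕ.+ length b →
        length r ℕ.+ length w ℕ.+ suc (length c) ℕ.≤ n
      short {r} {w} lr lw = ℕₚ.≤-trans (ℕₚ.≤-trans (ℕₚ.+-monoˡ-≤ (suc (length c)) (ℕₚ.+-mono-≤ lr lw))
        (ℕₚ.≤-reflexive (cong suc (ℕₚ.+-suc (length a ℕ.+ length b) (length c))))) le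

      first : ∀ w → length w ℕ.≤ length a ℕ.+ length b →
        ∫₂ (dl x y) (λ l r → S r w (λ t → S t (z ∷ c) (l ◁ φ))) ≡ S w (z ∷ c) (⋄-term x y φ)
      first w lw = trans
        (∫-congAll (dl x y) (dl-length x y) λ (l , r) lr → rotation⇒assoc rot r w (z ∷ c) (short {r} {w} lr lw) (l ◁ φ))
        (∫-swap (dl x y) (sh w (z ∷ c)) _)

      rest : ∀ w → length w ℕ.≤ length a ℕ.+ length b →
        ⋄-rest w ≡ S w c (λ e → Triple x y z (λ l f → S f e (l ◁ φ)))
      rest w lw = trans
        (∫-congAll (dl x y) (dl-length x y) λ (l , r) lr → trans
          (rotation⇒assoc rot r w c (ℕₚ.≤-trans (ℕₚ.+-monoʳ-≤ (length r ℕ.+ length w) (ℕₚ.n≤1+n (length c))) (short {r} {w} lr lw)) (⋄-term l z φ))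
          (S-congLength w c λ e le′ → trans (∫-swap (sh r e) (dl l z) _)
            (∫-congAll (dl l z) (dl-length l z) λ (l′ , r′) lr′ → sym (rotation⇒assoc rot r′ r e (short₂ r′ r w e lr′ lr lw le′) (l′ ◁ φ)))))
        (∫-swap (dl x y) (sh w c) _)
        where
        short₂ : ∀ r′ r w e → length r′ ℕ.≤ 1 → length r ℕ.≤ 1 → length w ℕ.≤ length a ℕ.+ length b →
          length e ℕ.≤ length w ℕ.+ length c → length r′ ℕ.+ length r ℕ.+ length e ℕ.≤ n
        short₂ r′ r w e lr′ lr lw le′ = ℕₚ.≤-trans
          (ℕₚ.+-mono-≤ (ℕₚ.+-mono-≤ lr′ lr) (ℕₚ.≤-trans le′ (ℕₚ.+-monoˡ-≤ (length c) lw))) le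

      diamond : S a b (⋄-term x y (λ p → S p (z ∷ c) φ)) ≡ L a b (z ∷ c) (⋄-term x y φ) + (zxy + T)
      diamond = begin
        S a b (λ w → ∫₂ (dl x y) (λ l r → S r w (λ t → S (l ∷ t) (z ∷ c) φ)))
          ≡⟨ S-cong a b (λ w → trans (∫-cong (dl x y) λ (l , r) → split r w l)
               (trans (∫-+ (dl x y) _ _) (cong (_+_ (∫₂ (dl x y) (λ l r → S r w (λ t → S t (z ∷ c) (l ◁ φ))))) (∫-+ (dl x y) _ _)))) ⟩
        S a b (λ w → ∫₂ (dl x y) (λ l r → S r w (λ t → S t (z ∷ c) (l ◁ φ)))
          + (⋄-term x y (λ p → S p c (z ◁ φ)) w + ⋄-rest w))
          ≡⟨ S-congLength a b (λ w lw → cong₂ _+_ (first w lw) (cong (_+_ (⋄-term x y (λ p → S p c (z ◁ φ)) w)) (rest w lw))) ⟩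
        S a b (λ w → S w (z ∷ c) (⋄-term x y φ)
          + (⋄-term x y (λ p → S p c (z ◁ φ)) w + S w c (λ e → Triple x y z (λ l f → S f e (l ◁ φ)))))
          ≡⟨ trans (∫-+ (sh a b) _ _) (cong (_+_ (L a b (z ∷ c) (⋄-term x y φ))) (∫-+ (sh a b) _ _)) ⟩
        L a b (z ∷ c) (⋄-term x y φ) + (zxy + T) ∎

    L-cong : ∀ u v w {φ ψ} → (∀ z → φ z ≡ ψ z) → L u v w φ ≡ L u v w ψ
    L-cong u v w h = S-cong u v λ p → S-cong p w h

    rotation : ∀ n → Rotation n
    rotation n [] v w le φ = trans (S-[]ˡ v (λ p → S p w φ)) (sym (S-cong v w λ p → S-[]ʳ p φ))
    rotation n (x ∷ a) [] w le φ =
      trans (S-[]ʳ (x ∷ a) (λ p → S p w φ)) (trans (S-comm (x ∷ a) w φ) (sym (S-[]ˡ w (λ p → S p (x ∷ a) φ))))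
    rotation n (x ∷ a) (y ∷ b) [] le φ = trans (S-cong (x ∷ a) (y ∷ b) λ p → S-[]ʳ p φ)
      (trans (S-comm (x ∷ a) (y ∷ b) φ) (sym (S-[]ʳ (y ∷ b) (λ p → S p (x ∷ a) φ))))
    rotation (suc n) (x ∷ a) (y ∷ b) (z ∷ c) (ℕ.s≤s le) φ = begin
      L (x ∷ a) (y ∷ b) (z ∷ c) φ
        ≡⟨ L-expand n rot x a y b z c (le-abc le) φ ⟩
      (L a (y ∷ b) (z ∷ c) (x ◁ φ) + L (x ∷ a) b (z ∷ c) (y ◁ φ) + L (x ∷ a) (y ∷ b) c (z ◁ φ))
        + (L a (y ∷ b) c (⋄-term x z φ) + L (x ∷ a) b c (⋄-term y z φ) + L a b (z ∷ c) (⋄-term x y φ))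
        + L a b c (λ e → Triple x y z (λ l f → S f e (l ◁ φ)))
        ≡⟨ cong₂ _+_ (cong₂ _+_
             (cong₂ _+_ (cong₂ _+_ (rot a (y ∷ b) (z ∷ c) le (x ◁ φ)) (rot (x ∷ a) b (z ∷ c) (≤-xbz le) (y ◁ φ))) (rot (x ∷ a) (y ∷ b) c (≤-xyc le) (z ◁ φ)))
             (cong₂ _+_ (cong₂ _+_ (trans (rot a (y ∷ b) c (≤-ayc le) _) (L-cong (y ∷ b) c a (⋄-term-comm x z φ)))
                                   (rot (x ∷ a) b c (≤-xbc le) _))
                        (trans (rot a b (z ∷ c) (≤-abz le) _) (L-cong b (z ∷ c) a (⋄-term-comm x y φ)))))
             (trans (rot a b c (≤-abc le) _) (L-cong b c a λ e → Triple-rotate x y z _)) ⟩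
      (L (y ∷ b) (z ∷ c) a (x ◁ φ) + L b (z ∷ c) (x ∷ a) (y ◁ φ) + L (y ∷ b) c (x ∷ a) (z ◁ φ))
        + (L (y ∷ b) c a (⋄-term z x φ) + L b c (x ∷ a) (⋄-term y z φ) + L b (z ∷ c) a (⋄-term y x φ))
        + L b c a (λ e → Triple y z x (λ l f → S f e (l ◁ φ)))
        ≡⟨ cong (_+ L b c a (λ e → Triple y z x (λ l f → S f e (l ◁ φ)))) (cong₂ _+_
             (solve 3 (λ p r s → p :+ r :+ s := r :+ s :+ p) refl _ _ _) (solve 3 (λ p r s → p :+ r :+ s := s :+ p :+ r) refl _ _ _)) ⟩
      (L b (z ∷ c) (x ∷ a) (y ◁ φ) + L (y ∷ b) c (x ∷ a) (z ◁ φ) + L (y ∷ b) (z ∷ c) a (x ◁ φ))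
        + (L b (z ∷ c) a (⋄-term y x φ) + L (y ∷ b) c a (⋄-term z x φ) + L b c (x ∷ a) (⋄-term y z φ))
        + L b c a (λ e → Triple y z x (λ l f → S f e (l ◁ φ)))
        ≡⟨ L-expand n rot y b z c x a (subst (λ s → suc (suc s) ℕ.≤ n) (turn (length a) (length b) (length c)) (le-abc le)) φ ⟨
      L (y ∷ b) (z ∷ c) (x ∷ a) φ ∎
      where
      rot = rotation n
      A = length a
      B = length b
      C = length c
      open +-*-Solver renaming (solve to solveℕ; _:=_ to _≔_; _:+_ to _⊞_; con to conℕ)
      turn : ∀ a b c → a ℕ.+ b ℕ.+ c ≡ b ℕ.+ c ℕ.+ a
      turn = solveℕ 3 (λ a b c → a ⊞ b ⊞ c ≔ b ⊞ c ⊞ a) refl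
      Bound = A ℕ.+ suc B ℕ.+ suc C ℕ.≤ n
      via : ∀ {s t} → t ≡ s → s ℕ.≤ n → t ℕ.≤ n
      via e = subst (ℕ._≤ n) (sym e)
      le-abc : Bound → suc (suc (A ℕ.+ B ℕ.+ C)) ℕ.≤ n
      le-abc = via (solveℕ 3 (λ a b c → conℕ 2 ⊞ (a ⊞ b ⊞ c) ≔ a ⊞ (conℕ 1 ⊞ b) ⊞ (conℕ 1 ⊞ c)) refl A B C)
      ≤-xbz : Bound → suc A ℕ.+ B ℕ.+ suc C ℕ.≤ n
      ≤-xbz = via (solveℕ 3 (λ a b c → (conℕ 1 ⊞ a) ⊞ b ⊞ (conℕ 1 ⊞ c) ≔ a ⊞ (conℕ 1 ⊞ b) ⊞ (conℕ 1 ⊞ c)) refl A B C)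
      ≤-xyc : Bound → suc A ℕ.+ suc B ℕ.+ C ℕ.≤ n
      ≤-xyc = via (solveℕ 3 (λ a b c → (conℕ 1 ⊞ a) ⊞ (conℕ 1 ⊞ b) ⊞ c ≔ a ⊞ (conℕ 1 ⊞ b) ⊞ (conℕ 1 ⊞ c)) refl A B C)
      ≤-ayc : Bound → A ℕ.+ suc B ℕ.+ C ℕ.≤ n
      ≤-ayc le = ℕₚ.≤-trans (ℕₚ.n≤1+n _) (≤-xyc le)
      ≤-xbc : Bound → suc A ℕ.+ B ℕ.+ C ℕ.≤ n
      ≤-xbc le = ℕₚ.≤-trans (ℕₚ.n≤1+n _) (le-abc le)
      ≤-abc : Bound → A ℕ.+ B ℕ.+ C ℕ.≤ n
      ≤-abc le = ℕₚ.≤-trans (ℕₚ.n≤1+n _) (≤-xbc le)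
      ≤-abz : Bound → A ℕ.+ B ℕ.+ suc C ℕ.≤ n
      ≤-abz le = ℕₚ.≤-trans (ℕₚ.n≤1+n _) (≤-xbz le)

    S-assoc : ∀ u v w φ → S u v (λ p → S p w φ) ≡ S v w (λ p → S u p φ)
    S-assoc u v w φ = rotation⇒assoc (rotation _) u v w ℕₚ.≤-refl φ

-- Power series rings and cancellation of non-zero-divisors.

module PowerSeries (R : CommutativeRing 0ℓ 0ℓ) where
  open CommutativeRing R renaming (Carrier to C; refl to ≈-refl; sym to ≈-sym; trans to ≈-trans; reflexive to ≈-reflexive)
  open Algebra.Properties.Ring ring
  open Antidiagonal R
  open Relation.Binary.Reasoning.Setoid setoid

  PS : Set
  PS = ℕ → C

  const : C → PS
  const c zero    = c
  const c (suc _) = 0#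

  var : PS
  var zero          = 0#
  var (suc zero)    = 1#
  var (suc (suc _)) = 0#

  _⊛_ : PS → PS → PS
  (f ⊛ g) n = conv n (λ i j → f i * g j)

  const-⊛ : ∀ c f n → (const c ⊛ f) n ≈ c * f n
  const-⊛ c f n = conv-single n 0 n (λ i j → const c i * f j) refl λ { zero _ ne → contradiction refl ne ; (suc i) _ _ → zeroˡ _ }

  var-⊛ : ∀ f n → (var ⊛ f) (suc n) ≈ f n
  var-⊛ f n = ≈-trans (conv-single (suc n) 1 n (λ i j → var i * f j) refl
    λ { zero _ _ → zeroˡ _ ; (suc zero) _ ne → contradiction refl ne ; (suc (suc i)) _ _ → zeroˡ _ }) (*-identityˡ _)

  ring-PS : CommutativeRing 0ℓ 0ℓ
  ring-PS = record
    { Carrier = PS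
    ; _≈_ = λ f g → ∀ n → f n ≈ g n
    ; _+_ = λ f g n → f n + g n
    ; _*_ = _⊛_
    ; -_  = λ f n → - f n
    ; 0#  = λ _ → 0#
    ; 1#  = const 1#
    ; isCommutativeRing = record
      { isRing = record
        { +-isAbelianGroup = record
          { isGroup = record
            { isMonoid = record
              { isSemigroup = record
                { isMagma = record
                  { isEquivalence = record { refl = λ _ → ≈-refl ; sym = λ e n → ≈-sym (e n) ; trans = λ e e′ n → ≈-trans (e n) (e′ n) }
                  ; ∙-cong = λ e e′ n → +-cong (e n) (e′ n) }
                ; assoc = λ f g h n → +-assoc _ _ _ }
              ; identity = (λ f n → +-identityˡ _) , (λ f n → +-identityʳ _) }
            ; inverse = (λ f n → -‿inverseˡ _) , (λ f n → -‿inverseʳ _)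
            ; ⁻¹-cong = λ e n → -‿cong (e n) }
          ; comm = λ f g n → +-comm _ _ }
        ; *-cong = λ e e′ n → conv-ext n λ i j → *-cong (e i) (e′ j)
        ; *-assoc = ⊛-assoc
        ; *-identity = (λ f n → ≈-trans (const-⊛ 1# f n) (*-identityˡ _))
                     , (λ f n → ≈-trans (⊛-comm f (const 1#) n) (≈-trans (const-⊛ 1# f n) (*-identityˡ _)))
        ; distrib = (λ f g h n → ≈-trans (conv-ext n λ i j → distribˡ _ _ _) (conv-+ n _ _))
                  , (λ f g h n → ≈-trans (conv-ext n λ i j → distribʳ _ _ _) (conv-+ n _ _)) }
      ; *-comm = ⊛-comm } }
    where
    ⊛-comm : ∀ f g n → (f ⊛ g) n ≈ (g ⊛ f) n
    ⊛-comm f g n = ≈-trans (conv-comm n _) (conv-ext n λ i j → *-comm _ _)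
    ⊛-assoc : ∀ f g h n → ((f ⊛ g) ⊛ h) n ≈ (f ⊛ (g ⊛ h)) n
    ⊛-assoc f g h n = begin
      conv n (λ p k → conv p (λ i j → f i * g j) * h k)
        ≈⟨ conv-ext n (λ p k → conv-*ʳ p (h k) λ i j → f i * g j) ⟩
      conv n (λ p k → conv p (λ i j → f i * g j * h k))
        ≈⟨ conv-ext n (λ p k → conv-ext p λ i j → *-assoc _ _ _) ⟩
      conv n (λ p k → conv p (λ i j → f i * (g j * h k)))
        ≈⟨ conv-assoc n (λ i j k → f i * (g j * h k)) ⟨
      conv n (λ i q → conv q (λ j k → f i * (g j * h k)))
        ≈⟨ conv-ext n (λ i q → conv-*ˡ q (f i) λ j k → g j * h k) ⟨
      conv n (λ i q → f i * conv q (λ j k → g j * h k)) ∎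

  private module P = CommutativeRing ring-PS
  open Algebra.Properties.Semiring.Exp P.semiring using (_^_)

  const-+ : ∀ a b → const (a + b) P.≈ const a P.+ const b
  const-+ a b zero    = ≈-refl
  const-+ a b (suc n) = ≈-sym (+-identityˡ 0#)

  const-* : ∀ a b → const (a * b) P.≈ const a P.* const b
  const-* a b zero    = ≈-refl
  const-* a b (suc n) = ≈-sym (≈-trans (const-⊛ a (const b) (suc n)) (zeroʳ a))

  const-0 : const 0# P.≈ P.0#
  const-0 zero    = ≈-refl
  const-0 (suc n) = ≈-refl

  const-cong : ∀ {a b} → a ≈ b → const a P.≈ const b
  const-cong e zero    = e
  const-cong e (suc n) = ≈-refl

  const-neg : ∀ a → const (- a) P.≈ P.- const a
  const-neg a zero    = ≈-refl
  const-neg a (suc n) = ≈-sym -0#≈0#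

  private module E = Algebra.Properties.Semiring.Exp semiring

  const-^ : ∀ a n → const (a E.^ n) P.≈ const a ^ n
  const-^ a zero    = P.refl
  const-^ a (suc n) = P.trans (const-* a (a E.^ n)) (P.*-congˡ {const a} (const-^ a n))

  const-conv : ∀ n f → const (conv n f) P.≈ Antidiagonal.conv ring-PS n (λ i j → const (f i j))
  const-conv zero    f = P.refl
  const-conv (suc n) f = P.trans (const-+ (f 0 (suc n)) _) (P.+-congˡ {const (f 0 (suc n))} (const-conv n λ i j → f (suc i) j))

  var^ : ∀ k f n → (var ^ k P.* f) (k ℕ.+ n) ≈ f n
  var^ zero    f n = ≈-trans (const-⊛ 1# f n) (*-identityˡ _)
  var^ (suc k) f n = ≈-trans (P.*-assoc var (var ^ k) f (suc k ℕ.+ n)) (≈-trans (var-⊛ (var ^ k P.* f) (k ℕ.+ n)) (var^ k f n))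

  var^-< : ∀ k f {n} → n ℕ.< k → (var ^ k P.* f) n ≈ 0#
  var^-< (suc k) f {zero}  _        = zeroˡ′ where
    zeroˡ′ : (var ^ suc k P.* f) 0 ≈ 0#
    zeroˡ′ = ≈-trans (P.*-assoc var (var ^ k) f 0) (zeroˡ _)
  var^-< (suc k) f {suc n} (ℕ.s≤s l) = ≈-trans (P.*-assoc var (var ^ k) f (suc n)) (≈-trans (var-⊛ (var ^ k P.* f) n) (var^-< k f l))

  -- Terms with a < k have no coefficient at k because `const` stops at degree a, and terms with a >
  -- k start too late. The lemma recovers a family from its homogeneous generating function.
  coefficient : ∀ N (g : ℕ → ℕ → C) k l → k ℕ.+ l ≡ N →
    Antidiagonal.conv ring-PS N (λ a b → var ^ a P.* const (g a b)) k ≈ g k l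
  coefficient N g k l e = ≈-trans (pointwise N (λ a b → var ^ a P.* const (g a b)) k)
    (≈-trans (conv-single N k l (λ a b → (var ^ a P.* const (g a b)) k) e off)
      (≈-trans (≈-reflexive (cong (var ^ k P.* const (g k l)) (sym (ℕₚ.+-identityʳ k)))) (var^ k (const (g k l)) 0)))
    where
    pointwise : ∀ N (f : ℕ → ℕ → PS) k → Antidiagonal.conv ring-PS N f k ≈ conv N (λ a b → f a b k)
    pointwise zero    f k = ≈-refl
    pointwise (suc N) f k = +-congˡ (pointwise N (λ a → f (suc a)) k)
    off : ∀ i j → i ≢ k → (var ^ i P.* const (g i j)) k ≈ 0#
    off i j i≢k with ℕₚ.<-cmp i k
    ... | Relation.Binary.Definitions.tri< i<k _ _ = ≈-trans (≈-reflexive (cong (var ^ i P.* const (g i j)) (sym k≡))) (var^ i (const (g i j)) (suc d))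
      where
      d = k ∸ suc i
      k≡ : i ℕ.+ suc d ≡ k
      k≡ = trans (ℕₚ.+-suc i d) (ℕₚ.m+[n∸m]≡n i<k)
    ... | Relation.Binary.Definitions.tri≈ _ i≡k _ = contradiction i≡k i≢k
    ... | Relation.Binary.Definitions.tri> _ _ k<i = var^-< i (const (g i j)) k<i

module Cancellation (R : CommutativeRing 0ℓ 0ℓ) where
  open CommutativeRing R renaming (Carrier to C; refl to ≈-refl; sym to ≈-sym; trans to ≈-trans)
  open Algebra.Properties.Ring ring
  open Antidiagonal R
  open PowerSeries R
  open Relation.Binary.Reasoning.Setoid setoid
  private module P = CommutativeRing ring-PS

  -- The notion that replaces being nonzero, since the coefficient rings need not be domains.
  Regular : C → Set
  Regular p = ∀ f → p * f ≈ 0# → f ≈ 0#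

  Regular-resp : ∀ {p r} → p ≈ r → Regular p → Regular r
  Regular-resp e reg f z = reg f (≈-trans (*-congʳ e) z)

  Regular-neg : ∀ {p} → Regular p → Regular (- p)
  Regular-neg {p} reg f z = reg f (begin
    p * f          ≈⟨ -‿involutive _ ⟨
    - - (p * f)    ≈⟨ -‿cong (≈-trans (-‿distribˡ-* p f) z) ⟩
    - 0#           ≈⟨ -0#≈0# ⟩
    0# ∎)

  Regular-* : ∀ {p r} → Regular p → Regular r → Regular (p * r)
  Regular-* reg reg′ f z = reg′ f (reg _ (≈-trans (≈-sym (*-assoc _ _ _)) z))

  Regular-cancel : ∀ {p} → Regular p → ∀ f g → p * f ≈ p * g → f ≈ g
  Regular-cancel {p} reg f g e = x∙y⁻¹≈ε⇒x≈y f g (reg (f - g) (≈-trans ([z-y]x f g) (≈-trans (+-congʳ e) (-‿inverseʳ _))))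
    where
    [z-y]x : ∀ f g → p * (f - g) ≈ p * f - p * g
    [z-y]x f g = ≈-trans (distribˡ p f (- g)) (+-congˡ (≈-sym (-‿distribʳ-* p g)))

  RegularPS : PS → Set
  RegularPS p = ∀ f → (∀ n → (p ⊛ f) n ≈ 0#) → ∀ n → f n ≈ 0#

  Regular-const : ∀ {c} → Regular c → RegularPS (const c)
  Regular-const {c} reg f z n = reg (f n) (≈-trans (≈-sym (const-⊛ c f n)) (z n))

  Regular-var : RegularPS var
  Regular-var f z n = ≈-trans (≈-sym (var-⊛ f n)) (z (suc n))

  -- Solve for the coefficients one after the other.
  Regular-leading : ∀ p → Regular (p 0) → RegularPS p
  Regular-leading p reg f z n = go n n ℕₚ.≤-refl
    where
    go : ∀ b n → n ℕ.≤ b → f n ≈ 0#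
    go b       zero    _         = reg (f 0) (z 0)
    go (suc b) (suc n) (ℕ.s≤s l) = reg (f (suc n)) (begin
      p 0 * f (suc n)                                        ≈⟨ +-identityʳ _ ⟨
      p 0 * f (suc n) + 0#                                   ≈⟨ +-congˡ (conv-zero n λ i j e →
                                                                   ≈-trans (*-congˡ (go b j (ℕₚ.≤-trans (subst (j ℕ.≤_) e (ℕₚ.m≤n+m j i)) l))) (zeroʳ _)) ⟨
      p 0 * f (suc n) + conv n (λ i j → p (suc i) * f j)     ≈⟨ z (suc n) ⟩
      0# ∎)

module PowerSeriesAlgebra (q : ℕ) (𝔽 : FiniteField q) where
  algebra-PS : 𝔽-Algebra q 𝔽 → 𝔽-Algebra q 𝔽
  algebra-PS A = record
    { commutativeRing = ring-PS
    ; ι   = λ c → const (ι c)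
    ; ι-+ = λ a b n → ≈-trans (const-cong (ι-+ a b) n) (const-+ _ _ n)
    ; ι-* = λ a b n → ≈-trans (const-cong (ι-* a b) n) (const-* _ _ n)
    ; ι-0 = λ n → ≈-trans (const-cong ι-0 n) (const-0 n)
    ; ι-1 = const-cong ι-1 }
    where
    open 𝔽-Algebra A renaming (trans to ≈-trans)
    open PowerSeries commutativeRing

-- Generating functions of diamond products of letters.

module LetterOperator (q : ℕ) (𝔽 : FiniteField q) (A : 𝔽-Algebra q 𝔽) where
  open FieldFacts q 𝔽 using (m)
  open PowerSums q 𝔽 using (κ)
  open 𝔽-Algebra A renaming (Carrier to R; refl to ≈-refl; sym to ≈-sym; trans to ≈-trans; reflexive to ≈-reflexive)
  open Algebra.Properties.Semiring.Exp semiring using (_^_; ^-congˡ)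
  open AlgebraIdentities q 𝔽 A
  open IntegerSolver commutativeRing
  open Antidiagonal commutativeRing
  open Relation.Binary.Reasoning.Setoid setoid

  -- f applied to x_{a+1} ⋄ x_{b+1} = Σ κ x_{i+1} x_l, where n = a + b.
  K⋄ : ℕ → ℕ → ℕ → (ℕ → ℕ → R) → R
  K⋄ n a b f = conv (suc n) (λ i l → ι (κ a b l) * f i l)

  K⋄-generating : ∀ n f → (∀ i {l} → ¬ (m ∣ l) → f i l ≈ 0#) → ∀ v w →
    (v - w) * conv n (λ a b → (v ^ a * w ^ b) * K⋄ n a b f) ≈ conv (suc n) (λ i l → f i l * ((v ^ i - w ^ i) * (v - w) ^ l))
  K⋄-generating n f f-∤ v w = begin
    (v - w) * conv n (λ a b → (v ^ a * w ^ b) * K⋄ n a b f)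
      ≈⟨ *-congˡ (conv-ext n λ a b → conv-*ˡ (suc n) (v ^ a * w ^ b) (λ i l → ι (κ a b l) * f i l)) ⟩
    (v - w) * conv n (λ a b → conv (suc n) (λ i l → (v ^ a * w ^ b) * (ι (κ a b l) * f i l)))
      ≈⟨ *-congˡ (conv-swap n (suc n) (λ a b i l → (v ^ a * w ^ b) * (ι (κ a b l) * f i l))) ⟩
    (v - w) * conv (suc n) (λ i l → conv n (λ a b → (v ^ a * w ^ b) * (ι (κ a b l) * f i l)))
      ≈⟨ conv-*ˡ (suc n) (v - w) (λ i l → conv n (λ a b → (v ^ a * w ^ b) * (ι (κ a b l) * f i l))) ⟩
    conv (suc n) (λ i l → (v - w) * conv n (λ a b → (v ^ a * w ^ b) * (ι (κ a b l) * f i l)))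
      ≈⟨ conv-cong (suc n) term ⟩
    conv (suc n) (λ i l → f i l * ((v ^ i - w ^ i) * (v - w) ^ l)) ∎
    where
    term : ∀ i l → i ℕ.+ l ≡ suc n →
      (v - w) * conv n (λ a b → (v ^ a * w ^ b) * (ι (κ a b l) * f i l)) ≈ f i l * ((v ^ i - w ^ i) * (v - w) ^ l)
    term i l e with m ∣? l
    ... | no ¬d = begin
      (v - w) * conv n (λ a b → (v ^ a * w ^ b) * (ι (κ a b l) * f i l))
        ≈⟨ *-congˡ (conv-zero n λ a b _ → ≈-trans (*-congˡ (≈-trans (*-congˡ (f-∤ i ¬d)) (zeroʳ _))) (zeroʳ _)) ⟩
      (v - w) * 0#   ≈⟨ zeroʳ _ ⟩
      0#             ≈⟨ ≈-trans (*-congʳ (f-∤ i ¬d)) (zeroˡ _) ⟨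
      f i l * ((v ^ i - w ^ i) * (v - w) ^ l) ∎
    ... | yes d = begin
      (v - w) * conv n (λ a b → (v ^ a * w ^ b) * (ι (κ a b l) * f i l))
        ≈⟨ *-congˡ (≈-trans (conv-ext n λ a b → solve 3 (λ p c f → p :* (c :* f) := f :* (c :* p)) ≈-refl (v ^ a * w ^ b) (ι (κ a b l)) (f i l))
             (≈-sym (conv-*ˡ n (f i l) (λ a b → ι (κ a b l) * (v ^ a * w ^ b))))) ⟩
      (v - w) * (f i l * conv n (λ a b → ι (κ a b l) * (v ^ a * w ^ b)))
        ≈⟨ solve 3 (λ d f s → d :* (f :* s) := f :* (d :* s)) ≈-refl (v - w) (f i l) _ ⟩
      f i l * ((v - w) * conv n (λ a b → ι (κ a b l) * (v ^ a * w ^ b)))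
        ≈⟨ *-congˡ (κ-generating n i l e d v w) ⟩
      f i l * ((v ^ i - w ^ i) * (v - w) ^ l) ∎

  module Additive (g : ℕ → ℕ → ℕ → R)
    (g-comm : ∀ k l j → g k l j ≈ g k j l)
    (g-∤ : ∀ k l {j} → ¬ (m ∣ j) → g k l j ≈ 0#)
    (g-additive : ∀ k n a b → (a + b) * conv n (λ l j → g k l j * (a ^ l * b ^ j)) ≈
      b * conv n (λ l j → g k l j * ((a + b) ^ l * a ^ j)) + a * conv n (λ l j → g k l j * ((a + b) ^ l * b ^ j)))
    where

    -- (x_{a+1} ⋄ x_{b+1}) ⋄ x_{c+1}, with g k l j standing for x_{k+1} (P_l ⧢ P_j).
    K⋄⋄ : ℕ → ℕ → ℕ → R
    K⋄⋄ a b c = K⋄ (a ℕ.+ b) a b (λ i j → K⋄ (i ℕ.+ c) i c (λ k l → g k l j))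

    Ψ : ℕ → ℕ → R → R → R
    Ψ k n v w = conv n (λ l j → g k l j * (v ^ l * w ^ j))

    -- The part of degree n of X(u) (P(v) ⧢ P(w)), where X(u) = Σ x_{k+1} u^k supplies the first
    -- letter.
    Θ : ℕ → R → R → R → R
    Θ n u v w = conv n (λ k p → u ^ k * Ψ k p v w)

    Ψ-cong : ∀ k n {v v′ w w′} → v ≈ v′ → w ≈ w′ → Ψ k n v w ≈ Ψ k n v′ w′
    Ψ-cong k n e e′ = conv-ext n λ l j → *-congˡ (*-cong (^-congˡ l e) (^-congˡ j e′))

    Θ-cong : ∀ n u {v v′ w w′} → v ≈ v′ → w ≈ w′ → Θ n u v w ≈ Θ n u v′ w′
    Θ-cong n u e e′ = conv-ext n λ k p → *-congˡ (Ψ-cong k p e e′)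

    Θ-comm : ∀ n u v w → Θ n u v w ≈ Θ n u w v
    Θ-comm n u v w = conv-ext n λ k p → *-congˡ (≈-trans (conv-comm p _) (conv-ext p λ j l → *-cong (g-comm k l j) (*-comm _ _)))

    Θ-negʳ : ∀ n u v w → Θ n u v (- w) ≈ Θ n u v w
    Θ-negʳ n u v w = conv-ext n λ k p → *-congˡ (conv-ext p λ l j → term k l j)
      where
      term : ∀ k l j → g k l j * (v ^ l * (- w) ^ j) ≈ g k l j * (v ^ l * w ^ j)
      term k l j with m ∣? j
      ... | yes d = *-congˡ (*-congˡ (neg^-∣ d w))
      ... | no ¬d = ≈-trans (≈-trans (*-congʳ (g-∤ k l ¬d)) (zeroˡ _)) (≈-sym (≈-trans (*-congʳ (g-∤ k l ¬d)) (zeroˡ _)))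

    Θ-negˡ : ∀ n u v w → Θ n u (- v) w ≈ Θ n u v w
    Θ-negˡ n u v w = ≈-trans (Θ-comm n u (- v) w) (≈-trans (Θ-negʳ n u w v) (Θ-comm n u w v))

    Θ-additive : ∀ n u a b → (a + b) * Θ n u a b ≈ b * Θ n u (a + b) a + a * Θ n u (a + b) b
    Θ-additive n u a b = begin
      (a + b) * Θ n u a b
        ≈⟨ ≈-trans (conv-*ˡ n (a + b) (λ k p → u ^ k * Ψ k p a b)) (conv-ext n λ k p → ≈-trans
             (solve 3 (λ s u x → s :* (u :* x) := u :* (s :* x)) ≈-refl (a + b) (u ^ k) (Ψ k p a b))
             (≈-trans (*-congˡ (g-additive k p a b))
             (solve 5 (λ u a b x y → u :* (b :* x :+ a :* y) := b :* (u :* x) :+ a :* (u :* y)) ≈-refl (u ^ k) a b (Ψ k p (a + b) a) (Ψ k p (a + b) b)))) ⟩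
      conv n (λ k p → b * (u ^ k * Ψ k p (a + b) a) + a * (u ^ k * Ψ k p (a + b) b))
        ≈⟨ conv-+ n (λ k p → b * (u ^ k * Ψ k p (a + b) a)) (λ k p → a * (u ^ k * Ψ k p (a + b) b)) ⟩
      conv n (λ k p → b * (u ^ k * Ψ k p (a + b) a)) + conv n (λ k p → a * (u ^ k * Ψ k p (a + b) b))
        ≈⟨ +-cong (conv-*ˡ n b (λ k p → u ^ k * Ψ k p (a + b) a)) (conv-*ˡ n a (λ k p → u ^ k * Ψ k p (a + b) b)) ⟨
      b * Θ n u (a + b) a + a * Θ n u (a + b) b ∎

    -- The part of degree n of (X(s) ⋄ X(t)) ⋄ X(r).
    Gen : ℕ → R → R → R → R
    Gen n s t r = conv n (λ a p → s ^ a * conv p (λ b c → t ^ b * (r ^ c * K⋄⋄ a b c)))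

    -- The triple product with its denominators cleared. Since P is even, rotating s, t, r merely
    -- permutes the three terms.
    Sym : ℕ → R → R → R → R
    Sym n s t r = (t - r) * Θ n s (s - r) (s - t) - (s - r) * Θ n t (t - r) (s - t) + (s - t) * Θ n r (s - r) (t - r)

    Sym-rotate : ∀ n s t r → Sym n t r s ≈ Sym n s t r
    Sym-rotate n s t r = begin
      (r - s) * Θ n t (t - s) (t - r) - (t - s) * Θ n r (r - s) (t - r) + (t - r) * Θ n s (t - s) (r - s)
        ≈⟨ +-cong (+-cong (*-congˡ (≈-trans (Θ-cong n t (flipped s t) ≈-refl) (≈-trans (Θ-negˡ n t _ _) (Θ-comm n t _ _))))
                          (-‿cong (*-congˡ (≈-trans (Θ-cong n r (flipped s r) ≈-refl) (Θ-negˡ n r _ _)))))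
             (*-congˡ (≈-trans (Θ-cong n s (flipped s t) (flipped s r)) (≈-trans (Θ-negˡ n s _ _) (≈-trans (Θ-negʳ n s _ _) (Θ-comm n s _ _))))) ⟩
      (r - s) * Θ n t (t - r) (s - t) - (t - s) * Θ n r (s - r) (t - r) + (t - r) * Θ n s (s - r) (s - t)
        ≈⟨ solve 6 (λ s t r x y z → (r :- s) :* x :- (t :- s) :* y :+ (t :- r) :* z := (t :- r) :* z :- (s :- r) :* x :+ (s :- t) :* y)
             ≈-refl s t r (Θ n t (t - r) (s - t)) (Θ n r (s - r) (t - r)) (Θ n s (s - r) (s - t)) ⟩
      Sym n s t r ∎
      where
      flipped : ∀ a b → b - a ≈ - (a - b)
      flipped a b = solve 2 (λ a b → b :- a := :- (a :- b)) ≈-refl a b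

    -- The product rule is applied twice, first with s - t and then with u - r for u = s and u = t.
    -- Each application raises the degree by one, since `K⋄ n` sums over i + l = n + 1.
    Gen-Sym : ∀ n s t r → (s - t) * ((s - r) * (t - r)) * Gen n s t r ≈ Sym (suc (suc n)) s t r
    Gen-Sym n s t r = begin
      (s - t) * ((s - r) * (t - r)) * Gen n s t r
        ≈⟨ solve 4 (λ a b c x → a :* (b :* c) :* x := (b :* c) :* (a :* x)) ≈-refl (s - t) (s - r) (t - r) (Gen n s t r) ⟩
      ((s - r) * (t - r)) * ((s - t) * Gen n s t r)
        ≈⟨ *-congˡ step₁ ⟩
      ((s - r) * (t - r)) * conv (suc n) (λ j p → (s - t) ^ j * (U j p s - U j p t))
        ≈⟨ conv-*ˡ (suc n) ((s - r) * (t - r)) (λ j p → (s - t) ^ j * (U j p s - U j p t)) ⟩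
      conv (suc n) (λ j p → ((s - r) * (t - r)) * ((s - t) ^ j * (U j p s - U j p t)))
        ≈⟨ conv-ext (suc n) (λ j p → ≈-trans
             (solve 5 (λ a b d x y → (a :* b) :* (d :* (x :- y)) := d :* (b :* (a :* x) :- a :* (b :* y))) ≈-refl (s - r) (t - r) ((s - t) ^ j) (U j p s) (U j p t))
             (*-congˡ (+-cong (*-congˡ (U-V j p s)) (-‿cong (*-congˡ (U-V j p t)))))) ⟩
      conv (suc n) (λ j p → W j (suc p))
        ≈⟨ ≈-trans (conv-last (suc n) W) (≈-trans (+-congˡ W-0) (+-identityʳ _)) ⟨
      conv N W
        ≈⟨ ≈-trans (conv-ext N λ j p → solve 5 (λ d b a x y → d :* (b :* x :- a :* y) := b :* (d :* x) :+ (:- a) :* (d :* y)) ≈-refl ((s - t) ^ j) (t - r) (s - r) (V j p s) (V j p t))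
             (≈-trans (conv-+ N (λ j p → (t - r) * ((s - t) ^ j * V j p s)) (λ j p → - (s - r) * ((s - t) ^ j * V j p t)))
             (+-cong (≈-sym (conv-*ˡ N (t - r) (λ j p → (s - t) ^ j * V j p s))) (≈-sym (conv-*ˡ N (- (s - r)) (λ j p → (s - t) ^ j * V j p t))))) ⟩
      (t - r) * conv N (λ j p → (s - t) ^ j * V j p s) + - (s - r) * conv N (λ j p → (s - t) ^ j * V j p t)
        ≈⟨ +-cong (*-congˡ (V-Θ s)) (*-congˡ (V-Θ t)) ⟩
      (t - r) * (Θ N s (s - r) (s - t) - Θ N r (s - r) (s - t)) + - (s - r) * (Θ N t (t - r) (s - t) - Θ N r (t - r) (s - t))
        ≈⟨ solve 7 (λ s t r x y z o → (t :- r) :* (x :- y) :+ (:- (s :- r)) :* (z :- o) :=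
             (t :- r) :* x :- (s :- r) :* z :+ (((s :- t) :+ (t :- r)) :* o :- (t :- r) :* y)) ≈-refl s t r
             (Θ N s (s - r) (s - t)) (Θ N r (s - r) (s - t)) (Θ N t (t - r) (s - t)) (Θ N r (t - r) (s - t)) ⟩
      (t - r) * Θ N s (s - r) (s - t) - (s - r) * Θ N t (t - r) (s - t)
        + (((s - t) + (t - r)) * Θ N r (t - r) (s - t) - (t - r) * Θ N r (s - r) (s - t))
        ≈⟨ +-congˡ last ⟩
      Sym N s t r ∎
      where
      N = suc (suc n)
      B : ℕ → ℕ → ℕ → R
      B i c j = K⋄ (i ℕ.+ c) i c (λ k l → g k l j)
      U V : ℕ → ℕ → R → R
      U j p u = conv p (λ i c → (u ^ i * r ^ c) * B i c j)
      V j p u = conv p (λ k l → g k l j * ((u ^ k - r ^ k) * (u - r) ^ l))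
      W : ℕ → ℕ → R
      W j p = (s - t) ^ j * ((t - r) * V j p s - (s - r) * V j p t)
      -- A padding term, zero because u^0 - r^0 = 0; it completes the shifted sum to a full
      -- antidiagonal of degree N.
      W-0 : W N 0 ≈ 0#
      W-0 = solve 4 (λ d a b g → d :* (a :* (g :* ((:1 :- :1) :* :1)) :- b :* (g :* ((:1 :- :1) :* :1))) := :0) ≈-refl ((s - t) ^ N) (t - r) (s - r) (g 0 0 N)
      U-V : ∀ j p u → (u - r) * U j p u ≈ V j (suc p) u
      U-V j p u = ≈-trans (*-congˡ (conv-cong p λ i c e → *-congˡ (≈-reflexive (cong (λ p → K⋄ p i c (λ k l → g k l j)) e))))
        (K⋄-generating p (λ k l → g k l j) (λ k {l} ¬d → ≈-trans (g-comm k l j) (g-∤ k j ¬d)) u r)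
      Z : ℕ → ℕ → ℕ → R
      Z i j c = (s ^ i - t ^ i) * (s - t) ^ j * (r ^ c * B i c j)
      step₁ : (s - t) * Gen n s t r ≈ conv (suc n) (λ j p → (s - t) ^ j * (U j p s - U j p t))
      step₁ = begin
        (s - t) * Gen n s t r
          ≈⟨ *-congˡ (≈-trans (conv-ext n λ a p → ≈-trans (conv-*ˡ p (s ^ a) (λ b c → t ^ b * (r ^ c * K⋄⋄ a b c)))
                (conv-ext p λ b c → ≈-sym (*-assoc _ _ _)))
              (conv-assoc n (λ a b c → (s ^ a * t ^ b) * (r ^ c * K⋄⋄ a b c)))) ⟩
        (s - t) * conv n (λ p c → conv p (λ a b → (s ^ a * t ^ b) * (r ^ c * K⋄⋄ a b c)))
          ≈⟨ conv-*ˡ n (s - t) (λ p c → conv p (λ a b → (s ^ a * t ^ b) * (r ^ c * K⋄⋄ a b c))) ⟩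
        conv n (λ p c → (s - t) * conv p (λ a b → (s ^ a * t ^ b) * (r ^ c * K⋄⋄ a b c)))
          ≈⟨ conv-ext n inner ⟩
        conv n (λ p c → conv (suc p) (λ i j → Z i j c))
          ≈⟨ ≈-trans (+-congʳ Z-0) (+-identityˡ _) ⟨
        conv (suc n) (λ p c → conv p (λ i j → Z i j c))
          ≈⟨ conv-rotate (suc n) Z ⟩
        conv (suc n) (λ j p → conv p (λ i c → Z i j c))
          ≈⟨ conv-ext (suc n) (λ j p → ≈-trans (conv-ext p λ i c →
               solve 5 (λ a b d x y → (a :- b) :* d :* (x :* y) := d :* ((a :* x) :* y :+ :- ((b :* x) :* y))) ≈-refl (s ^ i) (t ^ i) ((s - t) ^ j) (r ^ c) (B i c j))
               (≈-trans (≈-sym (conv-*ˡ p ((s - t) ^ j) (λ i c → (s ^ i * r ^ c) * B i c j + - ((t ^ i * r ^ c) * B i c j))))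
                 (*-congˡ (≈-trans (conv-+ p (λ i c → (s ^ i * r ^ c) * B i c j) (λ i c → - ((t ^ i * r ^ c) * B i c j)))
                   (+-congˡ (≈-sym (conv-neg p (λ i c → (t ^ i * r ^ c) * B i c j)))))))) ⟩
        conv (suc n) (λ j p → (s - t) ^ j * (U j p s - U j p t)) ∎
        where
        Z-0 : Z 0 0 (suc n) ≈ 0#
        Z-0 = solve 1 (λ x → (:1 :- :1) :* :1 :* x := :0) ≈-refl (r ^ suc n * B 0 (suc n) 0)
        inner : ∀ p c → (s - t) * conv p (λ a b → (s ^ a * t ^ b) * (r ^ c * K⋄⋄ a b c)) ≈ conv (suc p) (λ i j → Z i j c)
        inner p c = begin
          (s - t) * conv p (λ a b → (s ^ a * t ^ b) * (r ^ c * K⋄⋄ a b c))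
            ≈⟨ *-congˡ (conv-cong p λ a b e → *-congˡ (≈-trans (*-congˡ (≈-reflexive (cong (λ p → K⋄ p a b (λ i j → B i c j)) e)))
                 (≈-trans (conv-*ˡ (suc p) (r ^ c) (λ i j → ι (κ a b j) * B i c j))
                   (conv-ext (suc p) λ i j → solve 3 (λ x y z → x :* (y :* z) := y :* (x :* z)) ≈-refl (r ^ c) (ι (κ a b j)) (B i c j))))) ⟩
          (s - t) * conv p (λ a b → (s ^ a * t ^ b) * K⋄ p a b (λ i j → r ^ c * B i c j))
            ≈⟨ K⋄-generating p (λ i j → r ^ c * B i c j) vanish s t ⟩
          conv (suc p) (λ i j → (r ^ c * B i c j) * ((s ^ i - t ^ i) * (s - t) ^ j))
            ≈⟨ conv-ext (suc p) (λ i j → *-comm (r ^ c * B i c j) ((s ^ i - t ^ i) * (s - t) ^ j)) ⟩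
          conv (suc p) (λ i j → Z i j c) ∎
          where
          vanish : ∀ i {j} → ¬ (m ∣ j) → r ^ c * B i c j ≈ 0#
          vanish i {j} ¬d = ≈-trans (*-congˡ (conv-zero (suc (i ℕ.+ c)) {f = λ k l → ι (κ i c l) * g k l j} λ k l _ → ≈-trans (*-congˡ (g-∤ k l ¬d)) (zeroʳ _))) (zeroʳ _)
      V-Θ : ∀ u → conv N (λ j p → (s - t) ^ j * V j p u) ≈ Θ N u (u - r) (s - t) - Θ N r (u - r) (s - t)
      V-Θ u = begin
        conv N (λ j p → (s - t) ^ j * V j p u)
          ≈⟨ conv-ext N (λ j p → conv-*ˡ p ((s - t) ^ j) (λ k l → g k l j * ((u ^ k - r ^ k) * (u - r) ^ l))) ⟩
        conv N (λ j p → conv p (λ k l → Y k j l))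
          ≈⟨ conv-rotate N Y ⟨
        conv N (λ p l → conv p (λ k j → Y k j l))
          ≈⟨ conv-assoc N Y ⟨
        conv N (λ k p → conv p (λ j l → Y k j l))
          ≈⟨ conv-ext N (λ k p → ≈-trans (conv-comm p (λ j l → Y k j l)) (≈-trans (conv-ext p λ l j →
               solve 5 (λ d g a b v → d :* (g :* ((a :- b) :* v)) := (a :- b) :* (g :* (v :* d))) ≈-refl ((s - t) ^ j) (g k l j) (u ^ k) (r ^ k) ((u - r) ^ l))
               (≈-trans (≈-sym (conv-*ˡ p (u ^ k - r ^ k) (λ l j → g k l j * ((u - r) ^ l * (s - t) ^ j))))
                 (solve 3 (λ a b x → (a :- b) :* x := a :* x :+ :- (b :* x)) ≈-refl (u ^ k) (r ^ k) (Ψ k p (u - r) (s - t)))))) ⟩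
        conv N (λ k p → u ^ k * Ψ k p (u - r) (s - t) + - (r ^ k * Ψ k p (u - r) (s - t)))
          ≈⟨ ≈-trans (conv-+ N (λ k p → u ^ k * Ψ k p (u - r) (s - t)) (λ k p → - (r ^ k * Ψ k p (u - r) (s - t))))
               (+-congˡ (≈-sym (conv-neg N (λ k p → r ^ k * Ψ k p (u - r) (s - t))))) ⟩
        Θ N u (u - r) (s - t) - Θ N r (u - r) (s - t) ∎
        where
        Y : ℕ → ℕ → ℕ → R
        Y k j l = (s - t) ^ j * (g k l j * ((u ^ k - r ^ k) * (u - r) ^ l))
      -- This is where additivity enters: with a = s - t and b = t - r, the two contributions of
      -- X(r) combine to the one that symmetry demands.
      last : ((s - t) + (t - r)) * Θ N r (t - r) (s - t) - (t - r) * Θ N r (s - r) (s - t) ≈ (s - t) * Θ N r (s - r) (t - r)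
      last = begin
        (a + b) * Θ N r b a - b * Θ N r (s - r) a
          ≈⟨ +-cong (≈-trans (*-congˡ (Θ-comm N r b a)) (Θ-additive N r a b)) (-‿cong (*-congˡ (Θ-cong N r telescope ≈-refl))) ⟩
        (b * Θ N r (a + b) a + a * Θ N r (a + b) b) - b * Θ N r (a + b) a
          ≈⟨ solve 2 (λ x y → (x :+ y) :- x := y) ≈-refl (b * Θ N r (a + b) a) (a * Θ N r (a + b) b) ⟩
        a * Θ N r (a + b) b
          ≈⟨ *-congˡ (Θ-cong N r (≈-sym telescope) ≈-refl) ⟩
        a * Θ N r (s - r) b ∎
        where
        a = s - t
        b = t - r
        telescope : s - r ≈ a + b
        telescope = solve 3 (λ s t r → s :- r := (s :- t) :+ (t :- r)) ≈-refl s t r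

    Gen-rotate : ∀ n s t r → (s - t) * ((s - r) * (t - r)) * Gen n s t r ≈ (s - t) * ((s - r) * (t - r)) * Gen n t r s
    Gen-rotate n s t r = begin
      (s - t) * ((s - r) * (t - r)) * Gen n s t r    ≈⟨ Gen-Sym n s t r ⟩
      Sym (suc (suc n)) s t r                        ≈⟨ Sym-rotate (suc (suc n)) s t r ⟨
      Sym (suc (suc n)) t r s                        ≈⟨ Gen-Sym n t r s ⟨
      (t - r) * ((t - s) * (r - s)) * Gen n t r s    ≈⟨ solve 4 (λ s t r x → (t :- r) :* ((t :- s) :* (r :- s)) :* x := (s :- t) :* ((s :- r) :* (t :- r)) :* x) ≈-refl s t r (Gen n t r s) ⟩
      (s - t) * ((s - r) * (t - r)) * Gen n t r s    ∎

    -- The rotated series is sorted by s, t, r in the original order, so that its coefficients can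
    -- be compared with those of `Gen n s t r`.
    Gen-reindex : ∀ n s t r → Gen n t r s ≈ conv n (λ a p → s ^ a * conv p (λ b c → t ^ b * (r ^ c * K⋄⋄ b c a)))
    Gen-reindex n s t r = begin
      conv n (λ b p → t ^ b * conv p (λ c a → r ^ c * (s ^ a * K⋄⋄ b c a)))
        ≈⟨ conv-ext n (λ b p → conv-*ˡ p (t ^ b) (λ c a → r ^ c * (s ^ a * K⋄⋄ b c a))) ⟩
      conv n (λ b p → conv p (λ c a → t ^ b * (r ^ c * (s ^ a * K⋄⋄ b c a))))
        ≈⟨ ≈-trans (conv-assoc n (λ b c a → t ^ b * (r ^ c * (s ^ a * K⋄⋄ b c a)))) (conv-comm n _) ⟩
      conv n (λ a p → conv p (λ b c → t ^ b * (r ^ c * (s ^ a * K⋄⋄ b c a))))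
        ≈⟨ conv-ext n (λ a p → ≈-trans (conv-ext p λ b c → solve 4 (λ x y z k → x :* (y :* (z :* k)) := z :* (x :* (y :* k))) ≈-refl (t ^ b) (r ^ c) (s ^ a) (K⋄⋄ b c a))
             (≈-sym (conv-*ˡ p (s ^ a) (λ b c → t ^ b * (r ^ c * K⋄⋄ b c a))))) ⟩
      conv n (λ a p → s ^ a * conv p (λ b c → t ^ b * (r ^ c * K⋄⋄ b c a))) ∎

-- The series P and products of letters of character 1.

module LetterProducts (q : ℕ) (𝔽 : FiniteField q) where
  open Construction q 𝔽 using (Letter; letter; Word; xₛ; 𝔇; ⟦_⟧; scale; pre; Δc; pw; sgn; _⧢_)
  open FieldFacts q 𝔽 using (𝔽-ring; m)
  open PowerSums q 𝔽 using (bin-def; κ)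
  open BinomialModQ q 𝔽 using (𝔽-self)
  open CommutativeRing 𝔽-ring hiding (refl; sym; trans) renaming (Carrier to K)
  open Antidiagonal 𝔽-ring
  open LetterOperator q 𝔽 𝔽-self using (K⋄)
  open Pairing q 𝔽
  open Shuffle q 𝔽
  open ShuffleLaws q 𝔽 using (letter-cong; S-comm)
  open ≡-Reasoning

  -- The coefficients of P(t) = 1 + Σ x_j t^j over positive multiples j of q − 1.
  P : ℕ → 𝔇
  P zero    = ⟦ [] ⟧
  P (suc j) with m ∣? suc j
  ... | yes _ = ⟦ xₛ j ∷ [] ⟧
  ... | no  _ = []

  P-∤ : ∀ {l} → ¬ (m ∣ l) → P l ≡ []
  P-∤ {zero}  ¬d = contradiction (m ∣.∣0) ¬d
  P-∤ {suc l} ¬d with m ∣? suc l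
  ... | yes d = contradiction d ¬d
  ... | no  _ = refl

  P-∣ : ∀ {l} → m ∣ suc l → P (suc l) ≡ ⟦ xₛ l ∷ [] ⟧
  P-∣ {l} d with m ∣? suc l
  ... | yes _ = refl
  ... | no ¬d = contradiction d ¬d

  Δc-P : ∀ a b l (φ : Word → K) → Δc (suc l) (suc a) (suc b) * φ (xₛ l ∷ []) ≡ κ a b (suc l) * ∫ (P (suc l)) φ
  Δc-P a b l φ with (q ∸ 1) ∣? suc l
  ... | yes _ = cong₂ _*_ (sym (cong₂ (λ c d → sgn a * c + sgn b * d) (bin-def l a) (bin-def l b))) (sym (∫-single _ φ))
  ... | no  _ = trans (zeroˡ _) (sym (zeroʳ _))

  -- Read as a first letter followed by P_0 = 1 with coefficient κ = 1, the single letter of weight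
  -- a + b joins the other terms in one antidiagonal sum.
  dl-K⋄ : ∀ x y (φ : Letter → Word → K) →
    ∫₂ (dl x y) φ ≡ K⋄ (pw x ℕ.+ pw y) (pw x) (pw y) (λ i l → ∫ (P l) (φ (withWeight i x y)))
  dl-K⋄ x@(letter a α _) y@(letter b β _) φ = begin
    ∫₂ (dl x y) φ
      ≡⟨ ∫-dl x y φ ⟩
    φ (x ·L y) [] + conv (a ℕ.+ b) (λ i j → Δc (suc j) (suc a) (suc b) * φ (withWeight i x y) (xₛ j ∷ []))
      ≡⟨ cong₂ _+_ (trans (sym (∫-single [] (φ (x ·L y)))) (sym (*-identityˡ _))) (conv-ext (a ℕ.+ b) λ i j → Δc-P a b j (φ (withWeight i x y))) ⟩
    1# * ∫ (P 0) (φ (x ·L y)) + conv (a ℕ.+ b) (λ i j → κ a b (suc j) * ∫ (P (suc j)) (φ (withWeight i x y)))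
      ≡⟨ trans (+-comm _ _) (sym (conv-last (a ℕ.+ b) (λ i l → κ a b l * ∫ (P l) (φ (withWeight i x y))))) ⟩
    K⋄ (a ℕ.+ b) a b (λ i l → ∫ (P l) (φ (withWeight i x y))) ∎

  -- The list form of `conv`: an antidiagonal sum of formal combinations that is itself a formal
  -- combination.
  convL : ∀ {B : Set} → ℕ → (ℕ → ℕ → FM B) → FM B
  convL zero    f = f 0 0
  convL (suc n) f = f 0 (suc n) ++ convL n (λ i j → f (suc i) j)

  ∫-convL : ∀ {B : Set} n (f : ℕ → ℕ → FM B) φ → ∫ (convL n f) φ ≡ conv n (λ i j → ∫ (f i j) φ)
  ∫-convL zero    f φ = refl
  ∫-convL (suc n) f φ = trans (∫-++ (f 0 (suc n)) _ φ) (cong (_+_ _) (∫-convL n (λ i j → f (suc i) j) φ))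

  withWeight-xₛ : ∀ i j k → withWeight i (xₛ j) (xₛ k) ≡ xₛ i
  withWeight-xₛ i j k = letter-cong refl (*-identityˡ 1#)

  S-letters : ∀ j k (φ : Word → K) → S (xₛ j ∷ []) (xₛ k ∷ []) φ ≡ φ (xₛ j ∷ xₛ k ∷ []) + φ (xₛ k ∷ xₛ j ∷ [])
    + K⋄ (j ℕ.+ k) j k (λ i l → ∫ (P l) (xₛ i ◁ φ))
  S-letters j k φ = begin
    S (xₛ j ∷ []) (xₛ k ∷ []) φ
      ≡⟨ S-∷∷ (xₛ j) [] (xₛ k) [] φ ⟩
    S [] (xₛ k ∷ []) (xₛ j ◁ φ) + (S (xₛ j ∷ []) [] (xₛ k ◁ φ) + S [] [] (⋄-term (xₛ j) (xₛ k) φ))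
      ≡⟨ cong₂ _+_ (S-[]ˡ (xₛ k ∷ []) (xₛ j ◁ φ)) (cong₂ _+_ (S-[]ʳ (xₛ j ∷ []) (xₛ k ◁ φ)) (trans (S-[]ˡ [] (⋄-term (xₛ j) (xₛ k) φ))
           (trans (∫-cong (dl (xₛ j) (xₛ k)) λ p → S-[]ʳ (proj₂ p) (proj₁ p ◁ φ)) (trans (dl-K⋄ (xₛ j) (xₛ k) (λ l → l ◁ φ))
             (conv-ext (suc (j ℕ.+ k)) λ i l → cong (λ x → κ j k l * ∫ (P l) (x ◁ φ)) (withWeight-xₛ i j k)))))) ⟩
    φ (xₛ j ∷ xₛ k ∷ []) + (φ (xₛ k ∷ xₛ j ∷ []) + K⋄ (j ℕ.+ k) j k (λ i l → ∫ (P l) (xₛ i ◁ φ)))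
      ≡⟨ +-assoc _ _ _ ⟨
    φ (xₛ j ∷ xₛ k ∷ []) + φ (xₛ k ∷ xₛ j ∷ []) + K⋄ (j ℕ.+ k) j k (λ i l → ∫ (P l) (xₛ i ◁ φ)) ∎

  ∫-⧢-[]ˡ : ∀ e φ → ∫ (⟦ [] ⟧ ⧢ e) φ ≡ ∫ e φ
  ∫-⧢-[]ˡ e φ = trans (∫-⧢ ⟦ [] ⟧ e φ) (trans (∫-single [] (λ v → ∫ e λ w → S v w φ)) (∫-cong e λ w → S-[]ˡ w φ))

  ∫-⧢-[]ʳ : ∀ d φ → ∫ (d ⧢ ⟦ [] ⟧) φ ≡ ∫ d φ
  ∫-⧢-[]ʳ d φ = trans (∫-⧢ d ⟦ [] ⟧ φ) (∫-cong d λ v → trans (∫-single [] (λ w → S v w φ)) (S-[]ʳ v φ))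

  ∫-⧢-comm : ∀ d e φ → ∫ (d ⧢ e) φ ≡ ∫ (e ⧢ d) φ
  ∫-⧢-comm d e φ = trans (∫-⧢ d e φ) (trans (∫-swap d e _)
    (trans (∫-cong e λ w → ∫-cong d λ v → S-comm v w φ) (sym (∫-⧢ e d φ))))

  infix 4 _≋_
  -- Agreement on all functionals implies agreement of all coefficients, and it passes through every
  -- construction that has an `∫` rule.
  _≋_ : ∀ {B : Set} → FM B → FM B → Set
  d ≋ e = ∀ φ → ∫ d φ ≡ ∫ e φ

  -- Only linearity of ρ is asked for, because associativity of the shuffle product is still to be
  -- proved with the help of this module. It is used with the values of a functional and, later,
  -- with the inclusion of `𝔇` as constants in a power series ring.
  module LinearImage (A : 𝔽-Algebra q 𝔽) (ρ : 𝔇 → 𝔽-Algebra.Carrier A)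
    (ρ-cong  : ∀ {d e} → d ≋ e → 𝔽-Algebra._≈_ A (ρ d) (ρ e))
    (ρ-[]    : 𝔽-Algebra._≈_ A (ρ []) (𝔽-Algebra.0# A))
    (ρ-++    : ∀ d e → 𝔽-Algebra._≈_ A (ρ (d ++ e)) (𝔽-Algebra._+_ A (ρ d) (ρ e)))
    (ρ-scale : ∀ c d → 𝔽-Algebra._≈_ A (ρ (scale c d)) (𝔽-Algebra._*_ A (𝔽-Algebra.ι A c) (ρ d)))
    where
    private
      module A = 𝔽-Algebra A
      module AC = Antidiagonal A.commutativeRing
    open Algebra.Properties.Semiring.Exp A.semiring using (_^_)
    open Relation.Binary.Reasoning.Setoid A.setoid renaming (begin_ to begin≈_; _∎ to _∎≈)

    ρ-convL : ∀ n f → ρ (convL n f) A.≈ AC.conv n (λ i j → ρ (f i j))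
    ρ-convL zero    f = A.refl
    ρ-convL (suc n) f = A.trans (ρ-++ _ _) (A.+-congˡ (ρ-convL n λ i j → f (suc i) j))

    T θ : ℕ → ℕ → A.Carrier
    T j k = ρ (P j ⧢ P k)
    θ i l = ρ (pre (xₛ i) (P l))

    P-single : ∀ k → m ∣ suc k → P (suc k) ≋ pre (xₛ k) (P 0)
    P-single k d φ = cong (λ e → ∫ e φ) (P-∣ d)

    T-suc : ∀ j k → m ∣ suc j → m ∣ suc k → T (suc j) (suc k) A.≈
      θ j (suc k) A.+ θ k (suc j) A.+ AC.conv (suc (j ℕ.+ k)) (λ i l → A.ι (κ j k l) A.* θ i l)
    T-suc j k dj dk = begin≈
      ρ (P (suc j) ⧢ P (suc k))
        ≈⟨ ρ-cong {e = (pre (xₛ j) (P (suc k)) ++ pre (xₛ k) (P (suc j))) ++ convL n terms} expand ⟩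
      ρ ((pre (xₛ j) (P (suc k)) ++ pre (xₛ k) (P (suc j))) ++ convL n terms)
        ≈⟨ A.trans (ρ-++ (pre (xₛ j) (P (suc k)) ++ pre (xₛ k) (P (suc j))) _) (A.+-cong (ρ-++ (pre (xₛ j) (P (suc k))) _)
             (A.trans (ρ-convL n terms) (AC.conv-ext n λ i l → ρ-scale (κ j k l) (pre (xₛ i) (P l))))) ⟩
      θ j (suc k) A.+ θ k (suc j) A.+ AC.conv n (λ i l → A.ι (κ j k l) A.* θ i l) ∎≈
      where
      n = suc (j ℕ.+ k)
      terms : ℕ → ℕ → 𝔇
      terms i l = scale (κ j k l) (pre (xₛ i) (P l))
      expand : P (suc j) ⧢ P (suc k) ≋
        (pre (xₛ j) (P (suc k)) ++ pre (xₛ k) (P (suc j))) ++ convL n terms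
      expand φ = trans
        (trans (∫-⧢ (P (suc j)) (P (suc k)) φ)
          (trans (cong₂ (λ d e → ∫ d (λ v → ∫ e (λ w → S v w φ))) (P-∣ dj) (P-∣ dk))
          (trans (∫-single (xₛ j ∷ []) (λ v → ∫ ⟦ xₛ k ∷ [] ⟧ λ w → S v w φ)) (trans (∫-single (xₛ k ∷ []) (λ w → S (xₛ j ∷ []) w φ)) (S-letters j k φ)))))
        (sym (trans (∫-++ (pre (xₛ j) (P (suc k)) ++ pre (xₛ k) (P (suc j))) _ φ) (cong₂ _+_
          (trans (∫-++ (pre (xₛ j) (P (suc k))) _ φ) (cong₂ _+_
            (trans (∫-pre (xₛ j) (P (suc k)) φ) (trans (cong (λ d → ∫ d (xₛ j ◁ φ)) (P-∣ dk)) (∫-single (xₛ k ∷ []) (xₛ j ◁ φ))))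
            (trans (∫-pre (xₛ k) (P (suc j)) φ) (trans (cong (λ d → ∫ d (xₛ k ◁ φ)) (P-∣ dj)) (∫-single (xₛ j ∷ []) (xₛ k ◁ φ))))))
          (trans (∫-convL n terms φ) (conv-ext n λ i l → trans (∫-scale (κ j k l) (pre (xₛ i) (P l)) φ) (cong (κ j k l *_) (∫-pre (xₛ i) (P l) φ)))))))

    P-additive : ∀ n a b → (a A.+ b) A.* AC.conv n (λ j k → T j k A.* (a ^ j A.* b ^ k)) A.≈
      b A.* AC.conv n (λ j k → T j k A.* ((a A.+ b) ^ j A.* a ^ k)) A.+ a A.* AC.conv n (λ j k → T j k A.* ((a A.+ b) ^ j A.* b ^ k))
    P-additive = AdditivityTheorem.Ψ-additive q 𝔽 A T θ
      (λ k d → ρ-cong λ φ → trans (∫-⧢-[]ˡ (P (suc k)) φ) (P-single k d φ))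
      (λ j d → ρ-cong λ φ → trans (∫-⧢-[]ʳ (P (suc j)) φ) (P-single j d φ))
      T-suc
      (λ {j} k ¬d → A.trans (A.reflexive (cong (λ d → ρ (d ⧢ P k)) (P-∤ ¬d))) ρ-[])
      (λ j {k} ¬d → A.trans (ρ-cong (λ φ → trans (cong (λ d → ∫ (P j ⧢ d) φ) (P-∤ ¬d)) (trans (∫-⧢ (P j) [] φ) (∫-zero (P j) λ _ → refl)))) ρ-[])
      (λ i {l} ¬d → A.trans (A.reflexive (cong (λ d → ρ (pre (xₛ i) d)) (P-∤ ¬d))) ρ-[])

-- Rotation invariance of the triple diamond product of letters.

module TripleRotation (q : ℕ) (𝔽 : FiniteField q) where
  open Construction q 𝔽 using (letter; Word; pw; _⧢_)
  open FieldFacts q 𝔽 using (𝔽-ring; m)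
  open PowerSums q 𝔽 using (κ)
  open BinomialModQ q 𝔽 using (𝔽-self)
  open PowerSeriesAlgebra q 𝔽
  open Pairing q 𝔽
  open Shuffle q 𝔽
  open ShuffleLaws q 𝔽 using (letter-cong; Triple)
  open LetterProducts q 𝔽
  open LetterOperator q 𝔽 𝔽-self using (K⋄)
  private
    module K = CommutativeRing 𝔽-ring
    module KC = Antidiagonal 𝔽-ring
    A₁ A₂ A₃ : 𝔽-Algebra q 𝔽
    A₁ = algebra-PS 𝔽-self
    A₂ = algebra-PS A₁
    A₃ = algebra-PS A₂
    module A₁ = 𝔽-Algebra A₁
    module A₂ = 𝔽-Algebra A₂
    module A₃ = 𝔽-Algebra A₃
    module S₁ = PowerSeries 𝔽-ring
    module S₂ = PowerSeries A₁.commutativeRing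
    module S₃ = PowerSeries A₂.commutativeRing
    module C₂ = Antidiagonal A₂.commutativeRing
    module C₃ = Antidiagonal A₃.commutativeRing
    module N₁ = Cancellation 𝔽-ring
    module N₂ = Cancellation A₁.commutativeRing
    module N₃ = Cancellation A₂.commutativeRing
  open AlgebraIdentities q 𝔽 A₃ using (ι-cong; ι-conv)
  open Algebra.Properties.Semiring.Exp A₁.semiring using () renaming (_^_ to _^₁_)
  open Algebra.Properties.Semiring.Exp A₂.semiring using () renaming (_^_ to _^₂_)
  open Algebra.Properties.Semiring.Exp A₃.semiring using () renaming (_^_ to _^₃_)

  -- Independent variables of the tower 𝔽[[r]][[t]][[s]], with s outermost.
  s t r : A₃.Carrier
  s = S₃.var
  t = S₃.const S₂.var
  r = S₃.const (S₂.const S₁.var)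

  -- A difference of two variables is a series in the outer one with constant term minus the inner
  -- one, hence regular. The factor t - r lies one level lower and is lifted as a constant.
  D-regular : Cancellation.Regular A₃.commutativeRing ((s A₃.- t) A₃.* ((s A₃.- r) A₃.* (t A₃.- r)))
  D-regular = N.Regular-* {s A₃.- t} {(s A₃.- r) A₃.* (t A₃.- r)}
    (N₃.Regular-leading (s A₃.- t) (N₃.Regular-resp (A₂.sym (A₂.+-identityˡ _)) (N₃.Regular-neg {S₂.var} N₂.Regular-var)))
    (N.Regular-* {s A₃.- r} {t A₃.- r}
      (N₃.Regular-leading (s A₃.- r) (N₃.Regular-resp (A₂.sym (A₂.+-identityˡ _)) (N₃.Regular-neg {S₂.const S₁.var} (N₂.Regular-const {S₁.var} N₁.Regular-var))))
      (N.Regular-resp {S₃.const (S₂.var A₂.- S₂.const S₁.var)}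
        (A₃.trans (S₃.const-+ S₂.var (A₂.- S₂.const S₁.var)) (A₃.+-congˡ {t} (S₃.const-neg (S₂.const S₁.var))))
        (N₃.Regular-const {S₂.var A₂.- S₂.const S₁.var}
          (N₂.Regular-leading (S₂.var A₂.- S₂.const S₁.var) (N₂.Regular-resp (A₁.sym (A₁.+-identityˡ _)) (N₂.Regular-neg {S₁.var} N₁.Regular-var))))))
    where module N = Cancellation A₃.commutativeRing

  module Fixed (ψ : ℕ → Word → K.Carrier) where
    g : ℕ → ℕ → ℕ → K.Carrier
    g k l j = ∫ (P l ⧢ P j) (ψ k)

    G : ℕ → ℕ → ℕ → A₃.Carrier
    G k l j = A₃.ι (g k l j)

    K⋄⋄₁ : ℕ → ℕ → ℕ → K.Carrier
    K⋄⋄₁ a b c = K⋄ (a ℕ.+ b) a b (λ i j → K⋄ (i ℕ.+ c) i c (λ k l → g k l j))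

    g-∤ : ∀ k l {j} → ¬ (m ∣ j) → g k l j ≡ K.0#
    g-∤ k l {j} ¬d = trans (cong (λ d → ∫ (P l ⧢ d) (ψ k)) (P-∤ ¬d)) (trans (∫-⧢ (P l) [] (ψ k)) (∫-zero (P l) λ _ → refl))

    G-comm : ∀ k l j → G k l j A₃.≈ G k j l
    G-comm k l j = ι-cong (∫-⧢-comm (P l) (P j) (ψ k))

    G-∤ : ∀ k l {j} → ¬ (m ∣ j) → G k l j A₃.≈ A₃.0#
    G-∤ k l ¬d = A₃.trans (ι-cong (g-∤ k l ¬d)) A₃.ι-0

    module Image (k : ℕ) = LinearImage A₃ (λ d → A₃.ι (∫ d (ψ k))) (λ e → ι-cong (e (ψ k))) A₃.ι-0
      (λ d e → A₃.trans (ι-cong (∫-++ d e (ψ k))) (A₃.ι-+ (∫ d (ψ k)) (∫ e (ψ k))))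
      (λ c d → A₃.trans (ι-cong (∫-scale c d (ψ k))) (A₃.ι-* c (∫ d (ψ k))))

    open LetterOperator.Additive q 𝔽 A₃ G G-comm G-∤ (λ k → Image.P-additive k) using (Gen-rotate; Gen-reindex; K⋄⋄)

    K⋄⋄-ι : ∀ a b c → K⋄⋄ a b c A₃.≈ A₃.ι (K⋄⋄₁ a b c)
    K⋄⋄-ι a b c = A₃.sym (A₃.trans (ι-conv (suc (a ℕ.+ b)) λ i j → κ a b j K.* K⋄ (i ℕ.+ c) i c (λ k l → g k l j)) (C₃.conv-ext (suc (a ℕ.+ b)) λ i j →
      A₃.trans (A₃.ι-* (κ a b j) (K⋄ (i ℕ.+ c) i c (λ k l → g k l j))) (A₃.*-congˡ (A₃.trans (ι-conv (suc (i ℕ.+ c)) (λ k l → κ i c l K.* g k l j))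
        (C₃.conv-ext (suc (i ℕ.+ c)) λ k l → A₃.ι-* (κ i c l) (g k l j))))))

    D : A₃.Carrier
    D = (s A₃.- t) A₃.* ((s A₃.- r) A₃.* (t A₃.- r))

    -- The coefficient of s^a, still a series in t over the series in r.
    layers : (ℕ → ℕ → ℕ → K.Carrier) → ℕ → ℕ → A₂.Carrier
    layers h a p = C₂.conv p (λ b c → (S₂.var ^₂ b) A₂.* S₂.const ((S₁.var ^₁ c) A₁.* S₁.const (h a b c)))

    Gen-layers : ∀ n (h : ℕ → ℕ → ℕ → A₃.Carrier) h₁ → (∀ a b c → h a b c A₃.≈ A₃.ι (h₁ a b c)) →
      C₃.conv n (λ a p → (s ^₃ a) A₃.* C₃.conv p (λ b c → (t ^₃ b) A₃.* ((r ^₃ c) A₃.* h a b c)))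
        A₃.≈ C₃.conv n (λ a p → (s ^₃ a) A₃.* S₃.const (layers h₁ a p))
    Gen-layers n h h₁ h≈ = C₃.conv-ext n λ a p → A₃.*-congˡ {s ^₃ a} (A₃.trans
      (C₃.conv-ext p λ b c → A₃.trans
        (A₃.*-cong (A₃.sym (S₃.const-^ S₂.var b)) (A₃.*-cong (A₃.trans (A₃.sym (S₃.const-^ (S₂.const S₁.var) c)) (S₃.const-cong (A₂.sym (S₂.const-^ S₁.var c)))) (h≈ a b c)))
        (A₃.trans (A₃.*-congˡ {S₃.const (S₂.var ^₂ b)} (A₃.trans (A₃.sym (S₃.const-* (S₂.const (S₁.var ^₁ c)) (S₂.const (S₁.const (h₁ a b c)))))
                                (S₃.const-cong (A₂.sym (S₂.const-* (S₁.var ^₁ c) (S₁.const (h₁ a b c)))))))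
          (A₃.sym (S₃.const-* (S₂.var ^₂ b) (S₂.const ((S₁.var ^₁ c) A₁.* S₁.const (h₁ a b c)))))))
      (A₃.sym (S₃.const-conv p (λ b c → (S₂.var ^₂ b) A₂.* S₂.const ((S₁.var ^₁ c) A₁.* S₁.const (h₁ a b c))))))

    -- Once the regular factor `D` is cancelled from `Gen-rotate`, the coefficients at s^a, t^b and
    -- r^c are read off one variable after another.
    rotate : ∀ a b c → K⋄⋄₁ a b c ≡ K⋄⋄₁ b c a
    rotate a b c = K.trans (K.sym (S₁-coefficient (K⋄⋄₁ a b c))) (K.trans (coefficients c) (S₁-coefficient (K⋄⋄₁ b c a)))
      where
      n = a ℕ.+ (b ℕ.+ c)
      h h′ : ℕ → ℕ → ℕ → K.Carrier
      h  = K⋄⋄₁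
      h′ a b c = K⋄⋄₁ b c a
      S₁-coefficient : ∀ k → ((S₁.var ^₁ c) A₁.* S₁.const k) c ≡ k
      S₁-coefficient k = trans (cong ((S₁.var ^₁ c) A₁.* S₁.const k) (sym (ℕₚ.+-identityʳ c))) (S₁.var^ c (S₁.const k) 0)
      generating : C₃.conv n (λ a p → (s ^₃ a) A₃.* S₃.const (layers h a p)) A₃.≈ C₃.conv n (λ a p → (s ^₃ a) A₃.* S₃.const (layers h′ a p))
      generating = Cancellation.Regular-cancel A₃.commutativeRing {D} D-regular _ _ (A₃.trans
        (A₃.*-congˡ {D} (A₃.sym (Gen-layers n K⋄⋄ h K⋄⋄-ι))) (A₃.trans (Gen-rotate n s t r)
        (A₃.*-congˡ {D} (A₃.trans (Gen-reindex n s t r) (Gen-layers n (λ a b c → K⋄⋄ b c a) h′ λ a b c → K⋄⋄-ι b c a)))))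
      first : layers h a (b ℕ.+ c) A₂.≈ layers h′ a (b ℕ.+ c)
      first = A₂.trans (A₂.sym (S₃.coefficient n (layers h) a (b ℕ.+ c) refl)) (A₂.trans (generating a) (S₃.coefficient n (layers h′) a (b ℕ.+ c) refl))
      coefficients : (S₁.var ^₁ c) A₁.* S₁.const (h a b c) A₁.≈ (S₁.var ^₁ c) A₁.* S₁.const (h′ a b c)
      coefficients = A₁.trans (A₁.sym (S₂.coefficient (b ℕ.+ c) (λ b c → (S₁.var ^₁ c) A₁.* S₁.const (h a b c)) b c refl))
        (A₁.trans (first b) (S₂.coefficient (b ℕ.+ c) (λ b c → (S₁.var ^₁ c) A₁.* S₁.const (h′ a b c)) b c refl))

  -- Only the character of the intermediate letter survives, its weight being overwritten by the
  -- second `withWeight`; the inner k is therefore a placeholder.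
  Triple-K⋄ : ∀ x y z ψ → Triple x y z ψ ≡
    Fixed.K⋄⋄₁ (λ k → ψ (withWeight k (withWeight k x y) z)) (pw x) (pw y) (pw z)
  Triple-K⋄ x@(letter a α _) y@(letter b β _) z@(letter c γ _) ψ = begin
    ∫₂ (dl x y) (λ l r → ∫₂ (dl l z) λ l′ r′ → S r′ r (ψ l′))
      ≡⟨ dl-K⋄ x y (λ l r → ∫₂ (dl l z) λ l′ r′ → S r′ r (ψ l′)) ⟩
    K⋄ (a ℕ.+ b) a b (λ i j → ∫ (P j) (λ r → ∫₂ (dl (withWeight i x y) z) λ l′ r′ → S r′ r (ψ l′)))
      ≡⟨ KC.conv-ext (suc (a ℕ.+ b)) (λ i j → cong (κ a b j K.*_) (trans (∫-cong (P j) λ r → dl-K⋄ (withWeight i x y) z (λ l′ r′ → S r′ r (ψ l′)))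
           (trans (∫-conv (P j) (suc (i ℕ.+ c)) (λ k l r → κ i c l K.* ∫ (P l) (λ r′ → S r′ r (ψₖ k))))
             (KC.conv-ext (suc (i ℕ.+ c)) λ k l → trans (∫-* (P j) (κ i c l) (λ r → ∫ (P l) (λ r′ → S r′ r (ψₖ k))))
               (cong (κ i c l K.*_) (trans (∫-swap (P j) (P l) (λ r r′ → S r′ r (ψₖ k))) (sym (∫-⧢ (P l) (P j) (ψₖ k))))))))) ⟩
    Fixed.K⋄⋄₁ (λ k → ψ (withWeight k (withWeight k x y) z)) a b c ∎
    where
    open ≡-Reasoning
    ψₖ : ℕ → Word → K.Carrier
    ψₖ k = ψ (withWeight k (withWeight k x y) z)

  Triple-rotate : ∀ x y z ψ → Triple x y z ψ ≡ Triple y z x ψ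
  Triple-rotate x@(letter a α _) y@(letter b β _) z@(letter c γ _) ψ = begin
    Triple x y z ψ
      ≡⟨ Triple-K⋄ x y z ψ ⟩
    Fixed.K⋄⋄₁ (λ k → ψ (withWeight k (withWeight k x y) z)) a b c
      ≡⟨ Fixed.rotate (λ k → ψ (withWeight k (withWeight k x y) z)) a b c ⟩
    Fixed.K⋄⋄₁ (λ k → ψ (withWeight k (withWeight k x y) z)) b c a
      ≡⟨ KC.conv-ext (suc (b ℕ.+ c)) (λ i j → cong (κ b c j K.*_) (KC.conv-ext (suc (i ℕ.+ a)) λ k l → cong (λ x → κ i a l K.* ∫ (P l ⧢ P j) (ψ x)) (rotated k))) ⟩
    Fixed.K⋄⋄₁ (λ k → ψ (withWeight k (withWeight k y z) x)) b c a
      ≡⟨ Triple-K⋄ y z x ψ ⟨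
    Triple y z x ψ ∎
    where
    open ≡-Reasoning
    rotated : ∀ k → withWeight k (withWeight k x y) z ≡ withWeight k (withWeight k y z) x
    rotated k = letter-cong refl (trans (K.*-assoc α β γ) (K.*-comm α (β K.* γ)))

-- The shuffle algebra and its tensor square as commutative 𝔽-algebras.

module FreeAlgebra (q : ℕ) (𝔽 : FiniteField q) where
  open FieldFacts q 𝔽 using (𝔽-ring)
  open CommutativeRing 𝔽-ring hiding (refl; sym; trans) renaming (Carrier to K)
  open IntegerSolver 𝔽-ring
  open Algebra.Properties.Ring ring using (-1*x≈-x)
  open Pairing q 𝔽
  open LetterProducts q 𝔽 using (_≋_)

  -- The laws are asked for on basis elements and extended bilinearly. The product of combinations
  -- is a parameter tied to `mul` by its `∫` rule, so that `_⧢_` and `_⧢²_` can be used exactly as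
  -- they are defined.
  module _ {B : Set} (mul : B → B → FM B) (unit : B)
    (mul-comm  : ∀ a b φ → ∫ (mul a b) φ ≡ ∫ (mul b a) φ)
    (mul-assoc : ∀ a b c φ → ∫ (mul a b) (λ p → ∫ (mul p c) φ) ≡ ∫ (mul b c) (λ p → ∫ (mul a p) φ))
    (mul-unit  : ∀ a φ → ∫ (mul unit a) φ ≡ φ a)
    (_∙_ : FM B → FM B → FM B)
    (∫-∙ : ∀ d e φ → ∫ (d ∙ e) φ ≡ ∫ d (λ a → ∫ e (λ b → ∫ (mul a b) φ)))
    where

    scaleFM : K → FM B → FM B
    scaleFM c = map (λ p → c * proj₁ p , proj₂ p)

    ∫-scaleFM : ∀ c d φ → ∫ (scaleFM c d) φ ≡ c * ∫ d φ
    ∫-scaleFM c d φ = ∫-map-scale c id _ (λ _ → refl) d φ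

    private
      comm : ∀ d e → d ∙ e ≋ e ∙ d
      comm d e φ = trans (∫-∙ d e φ) (trans (∫-swap d e λ a b → ∫ (mul a b) φ)
        (trans (∫-cong e λ b → ∫-cong d λ a → mul-comm a b φ) (sym (∫-∙ e d φ))))

      assoc : ∀ d e f → (d ∙ e) ∙ f ≋ d ∙ (e ∙ f)
      assoc d e f φ = begin
        ∫ ((d ∙ e) ∙ f) φ
          ≡⟨ trans (∫-∙ (d ∙ e) f φ) (∫-∙ d e λ p → ∫ f λ c → ∫ (mul p c) φ) ⟩
        ∫ d (λ a → ∫ e (λ b → ∫ (mul a b) (λ p → ∫ f (λ c → ∫ (mul p c) φ))))
          ≡⟨ (∫-cong d λ a → ∫-cong e λ b → trans (∫-swap (mul a b) f λ p c → ∫ (mul p c) φ) (∫-cong f λ c → mul-assoc a b c φ)) ⟩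
        ∫ d (λ a → ∫ e (λ b → ∫ f (λ c → ∫ (mul b c) (λ p → ∫ (mul a p) φ))))
          ≡⟨ (∫-cong d λ a → sym (∫-∙ e f λ p → ∫ (mul a p) φ)) ⟩
        ∫ d (λ a → ∫ (e ∙ f) (λ p → ∫ (mul a p) φ))
          ≡⟨ ∫-∙ d (e ∙ f) φ ⟨
        ∫ (d ∙ (e ∙ f)) φ ∎
        where open ≡-Reasoning

      identityˡ : ∀ d → ((1# , unit) ∷ []) ∙ d ≋ d
      identityˡ d φ = trans (∫-∙ ((1# , unit) ∷ []) d φ) (trans (∫-single unit (λ a → ∫ d λ b → ∫ (mul a b) φ)) (∫-cong d λ b → mul-unit b φ))

      distribˡ-∙ : ∀ d e f → d ∙ (e ++ f) ≋ (d ∙ e) ++ (d ∙ f)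
      distribˡ-∙ d e f φ = trans (∫-∙ d (e ++ f) φ) (trans (∫-cong d λ a → ∫-++ e f λ b → ∫ (mul a b) φ)
        (trans (∫-+ d (λ a → ∫ e λ b → ∫ (mul a b) φ) (λ a → ∫ f λ b → ∫ (mul a b) φ))
        (sym (trans (∫-++ (d ∙ e) (d ∙ f) φ) (cong₂ _+_ (∫-∙ d e φ) (∫-∙ d f φ))))))

      ++-cong : ∀ {d d′ e e′ : FM B} → d ≋ d′ → e ≋ e′ → d ++ e ≋ d′ ++ e′
      ++-cong {d} {d′} {e} {e′} h h′ φ = trans (∫-++ d e φ) (trans (cong₂ _+_ (h φ) (h′ φ)) (sym (∫-++ d′ e′ φ)))

      ++-comm : ∀ (d e : FM B) → d ++ e ≋ e ++ d
      ++-comm d e φ = trans (∫-++ d e φ) (trans (+-comm _ _) (sym (∫-++ e d φ)))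

      distribʳ-∙ : ∀ d e f → (e ++ f) ∙ d ≋ (e ∙ d) ++ (f ∙ d)
      distribʳ-∙ d e f φ = trans (comm (e ++ f) d φ) (trans (distribˡ-∙ d e f φ)
        (++-cong {d ∙ e} {e ∙ d} {d ∙ f} {f ∙ d} (comm d e) (comm d f) φ))

      negate : FM B → FM B
      negate = scaleFM (- 1#)

      ∫-negate : ∀ d φ → ∫ (negate d) φ ≡ - ∫ d φ
      ∫-negate d φ = trans (∫-scaleFM (- 1#) d φ) (-1*x≈-x _)

      inverseˡ : ∀ (d : FM B) → negate d ++ d ≋ []
      inverseˡ d φ = trans (∫-++ (negate d) d φ) (trans (cong (_+ ∫ d φ) (∫-negate d φ)) (-‿inverseˡ _))

      ∙-cong : ∀ {d d′ e e′} → d ≋ d′ → e ≋ e′ → d ∙ e ≋ d′ ∙ e′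
      ∙-cong {d} {d′} {e} {e′} h h′ φ = trans (∫-∙ d e φ) (trans (h (λ a → ∫ e λ b → ∫ (mul a b) φ))
        (trans (∫-cong d′ λ a → h′ (λ b → ∫ (mul a b) φ)) (sym (∫-∙ d′ e′ φ))))

    freeRing : CommutativeRing 0ℓ 0ℓ
    freeRing = record
      { Carrier = FM B ; _≈_ = _≋_ ; _+_ = _++_ ; _*_ = _∙_ ; -_ = negate ; 0# = [] ; 1# = (1# , unit) ∷ []
      ; isCommutativeRing = record
        { isRing = record
          { +-isAbelianGroup = record
            { isGroup = record
              { isMonoid = record
                { isSemigroup = record
                  { isMagma = record
                    { isEquivalence = record { refl = λ _ → refl ; sym = λ h φ → sym (h φ) ; trans = λ h h′ φ → trans (h φ) (h′ φ) }
                    ; ∙-cong = λ {d} {d′} {e} {e′} → ++-cong {d} {d′} {e} {e′} }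
                  ; assoc = λ d e f φ → cong (λ l → ∫ l φ) (Listₚ.++-assoc d e f) }
                ; identity = (λ _ _ → refl) , λ d φ → cong (λ l → ∫ l φ) (Listₚ.++-identityʳ d) }
              ; inverse = inverseˡ , λ d φ → trans (++-comm d (negate d) φ) (inverseˡ d φ)
              ; ⁻¹-cong = λ {d} {e} h φ → trans (∫-negate d φ) (trans (cong -_ (h φ)) (sym (∫-negate e φ))) }
            ; comm = ++-comm }
          ; *-cong = λ {d} {d′} {e} {e′} → ∙-cong {d} {d′} {e} {e′}
          ; *-assoc = assoc
          ; *-identity = identityˡ , λ d φ → trans (comm d ((1# , unit) ∷ []) φ) (identityˡ d φ)
          ; distrib = distribˡ-∙ , distribʳ-∙ }
        ; *-comm = comm } }

    freeAlgebra : 𝔽-Algebra q 𝔽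
    freeAlgebra = record
      { commutativeRing = freeRing
      ; ι   = λ c → (c , unit) ∷ []
      ; ι-+ = λ a b φ → solve 3 (λ a b x → (a :+ b) :* x :+ :0 := a :* x :+ (b :* x :+ :0)) refl a b (φ unit)
      ; ι-* = λ a b φ → trans (solve 3 (λ a b x → (a :* b) :* x :+ :0 := a :* (b :* x)) refl a b (φ unit))
          (sym (trans (∫-∙ ((a , unit) ∷ []) ((b , unit) ∷ []) φ) (trans (+-identityʳ _) (cong (a *_) (trans (+-identityʳ _) (cong (b *_) (mul-unit unit φ)))))))
      ; ι-0 = λ φ → trans (+-identityʳ _) (zeroˡ _)
      ; ι-1 = λ _ → refl }

    ι-∙ : ∀ c d φ → ∫ (((c , unit) ∷ []) ∙ d) φ ≡ c * ∫ d φ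
    ι-∙ c d φ = trans (∫-∙ ((c , unit) ∷ []) d φ) (trans (+-identityʳ _) (cong (c *_) (∫-cong d λ b → mul-unit b φ)))

module ShuffleAlgebra (q : ℕ) (𝔽 : FiniteField q) where
  open Construction q 𝔽 using (Word; 𝔇²; _⧢_; _⧢²_; _⊗_; ⟦_⟧; scale)
  open FieldFacts q 𝔽 using (𝔽-ring)
  open CommutativeRing 𝔽-ring hiding (refl; sym; trans) renaming (Carrier to K)
  open IntegerSolver 𝔽-ring
  open Pairing q 𝔽
  open Shuffle q 𝔽
  open ShuffleLaws q 𝔽 using (S-comm)
  open TripleRotation q 𝔽 using (Triple-rotate)
  open LetterProducts q 𝔽 using (_≋_)
  open FreeAlgebra q 𝔽

  S-assoc : ∀ u v w φ → S u v (λ p → S p w φ) ≡ S v w (λ p → S u p φ)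
  S-assoc = ShuffleLaws.S-assoc q 𝔽 Triple-rotate

  algebra-𝔇 : 𝔽-Algebra q 𝔽
  algebra-𝔇 = freeAlgebra sh [] S-comm S-assoc S-[]ˡ _⧢_ ∫-⧢

  scale-ι : ∀ c d → scale c d ≋ ((c , []) ∷ []) ⧢ d
  scale-ι c d φ = trans (∫-scale c d φ) (sym (ι-∙ sh [] S-comm S-assoc S-[]ˡ _⧢_ ∫-⧢ c d φ))

  S² : Word × Word → Word × Word → (Word × Word → K) → K
  S² (a₁ , a₂) (b₁ , b₂) Φ = S a₁ b₁ λ w₁ → S a₂ b₂ λ w₂ → Φ (w₁ , w₂)

  ∫-⊗ : ∀ d e Φ → ∫ (d ⊗ e) Φ ≡ ∫ d (λ v → ∫ e (λ w → Φ (v , w)))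
  ∫-⊗ d e Φ = ∫-concatMap _ _ Φ (λ c v → ∫-map-scale c (v ,_) _ (λ _ → refl) e Φ) d

  S-⟦⟧ : ∀ v w φ → ∫ (⟦ v ⟧ ⧢ ⟦ w ⟧) φ ≡ S v w φ
  S-⟦⟧ v w φ = trans (∫-⧢ ⟦ v ⟧ ⟦ w ⟧ φ) (trans (∫-single v λ v → ∫ ⟦ w ⟧ λ w → S v w φ) (∫-single w λ w → S v w φ))

  sh² : Word × Word → Word × Word → 𝔇²
  sh² (a₁ , a₂) (b₁ , b₂) = sh a₁ b₁ ⊗ sh a₂ b₂

  ∫-sh² : ∀ a b Φ → ∫ (sh² a b) Φ ≡ S² a b Φ
  ∫-sh² (a₁ , a₂) (b₁ , b₂) Φ = ∫-⊗ (sh a₁ b₁) (sh a₂ b₂) Φ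

  ∫-⧢² : ∀ d e Φ → ∫ (d ⧢² e) Φ ≡ ∫ d (λ a → ∫ e (λ b → ∫ (sh² a b) Φ))
  ∫-⧢² d e Φ = ∫-concatMap _ (λ a → ∫ e λ b → ∫ (sh² a b) Φ) Φ (λ { c a@(a₁ , a₂) → trans
    (∫-concatMap _ (λ b → c * ∫ (sh² a b) Φ) Φ (λ { k b@(b₁ , b₂) → trans
      (∫-map-scale (c * k) id _ (λ _ → refl) ((⟦ a₁ ⟧ ⧢ ⟦ b₁ ⟧) ⊗ (⟦ a₂ ⟧ ⧢ ⟦ b₂ ⟧)) Φ)
      (trans (cong (c * k *_) (trans (∫-⊗ (⟦ a₁ ⟧ ⧢ ⟦ b₁ ⟧) (⟦ a₂ ⟧ ⧢ ⟦ b₂ ⟧) Φ)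
               (trans (S-⟦⟧ a₁ b₁ λ v → ∫ (⟦ a₂ ⟧ ⧢ ⟦ b₂ ⟧) λ w → Φ (v , w))
                 (trans (S-cong a₁ b₁ λ v → S-⟦⟧ a₂ b₂ λ w → Φ (v , w)) (sym (∫-sh² a b Φ))))))
        (solve 3 (λ c k s → c :* k :* s := k :* (c :* s)) refl c k (∫ (sh² a b) Φ))) }) e)
    (∫-* e c λ b → ∫ (sh² a b) Φ) }) d

  sh²-comm : ∀ a b Φ → ∫ (sh² a b) Φ ≡ ∫ (sh² b a) Φ
  sh²-comm a@(a₁ , a₂) b@(b₁ , b₂) Φ = trans (∫-sh² a b Φ) (trans (S-comm a₁ b₁ λ w₁ → S a₂ b₂ λ w₂ → Φ (w₁ , w₂))
    (trans (S-cong b₁ a₁ λ w₁ → S-comm a₂ b₂ λ w₂ → Φ (w₁ , w₂)) (sym (∫-sh² b a Φ))))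

  sh²-assoc : ∀ a b c Φ → ∫ (sh² a b) (λ p → ∫ (sh² p c) Φ) ≡ ∫ (sh² b c) (λ p → ∫ (sh² a p) Φ)
  sh²-assoc a@(a₁ , a₂) b@(b₁ , b₂) c@(c₁ , c₂) Φ = begin
    ∫ (sh² a b) (λ p → ∫ (sh² p c) Φ)
      ≡⟨ trans (∫-sh² a b λ p → ∫ (sh² p c) Φ) (S-cong a₁ b₁ λ p₁ → S-cong a₂ b₂ λ p₂ → ∫-sh² (p₁ , p₂) c Φ) ⟩
    S a₁ b₁ (λ p₁ → S a₂ b₂ λ p₂ → S p₁ c₁ λ w₁ → S p₂ c₂ λ w₂ → Φ (w₁ , w₂))
      ≡⟨ (S-cong a₁ b₁ λ p₁ → ∫-swap (sh a₂ b₂) (sh p₁ c₁) λ p₂ w₁ → S p₂ c₂ λ w₂ → Φ (w₁ , w₂)) ⟩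
    S a₁ b₁ (λ p₁ → S p₁ c₁ λ w₁ → S a₂ b₂ λ p₂ → S p₂ c₂ λ w₂ → Φ (w₁ , w₂))
      ≡⟨ (S-assoc a₁ b₁ c₁ λ w₁ → S a₂ b₂ λ p₂ → S p₂ c₂ λ w₂ → Φ (w₁ , w₂)) ⟩
    S b₁ c₁ (λ p₁ → S a₁ p₁ λ w₁ → S a₂ b₂ λ p₂ → S p₂ c₂ λ w₂ → Φ (w₁ , w₂))
      ≡⟨ (S-cong b₁ c₁ λ p₁ → trans (S-cong a₁ p₁ λ w₁ → S-assoc a₂ b₂ c₂ λ w₂ → Φ (w₁ , w₂)) (∫-swap (sh a₁ p₁) (sh b₂ c₂) λ w₁ p₂ → S a₂ p₂ λ w₂ → Φ (w₁ , w₂))) ⟩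
    S b₁ c₁ (λ p₁ → S b₂ c₂ λ p₂ → S a₁ p₁ λ w₁ → S a₂ p₂ λ w₂ → Φ (w₁ , w₂))
      ≡⟨ trans (∫-sh² b c λ p → ∫ (sh² a p) Φ) (S-cong b₁ c₁ λ p₁ → S-cong b₂ c₂ λ p₂ → ∫-sh² a (p₁ , p₂) Φ) ⟨
    ∫ (sh² b c) (λ p → ∫ (sh² a p) Φ) ∎
    where open ≡-Reasoning

  sh²-[] : ∀ a Φ → ∫ (sh² ([] , []) a) Φ ≡ Φ a
  sh²-[] a@(a₁ , a₂) Φ = trans (∫-sh² ([] , []) a Φ) (trans (S-[]ˡ a₁ λ w₁ → S [] a₂ λ w₂ → Φ (w₁ , w₂)) (S-[]ˡ a₂ λ w₂ → Φ (a₁ , w₂)))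

  algebra-𝔇² : 𝔽-Algebra q 𝔽
  algebra-𝔇² = freeAlgebra sh² ([] , []) sh²-comm sh²-assoc sh²-[] _⧢²_ ∫-⧢²

-- Negative powers of P as sums over compositions.

module CompositionSeries (q : ℕ) (𝔽 : FiniteField q) (A : 𝔽-Algebra q 𝔽) (Y : ℕ → 𝔽-Algebra.Carrier A) where
  open Construction q 𝔽 using (sgn; binomℤ; comps; compsS)
  open FieldFacts q 𝔽 using (𝔽-ring; m)
  open PowerSums q 𝔽 using (bin; bin-def; bin-pascal; bin->; bin-0)
  open BinomialModQ q 𝔽 using (bin-n)
  open 𝔽-Algebra A renaming (Carrier to R; refl to ≈-refl; sym to ≈-sym; trans to ≈-trans; reflexive to ≈-reflexive)
  open AlgebraIdentities q 𝔽 A using (ι-cong)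
  open IntegerSolver commutativeRing
  open Antidiagonal commutativeRing
  open PowerSeries commutativeRing using (PS; ring-PS)
  open Relation.Binary.Reasoning.Setoid setoid
  private
    module K = CommutativeRing 𝔽-ring
    module KS = IntegerSolver 𝔽-ring
    module Ps = CommutativeRing ring-PS
  open Algebra.Properties.Semiring.Exp Ps.semiring using (_^_)

  ∑ : ∀ {X : Set} → (X → R) → List X → R
  ∑ f = foldr (λ x s → f x + s) 0#

  ∑-ext : ∀ {X : Set} {f g : X → R} xs → (∀ x → f x ≈ g x) → ∑ f xs ≈ ∑ g xs
  ∑-ext []       h = ≈-refl
  ∑-ext (x ∷ xs) h = +-cong (h x) (∑-ext xs h)

  ∑-+ : ∀ {X : Set} (f g : X → R) xs → ∑ (λ x → f x + g x) xs ≈ ∑ f xs + ∑ g xs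
  ∑-+ f g []       = ≈-sym (+-identityˡ 0#)
  ∑-+ f g (x ∷ xs) = ≈-trans (+-congˡ (∑-+ f g xs))
    (solve 4 (λ a b c d → (a :+ b) :+ (c :+ d) := (a :+ c) :+ (b :+ d)) ≈-refl (f x) (g x) (∑ f xs) (∑ g xs))

  ∑-* : ∀ {X : Set} c (f : X → R) xs → ∑ (λ x → c * f x) xs ≈ c * ∑ f xs
  ∑-* c f []       = ≈-sym (zeroʳ c)
  ∑-* c f (x ∷ xs) = ≈-trans (+-congˡ (∑-* c f xs)) (≈-sym (distribˡ c (f x) (∑ f xs)))

  ∑-split : ∀ {X : Set} (f : X → R) (g h : X → X) xs →
    ∑ f (concatMap (λ c → g c ∷ h c ∷ []) xs) ≈ ∑ (f ∘ g) xs + ∑ (f ∘ h) xs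
  ∑-split f g h []       = ≈-sym (+-identityˡ 0#)
  ∑-split f g h (x ∷ xs) = ≈-trans (+-congˡ (+-congˡ (∑-split f g h xs)))
    (solve 4 (λ a b c d → a :+ (b :+ (c :+ d)) := (a :+ c) :+ (b :+ d)) ≈-refl (f (g x)) (f (h x)) (∑ (f ∘ g) xs) (∑ (f ∘ h) xs))

  -- The list of compositions is generated by prepending 1 or enlarging the first part; here it is
  -- sorted by the first part instead.
  ∑-comps : ∀ n (f : List ℕ → R) → ∑ f (comps (suc n)) ≈ conv n (λ i j → ∑ (λ is → f (suc i ∷ is)) (comps j))
  ∑-comps zero    f = ≈-refl
  ∑-comps (suc n) f = ≈-trans (∑-split f (1 ∷_) _ (compsS n)) (+-congˡ (∑-comps n _))

  prod : List ℕ → R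
  prod = foldr (λ i acc → Y i * acc) 1#

  P : PS
  P zero    = 1#
  P (suc i) = Y (suc i)

  -- The series Σ c(l) y^l at y = P - 1: a composition with l parts picks one term from each of l
  -- factors y.
  W : (ℕ → K.Carrier) → PS
  W c n = ∑ (λ is → ι (c (length is)) * prod is) (comps n)

  W-suc : ∀ c n → W c (suc n) ≈ conv n (λ i j → Y (suc i) * W (c ∘ suc) j)
  W-suc c n = ≈-trans (∑-comps n _) (conv-ext n λ i j → ≈-trans
    (∑-ext (comps j) λ is → solve 3 (λ c y p → c :* (y :* p) := y :* (c :* p)) ≈-refl (ι (c (suc (length is)))) (Y (suc i)) (prod is))
    (∑-* (Y (suc i)) (λ is → ι (c (suc (length is))) * prod is) (comps j)))

  W-zero : ∀ c → W c 0 ≈ ι (c 0)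
  W-zero c = ≈-trans (+-identityʳ _) (*-identityʳ _)

  W-cong : ∀ {c d} → (∀ l → c l ≡ d l) → ∀ n → W c n ≈ W d n
  W-cong h n = ∑-ext (comps n) λ is → *-congʳ (ι-cong (h (length is)))

  W-+ : ∀ c d n → W (λ l → c l K.+ d l) n ≈ W c n + W d n
  W-+ c d n = ≈-trans (∑-ext (comps n) λ is → ≈-trans (*-congʳ (ι-+ _ _)) (distribʳ _ _ _))
    (∑-+ (λ is → ι (c (length is)) * prod is) (λ is → ι (d (length is)) * prod is) (comps n))

  W-null : ∀ c → (∀ l → c l ≡ K.0#) → ∀ n → W c n ≈ 0#
  W-null c h n = ≈-trans (∑-ext (comps n) λ is → ≈-trans (*-congʳ (≈-trans (ι-cong (h _)) ι-0)) (≈-trans (zeroˡ _) (≈-sym (zeroˡ 0#))))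
    (≈-trans (∑-* 0# (λ _ → 0#) (comps n)) (zeroˡ _))

  -- A composition of n into multiples of m exists only if m divides n, so every other product
  -- contains a vanishing factor.
  W-∤ : (∀ i → ¬ (m ∣ suc i) → Y (suc i) ≈ 0#) → ∀ n → ¬ (m ∣ n) → ∀ c → W c n ≈ 0#
  W-∤ Y-∤ n = go n n ℕₚ.≤-refl
    where
    go : ∀ b n → n ℕ.≤ b → ¬ (m ∣ n) → ∀ c → W c n ≈ 0#
    go b       zero    _         ¬d c = contradiction (m ∣.∣0) ¬d
    go (suc b) (suc n) (ℕ.s≤s l) ¬d c = ≈-trans (W-suc c n) (conv-zero n term)
      where
      term : ∀ i j → i ℕ.+ j ≡ n → Y (suc i) * W (c ∘ suc) j ≈ 0#
      term i j e with m ∣? suc i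
      ... | no ¬di = ≈-trans (*-congʳ (Y-∤ i ¬di)) (zeroˡ _)
      ... | yes di = ≈-trans (*-congˡ (go b j (ℕₚ.≤-trans (subst (j ℕ.≤_) e (ℕₚ.m≤n+m j i)) l)
                       (λ dj → ¬d (subst (m ∣_) (cong suc e) (∣.∣m∣n⇒∣m+n di dj))) (c ∘ suc))) (zeroʳ _)

  -- (−1)^l binom(k + l − 1, l), the coefficient of y^l in (1 + y)^(−k).
  negBinomial : ℕ → ℕ → K.Carrier
  negBinomial k l = binomℤ (+ suc k ℤ.+ + l ℤ.- + 2) l K.* sgn l

  negBinomial-0 : ∀ k → negBinomial k 0 ≡ K.1#
  -- For k = l = 0 the upper index of the binomial is -1, so the negative branch of `binomℤ` is the
  -- one that computes.
  negBinomial-0 zero    = trans (K.*-identityʳ _) (trans (K.*-identityˡ _) (K.+-identityʳ K.1#))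
  negBinomial-0 (suc k) = trans (K.*-identityʳ _) (trans (sym (bin-def (k ℕ.+ 0) 0)) (bin-0 (k ℕ.+ 0)))

  negBinomial-zero : ∀ l → negBinomial 0 (suc l) ≡ K.0#
  negBinomial-zero l = trans (cong (K._* sgn (suc l)) (trans (sym (bin-def l (suc l))) (bin-> (ℕₚ.n<1+n l)))) (K.zeroˡ _)

  negBinomial-suc : ∀ k l → negBinomial (suc k) l ≡ bin (k ℕ.+ l) l K.* sgn l
  negBinomial-suc k l = cong (K._* sgn l) (sym (bin-def (k ℕ.+ l) l))

  -- This is (1 + y) (1 + y)^(-k-1) = (1 + y)^(-k), read at y^(l+1).
  negBinomial-pascal : ∀ k l → negBinomial (suc k) (suc l) K.+ negBinomial (suc k) l ≡ negBinomial k (suc l)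
  negBinomial-pascal zero l = trans (cong₂ K._+_ (negBinomial-suc 0 (suc l)) (negBinomial-suc 0 l))
    (trans (cong₂ (λ a b → a K.* sgn (suc l) K.+ b K.* sgn l) (bin-n (suc l)) (bin-n l))
    (trans (KS.solve 1 (λ s → KS.:1 KS.:* (KS.:- s) KS.:+ KS.:1 KS.:* s KS.:= KS.:0) refl (sgn l)) (sym (negBinomial-zero l))))
  negBinomial-pascal (suc k) l = trans (cong₂ K._+_ (negBinomial-suc (suc k) (suc l)) (negBinomial-suc (suc k) l))
    (trans (cong (λ b → b K.* sgn (suc l) K.+ bin (suc k ℕ.+ l) l K.* sgn l) (bin-pascal (k ℕ.+ suc l) l))
    (trans (cong (λ n → (bin n l K.+ bin (k ℕ.+ suc l) (suc l)) K.* sgn (suc l) K.+ bin (suc k ℕ.+ l) l K.* sgn l) (ℕₚ.+-suc k l))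
    (trans (KS.solve 3 (λ a b s → (a KS.:+ b) KS.:* (KS.:- s) KS.:+ a KS.:* s KS.:= b KS.:* (KS.:- s)) refl (bin (suc k ℕ.+ l) l) (bin (k ℕ.+ suc l) (suc l)) (sgn l))
    (sym (negBinomial-suc k (suc l))))))

  -- The k-th power of 1 / P.
  G : ℕ → PS
  G k = W (negBinomial k)

  G-0 : G 0 Ps.≈ Ps.1#
  G-0 zero    = ≈-trans (W-zero (negBinomial 0)) (≈-trans (ι-cong (negBinomial-0 0)) ι-1)
  G-0 (suc n) = ≈-trans (W-suc (negBinomial 0) n) (conv-zero n λ i j _ → ≈-trans (*-congˡ (W-null _ negBinomial-zero j)) (zeroʳ _))

  -- The preceding identity at y = P - 1, with compositions sorted by their first part.
  P-G : ∀ k → P Ps.* G (suc k) Ps.≈ G k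
  P-G k zero    = ≈-trans (*-identityˡ _) (≈-trans (W-zero (negBinomial (suc k))) (≈-trans (ι-cong (trans (negBinomial-0 (suc k)) (sym (negBinomial-0 k)))) (≈-sym (W-zero (negBinomial k)))))
  P-G k (suc n) = begin
    1# * G (suc k) (suc n) + conv n (λ i j → Y (suc i) * G (suc k) j)
      ≈⟨ +-congʳ (≈-trans (*-identityˡ _) (W-suc (negBinomial (suc k)) n)) ⟩
    conv n (λ i j → Y (suc i) * W (negBinomial (suc k) ∘ suc) j) + conv n (λ i j → Y (suc i) * G (suc k) j)
      ≈⟨ conv-+ n _ _ ⟨
    conv n (λ i j → Y (suc i) * W (negBinomial (suc k) ∘ suc) j + Y (suc i) * G (suc k) j)
      ≈⟨ conv-ext n (λ i j → ≈-trans (≈-sym (distribˡ _ _ _)) (*-congˡ (≈-trans (≈-sym (W-+ (negBinomial (suc k) ∘ suc) (negBinomial (suc k)) j)) (W-cong (negBinomial-pascal k) j)))) ⟩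
    conv n (λ i j → Y (suc i) * W (negBinomial k ∘ suc) j)
      ≈⟨ W-suc (negBinomial k) n ⟨
    G k (suc n) ∎

  P-inverse : P Ps.* G 1 Ps.≈ Ps.1#
  P-inverse n = ≈-trans (P-G 0 n) (G-0 n)

  G-^ : ∀ k → G k Ps.≈ G 1 ^ k
  G-^ zero    = G-0
  G-^ (suc k) = Ps.trans (Ps.sym (Ps.trans (Ps.*-congʳ {G (suc k)} (Ps.trans (Ps.*-comm (G 1) P) P-inverse)) (Ps.*-identityˡ (G (suc k)))))
    (Ps.trans (Ps.*-assoc (G 1) P (G (suc k))) (Ps.*-congˡ {G 1} (Ps.trans (P-G k) (G-^ k))))

-- The product rule for letters after substitution of E.

module LetterCompatibility (q : ℕ) (𝔽 : FiniteField q) (A : 𝔽-Algebra q 𝔽) (Y : ℕ → 𝔽-Algebra.Carrier A)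
  (Y-∤ : ∀ i → ¬ (FieldFacts.m q 𝔽 ∣ suc i) → 𝔽-Algebra._≈_ A (Y (suc i)) (𝔽-Algebra.0# A))
  where
  open FieldFacts q 𝔽 using (m)
  open PowerSums q 𝔽 using (κ)
  open PowerSeriesAlgebra q 𝔽 using (algebra-PS)
  open CompositionSeries q 𝔽 A Y using (P; G; G-^; P-inverse; W-∤; negBinomial)

  A₁ A₂ A₃ : 𝔽-Algebra q 𝔽
  A₁ = algebra-PS A
  A₂ = algebra-PS A₁
  A₃ = algebra-PS A₂
  private
    module A = 𝔽-Algebra A
    module A₁ = 𝔽-Algebra A₁
    module A₂ = 𝔽-Algebra A₂
    module A₃ = 𝔽-Algebra A₃
    module S₁ = PowerSeries A.commutativeRing
    module S₂ = PowerSeries A₁.commutativeRing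
    module S₃ = PowerSeries A₂.commutativeRing
    module C = Antidiagonal A.commutativeRing
    module C₂ = Antidiagonal A₂.commutativeRing
    module C₃ = Antidiagonal A₃.commutativeRing
    module I₁ = IntegerSolver A₁.commutativeRing
    module I₃ = IntegerSolver A₃.commutativeRing
    module I₂ = IntegerSolver A₂.commutativeRing
    module N₁ = Cancellation A.commutativeRing
    module N₂ = Cancellation A₁.commutativeRing
    module N  = Cancellation A₂.commutativeRing
    module E₁ = Algebra.Properties.Semiring.Exp A₁.semiring
    module E₂ = Algebra.Properties.Semiring.Exp A₂.semiring
    module E₃ = Algebra.Properties.Semiring.Exp A₃.semiring
    module D₁ = Algebra.Properties.CommutativeSemiring.Exp A₁.commutativeSemiring
  open E₁ using () renaming (_^_ to _^₁_)
  open E₂ using () renaming (_^_ to _^₂_)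
  open E₃ using () renaming (_^_ to _^₃_)

  E : S₁.PS
  E = S₁.var A₁.* G 1

  E^≈ : ∀ k → E ^₁ k A₁.≈ S₁.var ^₁ k A₁.* G 1 ^₁ k
  E^≈ k = D₁.^-distrib-* S₁.var (G 1) k

  -- The order of E^k is at least k, and its coefficients from k on are those of P^(-k). This
  -- identifies the right tensor factor of x_{k+1} in the coproduct of a letter as a coefficient of
  -- E^k.
  E-coefficient : ∀ k d → (E ^₁ k) (k ℕ.+ d) A.≈ G k d
  E-coefficient k d = A.trans (E^≈ k (k ℕ.+ d)) (A.trans (S₁.var^ k (G 1 ^₁ k) d) (A.sym (G-^ k d)))

  E-< : ∀ k {i} → i ℕ.< k → (E ^₁ k) i A.≈ A.0#
  E-< k {i} i<k = A.trans (E^≈ k i) (S₁.var^-< k (G 1 ^₁ k) i<k)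

  private
    PE^≈ : ∀ l → P A₁.* E ^₁ l A₁.≈ S₁.var ^₁ l A₁.* (P A₁.* G l)
    PE^≈ l = A₁.trans (A₁.*-congˡ {P} (E^≈ l)) (A₁.trans
      (I₁.solve 3 (λ p v g → p I₁.:* (v I₁.:* g) I₁.:= v I₁.:* (p I₁.:* g)) A₁.refl P (S₁.var ^₁ l) (G 1 ^₁ l))
      (A₁.*-congˡ {S₁.var ^₁ l} (A₁.*-congˡ {P} (A₁.sym (G-^ l)))))

  PE-coefficient : ∀ l h → (P A₁.* E ^₁ l) (l ℕ.+ h) A.≈ (P A₁.* G l) h
  PE-coefficient l h = A.trans (PE^≈ l (l ℕ.+ h)) (S₁.var^ l (P A₁.* G l) h)

  PE-< : ∀ l {j} → j ℕ.< l → (P A₁.* E ^₁ l) j A.≈ A.0#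
  PE-< l {j} j<l = A.trans (PE^≈ l j) (S₁.var^-< l (P A₁.* G l) j<l)

  P-∤ : ∀ j → ¬ (m ∣ j) → P j A.≈ A.0#
  P-∤ zero    ¬d = contradiction (m ∣.∣0) ¬d
  P-∤ (suc i) ¬d = Y-∤ i ¬d

  private
    Sparse : S₁.PS → Set
    Sparse f = ∀ n → ¬ (m ∣ n) → f n A.≈ A.0#

    Sparse-* : ∀ {f g} → Sparse f → Sparse g → Sparse (f A₁.* g)
    Sparse-* {f} {g} hf hg n ¬d = C.conv-zero n {f = λ i j → f i A.* g j} term
      where
      term : ∀ i j → i ℕ.+ j ≡ n → f i A.* g j A.≈ A.0#
      term i j e with m ∣? i | m ∣? j
      ... | no ¬i | _     = A.trans (A.*-congʳ (hf i ¬i)) (A.zeroˡ _)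
      ... | yes _ | no ¬j = A.trans (A.*-congˡ (hg j ¬j)) (A.zeroʳ _)
      ... | yes i | yes j = contradiction (subst (m ∣_) e (∣.∣m∣n⇒∣m+n i j)) ¬d

    Sparse-1 : Sparse A₁.1#
    Sparse-1 zero    ¬d = contradiction (m ∣.∣0) ¬d
    Sparse-1 (suc n) ¬d = A.refl

    Sparse-^ : ∀ {f} → Sparse f → ∀ k → Sparse (f ^₁ k)
    Sparse-^ h zero    = Sparse-1
    Sparse-^ {f} h (suc k) = Sparse-* {f} {f ^₁ k} h (Sparse-^ {f} h k)

    Sparse-resp : ∀ {f g} → f A₁.≈ g → Sparse f → Sparse g
    Sparse-resp e h n ¬d = A.trans (A.sym (e n)) (h n ¬d)

    Sparse-var^ : ∀ l → m ∣ l → Sparse (S₁.var ^₁ l)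
    Sparse-var^ l d n ¬d with ℕₚ.<-cmp l n
    ... | Relation.Binary.Definitions.tri≈ _ refl _ = contradiction d ¬d
    ... | Relation.Binary.Definitions.tri< l<n _ _ = A.trans (A.sym (A₁.*-identityʳ (S₁.var ^₁ l) n))
            (A.trans (A.reflexive (cong (S₁.var ^₁ l A₁.* A₁.1#) (sym (trans (ℕₚ.+-suc l (n ∸ suc l)) (ℕₚ.m+[n∸m]≡n l<n))))) (S₁.var^ l A₁.1# (suc (n ∸ suc l))))
    ... | Relation.Binary.Definitions.tri> _ _ n<l = A.trans (A.sym (A₁.*-identityʳ (S₁.var ^₁ l) n)) (S₁.var^-< l A₁.1# n<l)

  G-sparse : ∀ n → ¬ (m ∣ n) → ∀ k → G k n A.≈ A.0#
  G-sparse n ¬d k = W-∤ Y-∤ n ¬d (negBinomial k)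

  -- Supplies the vanishing hypothesis of `K⋄-generating`: all three of P, G and t^l live in degrees
  -- divisible by m.
  PE-sparse : ∀ l → m ∣ l → ∀ n → ¬ (m ∣ n) → (P A₁.* E ^₁ l) n A.≈ A.0#
  PE-sparse l d = Sparse-* {P} {E ^₁ l} P-∤
    (Sparse-resp {S₁.var ^₁ l A₁.* G 1 ^₁ l} {E ^₁ l} (A₁.sym (E^≈ l)) (Sparse-* {S₁.var ^₁ l} {G 1 ^₁ l} (Sparse-var^ l d) (Sparse-^ {G 1} (λ n ¬d → G-sparse n ¬d 1) l)))

  emb : A.Carrier → A₂.Carrier
  emb a = S₂.const (S₁.const a)

  emb-* : ∀ a b → emb (a A.* b) A₂.≈ emb a A₂.* emb b
  emb-* a b = A₂.trans (S₂.const-cong (S₁.const-* a b)) (S₂.const-* (S₁.const a) (S₁.const b))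

  emb-+ : ∀ a b → emb (a A.+ b) A₂.≈ emb a A₂.+ emb b
  emb-+ a b = A₂.trans (S₂.const-cong (S₁.const-+ a b)) (S₂.const-+ (S₁.const a) (S₁.const b))

  emb-0 : emb A.0# A₂.≈ A₂.0#
  emb-0 = A₂.trans (S₂.const-cong S₁.const-0) S₂.const-0

  emb-cong : ∀ {a b} → a A.≈ b → emb a A₂.≈ emb b
  emb-cong e = S₂.const-cong (S₁.const-cong e)

  emb-conv : ∀ n f → emb (C.conv n f) A₂.≈ C₂.conv n (λ i j → emb (f i j))
  emb-conv zero    f = A₂.refl {emb (f 0 0)}
  emb-conv (suc n) f = A₂.trans (emb-+ (f 0 (suc n)) _) (A₂.+-congˡ {emb (f 0 (suc n))} (emb-conv n λ i j → f (suc i) j))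

  s t : A₂.Carrier
  s = S₂.var
  t = S₂.const S₁.var

  separate : ∀ n (f g : ℕ → ℕ → A.Carrier) →
    C₂.conv n (λ a b → (s ^₂ a A₂.* t ^₂ b) A₂.* emb (f a b)) A₂.≈ C₂.conv n (λ a b → (s ^₂ a A₂.* t ^₂ b) A₂.* emb (g a b)) →
    ∀ a b → a ℕ.+ b ≡ n → f a b A.≈ g a b
  separate n f g h a b e = A.trans (A.sym (last (f a b))) (A.trans (inner b) (last (g a b)))
    where
    layer : (ℕ → ℕ → A.Carrier) → ℕ → ℕ → A₁.Carrier
    layer f a b = S₁.var ^₁ b A₁.* S₁.const (f a b)
    layered : ∀ f → C₂.conv n (λ a b → (s ^₂ a A₂.* t ^₂ b) A₂.* emb (f a b)) A₂.≈ C₂.conv n (λ a b → s ^₂ a A₂.* S₂.const (layer f a b))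
    layered f = C₂.conv-ext n λ a b → A₂.trans (A₂.*-assoc (s ^₂ a) (t ^₂ b) (emb (f a b)))
      (A₂.*-congˡ {s ^₂ a} (A₂.trans (A₂.*-congʳ {emb (f a b)} (A₂.sym (S₂.const-^ S₁.var b))) (A₂.sym (S₂.const-* (S₁.var ^₁ b) (S₁.const (f a b))))))
    inner : layer f a b A₁.≈ layer g a b
    inner = A₁.trans (A₁.sym (S₂.coefficient n (layer f) a b e)) (A₁.trans
      (A₂.trans (A₂.sym (layered f)) (A₂.trans h (layered g)) a) (S₂.coefficient n (layer g) a b e))
    last : ∀ x → (S₁.var ^₁ b A₁.* S₁.const x) b A.≈ x
    last x = A.trans (A.reflexive (cong (S₁.var ^₁ b A₁.* S₁.const x) (sym (ℕₚ.+-identityʳ b)))) (S₁.var^ b (S₁.const x) 0)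

  s-t-regular : N.Regular (s A₂.- t)
  s-t-regular = N₂.Regular-leading (s A₂.- t) (N₂.Regular-resp (A₁.sym (A₁.+-identityˡ _)) (N₂.Regular-neg {S₁.var} N₁.Regular-var))

  -- The series f(c z) in an additional outermost variable z. Since z records the degree, an
  -- arbitrary element c may be substituted with no question of convergence.
  sub : A₂.Carrier → S₁.PS → S₃.PS
  sub c f n = emb (f n) A₂.* c ^₂ n

  sub-cong : ∀ c {f g} → f A₁.≈ g → sub c f A₃.≈ sub c g
  sub-cong c e n = A₂.*-congʳ (emb-cong (e n))

  sub-* : ∀ c f g → sub c (f A₁.* g) A₃.≈ sub c f A₃.* sub c g
  sub-* c f g n = A₂.trans (A₂.*-congʳ (emb-conv n λ i j → f i A.* g j)) (A₂.trans (C₂.conv-*ʳ n (c ^₂ n) (λ i j → emb (f i A.* g j)))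
    (C₂.conv-cong n λ i j e → A₂.trans (A₂.*-cong (emb-* (f i) (g j)) (A₂.trans (E₂.^-congʳ c (sym e)) (E₂.^-homo-* c i j)))
      (I₂.solve 4 (λ a b x y → (a I₂.:* b) I₂.:* (x I₂.:* y) I₂.:= (a I₂.:* x) I₂.:* (b I₂.:* y)) A₂.refl (emb (f i)) (emb (g j)) (c ^₂ i) (c ^₂ j))))

  sub-1 : ∀ c → sub c A₁.1# A₃.≈ A₃.1#
  sub-1 c zero    = A₂.*-identityʳ _
  sub-1 c (suc n) = A₂.trans (A₂.*-congʳ emb-0) (A₂.zeroˡ _)

  sub-^ : ∀ c f k → sub c (f ^₁ k) A₃.≈ sub c f ^₃ k
  sub-^ c f zero    = sub-1 c
  sub-^ c f (suc k) = A₃.trans (sub-* c f (f ^₁ k)) (A₃.*-congˡ {sub c f} (sub-^ c f k))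

  sub-var : ∀ c → sub c S₁.var A₃.≈ S₃.const c A₃.* S₃.var
  sub-var c zero          = A₂.trans (A₂.trans (A₂.*-congʳ emb-0) (A₂.zeroˡ _)) (A₂.sym (A₂.trans (S₃.const-⊛ c S₃.var 0) (A₂.zeroʳ _)))
  sub-var c (suc zero)    = A₂.trans (A₂.trans (A₂.*-identityˡ _) (A₂.*-identityʳ c)) (A₂.sym (A₂.trans (S₃.const-⊛ c S₃.var 1) (A₂.*-identityʳ c)))
  sub-var c (suc (suc n)) = A₂.trans (A₂.trans (A₂.*-congʳ emb-0) (A₂.zeroˡ _)) (A₂.sym (A₂.trans (S₃.const-⊛ c S₃.var (suc (suc n))) (A₂.zeroʳ _)))

  Pₛ Gₛ Eₛ : A₂.Carrier → S₃.PS
  Pₛ c = sub c P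
  Gₛ c = sub c (G 1)
  Eₛ c = sub c E

  PG≈1 : ∀ c → Pₛ c A₃.* Gₛ c A₃.≈ A₃.1#
  PG≈1 c = A₃.trans (A₃.sym (sub-* c P (G 1))) (A₃.trans (sub-cong c P-inverse) (sub-1 c))

  E≈ : ∀ c → Eₛ c A₃.≈ S₃.var A₃.* (S₃.const c A₃.* Gₛ c)
  E≈ c = A₃.trans (sub-* c S₁.var (G 1)) (A₃.trans (A₃.*-congʳ {Gₛ c} (sub-var c))
    (I₃.solve 3 (λ c v g → (c I₃.:* v) I₃.:* g I₃.:= v I₃.:* (c I₃.:* g)) A₃.refl (S₃.const c) S₃.var (Gₛ c)))

  PE≈ : ∀ c → Pₛ c A₃.* Eₛ c A₃.≈ S₃.var A₃.* S₃.const c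
  PE≈ c = begin
    Pₛ c A₃.* Eₛ c
      ≈⟨ A₃.*-congˡ {Pₛ c} (E≈ c) ⟩
    Pₛ c A₃.* (S₃.var A₃.* (S₃.const c A₃.* Gₛ c))
      ≈⟨ I₃.solve 4 (λ p v c g → p I₃.:* (v I₃.:* (c I₃.:* g)) I₃.:= (v I₃.:* c) I₃.:* (p I₃.:* g)) A₃.refl (Pₛ c) S₃.var (S₃.const c) (Gₛ c) ⟩
    (S₃.var A₃.* S₃.const c) A₃.* (Pₛ c A₃.* Gₛ c)
      ≈⟨ A₃.trans (A₃.*-congˡ {S₃.var A₃.* S₃.const c} (PG≈1 c)) (A₃.*-identityʳ (S₃.var A₃.* S₃.const c)) ⟩
    S₃.var A₃.* S₃.const c ∎
    where open Relation.Binary.Reasoning.Setoid A₃.setoid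

  IsAdditive : (ℕ → A.Carrier) → Set
  IsAdditive p = ∀ n a b → (a A₂.+ b) A₂.* C₂.conv n (λ j k → emb (p j A.* p k) A₂.* (a ^₂ j A₂.* b ^₂ k)) A₂.≈
    b A₂.* C₂.conv n (λ j k → emb (p j A.* p k) A₂.* ((a A₂.+ b) ^₂ j A₂.* a ^₂ k))
    A₂.+ a A₂.* C₂.conv n (λ j k → emb (p j A.* p k) A₂.* ((a A₂.+ b) ^₂ j A₂.* b ^₂ k))

  -- `p′` is P in the form for which the product identity is available; the two agree only up to the
  -- equality of the algebra.
  module Compatible (p′ : ℕ → A.Carrier) (P≈p : ∀ j → P j A.≈ p′ j) (p-additive : IsAdditive p′) where
    P-additive : IsAdditive P
    P-additive n a b = A₂.trans (A₂.*-congˡ {a A₂.+ b} (PP n a b)) (A₂.trans (p-additive n a b)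
      (A₂.sym (A₂.+-cong (A₂.*-congˡ {b} (PP n (a A₂.+ b) a)) (A₂.*-congˡ {a} (PP n (a A₂.+ b) b)))))
      where
      PP : ∀ n a b → C₂.conv n (λ j k → emb (P j A.* P k) A₂.* (a ^₂ j A₂.* b ^₂ k)) A₂.≈ C₂.conv n (λ j k → emb (p′ j A.* p′ k) A₂.* (a ^₂ j A₂.* b ^₂ k))
      PP n a b = C₂.conv-ext n λ j k → A₂.*-congʳ {a ^₂ j A₂.* b ^₂ k} (emb-cong (A.*-cong (P≈p j) (P≈p k)))

    P-additiveₛ : ∀ a b → S₃.const (a A₂.+ b) A₃.* (Pₛ a A₃.* Pₛ b) A₃.≈
      S₃.const b A₃.* (Pₛ (a A₂.+ b) A₃.* Pₛ a) A₃.+ S₃.const a A₃.* (Pₛ (a A₂.+ b) A₃.* Pₛ b)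
    P-additiveₛ a b n = A₂.trans (product (a A₂.+ b) a b) (A₂.trans (P-additive n a b)
      (A₂.sym (A₂.+-cong (product b (a A₂.+ b) a) (product a (a A₂.+ b) b))))
      where
      product : ∀ c a b → (S₃.const c A₃.* (Pₛ a A₃.* Pₛ b)) n A₂.≈ c A₂.* C₂.conv n (λ j k → emb (P j A.* P k) A₂.* (a ^₂ j A₂.* b ^₂ k))
      product c a b = A₂.trans (S₃.const-⊛ c (Pₛ a A₃.* Pₛ b) n) (A₂.*-congˡ (C₂.conv-ext n λ j k → A₂.trans
        (I₂.solve 4 (λ x a y b → (x I₂.:* a) I₂.:* (y I₂.:* b) I₂.:= (x I₂.:* y) I₂.:* (a I₂.:* b)) A₂.refl (emb (P j)) (a ^₂ j) (emb (P k)) (b ^₂ k))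
        (A₂.*-congʳ (A₂.sym (emb-* (P j) (P k))))))

    -- The product identity for P is multiplied by z and by the inverses of P(a z), P(b z) and P((a
    -- + b) z).
    E-additive : ∀ a b → Eₛ (a A₂.+ b) A₃.≈ Eₛ a A₃.+ Eₛ b
    E-additive a b = begin
      Eₛ (a A₂.+ b)
        ≈⟨ E≈ (a A₂.+ b) ⟩
      v A₃.* (cc A₃.* Gₛ (a A₂.+ b))
        ≈⟨ I₃.solve 3 (λ v c g → v I₃.:* (c I₃.:* g) I₃.:= v I₃.:* (c I₃.:* ((I₃.:1 I₃.:* I₃.:1) I₃.:* g))) A₃.refl v cc g ⟩
      v A₃.* (cc A₃.* ((A₃.1# A₃.* A₃.1#) A₃.* g))
        ≈⟨ A₃.*-congˡ {v} (A₃.*-congˡ {cc} (A₃.*-congʳ {g} (A₃.*-cong (PG≈1 a) (PG≈1 b)))) ⟨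
      v A₃.* (cc A₃.* (((pa A₃.* ga) A₃.* (pb A₃.* gb)) A₃.* g))
        ≈⟨ I₃.solve 7 (λ v c x x′ y y′ g → v I₃.:* (c I₃.:* (((x I₃.:* x′) I₃.:* (y I₃.:* y′)) I₃.:* g)) I₃.:=
             (v I₃.:* (x′ I₃.:* y′ I₃.:* g)) I₃.:* (c I₃.:* (x I₃.:* y))) A₃.refl v cc pa ga pb gb g ⟩
      (v A₃.* (ga A₃.* gb A₃.* g)) A₃.* (cc A₃.* (pa A₃.* pb))
        ≈⟨ A₃.*-congˡ {v A₃.* (ga A₃.* gb A₃.* g)} (P-additiveₛ a b) ⟩
      (v A₃.* (ga A₃.* gb A₃.* g)) A₃.* (cb A₃.* (p A₃.* pa) A₃.+ ca A₃.* (p A₃.* pb))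
        ≈⟨ I₃.solve 9 (λ v ca cb ga gb g pa pb p → (v I₃.:* (ga I₃.:* gb I₃.:* g)) I₃.:* (cb I₃.:* (p I₃.:* pa) I₃.:+ ca I₃.:* (p I₃.:* pb)) I₃.:=
             v I₃.:* (ca I₃.:* ga) I₃.:* ((p I₃.:* g) I₃.:* (pb I₃.:* gb)) I₃.:+ v I₃.:* (cb I₃.:* gb) I₃.:* ((p I₃.:* g) I₃.:* (pa I₃.:* ga))) A₃.refl v ca cb ga gb g pa pb p ⟩
      v A₃.* (ca A₃.* ga) A₃.* ((p A₃.* g) A₃.* (pb A₃.* gb)) A₃.+ v A₃.* (cb A₃.* gb) A₃.* ((p A₃.* g) A₃.* (pa A₃.* ga))
        ≈⟨ A₃.+-cong (A₃.*-congˡ {v A₃.* (ca A₃.* ga)} (A₃.*-cong (PG≈1 (a A₂.+ b)) (PG≈1 b))) (A₃.*-congˡ {v A₃.* (cb A₃.* gb)} (A₃.*-cong (PG≈1 (a A₂.+ b)) (PG≈1 a))) ⟩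
      v A₃.* (ca A₃.* ga) A₃.* (A₃.1# A₃.* A₃.1#) A₃.+ v A₃.* (cb A₃.* gb) A₃.* (A₃.1# A₃.* A₃.1#)
        ≈⟨ I₃.solve 2 (λ x y → x I₃.:* (I₃.:1 I₃.:* I₃.:1) I₃.:+ y I₃.:* (I₃.:1 I₃.:* I₃.:1) I₃.:= x I₃.:+ y) A₃.refl (v A₃.* (ca A₃.* ga)) (v A₃.* (cb A₃.* gb)) ⟩
      v A₃.* (ca A₃.* ga) A₃.+ v A₃.* (cb A₃.* gb)
        ≈⟨ A₃.+-cong (E≈ a) (E≈ b) ⟨
      Eₛ a A₃.+ Eₛ b ∎
      where
      open Relation.Binary.Reasoning.Setoid A₃.setoid
      v = S₃.var
      ca = S₃.const a
      cb = S₃.const b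
      cc = S₃.const (a A₂.+ b)
      pa = Pₛ a
      pb = Pₛ b
      p = Pₛ (a A₂.+ b)
      ga = Gₛ a
      gb = Gₛ b
      g = Gₛ (a A₂.+ b)

    private
      v w : A₃.Carrier
      v = Eₛ s
      w = Eₛ t

    v-w : v A₃.- w A₃.≈ Eₛ (s A₂.- t)
    v-w = begin
      Eₛ s A₃.- Eₛ t
        ≈⟨ A₃.+-congʳ {A₃.- Eₛ t} (A₃.trans (sub-E (I₂.solve 2 (λ s t → s I₂.:= (s I₂.:- t) I₂.:+ t) A₂.refl s t)) (E-additive (s A₂.- t) t)) ⟩
      (Eₛ (s A₂.- t) A₃.+ Eₛ t) A₃.- Eₛ t
        ≈⟨ I₃.solve 2 (λ x y → (x I₃.:+ y) I₃.:- y I₃.:= x) A₃.refl (Eₛ (s A₂.- t)) (Eₛ t) ⟩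
      Eₛ (s A₂.- t) ∎
      where
      open Relation.Binary.Reasoning.Setoid A₃.setoid
      sub-E : ∀ {c d} → c A₂.≈ d → Eₛ c A₃.≈ Eₛ d
      sub-E e n = A₂.*-congˡ (E₂.^-congˡ n e)

    open LetterOperator q 𝔽 A using (K⋄)
    open LetterOperator q 𝔽 A₂ using (K⋄-generating) renaming (K⋄ to K⋄₂)
    module _ (k l : ℕ) (m∣l : m ∣ l) where
      -- The right tensor factor that accompanies x_{k+1} P_l in the coproduct of x_{a+1} ⋄ x_{b+1}.
      -- The family `rhs` below is its counterpart when the coproducts of the two letters are
      -- multiplied.
      lhs : ℕ → ℕ → A.Carrier
      lhs a b = K⋄ (a ℕ.+ b) a b (λ i j → (E ^₁ k) i A.* (P A₁.* E ^₁ l) j)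

      F : ℕ → ℕ → A₂.Carrier
      F i j = emb ((E ^₁ k) i A.* (P A₁.* E ^₁ l) j)

      F-∤ : ∀ i {j} → ¬ (m ∣ j) → F i j A₂.≈ A₂.0#
      F-∤ i {j} ¬d = A₂.trans (emb-cong (A.trans (A.*-congˡ (PE-sparse l m∣l j ¬d)) (A.zeroʳ _))) emb-0

      U : ℕ → A₂.Carrier
      U n = C₂.conv n (λ a b → (s ^₂ a A₂.* t ^₂ b) A₂.* emb (lhs a b))

      -- The closed form to which both sides lead: the right side of the product rule for v = E(s z)
      -- and w = E(t z), times P((s - t) z).
      target : A₃.Carrier
      target = (v ^₃ k A₃.- w ^₃ k) A₃.* (Pₛ (s A₂.- t) A₃.* (v A₃.- w) ^₃ l)

      target≈ : target A₃.≈ (sub s (E ^₁ k) A₃.- sub t (E ^₁ k)) A₃.* sub (s A₂.- t) (P A₁.* E ^₁ l)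
      target≈ = A₃.*-cong (A₃.+-cong (A₃.sym (sub-^ s E k)) (A₃.-‿cong (A₃.sym (sub-^ t E k))))
        (A₃.sym (A₃.trans (sub-* (s A₂.- t) P (E ^₁ l)) (A₃.*-congˡ {Pₛ (s A₂.- t)} (A₃.trans (sub-^ (s A₂.- t) E l) (E₃.^-congˡ l (A₃.sym v-w))))))

      -- The product rule in s and t yields an antidiagonal sum that factors into series in z;
      -- additivity then rewrites E((s - t) z) as v - w inside `target`.
      U-target : ∀ n → (s A₂.- t) A₂.* U n A₂.≈ target (suc n)
      U-target n = begin
        (s A₂.- t) A₂.* U n
          ≈⟨ A₂.*-congˡ {s A₂.- t} (C₂.conv-cong n λ a b e → A₂.*-congˡ {s ^₂ a A₂.* t ^₂ b} (emb-K⋄ a b e)) ⟩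
        (s A₂.- t) A₂.* C₂.conv n (λ a b → (s ^₂ a A₂.* t ^₂ b) A₂.* K⋄₂ n a b F)
          ≈⟨ K⋄-generating n F F-∤ s t ⟩
        C₂.conv (suc n) (λ i j → F i j A₂.* ((s ^₂ i A₂.- t ^₂ i) A₂.* (s A₂.- t) ^₂ j))
          ≈⟨ C₂.conv-ext (suc n) (λ i j → A₂.trans (A₂.*-congʳ (emb-* ((E ^₁ k) i) ((P A₁.* E ^₁ l) j)))
               (I₂.solve 5 (λ e p x y d → (e I₂.:* p) I₂.:* ((x I₂.:- y) I₂.:* d) I₂.:= (e I₂.:* x I₂.:- e I₂.:* y) I₂.:* (p I₂.:* d)) A₂.refl
                 (emb ((E ^₁ k) i)) (emb ((P A₁.* E ^₁ l) j)) (s ^₂ i) (t ^₂ i) ((s A₂.- t) ^₂ j))) ⟩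
        ((sub s (E ^₁ k) A₃.- sub t (E ^₁ k)) A₃.* sub (s A₂.- t) (P A₁.* E ^₁ l)) (suc n)
          ≈⟨ target≈ (suc n) ⟨
        target (suc n) ∎
        where
        open Relation.Binary.Reasoning.Setoid A₂.setoid
        emb-K⋄ : ∀ a b → a ℕ.+ b ≡ n → emb (lhs a b) A₂.≈ K⋄₂ n a b F
        emb-K⋄ a b refl = A₂.trans (emb-conv (suc n) (λ i j → A.ι (κ a b j) A.* ((E ^₁ k) i A.* (P A₁.* E ^₁ l) j)))
          (C₂.conv-ext (suc n) λ i j → emb-* (A.ι (κ a b j)) ((E ^₁ k) i A.* (P A₁.* E ^₁ l) j))

      module _ (N : ℕ) (k+l : k ℕ.+ l ≡ suc N) where
        rhs : ℕ → ℕ → A.Carrier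
        rhs a b = C.conv N (λ k₁ k₂ → A.ι (κ k₁ k₂ l) A.* ((E ^₁ k₁) a A.* (E ^₁ k₂) b))

        V : A₃.Carrier
        V = C₃.conv N (λ k₁ k₂ → A₃.ι (κ k₁ k₂ l) A₃.* (v ^₃ k₁ A₃.* w ^₃ k₂))

        V-coefficient : ∀ n → V n A₂.≈ C₂.conv n (λ a b → (s ^₂ a A₂.* t ^₂ b) A₂.* emb (rhs a b))
        V-coefficient n = begin
          V n
            ≈⟨ pointwise N (λ k₁ k₂ → A₃.ι (κ k₁ k₂ l) A₃.* (v ^₃ k₁ A₃.* w ^₃ k₂)) ⟩
          C₂.conv N (λ k₁ k₂ → (A₃.ι (κ k₁ k₂ l) A₃.* (v ^₃ k₁ A₃.* w ^₃ k₂)) n)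
            ≈⟨ C₂.conv-ext N (λ k₁ k₂ → A₂.trans (S₃.const-⊛ (A₂.ι (κ k₁ k₂ l)) (v ^₃ k₁ A₃.* w ^₃ k₂) n)
                 (A₂.trans (A₂.*-congˡ (A₃.*-cong (A₃.sym (sub-^ s E k₁)) (A₃.sym (sub-^ t E k₂)) n))
                 (A₂.trans (C₂.conv-*ˡ n (A₂.ι (κ k₁ k₂ l)) (λ a b → sub s (E ^₁ k₁) a A₂.* sub t (E ^₁ k₂) b))
                 (C₂.conv-ext n λ a b → A₂.trans
                   (I₂.solve 5 (λ c x y a b → c I₂.:* ((x I₂.:* a) I₂.:* (y I₂.:* b)) I₂.:= (a I₂.:* b) I₂.:* (c I₂.:* (x I₂.:* y))) A₂.refl
                     (A₂.ι (κ k₁ k₂ l)) (emb ((E ^₁ k₁) a)) (emb ((E ^₁ k₂) b)) (s ^₂ a) (t ^₂ b))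
                   (A₂.*-congˡ {s ^₂ a A₂.* t ^₂ b} (A₂.sym (A₂.trans (emb-* (A.ι (κ k₁ k₂ l)) ((E ^₁ k₁) a A.* (E ^₁ k₂) b)) (A₂.*-congˡ (emb-* ((E ^₁ k₁) a) ((E ^₁ k₂) b)))))))))) ⟩
          C₂.conv N (λ k₁ k₂ → C₂.conv n (λ a b → (s ^₂ a A₂.* t ^₂ b) A₂.* emb (A.ι (κ k₁ k₂ l) A.* ((E ^₁ k₁) a A.* (E ^₁ k₂) b))))
            ≈⟨ C₂.conv-swap N n (λ k₁ k₂ a b → (s ^₂ a A₂.* t ^₂ b) A₂.* emb (A.ι (κ k₁ k₂ l) A.* ((E ^₁ k₁) a A.* (E ^₁ k₂) b))) ⟩
          C₂.conv n (λ a b → C₂.conv N (λ k₁ k₂ → (s ^₂ a A₂.* t ^₂ b) A₂.* emb (A.ι (κ k₁ k₂ l) A.* ((E ^₁ k₁) a A.* (E ^₁ k₂) b))))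
            ≈⟨ C₂.conv-ext n (λ a b → A₂.trans (A₂.sym (C₂.conv-*ˡ N (s ^₂ a A₂.* t ^₂ b) (λ k₁ k₂ → emb (A.ι (κ k₁ k₂ l) A.* ((E ^₁ k₁) a A.* (E ^₁ k₂) b)))))
                 (A₂.*-congˡ {s ^₂ a A₂.* t ^₂ b} (A₂.sym (emb-conv N (λ k₁ k₂ → A.ι (κ k₁ k₂ l) A.* ((E ^₁ k₁) a A.* (E ^₁ k₂) b)))))) ⟩
          C₂.conv n (λ a b → (s ^₂ a A₂.* t ^₂ b) A₂.* emb (rhs a b)) ∎
          where
          open Relation.Binary.Reasoning.Setoid A₂.setoid
          pointwise : ∀ N (f : ℕ → ℕ → A₃.Carrier) → C₃.conv N f n A₂.≈ C₂.conv N (λ a b → f a b n)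
          pointwise zero    f = A₂.refl {f 0 0 n}
          pointwise (suc N) f = A₂.+-congˡ {f 0 (suc N) n} (pointwise N λ a → f (suc a))

        V-target : S₃.var A₃.* (S₃.const (s A₂.- t) A₃.* V) A₃.≈ target
        V-target = begin
          S₃.var A₃.* (S₃.const (s A₂.- t) A₃.* V)
            ≈⟨ A₃.*-assoc S₃.var (S₃.const (s A₂.- t)) V ⟨
          (S₃.var A₃.* S₃.const (s A₂.- t)) A₃.* V
            -- The factor z (s - t) equals P E at s - t, and there E is v - w by additivity. What
            -- remains is the left side of the product rule for v and w.
            ≈⟨ A₃.*-congʳ {V} (A₃.trans (A₃.sym (PE≈ (s A₂.- t))) (A₃.*-congˡ {Pₛ (s A₂.- t)} (A₃.sym v-w))) ⟩
          (Pₛ (s A₂.- t) A₃.* (v A₃.- w)) A₃.* V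
            ≈⟨ A₃.*-assoc (Pₛ (s A₂.- t)) (v A₃.- w) V ⟩
          Pₛ (s A₂.- t) A₃.* ((v A₃.- w) A₃.* V)
            ≈⟨ A₃.*-congˡ {Pₛ (s A₂.- t)} (AlgebraIdentities.κ-generating q 𝔽 A₃ N k l k+l m∣l v w) ⟩
          Pₛ (s A₂.- t) A₃.* ((v ^₃ k A₃.- w ^₃ k) A₃.* (v A₃.- w) ^₃ l)
            ≈⟨ I₃.solve 3 (λ p x y → p I₃.:* (x I₃.:* y) I₃.:= x I₃.:* (p I₃.:* y)) A₃.refl (Pₛ (s A₂.- t)) (v ^₃ k A₃.- w ^₃ k) ((v A₃.- w) ^₃ l) ⟩
          target ∎
          where open Relation.Binary.Reasoning.Setoid A₃.setoid

        -- Both generating series become the coefficient of `target` in degree n + 1 when multiplied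
        -- by s - t, which is regular.
        lhs≈rhs : ∀ a b → lhs a b A.≈ rhs a b
        lhs≈rhs a b = separate n lhs rhs (N.Regular-cancel {s A₂.- t} s-t-regular (U n) (C₂.conv n (λ a b → (s ^₂ a A₂.* t ^₂ b) A₂.* emb (rhs a b)))
          (A₂.trans (U-target n) (A₂.trans (A₂.sym (V-target (suc n))) (A₂.trans (S₃.var-⊛ (S₃.const (s A₂.- t) A₃.* V) n)
            (A₂.trans (S₃.const-⊛ (s A₂.- t) V n) (A₂.*-congˡ {s A₂.- t} (V-coefficient n))))))) a b refl
          where n = a ℕ.+ b

      -- The closed form contains v^0 - w^0. This settles k = l = 0, for which the formula with k +
      -- l = N + 1 has no instance.
      lhs≈0 : k ≡ 0 → ∀ a b → lhs a b A.≈ A.0#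
      lhs≈0 refl a b = separate n lhs (λ _ _ → A.0#) (A₂.trans U≈0 (A₂.sym (C₂.conv-zero n {f = λ a b → (s ^₂ a A₂.* t ^₂ b) A₂.* emb A.0#} λ a b _ →
          A₂.trans (A₂.*-congˡ {s ^₂ a A₂.* t ^₂ b} emb-0) (A₂.zeroʳ _)))) a b refl
        where
        n = a ℕ.+ b
        U≈0 : U n A₂.≈ A₂.0#
        U≈0 = s-t-regular (U n) (A₂.trans (U-target n)
          (I₃.solve 1 (λ x → (I₃.:1 I₃.:- I₃.:1) I₃.:* x I₃.:= I₃.:0) A₃.refl (Pₛ (s A₂.- t) A₃.* (v A₃.- w) ^₃ l) (suc n)))

-- The coproduct in terms of the powers of 1/P.

module Coproduct (q : ℕ) (𝔽 : FiniteField q) where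
  open Construction q 𝔽 using (Letter; letter; Word; weight; charOneWord; xₛ; 𝔇; ⟦_⟧; scale; _⧢_; sgn; fromℕ; binomℤ; comps; bracket; prodF; Δc; ΔletterRest; Δw)
  open FieldFacts q 𝔽 using (𝔽-ring; m)
  open PowerSums q 𝔽 using (bin-def; bin-0; bin->)
  open CommutativeRing 𝔽-ring hiding (refl; sym; trans) renaming (Carrier to K)
  open IntegerSolver 𝔽-ring
  open Antidiagonal 𝔽-ring
  open Pairing q 𝔽
  open Shuffle q 𝔽
  open LetterProducts q 𝔽 using (P; P-∤; P-∣; _≋_)
  open ShuffleAlgebra q 𝔽 using (algebra-𝔇; scale-ι)
  open ≡-Reasoning
  private
    module A = 𝔽-Algebra algebra-𝔇

  -- The value at 0 is a default: the parts of compositions are positive, but `bracket` reads a part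
  -- 0 as the letter x_1, and this choice makes `Δc-1` hold for arbitrary lists.
  Y : ℕ → 𝔇
  Y zero    = ⟦ xₛ 0 ∷ [] ⟧
  Y (suc j) = P (suc j)

  open CompositionSeries q 𝔽 algebra-𝔇 Y using (G; G-0; P-G; W-∤; negBinomial; prod; ∑) renaming (P to P′)

  P≋ : ∀ j → P′ j ≋ P j
  P≋ zero    φ = refl
  P≋ (suc j) φ = refl

  Y-∤ : ∀ i → ¬ (m ∣ suc i) → Y (suc i) ≋ []
  Y-∤ i ¬d φ = cong (λ d → ∫ d φ) (P-∤ ¬d)

  private
    product : List ℕ → 𝔇
    product = foldr (λ i acc → ⟦ xₛ (i ∸ 1) ∷ [] ⟧ ⧢ acc) ⟦ [] ⟧

    -- The second binomial in Δ^i_{1,w+1} is binom(i - 1, w), which vanishes for i - 1 < w. What is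
    -- left is the indicator of q - 1 dividing i, the same condition that defines P.
    Δc-1 : ∀ i w → i ∸ 1 ℕ.< w → ∀ acc → scale (Δc i 1 (w ℕ.+ 1)) (⟦ xₛ (i ∸ 1) ∷ [] ⟧ ⧢ acc) ≋ Y i ⧢ acc
    Δc-1 i w i<w acc φ = trans (∫-scale (Δc i 1 (w ℕ.+ 1)) (⟦ xₛ (i ∸ 1) ∷ [] ⟧ ⧢ acc) φ) (trans (coefficient i i<w)
        (sym (∫-⧢ (Y i) acc φ)))
      where
      one : ∀ i → i ∸ 1 ℕ.< w → sgn 0 * fromℕ ((i ∸ 1) C 0) + sgn (w ℕ.+ 1 ∸ 1) * fromℕ ((i ∸ 1) C (w ℕ.+ 1 ∸ 1)) ≡ 1#
      one i i<w = trans (cong₂ _+_ (trans (*-identityˡ _) (trans (sym (bin-def (i ∸ 1) 0)) (bin-0 (i ∸ 1))))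
          (trans (cong (sgn (w ℕ.+ 1 ∸ 1) *_) (trans (cong (λ n → fromℕ ((i ∸ 1) C n)) (ℕₚ.m+n∸n≡m w 1)) (trans (sym (bin-def (i ∸ 1) w)) (bin-> i<w)))) (zeroʳ _)))
        (+-identityʳ 1#)
      letter-product : ∀ i → ∫ (⟦ xₛ (i ∸ 1) ∷ [] ⟧ ⧢ acc) φ ≡ ∫ ⟦ xₛ (i ∸ 1) ∷ [] ⟧ (λ v → ∫ acc (λ w → S v w φ))
      letter-product i = ∫-⧢ ⟦ xₛ (i ∸ 1) ∷ [] ⟧ acc φ
      coefficient : ∀ i → i ∸ 1 ℕ.< w → Δc i 1 (w ℕ.+ 1) * ∫ (⟦ xₛ (i ∸ 1) ∷ [] ⟧ ⧢ acc) φ ≡ ∫ (Y i) (λ v → ∫ acc (λ w → S v w φ))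
      coefficient zero i<w with (q ∸ 1) ∣? 0
      ... | yes _ = trans (cong₂ _*_ (one 0 i<w) (letter-product 0)) (*-identityˡ _)
      ... | no ¬d = contradiction ((q ∸ 1) ∣.∣0) ¬d
      coefficient (suc i) i<w with (q ∸ 1) ∣? suc i
      ... | yes _ = trans (cong₂ _*_ (one (suc i) i<w) (letter-product (suc i))) (*-identityˡ _)
      ... | no _  = zeroˡ _

    brackets : ∀ w is → All (λ i → i ∸ 1 ℕ.< w) is → scale (prodF (map (λ i → Δc i 1 (w ℕ.+ 1)) is)) (product is) ≋ prod is
    brackets w []       []       φ = trans (∫-scale 1# ⟦ [] ⟧ φ) (*-identityˡ _)
    brackets w (i ∷ is) (l ∷ ls) φ = begin
      ∫ (scale (c * cs) (⟦ xₛ (i ∸ 1) ∷ [] ⟧ ⧢ product is)) φ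
        ≡⟨ trans (∫-scale (c * cs) (⟦ xₛ (i ∸ 1) ∷ [] ⟧ ⧢ product is) φ) (cong (c * cs *_) (∫-⧢ ⟦ xₛ (i ∸ 1) ∷ [] ⟧ (product is) φ)) ⟩
      c * cs * ∫ ⟦ xₛ (i ∸ 1) ∷ [] ⟧ (λ v → ∫ (product is) (λ w → S v w φ))
        ≡⟨ trans (*-assoc c cs _) (cong (c *_) (sym (∫-* ⟦ xₛ (i ∸ 1) ∷ [] ⟧ cs λ v → ∫ (product is) (λ w → S v w φ)))) ⟩
      c * ∫ ⟦ xₛ (i ∸ 1) ∷ [] ⟧ (λ v → cs * ∫ (product is) (λ w → S v w φ))
        ≡⟨ cong (c *_) (∫-cong ⟦ xₛ (i ∸ 1) ∷ [] ⟧ λ v → trans (sym (∫-scale cs (product is) λ w → S v w φ)) (brackets w is ls λ w → S v w φ)) ⟩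
      c * ∫ ⟦ xₛ (i ∸ 1) ∷ [] ⟧ (λ v → ∫ (prod is) (λ w → S v w φ))
        ≡⟨ trans (∫-scale c (⟦ xₛ (i ∸ 1) ∷ [] ⟧ ⧢ prod is) φ) (cong (c *_) (∫-⧢ ⟦ xₛ (i ∸ 1) ∷ [] ⟧ (prod is) φ)) ⟨
      ∫ (scale c (⟦ xₛ (i ∸ 1) ∷ [] ⟧ ⧢ prod is)) φ
        ≡⟨ Δc-1 i w l (prod is) φ ⟩
      ∫ (Y i ⧢ prod is) φ ∎
      where
      c = Δc i 1 (w ℕ.+ 1)
      cs = prodF (map (λ i → Δc i 1 (w ℕ.+ 1)) is)

    parts-bounded : ∀ is → All (λ i → i ∸ 1 ℕ.< weight (charOneWord is)) is
    parts-bounded []       = []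
    parts-bounded (i ∷ is) = ℕ.s≤s (ℕₚ.m≤m+n (i ∸ 1) _) ∷
      All.map (λ l → ℕₚ.<-≤-trans l (ℕₚ.m≤n+m _ (suc (i ∸ 1)))) (parts-bounded is)

  bracket≋ : ∀ is φ → ∫ (bracket is) φ ≡ sgn (length is) * ∫ (prod is) φ
  bracket≋ is φ = trans (∫-scale (sgn (length is) * c) (product is) φ) (trans (*-assoc _ _ _) (cong (sgn (length is) *_)
      (trans (sym (∫-scale c (product is) φ)) (brackets (weight (charOneWord is)) is (parts-bounded is) φ))))
    where c = prodF (map (λ i → Δc i 1 (weight (charOneWord is) ℕ.+ 1)) is)

  ∫-∑ : ∀ {X : Set} (f : X → 𝔇) xs φ → ∫ (∑ f xs) φ ≡ foldr (λ x s → ∫ (f x) φ + s) 0# xs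
  ∫-∑ f []       φ = refl
  ∫-∑ f (x ∷ xs) φ = trans (∫-++ (f x) _ φ) (cong (_+_ (∫ (f x) φ)) (∫-∑ f xs φ))

  -- Δ(x_{n+1,ε}) − 1 ⊗ x_{n+1,ε} = Σ x_{k+1,ε} ⊗ [t^{n-k}] P(t)^{-k}.
  δ : Letter → (Letter → Word → K) → K
  δ (letter n ε hε) ψ = conv n (λ k d → ∫ (G k d) (ψ (letter k ε hε)))

  ∫-ΔletterRest : ∀ x (ψ : Letter → Word → K) → ∫₂ (ΔletterRest x) (λ l b → ∫ b (ψ l)) ≡ δ x ψ
  ∫-ΔletterRest x@(letter n ε hε) ψ = ∫-concatMap-upTo n term (λ lb → ∫ (proj₂ lb) (ψ (proj₁ lb))) (λ k d → ∫ (G k d) (ψ (letter k ε hε))) λ k d e →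
    trans (terms k (comps (n ∸ k))) (trans (sym (∫-∑ (λ is → A.ι (negBinomial k (length is)) A.* prod is) (comps (n ∸ k)) (ψ (letter k ε hε))))
      (cong (λ d → ∫ (G k d) (ψ (letter k ε hε))) (trans (cong (_∸ k) (sym e)) (ℕₚ.m+n∸m≡n k d))))
    where
    term : ℕ → FM (Letter × 𝔇)
    term k = map (λ is → binomℤ (+ suc k ℤ.+ + length is ℤ.- + 2) (length is) , letter k ε hε , bracket is) (comps (n ∸ k))
    terms : ∀ k iss → ∫₂ (map (λ is → binomℤ (+ suc k ℤ.+ + length is ℤ.- + 2) (length is) , letter k ε hε , bracket is) iss) (λ l b → ∫ b (ψ l))
      ≡ foldr (λ is s → ∫ (A.ι (negBinomial k (length is)) A.* prod is) (ψ (letter k ε hε)) + s) 0# iss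
    terms k []         = refl
    terms k (is ∷ iss) = cong₂ _+_ (trans (cong (b *_) (bracket≋ is (ψ (letter k ε hε)))) (trans (sym (*-assoc b _ _))
        (trans (sym (∫-scale (negBinomial k (length is)) (prod is) _)) (scale-ι (negBinomial k (length is)) (prod is) _)))) (terms k iss)
      where b = binomℤ (+ suc k ℤ.+ + length is ℤ.- + 2) (length is)

  Δ-S : Word → (Word × Word → K) → K
  Δ-S w Φ = ∫ (Δw w) Φ

  Δ-[] : ∀ Φ → Δ-S [] Φ ≡ Φ ([] , [])
  Δ-[] Φ = ∫-single ([] , []) Φ

  -- The transpose of p ⊗ r ↦ l p ⊗ (b ⧢ r), the operation in the recursion for the coproduct of a
  -- word.
  _∣_▷_ : Letter → Word → (Word × Word → K) → Word × Word → K
  (l ∣ b ▷ Φ) (p , r) = S b r (λ z → Φ (l ∷ p , z))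

  Δ-∷ : ∀ x v Φ → Δ-S (x ∷ v) Φ ≡ Φ ([] , x ∷ v) + δ x (λ l b → Δ-S v (l ∣ b ▷ Φ))
  Δ-∷ x v Φ = cong₂ _+_ (*-identityˡ _) (trans (∫-concatMap _ outer Φ step (ΔletterRest x)) exchange)
    where
    inner : Letter → 𝔇 → Word × Word → K
    inner l bx pr = ∫ bx (λ b → (l ∣ b ▷ Φ) pr)
    outer : Letter × 𝔇 → K
    outer lb = ∫ (Δw v) (inner (proj₁ lb) (proj₂ lb))
    innermost : ∀ c c′ l bx (pr : Word × Word) → ∫ (map (λ p → c * c′ * proj₁ p , l ∷ proj₁ pr , proj₂ p) (bx ⧢ ⟦ proj₂ pr ⟧)) Φ ≡ c′ * (c * inner l bx pr)
    innermost c c′ l bx pr = trans (∫-map-scale (c * c′) (λ w → l ∷ proj₁ pr , w) _ (λ _ → refl) (bx ⧢ ⟦ proj₂ pr ⟧) Φ)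
      (trans (cong (c * c′ *_) (trans (∫-⧢ bx ⟦ proj₂ pr ⟧ (λ w → Φ (l ∷ proj₁ pr , w)))
          (∫-cong bx λ b → ∫-single (proj₂ pr) λ w → S b w λ z → Φ (l ∷ proj₁ pr , z))))
        (solve 3 (λ c c′ s → c :* c′ :* s := c′ :* (c :* s)) refl c c′ (inner l bx pr)))
    step : ∀ c lb → ∫ (concatMap (λ q′ → map (λ p → c * proj₁ q′ * proj₁ p , proj₁ lb ∷ proj₁ (proj₂ q′) , proj₂ p) (proj₂ lb ⧢ ⟦ proj₂ (proj₂ q′) ⟧)) (Δw v)) Φ ≡ c * outer lb
    step c lb = trans (∫-concatMap _ (λ pr → c * inner (proj₁ lb) (proj₂ lb) pr) Φ (λ c′ pr → innermost c c′ (proj₁ lb) (proj₂ lb) pr) (Δw v))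
      (∫-* (Δw v) c (inner (proj₁ lb) (proj₂ lb)))
    exchange : ∫ (ΔletterRest x) outer ≡ δ x (λ l b → Δ-S v (l ∣ b ▷ Φ))
    exchange = trans (∫-cong (ΔletterRest x) λ lb → ∫-swap (Δw v) (proj₂ lb) λ pr b → (proj₁ lb ∣ b ▷ Φ) pr)
           (∫-ΔletterRest x (λ l b → Δ-S v (l ∣ b ▷ Φ)))

  δ-cong : ∀ x {ψ χ} → (∀ l b → ψ l b ≡ χ l b) → δ x ψ ≡ δ x χ
  δ-cong (letter n ε hε) h = conv-ext n λ k d → ∫-cong (G k d) (h (letter k ε hε))

  ∫-δ : ∀ {B : Set} (d : FM B) x (ψ : B → Letter → Word → K) → ∫ d (λ b → δ x (ψ b)) ≡ δ x (λ l w → ∫ d (λ b → ψ b l w))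
  ∫-δ d (letter n ε hε) ψ = trans (∫-conv d n λ k e b → ∫ (G k e) (ψ b (letter k ε hε)))
    (conv-ext n λ k e → ∫-swap d (G k e) λ b → ψ b (letter k ε hε))

  -- The coefficients of P^(1-l), written as P times P^(-l) so that one formula covers l = 0 as
  -- well.
  H : ℕ → ℕ → 𝔇
  H l h = Antidiagonal.conv A.commutativeRing h (λ i j → P′ i ⧢ G l j)

  H-0 : ∀ h → H 0 h ≋ P h
  H-0 h φ = trans (CommutativeRing.trans R {P′ R.* G 0} {P′ R.* R.1#} {P′} (R.*-congˡ {P′} {G 0} {R.1#} G-0) (R.*-identityʳ P′) h φ) (P≋ h φ)
    where
    R = PowerSeries.ring-PS A.commutativeRing
    module R = CommutativeRing R

  H-suc : ∀ l h → H (suc l) h ≋ G l h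
  H-suc l h = P-G l h

  G-∤ : ∀ k {h} → ¬ (m ∣ h) → G k h ≋ []
  G-∤ k {h} ¬d = W-∤ Y-∤ h ¬d (negBinomial k)

  H-∤ : ∀ l {h} → ¬ (m ∣ h) → H l h ≋ []
  H-∤ zero    {h} ¬d φ = trans (H-0 h φ) (cong (λ d → ∫ d φ) (P-∤ ¬d))
  H-∤ (suc l) {h} ¬d φ = trans (H-suc l h φ) (G-∤ l ¬d φ)

  -- ΔP(t) = Σ P_l ⊗ t^l P(t)^{1−l}.
  Δ-P : ∀ j Φ → ∫ (P j) (λ w → Δ-S w Φ) ≡ conv j (λ l h → ∫ (P l) (λ p → ∫ (H l h) (λ r → Φ (p , r))))
  Δ-P zero    Φ = trans (trans (∫-single [] λ w → Δ-S w Φ) (Δ-[] Φ))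
    (sym (trans (∫-single [] λ p → ∫ (H 0 0) λ r → Φ (p , r)) (trans (H-0 0 (λ r → Φ ([] , r))) (∫-single [] λ r → Φ ([] , r)))))
  Δ-P (suc j) Φ = by-cases (m ∣? suc j)
    where
    right : ℕ → ℕ → K
    right l h = ∫ (P l) (λ p → ∫ (H l h) (λ r → Φ (p , r)))
    by-cases : Dec (m ∣ suc j) → ∫ (P (suc j)) (λ w → Δ-S w Φ) ≡ conv (suc j) right
    by-cases (no ¬d) = trans (cong (λ d → ∫ d (λ w → Δ-S w Φ)) (P-∤ ¬d)) (sym (conv-zero (suc j) λ l h e → term l h e (m ∣? l)))
      where
      term : ∀ l h → l ℕ.+ h ≡ suc j → Dec (m ∣ l) → right l h ≡ 0#
      term l h e (no ¬l)  = cong (λ d → ∫ d (λ p → ∫ (H l h) (λ r → Φ (p , r)))) (P-∤ ¬l)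
      term l h e (yes l∣) = ∫-zero (P l) λ p → H-∤ l (λ h∣ → ¬d (subst (m ∣_) e (∣.∣m∣n⇒∣m+n l∣ h∣))) (λ r → Φ (p , r))
    by-cases (yes d) = begin
      ∫ (P (suc j)) (λ w → Δ-S w Φ)
        ≡⟨ cong (λ d → ∫ d (λ w → Δ-S w Φ)) (P-∣ d) ⟩
      ∫ ⟦ xₛ j ∷ [] ⟧ (λ w → Δ-S w Φ)
        ≡⟨ trans (∫-single (xₛ j ∷ []) λ w → Δ-S w Φ) (Δ-∷ (xₛ j) [] Φ) ⟩
      Φ ([] , xₛ j ∷ []) + δ (xₛ j) (λ l b → Δ-S [] (l ∣ b ▷ Φ))
        ≡⟨ cong₂ _+_ (sym head) (conv-cong j λ l h e → term l h e (m ∣? suc l)) ⟩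
      right 0 (suc j) + conv j (λ l h → right (suc l) h) ∎
      where
      head : right 0 (suc j) ≡ Φ ([] , xₛ j ∷ [])
      head = trans (∫-single [] λ p → ∫ (H 0 (suc j)) λ r → Φ (p , r)) (trans (H-0 (suc j) (λ r → Φ ([] , r)))
        (trans (cong (λ d → ∫ d (λ r → Φ ([] , r))) (P-∣ d)) (∫-single (xₛ j ∷ []) λ r → Φ ([] , r))))
      simplify : ∀ l h → ∫ (G l h) (λ b → Δ-S [] (xₛ l ∣ b ▷ Φ)) ≡ ∫ (G l h) (λ r → Φ (xₛ l ∷ [] , r))
      simplify l h = ∫-cong (G l h) λ b → trans (Δ-[] (xₛ l ∣ b ▷ Φ)) (S-[]ʳ b λ z → Φ (xₛ l ∷ [] , z))
      term : ∀ l h → l ℕ.+ h ≡ j → Dec (m ∣ suc l) → ∫ (G l h) (λ b → Δ-S [] (xₛ l ∣ b ▷ Φ)) ≡ right (suc l) h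
      term l h e (yes l∣) = trans (simplify l h) (sym (trans (cong (λ d → ∫ d (λ p → ∫ (H (suc l) h) λ r → Φ (p , r))) (P-∣ l∣))
        (trans (∫-single (xₛ l ∷ []) λ p → ∫ (H (suc l) h) λ r → Φ (p , r)) (H-suc l h λ r → Φ (xₛ l ∷ [] , r)))))
      -- If q - 1 divides l + h + 1 but not l + 1, it does not divide h, so the right factor
      -- vanishes too. Hence the coproduct of a letter of P involves only letters of P on the left.
      term l h e (no ¬l)  = trans (simplify l h) (trans
        (G-∤ l (λ h∣ → ¬l (∣.∣m+n∣m⇒∣n (subst (m ∣_) (trans (cong suc (sym e)) (ℕₚ.+-comm (suc l) h)) d) h∣)) (λ r → Φ (xₛ l ∷ [] , r)))
        (sym (cong (λ d → ∫ d (λ p → ∫ (H (suc l) h) λ r → Φ (p , r))) (P-∤ ¬l))))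

-- From single coefficients to the coproduct of a product of letters.

module TriangularSums (R : CommutativeRing 0ℓ 0ℓ) where
  open CommutativeRing R renaming (refl to ≈-refl; sym to ≈-sym; trans to ≈-trans)
  open IntegerSolver R
  open Antidiagonal R
  open Relation.Binary.Reasoning.Setoid setoid

  fsum : ℕ → (ℕ → Carrier) → Carrier
  fsum zero    f = 0#
  fsum (suc n) f = f 0 + fsum n (f ∘ suc)

  fsum-ext : ∀ n {f g} → (∀ i → f i ≈ g i) → fsum n f ≈ fsum n g
  fsum-ext zero    h = ≈-refl
  fsum-ext (suc n) h = +-cong (h 0) (fsum-ext n λ i → h (suc i))

  fsum-+ : ∀ n f g → fsum n (λ i → f i + g i) ≈ fsum n f + fsum n g
  fsum-+ zero    f g = ≈-sym (+-identityˡ 0#)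
  fsum-+ (suc n) f g = ≈-trans (+-congˡ (fsum-+ n _ _))
    (solve 4 (λ a b c d → (a :+ b) :+ (c :+ d) := (a :+ c) :+ (b :+ d)) ≈-refl (f 0) (g 0) (fsum n (f ∘ suc)) (fsum n (g ∘ suc)))

  fsum-*ˡ : ∀ n c f → c * fsum n f ≈ fsum n (λ i → c * f i)
  fsum-*ˡ zero    c f = zeroʳ c
  fsum-*ˡ (suc n) c f = ≈-trans (distribˡ c _ _) (+-congˡ (fsum-*ˡ n c (f ∘ suc)))

  conv-fsum : ∀ n k (f : ℕ → ℕ → ℕ → Carrier) → conv n (λ i j → fsum k (f i j)) ≈ fsum k (λ r → conv n (λ i j → f i j r))
  conv-fsum n zero    f = conv-zero n λ _ _ _ → ≈-refl
  conv-fsum n (suc k) f = ≈-trans (conv-+ n (λ i j → f i j 0) _) (+-congˡ (conv-fsum n k λ i j r → f i j (suc r)))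

  fsum-tail : ∀ n k f → (∀ i → n ℕ.< i → f i ≈ 0#) → fsum (suc (k ℕ.+ n)) f ≈ conv n (λ i _ → f i)
  fsum-tail zero    k f z = ≈-trans (+-congˡ (vanish (k ℕ.+ 0) (f ∘ suc) λ i → z (suc i) (ℕ.s≤s ℕ.z≤n))) (+-identityʳ _)
    where
    vanish : ∀ n g → (∀ i → g i ≈ 0#) → fsum n g ≈ 0#
    vanish zero    g h = ≈-refl
    vanish (suc n) g h = ≈-trans (+-cong (h 0) (vanish n (g ∘ suc) (h ∘ suc))) (+-identityˡ 0#)
  fsum-tail (suc n) k f z rewrite ℕₚ.+-suc k n = +-congˡ (fsum-tail n k (f ∘ suc) λ i l → z (suc i) (ℕ.s≤s l))

  -- A sum over a rectangle is regrouped by k + l; outside the rectangle f vanishes. The product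
  -- rule compares terms at fixed k + l, whereas the coproducts of two letters give a rectangle.
  triangular : ∀ i j f → (∀ k l → i ℕ.< k → f k l ≈ 0#) → (∀ k l → j ℕ.< l → f k l ≈ 0#) →
    conv i (λ k _ → conv j (λ l _ → f k l)) ≈ fsum (suc (i ℕ.+ j)) (λ n → conv n f)
  triangular zero    j f zi zj = begin
    conv j (λ l _ → f 0 l)
      ≈⟨ fsum-tail j 0 (f 0) (zj 0) ⟨
    fsum (suc j) (f 0)
      ≈⟨ fsum-ext (suc j) first-column ⟩
    fsum (suc j) (λ n → conv n f) ∎
    where
    first-column : ∀ n → f 0 n ≈ conv n f
    first-column zero    = ≈-refl
    first-column (suc n) = ≈-sym (≈-trans (+-congˡ (conv-zero n λ k l _ → zi (suc k) l (ℕ.s≤s ℕ.z≤n))) (+-identityʳ _))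
  triangular (suc i) j f zi zj = begin
    conv j (λ l _ → f 0 l) + conv i (λ k _ → conv j (λ l _ → f (suc k) l))
      ≈⟨ +-cong (≈-sym (fsum-tail j (suc i) (f 0) (zj 0))) (triangular i j (λ k → f (suc k)) (λ k l h → zi (suc k) l (ℕ.s≤s h)) (λ k l → zj (suc k) l)) ⟩
    (f 0 0 + fsum (suc (i ℕ.+ j)) (λ n → f 0 (suc n))) + fsum (suc (i ℕ.+ j)) (λ n → conv n (λ k → f (suc k)))
      ≈⟨ ≈-trans (+-assoc _ _ _) (+-congˡ (≈-sym (fsum-+ (suc (i ℕ.+ j)) (λ n → f 0 (suc n)) (λ n → conv n (λ k → f (suc k)))))) ⟩
    fsum (suc (suc i ℕ.+ j)) (λ n → conv n f) ∎

-- A family ρ k l of linear functionals, thought of as the coefficients of x_{k+1} P_l.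
module LinearFunctionals (q : ℕ) (𝔽 : FiniteField q) (A : 𝔽-Algebra q 𝔽) (Y : ℕ → 𝔽-Algebra.Carrier A)
  (Y-∤ : ∀ i → ¬ (FieldFacts.m q 𝔽 ∣ suc i) → 𝔽-Algebra._≈_ A (Y (suc i)) (𝔽-Algebra.0# A))
  (p : ℕ → 𝔽-Algebra.Carrier A) (P≈p : ∀ j → 𝔽-Algebra._≈_ A (CompositionSeries.P q 𝔽 A Y j) (p j))
  (p-additive : LetterCompatibility.IsAdditive q 𝔽 A Y Y-∤ p)
  where
  open FieldFacts q 𝔽 using (𝔽-ring; m)
  open PowerSums q 𝔽 using (κ)
  open BinomialModQ q 𝔽 using (𝔽-self)
  open CommutativeRing 𝔽-ring hiding (refl; sym; trans) renaming (Carrier to K)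
  open Antidiagonal 𝔽-ring
  open TriangularSums 𝔽-ring
  open CompositionSeries q 𝔽 A Y using (G; P)
  open LetterCompatibility q 𝔽 A Y Y-∤ using (E; E-coefficient; E-<; PE-coefficient; PE-<; module Compatible)
  open LetterOperator q 𝔽 𝔽-self using (K⋄)
  private
    module A = 𝔽-Algebra A
    module CA = Antidiagonal A.commutativeRing
    module S₁ = PowerSeries A.commutativeRing
    module R₁ = CommutativeRing S₁.ring-PS
    module E₁ = Algebra.Properties.Semiring.Exp R₁.semiring
  open E₁ using () renaming (_^_ to _^₁_)
  open Compatible p P≈p p-additive using (lhs≈rhs; lhs≈0)

  H : ℕ → ℕ → A.Carrier
  H l h = (P R₁.* G l) h

  module _ (ρ : ℕ → ℕ → A.Carrier → K)
    (ρ-cong : ∀ k l {d e} → d A.≈ e → ρ k l d ≡ ρ k l e)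
    (ρ-0 : ∀ k l → ρ k l A.0# ≡ 0#)
    (ρ-+ : ∀ k l d e → ρ k l (d A.+ e) ≡ ρ k l d + ρ k l e)
    (ρ-ι : ∀ k l c d → ρ k l (A.ι c A.* d) ≡ c * ρ k l d)
    (ρ-∤ : ∀ k {l} d → ¬ (m ∣ l) → ρ k l d ≡ 0#)
    where

    ρ-[] : ∀ k l {d} → d A.≈ A.0# → ρ k l d ≡ 0#
    ρ-[] k l h = trans (ρ-cong k l h) (ρ-0 k l)

    ρ-conv : ∀ k l n f → ρ k l (CA.conv n f) ≡ conv n (λ i j → ρ k l (f i j))
    ρ-conv k l zero    f = refl
    ρ-conv k l (suc n) f = trans (ρ-+ k l (f 0 (suc n)) _) (cong (_+_ (ρ k l (f 0 (suc n)))) (ρ-conv k l n λ i j → f (suc i) j))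

    []-*ˡ : ∀ {d} e → d A.≈ A.0# → d A.* e A.≈ A.0#
    []-*ˡ e h = A.trans (A.*-congʳ h) (A.zeroˡ e)

    []-*ʳ : ∀ d {e} → e A.≈ A.0# → d A.* e A.≈ A.0#
    []-*ʳ d h = A.trans (A.*-congˡ h) (A.zeroʳ d)

    open ≡-Reasoning

    -- Since E^k has order at least k, the rectangles on both sides extend to triangles. After
    -- exchanging the sums, `lhs≈rhs` applies for each fixed k and l, with the functional taken
    -- outside.
    letters-compatible : ∀ a b →
      K⋄ (a ℕ.+ b) a b (λ i j → conv i (λ k d → conv j (λ l h → ρ k l (G k d A.* H l h))))
      ≡ conv a (λ k₁ d₁ → conv b (λ k₂ d₂ → K⋄ (k₁ ℕ.+ k₂) k₁ k₂ (λ k l → ρ k l (G k₁ d₁ A.* G k₂ d₂))))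
    letters-compatible a b = begin
      K⋄ (a ℕ.+ b) a b (λ i j → conv i (λ k d → conv j (λ l h → ρ k l (G k d A.* H l h))))
        ≡⟨ conv-cong n (λ i j e → cong (κ a b j *_) (trans (triangle i j) (cong (λ n → fsum (suc n) (λ r → conv r (f i j))) e))) ⟩
      conv n (λ i j → κ a b j * fsum (suc n) (λ r → conv r (f i j)))
        ≡⟨ trans (conv-ext n λ i j → fsum-*ˡ (suc n) (κ a b j) λ r → conv r (f i j)) (conv-fsum n (suc n) λ i j r → κ a b j * conv r (f i j)) ⟩
      fsum (suc n) (λ r → conv n (λ i j → κ a b j * conv r (f i j)))
        ≡⟨ fsum-ext (suc n) (λ r → trans (conv-ext n λ i j → conv-*ˡ r (κ a b j) (f i j)) (trans (conv-swap n r λ i j k l → κ a b j * f i j k l)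
             (conv-ext r λ k l → sym (trans (ρ-conv k l n λ i j → A.ι (κ a b j) A.* X k l i j) (conv-ext n λ i j → ρ-ι k l (κ a b j) (X k l i j)))))) ⟩
      fsum (suc n) (λ r → conv r (λ k l → ρ k l (left k l)))
        -- The term k = l = 0 has no partner on the other side, where k + l = k₁ + k₂ + 1; it
        -- vanishes by `lhs≈0`.
        ≡⟨ trans (cong (_+ fsum n (λ N → conv (suc N) (λ k l → ρ k l (left k l)))) (ρ-[] 0 0 (lhs≈0 0 0 (m ∣.∣0) refl a b))) (+-identityˡ _) ⟩
      fsum n (λ N → conv (suc N) (λ k l → ρ k l (left k l)))
        ≡⟨ fsum-ext n (λ N → conv-cong (suc N) (same N)) ⟩
      fsum n (λ N → conv (suc N) (λ k l → conv N (λ k₁ k₂ → κ k₁ k₂ l * ρ k l (E² k₁ k₂))))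
        ≡⟨ fsum-ext n (λ N → trans (conv-swap (suc N) N λ k l k₁ k₂ → κ k₁ k₂ l * ρ k l (E² k₁ k₂))
             (conv-cong N λ k₁ k₂ e → cong (λ N → K⋄ N k₁ k₂ (λ k l → ρ k l (E² k₁ k₂))) (sym e))) ⟩
      fsum n (λ N → conv N g)
        ≡⟨ triangular a b g
             (λ k₁ k₂ h → conv-zero (suc (k₁ ℕ.+ k₂)) λ k l _ → trans (cong (κ k₁ k₂ l *_) (ρ-[] k l ([]-*ˡ ((E ^₁ k₂) b) (E-< k₁ h)))) (zeroʳ _))
             (λ k₁ k₂ h → conv-zero (suc (k₁ ℕ.+ k₂)) λ k l _ → trans (cong (κ k₁ k₂ l *_) (ρ-[] k l ([]-*ʳ ((E ^₁ k₁) a) (E-< k₂ h)))) (zeroʳ _)) ⟨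
      conv a (λ k₁ _ → conv b (λ k₂ _ → g k₁ k₂))
        ≡⟨ conv-cong a (λ k₁ d₁ e₁ → conv-cong b λ k₂ d₂ e₂ → conv-ext (suc (k₁ ℕ.+ k₂)) λ k l → cong (κ k₁ k₂ l *_)
             (ρ-cong k l (A.*-cong (E-at k₁ d₁ e₁) (E-at k₂ d₂ e₂)))) ⟩
      conv a (λ k₁ d₁ → conv b (λ k₂ d₂ → K⋄ (k₁ ℕ.+ k₂) k₁ k₂ (λ k l → ρ k l (G k₁ d₁ A.* G k₂ d₂)))) ∎
      where
      n = suc (a ℕ.+ b)
      X : ℕ → ℕ → ℕ → ℕ → A.Carrier
      X k l i j = (E ^₁ k) i A.* (P R₁.* E ^₁ l) j
      f : ℕ → ℕ → ℕ → ℕ → K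
      f i j k l = ρ k l (X k l i j)
      left : ℕ → ℕ → A.Carrier
      left k l = CA.conv n (λ i j → A.ι (κ a b j) A.* X k l i j)
      E² : ℕ → ℕ → A.Carrier
      E² k₁ k₂ = (E ^₁ k₁) a A.* (E ^₁ k₂) b
      g : ℕ → ℕ → K
      g k₁ k₂ = K⋄ (k₁ ℕ.+ k₂) k₁ k₂ (λ k l → ρ k l (E² k₁ k₂))
      E-at : ∀ k {i} d → k ℕ.+ d ≡ i → (E ^₁ k) i A.≈ G k d
      E-at k d refl = E-coefficient k d
      PE-at : ∀ l {j} h → l ℕ.+ h ≡ j → (P R₁.* E ^₁ l) j A.≈ H l h
      PE-at l h refl = PE-coefficient l h
      triangle : ∀ i j → conv i (λ k d → conv j (λ l h → ρ k l (G k d A.* H l h))) ≡ fsum (suc (i ℕ.+ j)) (λ r → conv r (f i j))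
      triangle i j = trans
        (conv-cong i λ k d e → conv-cong j λ l h e′ → sym (ρ-cong k l
          (A.*-cong (E-at k d e) (PE-at l h e′))))
        (triangular i j (f i j) (λ k l h → ρ-[] k l ([]-*ˡ ((P R₁.* E ^₁ l) j) (E-< k h))) (λ k l h → ρ-[] k l ([]-*ʳ ((E ^₁ k) i) (PE-< l h))))
      same : ∀ N k l → k ℕ.+ l ≡ suc N → ρ k l (left k l) ≡ conv N (λ k₁ k₂ → κ k₁ k₂ l * ρ k l (E² k₁ k₂))
      same N k l e = by-cases (m ∣? l)
        where
        by-cases : Dec (m ∣ l) → ρ k l (left k l) ≡ conv N (λ k₁ k₂ → κ k₁ k₂ l * ρ k l (E² k₁ k₂))
        by-cases (yes d) = trans (ρ-cong k l (lhs≈rhs k l d N e a b))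
          (trans (ρ-conv k l N λ k₁ k₂ → A.ι (κ k₁ k₂ l) A.* E² k₁ k₂) (conv-ext N λ k₁ k₂ → ρ-ι k l (κ k₁ k₂ l) (E² k₁ k₂)))
        by-cases (no ¬d) = trans (ρ-∤ k (left k l) ¬d) (sym (conv-zero N λ k₁ k₂ _ → trans (cong (κ k₁ k₂ l *_) (ρ-∤ k (E² k₁ k₂) ¬d)) (zeroʳ _)))

-- Compatibility of the coproduct with the diamond product of letters.

module CoproductProduct (q : ℕ) (𝔽 : FiniteField q) where
  open Construction q 𝔽 using (Letter; letter; Word; 𝔇; scale; _⧢_)
  open FieldFacts q 𝔽 using (𝔽-ring; m)
  open PowerSums q 𝔽 using (κ)
  open BinomialModQ q 𝔽 using (𝔽-self)
  open CommutativeRing 𝔽-ring hiding (refl; sym; trans) renaming (Carrier to K)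
  open Antidiagonal 𝔽-ring
  open Pairing q 𝔽
  open Shuffle q 𝔽
  open LetterProducts q 𝔽 using (P; P-∤; _≋_; dl-K⋄; module LinearImage)
  open ShuffleAlgebra q 𝔽 using (algebra-𝔇; scale-ι)
  open Coproduct q 𝔽
  open CompositionSeries q 𝔽 algebra-𝔇 Y using (G)
  open LetterCompatibility q 𝔽 algebra-𝔇 Y Y-∤ using (A₂; emb; emb-cong; emb-0; emb-+; emb-*)
  open LetterOperator q 𝔽 𝔽-self using (K⋄)
  open ≡-Reasoning
  private
    module A = 𝔽-Algebra algebra-𝔇
    module A₂ = 𝔽-Algebra A₂
    emb-scale : ∀ c d → emb (scale c d) A₂.≈ A₂.ι c A₂.* emb d
    emb-scale c d = A₂.trans {emb (scale c d)} {emb (A.ι c ⧢ d)} {emb (A.ι c) A₂.* emb d}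
      (emb-cong {scale c d} {A.ι c ⧢ d} (scale-ι c d)) (emb-* (A.ι c) d)
    module Image = LinearImage A₂ emb (λ {d} {e} → emb-cong {d} {e}) emb-0 emb-+ emb-scale
  open LinearFunctionals q 𝔽 algebra-𝔇 Y Y-∤ P P≋ Image.P-additive using (letters-compatible)

  -- Only terms whose left factor has a first letter coming from x ⋄ y are compared, hence `δ`
  -- instead of the full coproduct on first letters. `Ψ` receives that letter, the remaining left
  -- word and the right factor separately, so that surrounding words can be attached later.
  coproduct-⋄ : ∀ x y (Ψ : Letter → Word → Word → K) →
    ∫₂ (dl x y) (λ l r → δ l (λ l′ e → Δ-S r (λ pr → S e (proj₂ pr) (Ψ l′ (proj₁ pr)))))
    ≡ δ x (λ l₁ e₁ → δ y (λ l₂ e₂ → ∫₂ (dl l₁ l₂) (λ l′ r → S e₁ e₂ (Ψ l′ r))))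
  coproduct-⋄ x@(letter a α hα) y@(letter b β hβ) Ψ = begin
    ∫₂ (dl x y) (λ l r → δ l (λ l′ e → Δ-S r (λ pr → S e (proj₂ pr) (Ψ l′ (proj₁ pr)))))
      ≡⟨ dl-K⋄ x y (λ l r → δ l (λ l′ e → Δ-S r (λ pr → S e (proj₂ pr) (Ψ l′ (proj₁ pr))))) ⟩
    K⋄ (a ℕ.+ b) a b (λ i j → ∫ (P j) (λ r → δ (withWeight i x y) (λ l′ e → Δ-S r (λ pr → S e (proj₂ pr) (Ψ l′ (proj₁ pr))))))
      ≡⟨ conv-ext (suc (a ℕ.+ b)) (λ i j → cong (κ a b j *_) (left i j)) ⟩
    K⋄ (a ℕ.+ b) a b (λ i j → conv i (λ k d → conv j (λ l h → ρ k l (G k d ⧢ H l h))))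
      ≡⟨ letters-compatible ρ ρ-cong ρ-0 ρ-+ ρ-ι ρ-∤ a b ⟩
    conv a (λ k₁ d₁ → conv b (λ k₂ d₂ → K⋄ (k₁ ℕ.+ k₂) k₁ k₂ (λ k l → ρ k l (G k₁ d₁ ⧢ G k₂ d₂))))
      ≡⟨ conv-ext a right ⟨
    δ x (λ l₁ e₁ → δ y (λ l₂ e₂ → ∫₂ (dl l₁ l₂) (λ l′ r → S e₁ e₂ (Ψ l′ r)))) ∎
    where
    Ψₖ : ℕ → Word → Word → K
    Ψₖ k = Ψ (withWeight k x y)
    ρ : ℕ → ℕ → 𝔇 → K
    ρ k l d = ∫ (P l) (λ p → ∫ d (Ψₖ k p))
    ρ-cong : ∀ k l {d e} → d ≋ e → ρ k l d ≡ ρ k l e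
    ρ-cong k l h = ∫-cong (P l) λ p → h (Ψₖ k p)
    ρ-0 : ∀ k l → ρ k l [] ≡ 0#
    ρ-0 k l = ∫-zero (P l) λ _ → refl
    ρ-+ : ∀ k l d e → ρ k l (d ++ e) ≡ ρ k l d + ρ k l e
    ρ-+ k l d e = trans (∫-cong (P l) λ p → ∫-++ d e (Ψₖ k p)) (∫-+ (P l) (λ p → ∫ d (Ψₖ k p)) (λ p → ∫ e (Ψₖ k p)))
    ρ-ι : ∀ k l c d → ρ k l (A.ι c ⧢ d) ≡ c * ρ k l d
    ρ-ι k l c d = trans (∫-cong (P l) λ p → trans (sym (scale-ι c d (Ψₖ k p))) (∫-scale c d (Ψₖ k p))) (∫-* (P l) c λ p → ∫ d (Ψₖ k p))
    ρ-∤ : ∀ k {l} d → ¬ (m ∣ l) → ρ k l d ≡ 0#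
    ρ-∤ k d ¬l = cong (λ e → ∫ e (λ p → ∫ d (Ψₖ k p))) (P-∤ ¬l)
    left : ∀ i j → ∫ (P j) (λ r → δ (withWeight i x y) (λ l′ e → Δ-S r (λ pr → S e (proj₂ pr) (Ψ l′ (proj₁ pr)))))
      ≡ conv i (λ k d → conv j (λ l h → ρ k l (G k d ⧢ H l h)))
    left i j = trans (∫-δ (P j) (withWeight i x y) (λ r l′ e → Δ-S r (λ pr → S e (proj₂ pr) (Ψ l′ (proj₁ pr))))) (conv-ext i λ k d →
      trans (∫-cong (G k d) λ e → Δ-P j (λ pr → S e (proj₂ pr) (Ψₖ k (proj₁ pr))))
      (trans (∫-conv (G k d) j λ l h e → ∫ (P l) (λ p → ∫ (H l h) (λ r → S e r (Ψₖ k p)))) (conv-ext j λ l h →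
        trans (∫-swap (G k d) (P l) λ e p → ∫ (H l h) (λ r → S e r (Ψₖ k p)))
              (∫-cong (P l) λ p → sym (∫-⧢ (G k d) (H l h) (Ψₖ k p))))))
    right : ∀ k₁ d₁ → ∫ (G k₁ d₁) (λ e₁ → conv b (λ k₂ d₂ → ∫ (G k₂ d₂) (λ e₂ → ∫₂ (dl (letter k₁ α hα) (letter k₂ β hβ)) (λ l′ r → S e₁ e₂ (Ψ l′ r)))))
      ≡ conv b (λ k₂ d₂ → K⋄ (k₁ ℕ.+ k₂) k₁ k₂ (λ k l → ρ k l (G k₁ d₁ ⧢ G k₂ d₂)))
    right k₁ d₁ = trans
      (∫-conv (G k₁ d₁) b λ k₂ d₂ e₁ → ∫ (G k₂ d₂) (λ e₂ → ∫₂ (dl (letter k₁ α hα) (letter k₂ β hβ)) (λ l′ r → S e₁ e₂ (Ψ l′ r))))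
      (conv-ext b λ k₂ d₂ → trans
        (∫-cong (G k₁ d₁) λ e₁ → ∫-cong (G k₂ d₂) λ e₂ → sym (∫-swap (sh e₁ e₂) (dl (letter k₁ α hα) (letter k₂ β hβ)) λ e p → Ψ (proj₁ p) (proj₂ p) e))
        (trans (sym (∫-⧢ (G k₁ d₁) (G k₂ d₂) λ e → ∫₂ (dl (letter k₁ α hα) (letter k₂ β hβ)) (λ l′ r → Ψ l′ r e)))
               (dl-out (G k₁ d₁ ⧢ G k₂ d₂) k₁ k₂)))
      where
      dl-out : ∀ d k₁ k₂ → ∫ d (λ e → ∫₂ (dl (letter k₁ α hα) (letter k₂ β hβ)) (λ l′ r → Ψ l′ r e)) ≡ K⋄ (k₁ ℕ.+ k₂) k₁ k₂ (λ k l → ρ k l d)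
      dl-out d k₁ k₂ = trans (∫-swap d (dl (letter k₁ α hα) (letter k₂ β hβ)) λ e p → Ψ (proj₁ p) (proj₂ p) e)
        (dl-K⋄ (letter k₁ α hα) (letter k₂ β hβ) (λ l′ r → ∫ d (Ψ l′ r)))

-- Multiplicativity of the coproduct on words.

module CoproductMultiplicative (q : ℕ) (𝔽 : FiniteField q) where
  open Construction q 𝔽 using (Letter; letter; Word; Δw)
  open FieldFacts q 𝔽 using (𝔽-ring)
  open CommutativeRing 𝔽-ring hiding (refl; sym; trans) renaming (Carrier to K)
  open IntegerSolver 𝔽-ring
  open Antidiagonal 𝔽-ring
  open Pairing q 𝔽
  open Shuffle q 𝔽
  open ShuffleLaws q 𝔽 using (S-comm; dl-length)
  open LetterProducts q 𝔽 using (convL; ∫-convL)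
  open ShuffleAlgebra q 𝔽 using (algebra-𝔇; S-assoc; S²)
  open Coproduct q 𝔽
  open CompositionSeries q 𝔽 algebra-𝔇 Y using (G)
  open CoproductProduct q 𝔽 using (coproduct-⋄)
  open ≡-Reasoning

  -- `δ` as a formal combination, so that it can be exchanged with other sums by `∫-swap`.
  δL : Letter → FM (Letter × Word)
  δL (letter n ε hε) = convL n (λ k d → map (λ p → proj₁ p , letter k ε hε , proj₂ p) (G k d))

  ∫-δL : ∀ x ψ → ∫₂ (δL x) ψ ≡ δ x ψ
  ∫-δL (letter n ε hε) ψ = trans (∫-convL n (λ k d → map (λ p → proj₁ p , letter k ε hε , proj₂ p) (G k d)) (λ p → ψ (proj₁ p) (proj₂ p)))
    (conv-ext n λ k d → ∫-map (letter k ε hε ,_) (λ p → proj₁ p , letter k ε hε , proj₂ p) (λ _ → refl) (G k d) (λ p → ψ (proj₁ p) (proj₂ p)))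

  Δ-∷′ : ∀ x v Φ → Δ-S (x ∷ v) Φ ≡ Φ ([] , x ∷ v) + ∫₂ (δL x) (λ l b → Δ-S v (l ∣ b ▷ Φ))
  Δ-∷′ x v Φ = trans (Δ-∷ x v Φ) (cong (_+_ (Φ ([] , x ∷ v))) (sym (∫-δL x λ l b → Δ-S v (l ∣ b ▷ Φ))))

  S-interchange : ∀ e₁ r₁ e₂ r₂ χ →
    S e₁ r₁ (λ z₁ → S e₂ r₂ (λ z₂ → S z₁ z₂ χ)) ≡ S e₁ e₂ (λ z → S r₁ r₂ (λ w → S z w χ))
  S-interchange e₁ r₁ e₂ r₂ χ = begin
    S e₁ r₁ (λ z₁ → S e₂ r₂ (λ z₂ → S z₁ z₂ χ))
      ≡⟨ (S-cong e₁ r₁ λ z₁ → S-assoc z₁ e₂ r₂ χ) ⟨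
    S e₁ r₁ (λ z₁ → S z₁ e₂ (λ z → S z r₂ χ))
      ≡⟨ S-assoc e₁ r₁ e₂ (λ z → S z r₂ χ) ⟩
    S r₁ e₂ (λ y → S e₁ y (λ z → S z r₂ χ))
      ≡⟨ S-comm r₁ e₂ _ ⟩
    S e₂ r₁ (λ y → S e₁ y (λ z → S z r₂ χ))
      ≡⟨ S-assoc e₁ e₂ r₁ (λ z → S z r₂ χ) ⟨
    S e₁ e₂ (λ z → S z r₁ (λ y → S y r₂ χ))
      ≡⟨ (S-cong e₁ e₂ λ z → S-assoc z r₁ r₂ χ) ⟩
    S e₁ e₂ (λ z → S r₁ r₂ (λ w → S z w χ)) ∎

  S-swapˡ : ∀ u e r χ → S u r (λ w → S e w χ) ≡ S e r (λ z → S u z χ)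
  S-swapˡ u e r χ = begin
    S u r (λ w → S e w χ)  ≡⟨ S-comm u r _ ⟩
    S r u (λ w → S e w χ)  ≡⟨ S-assoc e r u χ ⟨
    S e r (λ z → S z u χ)  ≡⟨ (S-cong e r λ z → S-comm z u χ) ⟩
    S e r (λ z → S u z χ)  ∎

  -- What a first letter of the second factor adds to a shuffle product.
  extra : Letter → Word → Word → (Word → K) → K
  extra l p []      φ = 0#
  extra l p (y ∷ v) φ = S (l ∷ p) v (y ◁ φ) + S p v (⋄-term l y φ)

  S-extra : ∀ l p v φ → S (l ∷ p) v φ ≡ S p v (l ◁ φ) + extra l p v φ
  S-extra l p []      φ = trans (S-[]ʳ (l ∷ p) φ) (sym (trans (+-identityʳ _) (S-[]ʳ p (l ◁ φ))))
  S-extra l p (y ∷ v) φ = S-∷∷ l p y v φ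

  Multiplicative : ℕ → Set
  Multiplicative n = ∀ u v → length u ℕ.+ length v ℕ.≤ n → ∀ Φ →
    S u v (λ z → Δ-S z Φ) ≡ Δ-S u (λ a → Δ-S v (λ b → S² a b Φ))

  module Step (n : ℕ) (ih : Multiplicative n) (x : Letter) (a : Word) (y : Letter) (b : Word)
    (le : suc (length a ℕ.+ length b) ℕ.≤ n) (Φ : Word × Word → K) where

    ξ η : FM (Letter × Word)
    ξ = δL x
    η = δL y

    Φ₀ : Word → K
    Φ₀ z = Φ ([] , z)

    -- The terms are sorted by their left tensor factor: empty, or with first letter coming from x,
    -- from y, or from x ⋄ y.
    T₀ X′ Y′ D′ : K
    T₀ = S (x ∷ a) (y ∷ b) Φ₀
    X′ = ∫₂ ξ (λ l e → Δ-S a (λ U → Δ-S (y ∷ b) (λ V → S² U V (l ∣ e ▷ Φ))))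
    Y′ = ∫₂ η (λ l e → Δ-S (x ∷ a) (λ U → Δ-S b (λ V → S² U V (l ∣ e ▷ Φ))))
    D′ = S a b (λ w → ∫₂ (dl x y) (λ l r → S r w (λ t → ∫₂ (δL l) (λ l′ e → Δ-S t (l′ ∣ e ▷ Φ)))))

    left : S (x ∷ a) (y ∷ b) (λ z → Δ-S z Φ) ≡ T₀ + (X′ + (Y′ + D′))
    left = begin
      S (x ∷ a) (y ∷ b) (λ z → Δ-S z Φ)
        ≡⟨ S-∷∷ x a y b (λ z → Δ-S z Φ) ⟩
      S a (y ∷ b) (λ z → Δ-S (x ∷ z) Φ) + (S (x ∷ a) b (λ z → Δ-S (y ∷ z) Φ) + S a b (⋄-term x y (λ z → Δ-S z Φ)))
        ≡⟨ cong₂ _+_ (part x a (y ∷ b) (ℕₚ.≤-trans (ℕₚ.≤-reflexive (ℕₚ.+-suc (length a) (length b))) le))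
             (cong₂ _+_ (part y (x ∷ a) b le) diamond) ⟩
      (S a (y ∷ b) (x ◁ Φ₀) + X′) + ((S (x ∷ a) b (y ◁ Φ₀) + Y′) + (S a b (⋄-term x y Φ₀) + D′))
        ≡⟨ solve 6 (λ p x r y s d → (p :+ x) :+ ((r :+ y) :+ (s :+ d)) := (p :+ (r :+ s)) :+ (x :+ (y :+ d))) refl
             (S a (y ∷ b) (x ◁ Φ₀)) X′ (S (x ∷ a) b (y ◁ Φ₀)) Y′ (S a b (⋄-term x y Φ₀)) D′ ⟩
      (S a (y ∷ b) (x ◁ Φ₀) + (S (x ∷ a) b (y ◁ Φ₀) + S a b (⋄-term x y Φ₀))) + (X′ + (Y′ + D′))
        ≡⟨ cong (_+ (X′ + (Y′ + D′))) (S-∷∷ x a y b Φ₀) ⟨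
      T₀ + (X′ + (Y′ + D′)) ∎
      where
      part : ∀ x u v → length u ℕ.+ length v ℕ.≤ n → S u v (λ z → Δ-S (x ∷ z) Φ) ≡
        S u v (x ◁ Φ₀) + ∫₂ (δL x) (λ l e → Δ-S u (λ U → Δ-S v (λ V → S² U V (l ∣ e ▷ Φ))))
      part x u v le = trans (S-cong u v λ z → Δ-∷′ x z Φ) (trans (∫-+ (sh u v) (x ◁ Φ₀) (λ z → ∫₂ (δL x) (λ l e → Δ-S z (l ∣ e ▷ Φ))))
        (cong (_+_ (S u v (x ◁ Φ₀))) (trans (∫-swap (sh u v) (δL x) λ z p → Δ-S z (proj₁ p ∣ proj₂ p ▷ Φ))
          (∫-cong (δL x) λ p → ih u v le (proj₁ p ∣ proj₂ p ▷ Φ)))))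
      rest : Letter → Word → K
      rest l t = ∫₂ (δL l) (λ l′ e → Δ-S t (l′ ∣ e ▷ Φ))
      diamond : S a b (⋄-term x y (λ z → Δ-S z Φ)) ≡ S a b (⋄-term x y Φ₀) + D′
      diamond = trans (S-cong a b λ w → trans
          (∫-cong (dl x y) λ p → trans (S-cong (proj₂ p) w λ t → Δ-∷′ (proj₁ p) t Φ) (∫-+ (sh (proj₂ p) w) (proj₁ p ◁ Φ₀) (rest (proj₁ p))))
          (∫-+ (dl x y) (λ p → S (proj₂ p) w (proj₁ p ◁ Φ₀)) (λ p → S (proj₂ p) w (rest (proj₁ p)))))
        (∫-+ (sh a b) (⋄-term x y Φ₀) (λ w → ∫₂ (dl x y) (λ l r → S r w (rest l))))

    -- The same sorting for the product of the coproducts. Terms whose first letter comes from y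
    -- split in two: in `Y₀` the first word contributes 1 ⊗ x a, in `Y₁` it contributes a nonempty
    -- left factor.
    Y₀ X Y₁ D : K
    Y₀ = ∫₂ η (λ l e → Δ-S b (λ V → S e (proj₂ V) (λ z → S (x ∷ a) z (λ w → Φ (l ∷ proj₁ V , w)))))
    X  = ∫₂ ξ (λ l e → Δ-S a (λ U → S e (proj₂ U) (λ z → Δ-S (y ∷ b) (λ V → S (proj₁ U) (proj₁ V) (λ w → S z (proj₂ V) (λ w′ → Φ (l ∷ w , w′)))))))
    Y₁ = ∫₂ ξ (λ l e → Δ-S a (λ U → S e (proj₂ U) (λ z → ∫₂ η (λ l₂ e₂ → Δ-S b (λ V → S e₂ (proj₂ V) (λ z₂ →
           S (l ∷ proj₁ U) (proj₁ V) (λ w → S z z₂ (λ w′ → Φ (l₂ ∷ w , w′)))))))))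
    D  = ∫₂ ξ (λ l e → Δ-S a (λ U → S e (proj₂ U) (λ z → ∫₂ η (λ l₂ e₂ → Δ-S b (λ V → S e₂ (proj₂ V) (λ z₂ →
           S (proj₁ U) (proj₁ V) (⋄-term l l₂ (λ w → S z z₂ (λ w′ → Φ (w , w′))))))))))

    right : Δ-S (x ∷ a) (λ U → Δ-S (y ∷ b) (λ V → S² U V Φ)) ≡ T₀ + (X + ((Y₀ + Y₁) + D))
    right = begin
      Δ-S (x ∷ a) (λ U → Δ-S (y ∷ b) (λ V → S² U V Φ))
        ≡⟨ Δ-∷′ x a (λ U → Δ-S (y ∷ b) (λ V → S² U V Φ)) ⟩
      Δ-S (y ∷ b) (λ V → S² ([] , x ∷ a) V Φ) + ∫₂ ξ (λ l e → Δ-S a (λ U → S e (proj₂ U) (λ z → Δ-S (y ∷ b) (λ V → S² (l ∷ proj₁ U , z) V Φ))))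
        ≡⟨ cong₂ _+_ first second ⟩
      (T₀ + Y₀) + (X + (Y₁ + D))
        ≡⟨ solve 5 (λ t y x y′ d → (t :+ y) :+ (x :+ (y′ :+ d)) := t :+ (x :+ ((y :+ y′) :+ d))) refl T₀ Y₀ X Y₁ D ⟩
      T₀ + (X + ((Y₀ + Y₁) + D)) ∎
      where
      first : Δ-S (y ∷ b) (λ V → S² ([] , x ∷ a) V Φ) ≡ T₀ + Y₀
      first = trans (Δ-∷′ y b (λ V → S² ([] , x ∷ a) V Φ)) (cong₂ _+_ (S-[]ˡ [] (λ w → S (x ∷ a) (y ∷ b) (λ w′ → Φ (w , w′))))
        (∫-cong η λ p → ∫-cong (Δw b) λ V → S-cong (proj₂ p) (proj₂ V) λ z → S-[]ˡ (proj₁ p ∷ proj₁ V) (λ w → S (x ∷ a) z (λ w′ → Φ (w , w′)))))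
      module _ (l : Letter) (p z : Word) where
        χ : Word → Word → K
        χ v₂ w = S z v₂ (λ w′ → Φ (w , w′))
        extraΔ : Δ-S (y ∷ b) (λ V → extra l p (proj₁ V) (χ (proj₂ V))) ≡
          ∫₂ η (λ l₂ e₂ → Δ-S b (λ V → S e₂ (proj₂ V) (λ z₂ → S (l ∷ p) (proj₁ V) (l₂ ◁ χ z₂))))
          + ∫₂ η (λ l₂ e₂ → Δ-S b (λ V → S e₂ (proj₂ V) (λ z₂ → S p (proj₁ V) (⋄-term l l₂ (χ z₂)))))
        extraΔ = trans (Δ-∷′ y b (λ V → extra l p (proj₁ V) (χ (proj₂ V)))) (trans (+-identityˡ _)
          (trans (∫-cong η λ q′ → trans (∫-cong (Δw b) λ V → ∫-+ (sh (proj₂ q′) (proj₂ V)) (λ z₂ → S (l ∷ p) (proj₁ V) (proj₁ q′ ◁ χ z₂)) (λ z₂ → S p (proj₁ V) (⋄-term l (proj₁ q′) (χ z₂))))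
              (∫-+ (Δw b) (λ V → S (proj₂ q′) (proj₂ V) (λ z₂ → S (l ∷ p) (proj₁ V) (proj₁ q′ ◁ χ z₂))) (λ V → S (proj₂ q′) (proj₂ V) (λ z₂ → S p (proj₁ V) (⋄-term l (proj₁ q′) (χ z₂))))))
            (∫-+ η (λ q′ → Δ-S b (λ V → S (proj₂ q′) (proj₂ V) (λ z₂ → S (l ∷ p) (proj₁ V) (proj₁ q′ ◁ χ z₂)))) (λ q′ → Δ-S b (λ V → S (proj₂ q′) (proj₂ V) (λ z₂ → S p (proj₁ V) (⋄-term l (proj₁ q′) (χ z₂))))))))
        expand : Δ-S (y ∷ b) (λ V → S² (l ∷ p , z) V Φ) ≡ Δ-S (y ∷ b) (λ V → S p (proj₁ V) (l ◁ χ (proj₂ V)))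
          + (∫₂ η (λ l₂ e₂ → Δ-S b (λ V → S e₂ (proj₂ V) (λ z₂ → S (l ∷ p) (proj₁ V) (l₂ ◁ χ z₂))))
          + ∫₂ η (λ l₂ e₂ → Δ-S b (λ V → S e₂ (proj₂ V) (λ z₂ → S p (proj₁ V) (⋄-term l l₂ (χ z₂))))))
        expand = trans (∫-cong (Δw (y ∷ b)) λ V → S-extra l p (proj₁ V) (χ (proj₂ V)))
          (trans (∫-+ (Δw (y ∷ b)) (λ V → S p (proj₁ V) (l ◁ χ (proj₂ V))) (λ V → extra l p (proj₁ V) (χ (proj₂ V))))
                 (cong (_+_ (Δ-S (y ∷ b) (λ V → S p (proj₁ V) (l ◁ χ (proj₂ V))))) extraΔ))
      nest : (Letter → Word → Word → K) → K
      nest f = ∫₂ ξ (λ l e → Δ-S a (λ U → S e (proj₂ U) (f l (proj₁ U))))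
      nest-+ : ∀ f g → nest (λ l p z → f l p z + g l p z) ≡ nest f + nest g
      nest-+ f g = trans (∫-cong ξ λ q′ → trans (∫-cong (Δw a) λ U → ∫-+ (sh (proj₂ q′) (proj₂ U)) (f (proj₁ q′) (proj₁ U)) (g (proj₁ q′) (proj₁ U)))
          (∫-+ (Δw a) (λ U → S (proj₂ q′) (proj₂ U) (f (proj₁ q′) (proj₁ U))) (λ U → S (proj₂ q′) (proj₂ U) (g (proj₁ q′) (proj₁ U)))))
        (∫-+ ξ (λ q′ → Δ-S a (λ U → S (proj₂ q′) (proj₂ U) (f (proj₁ q′) (proj₁ U)))) (λ q′ → Δ-S a (λ U → S (proj₂ q′) (proj₂ U) (g (proj₁ q′) (proj₁ U)))))
      fX fY fD : Letter → Word → Word → K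
      fX l p z = Δ-S (y ∷ b) (λ V → S p (proj₁ V) (l ◁ χ l p z (proj₂ V)))
      fY l p z = ∫₂ η (λ l₂ e₂ → Δ-S b (λ V → S e₂ (proj₂ V) (λ z₂ → S (l ∷ p) (proj₁ V) (l₂ ◁ χ l p z z₂))))
      fD l p z = ∫₂ η (λ l₂ e₂ → Δ-S b (λ V → S e₂ (proj₂ V) (λ z₂ → S p (proj₁ V) (⋄-term l l₂ (χ l p z z₂)))))
      second : nest (λ l p z → Δ-S (y ∷ b) (λ V → S² (l ∷ p , z) V Φ)) ≡ X + (Y₁ + D)
      second = trans (∫-cong ξ λ q′ → ∫-cong (Δw a) λ U → S-cong (proj₂ q′) (proj₂ U) λ z → expand (proj₁ q′) (proj₁ U) z)
        (trans (nest-+ fX (λ l p z → fY l p z + fD l p z)) (cong (_+_ (nest fX)) (nest-+ fY fD)))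

    X≡ : X′ ≡ X
    X≡ = ∫-cong ξ λ q′ → ∫-cong (Δw a) λ U → sym (begin
      S (proj₂ q′) (proj₂ U) (λ z → Δ-S (y ∷ b) (λ V → S (proj₁ U) (proj₁ V) (λ w → S z (proj₂ V) (λ w′ → Φ (proj₁ q′ ∷ w , w′)))))
        ≡⟨ ∫-swap (sh (proj₂ q′) (proj₂ U)) (Δw (y ∷ b)) (λ z V → S (proj₁ U) (proj₁ V) (λ w → S z (proj₂ V) (λ w′ → Φ (proj₁ q′ ∷ w , w′)))) ⟩
      Δ-S (y ∷ b) (λ V → S (proj₂ q′) (proj₂ U) (λ z → S (proj₁ U) (proj₁ V) (λ w → S z (proj₂ V) (λ w′ → Φ (proj₁ q′ ∷ w , w′)))))
        ≡⟨ (∫-cong (Δw (y ∷ b)) λ V → trans (∫-swap (sh (proj₂ q′) (proj₂ U)) (sh (proj₁ U) (proj₁ V)) (λ z w → S z (proj₂ V) (λ w′ → Φ (proj₁ q′ ∷ w , w′))))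
             (S-cong (proj₁ U) (proj₁ V) λ w → S-assoc (proj₂ q′) (proj₂ U) (proj₂ V) (λ w′ → Φ (proj₁ q′ ∷ w , w′)))) ⟩
      Δ-S (y ∷ b) (λ V → S² U V (proj₁ q′ ∣ proj₂ q′ ▷ Φ)) ∎)

    Y≡ : Y′ ≡ Y₀ + Y₁
    Y≡ = begin
      ∫₂ η (λ l e → Δ-S (x ∷ a) (λ U → Δ-S b (λ V → S² U V (l ∣ e ▷ Φ))))
        ≡⟨ (∫-cong η λ q′ → Δ-∷′ x a (λ U → Δ-S b (λ V → S² U V (proj₁ q′ ∣ proj₂ q′ ▷ Φ)))) ⟩
      ∫ η (λ q′ → Δ-S b (λ V → S² ([] , x ∷ a) V (proj₁ q′ ∣ proj₂ q′ ▷ Φ)) + inner q′)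
        ≡⟨ ∫-+ η (λ q′ → Δ-S b (λ V → S² ([] , x ∷ a) V (proj₁ q′ ∣ proj₂ q′ ▷ Φ))) inner ⟩
      ∫ η (λ q′ → Δ-S b (λ V → S² ([] , x ∷ a) V (proj₁ q′ ∣ proj₂ q′ ▷ Φ))) + ∫ η inner
        ≡⟨ cong₂ _+_ (∫-cong η λ q′ → ∫-cong (Δw b) λ V → trans (S-[]ˡ (proj₁ V) (λ w → S (x ∷ a) (proj₂ V) (λ w₂ → S (proj₂ q′) w₂ (λ z → Φ (proj₁ q′ ∷ w , z)))))
             (S-swapˡ (x ∷ a) (proj₂ q′) (proj₂ V) (λ w → Φ (proj₁ q′ ∷ proj₁ V , w)))) outer ⟩
      Y₀ + Y₁ ∎
      where
      inner : Letter × Word → K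
      inner q′ = ∫₂ ξ (λ l e → Δ-S a (λ U → S e (proj₂ U) (λ z → Δ-S b (λ V → S² (l ∷ proj₁ U , z) V (proj₁ q′ ∣ proj₂ q′ ▷ Φ)))))
      reorder : ∀ l p z (q′ : Letter × Word) (V : Word × Word) → S² (l ∷ p , z) V (proj₁ q′ ∣ proj₂ q′ ▷ Φ) ≡
        S (proj₂ q′) (proj₂ V) (λ z₂ → S (l ∷ p) (proj₁ V) (λ w → S z z₂ (λ w′ → Φ (proj₁ q′ ∷ w , w′))))
      reorder l p z q′ V = trans (S-cong (l ∷ p) (proj₁ V) λ w → S-swapˡ z (proj₂ q′) (proj₂ V) (λ w′ → Φ (proj₁ q′ ∷ w , w′)))
        (∫-swap (sh (l ∷ p) (proj₁ V)) (sh (proj₂ q′) (proj₂ V)) λ w z₂ → S z z₂ (λ w′ → Φ (proj₁ q′ ∷ w , w′)))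
      R : (p : Letter × Word) (U : Word × Word) (z : Word) (q′ : Letter × Word) → K
      R p U z q′ = Δ-S b (λ V → S (proj₂ q′) (proj₂ V) (λ z₂ → S (proj₁ p ∷ proj₁ U) (proj₁ V) (λ w → S z z₂ (λ w′ → Φ (proj₁ q′ ∷ w , w′)))))
      outer : ∫ η inner ≡ Y₁
      outer = begin
        ∫ η inner
          ≡⟨ (∫-cong η λ q′ → ∫-cong ξ λ p → ∫-cong (Δw a) λ U → S-cong (proj₂ p) (proj₂ U) λ z → ∫-cong (Δw b) λ V → reorder (proj₁ p) (proj₁ U) z q′ V) ⟩
        ∫ η (λ q′ → ∫ ξ (λ p → Δ-S a (λ U → S (proj₂ p) (proj₂ U) (λ z → R p U z q′))))
          ≡⟨ ∫-swap η ξ (λ q′ p → Δ-S a (λ U → S (proj₂ p) (proj₂ U) (λ z → R p U z q′))) ⟩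
        ∫ ξ (λ p → ∫ η (λ q′ → Δ-S a (λ U → S (proj₂ p) (proj₂ U) (λ z → R p U z q′))))
          ≡⟨ (∫-cong ξ λ p → trans (∫-swap η (Δw a) λ q′ U → S (proj₂ p) (proj₂ U) (λ z → R p U z q′))
               (∫-cong (Δw a) λ U → ∫-swap η (sh (proj₂ p) (proj₂ U)) λ q′ z → R p U z q′)) ⟩
        Y₁ ∎

    -- The tail r of x ⋄ y has at most one letter, so the induction hypothesis covers r ⧢ w as well
    -- as a ⧢ b. The first letters are matched by `coproduct-⋄`; the rest is regrouping of shuffles.
    D≡ : D′ ≡ D
    D≡ = begin
      D′
        ≡⟨ S-congLength a b (λ w lw → by-letters w lw) ⟩
      S a b (λ w → Δ-S w Θ)
        ≡⟨ ih a b (ℕₚ.<⇒≤ le) Θ ⟩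
      Δ-S a (λ U → Δ-S b (λ V → S² U V Θ))
        ≡⟨ (∫-cong (Δw a) λ U → trans (∫-cong (Δw b) λ V → trans (S²-Θ U V) (∫-swap′ U V)) (trans (∫-swap (Δw b) ξ λ V p → ∫ η (λ p₂ → final U V p p₂)) (∫-cong ξ λ p → ∫-swap (Δw b) η λ V p₂ → final U V p p₂))) ⟩
      Δ-S a (λ U → ∫ ξ (λ p → ∫ η (λ p₂ → Δ-S b (λ V → final U V p p₂))))
        ≡⟨ ∫-swap (Δw a) ξ (λ U p → ∫ η (λ p₂ → Δ-S b (λ V → final U V p p₂))) ⟩
      ∫ ξ (λ p → Δ-S a (λ U → ∫ η (λ p₂ → Δ-S b (λ V → final U V p p₂))))
        ≡⟨ (∫-cong ξ λ p → ∫-cong (Δw a) λ U → unfold p U) ⟩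
      D ∎
      where
      ψ : Word × Word → Letter → Word → Word → K
      ψ W l′ r z = S r (proj₁ W) (λ w₁ → S z (proj₂ W) (λ w′ → Φ (l′ ∷ w₁ , w′)))
      -- What the letters x and y contribute once a term W of the coproduct of the remaining word is
      -- fixed.
      Θ : Word × Word → K
      Θ W = ∫ ξ (λ p → ∫ η (λ p₂ → ∫₂ (dl (proj₁ p) (proj₁ p₂)) (λ l′ r → S (proj₂ p) (proj₂ p₂) (ψ W l′ r))))
      by-letters : ∀ w → length w ℕ.≤ length a ℕ.+ length b →
        ∫₂ (dl x y) (λ l r → S r w (λ t → ∫₂ (δL l) (λ l′ e → Δ-S t (l′ ∣ e ▷ Φ)))) ≡ Δ-S w Θ
      by-letters w lw = begin
        ∫₂ (dl x y) (λ l r → S r w (λ t → ∫₂ (δL l) (λ l′ e → Δ-S t (l′ ∣ e ▷ Φ))))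
          ≡⟨ ∫-congAll (dl x y) (dl-length x y) (λ (l , r) lr → trans (∫-swap (sh r w) (δL l) λ t p → Δ-S t (proj₁ p ∣ proj₂ p ▷ Φ))
               (trans (∫-cong (δL l) λ p → trans (ih r w (ℕₚ.≤-trans (ℕₚ.+-mono-≤ lr lw) le) (proj₁ p ∣ proj₂ p ▷ Φ))
                        (trans (∫-swap (Δw r) (Δw w) λ R W → S² R W (proj₁ p ∣ proj₂ p ▷ Φ)) (∫-cong (Δw w) λ W → ∫-cong (Δw r) λ R → regroup p R W)))
                 (∫-swap (δL l) (Δw w) λ p W → Δ-S r (λ R → S (proj₂ p) (proj₂ R) (ψ W (proj₁ p) (proj₁ R)))))) ⟩
        ∫ (dl x y) (λ lr → Δ-S w (λ W → ∫ (δL (proj₁ lr)) (λ p → Δ-S (proj₂ lr) (λ R → S (proj₂ p) (proj₂ R) (ψ W (proj₁ p) (proj₁ R))))))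
          ≡⟨ ∫-swap (dl x y) (Δw w) (λ lr W → ∫ (δL (proj₁ lr)) (λ p → Δ-S (proj₂ lr) (λ R → S (proj₂ p) (proj₂ R) (ψ W (proj₁ p) (proj₁ R))))) ⟩
        Δ-S w (λ W → ∫ (dl x y) (λ lr → ∫ (δL (proj₁ lr)) (λ p → Δ-S (proj₂ lr) (λ R → S (proj₂ p) (proj₂ R) (ψ W (proj₁ p) (proj₁ R))))))
          ≡⟨ (∫-cong (Δw w) λ W → trans (∫-cong (dl x y) λ lr → ∫-δL (proj₁ lr) λ l′ e → Δ-S (proj₂ lr) (λ R → S e (proj₂ R) (ψ W l′ (proj₁ R))))
               (trans (coproduct-⋄ x y (ψ W)) (sym (trans (∫-cong ξ λ p → ∫-δL y λ l₂ e₂ → ∫₂ (dl (proj₁ p) l₂) (λ l′ r → S (proj₂ p) e₂ (ψ W l′ r)))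
                 (∫-δL x λ l₁ e₁ → δ y (λ l₂ e₂ → ∫₂ (dl l₁ l₂) (λ l′ r → S e₁ e₂ (ψ W l′ r)))))))) ⟩
        Δ-S w Θ ∎
        where
        regroup : ∀ (p : Letter × Word) (R W : Word × Word) → S² R W (proj₁ p ∣ proj₂ p ▷ Φ) ≡ S (proj₂ p) (proj₂ R) (ψ W (proj₁ p) (proj₁ R))
        regroup p R W = trans (S-cong (proj₁ R) (proj₁ W) λ w₁ → sym (S-assoc (proj₂ p) (proj₂ R) (proj₂ W) λ z → Φ (proj₁ p ∷ w₁ , z)))
          (∫-swap (sh (proj₁ R) (proj₁ W)) (sh (proj₂ p) (proj₂ R)) λ w₁ z → S z (proj₂ W) (λ w′ → Φ (proj₁ p ∷ w₁ , w′)))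
      core : (U V : Word × Word) (p p₂ : Letter × Word) (q₁ q₂ : Word) → K
      core U V p p₂ q₁ q₂ = ∫₂ (dl (proj₁ p) (proj₁ p₂)) (λ l′ r → S (proj₂ p) (proj₂ p₂) (ψ (q₁ , q₂) l′ r))
      final : (U V : Word × Word) (p p₂ : Letter × Word) → K
      final U V p p₂ = S (proj₁ U) (proj₁ V) (λ q₁ → S (proj₂ U) (proj₂ V) (λ q₂ → core U V p p₂ q₁ q₂))
      S²-Θ : ∀ U V → S² U V Θ ≡ S (proj₁ U) (proj₁ V) (λ q₁ → S (proj₂ U) (proj₂ V) (λ q₂ → ∫ ξ (λ p → ∫ η (λ p₂ → core U V p p₂ q₁ q₂))))
      S²-Θ U V = refl
      ∫-swap′ : ∀ U V → S (proj₁ U) (proj₁ V) (λ q₁ → S (proj₂ U) (proj₂ V) (λ q₂ → ∫ ξ (λ p → ∫ η (λ p₂ → core U V p p₂ q₁ q₂))))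
        ≡ ∫ ξ (λ p → ∫ η (λ p₂ → final U V p p₂))
      ∫-swap′ U V = trans
        (S-cong (proj₁ U) (proj₁ V) λ q₁ → trans (∫-swap (sh (proj₂ U) (proj₂ V)) ξ λ q₂ p → ∫ η (λ p₂ → core U V p p₂ q₁ q₂))
          (∫-cong ξ λ p → ∫-swap (sh (proj₂ U) (proj₂ V)) η λ q₂ p₂ → core U V p p₂ q₁ q₂))
        (trans (∫-swap (sh (proj₁ U) (proj₁ V)) ξ λ q₁ p → ∫ η (λ p₂ → S (proj₂ U) (proj₂ V) (λ q₂ → core U V p p₂ q₁ q₂)))
          (∫-cong ξ λ p → ∫-swap (sh (proj₁ U) (proj₁ V)) η λ q₁ p₂ → S (proj₂ U) (proj₂ V) (λ q₂ → core U V p p₂ q₁ q₂)))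
      match : ∀ p U p₂ V → final U V p p₂ ≡ S (proj₂ p) (proj₂ U) (λ z → S (proj₂ p₂) (proj₂ V) (λ z₂ →
        S (proj₁ U) (proj₁ V) (⋄-term (proj₁ p) (proj₁ p₂) (λ w → S z z₂ (λ w′ → Φ (w , w′))))))
      match p U p₂ V = begin
        S u₁ v₁ (λ q₁ → S u₂ v₂ (λ q₂ → ∫ d (λ lr → S e e₂ (λ z → S (proj₂ lr) q₁ (λ w₁ → S z q₂ (λ w′ → Φ (proj₁ lr ∷ w₁ , w′)))))))
          ≡⟨ (S-cong u₁ v₁ λ q₁ → trans (∫-swap (sh u₂ v₂) d λ q₂ lr → S e e₂ (λ z → S (proj₂ lr) q₁ (λ w₁ → S z q₂ (λ w′ → Φ (proj₁ lr ∷ w₁ , w′)))))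
               (∫-cong d λ lr → collect q₁ lr)) ⟩
        S u₁ v₁ (λ q₁ → ∫ d (λ lr → S e u₂ (λ z → S e₂ v₂ (λ z₂ → S (proj₂ lr) q₁ (λ w₁ → S z z₂ (λ w′ → Φ (proj₁ lr ∷ w₁ , w′)))))))
          ≡⟨ (S-cong u₁ v₁ λ q₁ → trans (∫-swap d (sh e u₂) λ lr z → S e₂ v₂ (λ z₂ → S (proj₂ lr) q₁ (λ w₁ → S z z₂ (λ w′ → Φ (proj₁ lr ∷ w₁ , w′)))))
               (S-cong e u₂ λ z → ∫-swap d (sh e₂ v₂) λ lr z₂ → S (proj₂ lr) q₁ (λ w₁ → S z z₂ (λ w′ → Φ (proj₁ lr ∷ w₁ , w′))))) ⟩
        S u₁ v₁ (λ q₁ → S e u₂ (λ z → S e₂ v₂ (λ z₂ → ⋄-term (proj₁ p) (proj₁ p₂) (λ w → S z z₂ (λ w′ → Φ (w , w′))) q₁)))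
          ≡⟨ trans (∫-swap (sh u₁ v₁) (sh e u₂) λ q₁ z → S e₂ v₂ (λ z₂ → ⋄-term (proj₁ p) (proj₁ p₂) (λ w → S z z₂ (λ w′ → Φ (w , w′))) q₁))
               (S-cong e u₂ λ z → ∫-swap (sh u₁ v₁) (sh e₂ v₂) λ q₁ z₂ → ⋄-term (proj₁ p) (proj₁ p₂) (λ w → S z z₂ (λ w′ → Φ (w , w′))) q₁) ⟩
        S e u₂ (λ z → S e₂ v₂ (λ z₂ → S u₁ v₁ (⋄-term (proj₁ p) (proj₁ p₂) (λ w → S z z₂ (λ w′ → Φ (w , w′)))))) ∎
        where
        u₁ = proj₁ U
        u₂ = proj₂ U
        v₁ = proj₁ V
        v₂ = proj₂ V
        e = proj₂ p
        e₂ = proj₂ p₂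
        d = dl (proj₁ p) (proj₁ p₂)
        collect : ∀ q₁ (lr : Letter × Word) → S u₂ v₂ (λ q₂ → S e e₂ (λ z → S (proj₂ lr) q₁ (λ w₁ → S z q₂ (λ w′ → Φ (proj₁ lr ∷ w₁ , w′)))))
          ≡ S e u₂ (λ z → S e₂ v₂ (λ z₂ → S (proj₂ lr) q₁ (λ w₁ → S z z₂ (λ w′ → Φ (proj₁ lr ∷ w₁ , w′)))))
        collect q₁ lr = begin
          S u₂ v₂ (λ q₂ → S e e₂ (λ z → S r q₁ (λ w₁ → S z q₂ (φ w₁))))
            ≡⟨ (S-cong u₂ v₂ λ q₂ → ∫-swap (sh e e₂) (sh r q₁) λ z w₁ → S z q₂ (φ w₁)) ⟩
          S u₂ v₂ (λ q₂ → S r q₁ (λ w₁ → S e e₂ (λ z → S z q₂ (φ w₁))))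
            ≡⟨ ∫-swap (sh u₂ v₂) (sh r q₁) (λ q₂ w₁ → S e e₂ (λ z → S z q₂ (φ w₁))) ⟩
          S r q₁ (λ w₁ → S u₂ v₂ (λ q₂ → S e e₂ (λ z → S z q₂ (φ w₁))))
            ≡⟨ (S-cong r q₁ λ w₁ → trans (∫-swap (sh u₂ v₂) (sh e e₂) λ q₂ z → S z q₂ (φ w₁)) (sym (S-interchange e u₂ e₂ v₂ (φ w₁)))) ⟩
          S r q₁ (λ w₁ → S e u₂ (λ z → S e₂ v₂ (λ z₂ → S z z₂ (φ w₁))))
            ≡⟨ ∫-swap (sh r q₁) (sh e u₂) (λ w₁ z → S e₂ v₂ (λ z₂ → S z z₂ (φ w₁))) ⟩
          S e u₂ (λ z → S r q₁ (λ w₁ → S e₂ v₂ (λ z₂ → S z z₂ (φ w₁))))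
            ≡⟨ (S-cong e u₂ λ z → ∫-swap (sh r q₁) (sh e₂ v₂) λ w₁ z₂ → S z z₂ (φ w₁)) ⟩
          S e u₂ (λ z → S e₂ v₂ (λ z₂ → S r q₁ (λ w₁ → S z z₂ (φ w₁)))) ∎
          where
          r = proj₂ lr
          φ : Word → Word → K
          φ w₁ w′ = Φ (proj₁ lr ∷ w₁ , w′)
      unfold : ∀ p U → ∫ η (λ p₂ → Δ-S b (λ V → final U V p p₂)) ≡ S (proj₂ p) (proj₂ U) (λ z → ∫₂ η (λ l₂ e₂ → Δ-S b (λ V → S e₂ (proj₂ V) (λ z₂ →
        S (proj₁ U) (proj₁ V) (⋄-term (proj₁ p) l₂ (λ w → S z z₂ (λ w′ → Φ (w , w′))))))))
      unfold p U = trans (∫-cong η λ p₂ → trans (∫-cong (Δw b) λ V → match p U p₂ V)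
          (∫-swap (Δw b) (sh (proj₂ p) (proj₂ U)) λ V z → body z p₂ V))
        (∫-swap η (sh (proj₂ p) (proj₂ U)) λ p₂ z → Δ-S b (body z p₂))
        where
        body : Word → Letter × Word → Word × Word → K
        body z p₂ V = S (proj₂ p₂) (proj₂ V) (λ z₂ → S (proj₁ U) (proj₁ V) (⋄-term (proj₁ p) (proj₁ p₂) (λ w → S z z₂ (λ w′ → Φ (w , w′)))))

    step : S (x ∷ a) (y ∷ b) (λ z → Δ-S z Φ) ≡ Δ-S (x ∷ a) (λ U → Δ-S (y ∷ b) (λ V → S² U V Φ))
    step = trans left (trans (cong (_+_ T₀) (cong₂ _+_ X≡ (cong₂ _+_ Y≡ D≡))) (sym right))

  multiplicative : ∀ n → Multiplicative n
  multiplicative n [] v le Φ = trans (S-[]ˡ v (λ z → Δ-S z Φ)) (sym (trans (Δ-[] (λ a → Δ-S v (λ b → S² a b Φ)))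
    (∫-cong (Δw v) λ V → trans (S-[]ˡ (proj₁ V) λ w → S [] (proj₂ V) (λ w′ → Φ (w , w′))) (S-[]ˡ (proj₂ V) λ w′ → Φ (proj₁ V , w′)))))
  multiplicative n (x ∷ a) [] le Φ = trans (S-[]ʳ (x ∷ a) (λ z → Δ-S z Φ)) (sym (∫-cong (Δw (x ∷ a)) λ U → trans (Δ-[] (λ b → S² U b Φ))
    (trans (S-[]ʳ (proj₁ U) λ w → S (proj₂ U) [] (λ w′ → Φ (w , w′))) (S-[]ʳ (proj₂ U) λ w′ → Φ (proj₁ U , w′)))))
  multiplicative (suc n) (x ∷ a) (y ∷ b) (ℕ.s≤s le) Φ =
    Step.step n (multiplicative n) x a y b (ℕₚ.≤-trans (ℕₚ.≤-reflexive (sym (ℕₚ.+-suc (length a) (length b)))) le) Φ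

  Δ-multiplicative : ∀ u v Φ → S u v (λ z → Δ-S z Φ) ≡ Δ-S u (λ a → Δ-S v (λ b → S² a b Φ))
  Δ-multiplicative u v Φ = multiplicative _ u v ℕₚ.≤-refl Φ

-- Coassociativity.

record AlgebraMap {q : ℕ} {𝔽 : FiniteField q} (A B : 𝔽-Algebra q 𝔽) : Set where
  private
    module A = 𝔽-Algebra A
    module B = 𝔽-Algebra B
  field
    ⟪_⟫  : A.Carrier → B.Carrier
    cong≈ : ∀ {a b} → a A.≈ b → ⟪ a ⟫ B.≈ ⟪ b ⟫
    map-+ : ∀ a b → ⟪ a A.+ b ⟫ B.≈ ⟪ a ⟫ B.+ ⟪ b ⟫
    map-* : ∀ a b → ⟪ a A.* b ⟫ B.≈ ⟪ a ⟫ B.* ⟪ b ⟫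
    map-0 : ⟪ A.0# ⟫ B.≈ B.0#
    map-1 : ⟪ A.1# ⟫ B.≈ B.1#

  map-conv : ∀ n f → ⟪ Antidiagonal.conv A.commutativeRing n f ⟫ B.≈ Antidiagonal.conv B.commutativeRing n (λ i j → ⟪ f i j ⟫)
  map-conv zero    f = B.refl
  map-conv (suc n) f = B.trans (map-+ (f 0 (suc n)) _) (B.+-congˡ (map-conv n λ i j → f (suc i) j))

module CoproductPowers (q : ℕ) (𝔽 : FiniteField q) (A B : 𝔽-Algebra q 𝔽) (Y : ℕ → 𝔽-Algebra.Carrier A)
  (Δ i₁ i₂ : AlgebraMap A B) where
  open CompositionSeries q 𝔽 A Y using (P; G; G-0; G-^; P-G)
  private
    module A  = 𝔽-Algebra A
    module B  = 𝔽-Algebra B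
    module Δ  = AlgebraMap Δ
    module i₁ = AlgebraMap i₁
    module i₂ = AlgebraMap i₂
    module CA = Antidiagonal A.commutativeRing
    module CB = Antidiagonal B.commutativeRing
    module SA = PowerSeries A.commutativeRing
    module SB = PowerSeries B.commutativeRing
    module RA = CommutativeRing SA.ring-PS
    module RB = CommutativeRing SB.ring-PS
    module EA = Algebra.Properties.Semiring.Exp RA.semiring
    module IB = IntegerSolver B.commutativeRing

  G-+ : ∀ a b → G a RA.* G b RA.≈ G (a ℕ.+ b)
  G-+ a b = RA.trans (RA.*-cong (G-^ a) (G-^ b)) (RA.trans (RA.sym (EA.^-homo-* (G 1) a b)) (RA.sym (G-^ (a ℕ.+ b))))

  P-G-G : ∀ l l′ k → (P RA.* G l) RA.* G (l′ ℕ.+ suc k) RA.≈ G (l ℕ.+ l′ ℕ.+ k)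
  P-G-G l l′ k = RA.trans (RA.*-assoc P (G l) (G (l′ ℕ.+ suc k))) (RA.trans (RA.*-congˡ {P} (G-+ l (l′ ℕ.+ suc k)))
    (RA.trans (RA.*-congˡ {P} (λ n → A.reflexive (cong (λ i → G i n) (trans (sym (ℕₚ.+-assoc l l′ (suc k))) (ℕₚ.+-suc (l ℕ.+ l′) k))))) (P-G (l ℕ.+ l′ ℕ.+ k))))

  module _ (Δ-P : ∀ j → Δ.⟪ P j ⟫ B.≈ CB.conv j (λ l h → i₁.⟪ P l ⟫ B.* i₂.⟪ (P RA.* G l) h ⟫)) where
    ΔP : SB.PS
    ΔP j = Δ.⟪ P j ⟫

    -- `X k` is the coproduct of P^(-k), and `Z k` is what E ∘ E predicts for it: the coefficient of
    -- P^(-k) in degree l on the left meets E^(k+l) = t^(k+l) P^(-k-l) on the right.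
    X Z : ℕ → SB.PS
    X k n = Δ.⟪ G k n ⟫
    Z k n = CB.conv n (λ l h → i₁.⟪ G k l ⟫ B.* i₂.⟪ G (l ℕ.+ k) h ⟫)

    ΔP-X : ∀ k → ΔP RB.* X (suc k) RB.≈ X k
    ΔP-X k n = B.trans (CB.conv-ext n λ i j → B.sym (Δ.map-* (P i) (G (suc k) j))) (B.trans (B.sym (Δ.map-conv n λ i j → P i A.* G (suc k) j)) (Δ.cong≈ (P-G k n)))

    one : ∀ (f : AlgebraMap A B) n → AlgebraMap.⟪_⟫ f (G 0 n) B.≈ SB.const B.1# n
    one f zero    = B.trans (AlgebraMap.cong≈ f (G-0 0)) (AlgebraMap.map-1 f)
    one f (suc n) = B.trans (AlgebraMap.cong≈ f (G-0 (suc n))) (AlgebraMap.map-0 f)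

    X-0 : X 0 RB.≈ RB.1#
    X-0 = one Δ

    Z-0 : Z 0 RB.≈ RB.1#
    Z-0 n = B.trans (CB.conv-single n 0 n (λ l h → i₁.⟪ G 0 l ⟫ B.* i₂.⟪ G (l ℕ.+ 0) h ⟫) refl off)
      (B.trans (B.*-cong (one i₁ 0) (one i₂ n)) (B.*-identityˡ _))
      where
      off : ∀ l h → l ≢ 0 → i₁.⟪ G 0 l ⟫ B.* i₂.⟪ G (l ℕ.+ 0) h ⟫ B.≈ B.0#
      off zero    h ne = contradiction refl ne
      off (suc l) h ne = B.trans (B.*-congʳ (one i₁ (suc l))) (B.zeroˡ _)

    -- After `conv-interchange` the two tensor factors are summed separately, and each absorbs one
    -- factor P: on the left P lowers k + 1 to k, on the right it lowers l + l′ + k + 1.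
    ΔP-Z : ∀ k → ΔP RB.* Z (suc k) RB.≈ Z k
    ΔP-Z k n = begin
      CB.conv n (λ i j → ΔP i B.* Z (suc k) j)
        ≈⟨ CB.conv-ext n (λ i j → B.trans (B.*-congʳ (Δ-P i)) (B.trans (CB.conv-*ʳ i (Z (suc k) j) (λ l h → i₁.⟪ P l ⟫ B.* i₂.⟪ (P RA.* G l) h ⟫))
             (CB.conv-ext i λ l h → CB.conv-*ˡ j (i₁.⟪ P l ⟫ B.* i₂.⟪ (P RA.* G l) h ⟫) (λ l′ h′ → i₁.⟪ G (suc k) l′ ⟫ B.* i₂.⟪ G (l′ ℕ.+ suc k) h′ ⟫)))) ⟩
      CB.conv n (λ i j → CB.conv i (λ l h → CB.conv j (λ l′ h′ → f l h l′ h′)))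
        ≈⟨ CB.conv-interchange n f ⟩
      CB.conv n (λ L H → CB.conv L (λ l l′ → CB.conv H (λ h h′ → f l h l′ h′)))
        ≈⟨ CB.conv-ext n (λ L H → B.trans (CB.conv-cong L (inner L H)) (collect L H)) ⟩
      Z k n ∎
      where
      open Relation.Binary.Reasoning.Setoid B.setoid
      f : ℕ → ℕ → ℕ → ℕ → B.Carrier
      f l h l′ h′ = (i₁.⟪ P l ⟫ B.* i₂.⟪ (P RA.* G l) h ⟫) B.* (i₁.⟪ G (suc k) l′ ⟫ B.* i₂.⟪ G (l′ ℕ.+ suc k) h′ ⟫)
      inner : ∀ L H l l′ → l ℕ.+ l′ ≡ L → CB.conv H (λ h h′ → f l h l′ h′) B.≈ i₁.⟪ P l A.* G (suc k) l′ ⟫ B.* i₂.⟪ G (L ℕ.+ k) H ⟫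
      inner L H l l′ refl = begin
        CB.conv H (λ h h′ → f l h l′ h′)
          ≈⟨ CB.conv-ext H (λ h h′ → B.trans (IB.solve 4 (λ a b c d → (a IB.:* b) IB.:* (c IB.:* d) IB.:= (a IB.:* c) IB.:* (b IB.:* d)) B.refl
               (i₁.⟪ P l ⟫) (i₂.⟪ (P RA.* G l) h ⟫) (i₁.⟪ G (suc k) l′ ⟫) (i₂.⟪ G (l′ ℕ.+ suc k) h′ ⟫))
               (B.*-cong (B.sym (i₁.map-* (P l) (G (suc k) l′))) (B.sym (i₂.map-* ((P RA.* G l) h) (G (l′ ℕ.+ suc k) h′))))) ⟩
        CB.conv H (λ h h′ → i₁.⟪ P l A.* G (suc k) l′ ⟫ B.* i₂.⟪ (P RA.* G l) h A.* G (l′ ℕ.+ suc k) h′ ⟫)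
          ≈⟨ CB.conv-*ˡ H _ (λ h h′ → i₂.⟪ (P RA.* G l) h A.* G (l′ ℕ.+ suc k) h′ ⟫) ⟨
        i₁.⟪ P l A.* G (suc k) l′ ⟫ B.* CB.conv H (λ h h′ → i₂.⟪ (P RA.* G l) h A.* G (l′ ℕ.+ suc k) h′ ⟫)
          ≈⟨ B.*-congˡ (B.trans (B.sym (i₂.map-conv H λ h h′ → (P RA.* G l) h A.* G (l′ ℕ.+ suc k) h′)) (i₂.cong≈ (P-G-G l l′ k H))) ⟩
        i₁.⟪ P l A.* G (suc k) l′ ⟫ B.* i₂.⟪ G (l ℕ.+ l′ ℕ.+ k) H ⟫ ∎
      collect : ∀ L H → CB.conv L (λ l l′ → i₁.⟪ P l A.* G (suc k) l′ ⟫ B.* i₂.⟪ G (L ℕ.+ k) H ⟫) B.≈ i₁.⟪ G k L ⟫ B.* i₂.⟪ G (L ℕ.+ k) H ⟫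
      collect L H = B.trans (B.sym (CB.conv-*ʳ L _ λ l l′ → i₁.⟪ P l A.* G (suc k) l′ ⟫))
        (B.*-congʳ (B.trans (B.sym (i₁.map-conv L λ l l′ → P l A.* G (suc k) l′)) (i₁.cong≈ (P-G k L))))

    -- Both families start at 1 and pass from k + 1 to k on multiplication by the coproduct of P.
    -- That series has the inverse `X 1`, so the recursion can be run upwards.
    Δ-G : ∀ k → X k RB.≈ Z k
    Δ-G zero    = RB.trans X-0 (RB.sym Z-0)
    Δ-G (suc k) = RB.trans (RB.sym (undo (X (suc k)))) (RB.trans (RB.*-congˡ {X 1} (RB.trans (ΔP-X k) (RB.trans (Δ-G k) (RB.sym (ΔP-Z k))))) (undo (Z (suc k))))
      where
      undo : ∀ f → X 1 RB.* (ΔP RB.* f) RB.≈ f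
      undo f = RB.trans (RB.sym (RB.*-assoc (X 1) ΔP f)) (RB.trans (RB.*-congʳ {f} (RB.trans (RB.*-comm (X 1) ΔP) (RB.trans (ΔP-X 0) X-0))) (RB.*-identityˡ f))

module Coassociativity (q : ℕ) (𝔽 : FiniteField q) where
  open Construction q 𝔽 using (Letter; letter; Word; 𝔇; ⟦_⟧; _⧢_; _⧢²_; _⊗_; Δ; Δw)
  open FieldFacts q 𝔽 using (𝔽-ring)
  open CommutativeRing 𝔽-ring hiding (refl; sym; trans) renaming (Carrier to K)
  open Antidiagonal 𝔽-ring
  open Pairing q 𝔽
  open Shuffle q 𝔽
  open LetterProducts q 𝔽 using (P; _≋_)
  open ShuffleAlgebra q 𝔽 using (algebra-𝔇; algebra-𝔇²; ∫-⊗; ∫-⧢²; ∫-sh²; S²; sh²)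
  open Coproduct q 𝔽
  open CompositionSeries q 𝔽 algebra-𝔇 Y using (G)
  open CoproductMultiplicative q 𝔽 using (Δ-multiplicative; δL; ∫-δL; Δ-∷′)
  open ≡-Reasoning
  private
    module A = 𝔽-Algebra algebra-𝔇
    module B = 𝔽-Algebra algebra-𝔇²

  ∫-Δ : ∀ d Φ → ∫ (Δ d) Φ ≡ ∫ d (λ w → Δ-S w Φ)
  ∫-Δ d Φ = ∫-concatMap _ (λ w → Δ-S w Φ) Φ (λ c w → ∫-map-scale c id _ (λ _ → refl) (Δw w) Φ) d

  Δ-⧢ : ∀ d e → Δ (d ⧢ e) ≋ Δ d ⧢² Δ e
  Δ-⧢ d e Φ = begin
    ∫ (Δ (d ⧢ e)) Φ
      ≡⟨ trans (∫-Δ (d ⧢ e) Φ) (∫-⧢ d e λ w → Δ-S w Φ) ⟩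
    ∫ d (λ v → ∫ e (λ w → S v w (λ z → Δ-S z Φ)))
      ≡⟨ (∫-cong d λ v → ∫-cong e λ w → Δ-multiplicative v w Φ) ⟩
    ∫ d (λ v → ∫ e (λ w → Δ-S v (λ a → Δ-S w (λ b → S² a b Φ))))
      ≡⟨ (∫-cong d λ v → trans (∫-swap e (Δw v) λ w a → Δ-S w (λ b → S² a b Φ)) (∫-cong (Δw v) λ a → sym (∫-Δ e λ b → S² a b Φ))) ⟩
    ∫ d (λ v → Δ-S v (λ a → ∫ (Δ e) (λ b → S² a b Φ)))
      ≡⟨ ∫-Δ d (λ a → ∫ (Δ e) (λ b → S² a b Φ)) ⟨
    ∫ (Δ d) (λ a → ∫ (Δ e) (λ b → S² a b Φ))
      ≡⟨ trans (∫-⧢² (Δ d) (Δ e) Φ) (∫-cong (Δ d) λ a → ∫-cong (Δ e) λ b → ∫-sh² a b Φ) ⟨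
    ∫ (Δ d ⧢² Δ e) Φ ∎

  private
    Δ-map i₁ i₂ : AlgebraMap algebra-𝔇 algebra-𝔇²
    Δ-map = record
      { ⟪_⟫ = Δ
      ; cong≈ = λ {d} {e} h Φ → trans (∫-Δ d Φ) (trans (h λ w → Δ-S w Φ) (sym (∫-Δ e Φ)))
      ; map-+ = λ d e Φ → trans (∫-Δ (d ++ e) Φ) (trans (∫-++ d e λ w → Δ-S w Φ)
          (sym (trans (∫-++ (Δ d) (Δ e) Φ) (cong₂ _+_ (∫-Δ d Φ) (∫-Δ e Φ)))))
      ; map-* = Δ-⧢
      ; map-0 = λ _ → refl
      ; map-1 = λ Φ → trans (∫-Δ ⟦ [] ⟧ Φ) (trans (∫-single [] λ w → Δ-S w Φ) (trans (Δ-[] Φ) (sym (∫-single ([] , []) Φ)))) }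
    i₁ = record
      { ⟪_⟫ = _⊗ ⟦ [] ⟧
      ; cong≈ = λ {d} {e} h Φ → trans (e₁ d Φ) (trans (h λ v → Φ (v , [])) (sym (e₁ e Φ)))
      ; map-+ = λ d e Φ → trans (e₁ (d ++ e) Φ) (trans (∫-++ d e λ v → Φ (v , []))
          (sym (trans (∫-++ (d ⊗ ⟦ [] ⟧) (e ⊗ ⟦ [] ⟧) Φ) (cong₂ _+_ (e₁ d Φ) (e₁ e Φ)))))
      ; map-* = λ d e Φ → trans (e₁ (d ⧢ e) Φ) (trans (∫-⧢ d e λ v → Φ (v , []))
          (sym (trans (∫-⧢² (d ⊗ ⟦ [] ⟧) (e ⊗ ⟦ [] ⟧) Φ) (trans (e₁ d λ a → ∫ (e ⊗ ⟦ [] ⟧) λ b → ∫ (sh² a b) Φ)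
            (∫-cong d λ v → trans (e₁ e λ b → ∫ (sh² (v , []) b) Φ) (∫-cong e λ w → trans (∫-sh² (v , []) (w , []) Φ)
              (S-cong v w λ z → S-[]ˡ [] λ z′ → Φ (z , z′))))))))
      ; map-0 = λ _ → refl
      ; map-1 = λ Φ → trans (e₁ ⟦ [] ⟧ Φ) (trans (∫-single [] λ v → Φ (v , [])) (sym (∫-single ([] , []) Φ))) }
      where
      e₁ : ∀ d Φ → ∫ (d ⊗ ⟦ [] ⟧) Φ ≡ ∫ d (λ v → Φ (v , []))
      e₁ d Φ = trans (∫-⊗ d ⟦ [] ⟧ Φ) (∫-cong d λ v → ∫-single [] λ w → Φ (v , w))
    i₂ = record
      { ⟪_⟫ = ⟦ [] ⟧ ⊗_
      ; cong≈ = λ {d} {e} h Φ → trans (e₂ d Φ) (trans (h λ v → Φ ([] , v)) (sym (e₂ e Φ)))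
      ; map-+ = λ d e Φ → trans (e₂ (d ++ e) Φ) (trans (∫-++ d e λ v → Φ ([] , v))
          (sym (trans (∫-++ (⟦ [] ⟧ ⊗ d) (⟦ [] ⟧ ⊗ e) Φ) (cong₂ _+_ (e₂ d Φ) (e₂ e Φ)))))
      ; map-* = λ d e Φ → trans (e₂ (d ⧢ e) Φ) (trans (∫-⧢ d e λ v → Φ ([] , v))
          (sym (trans (∫-⧢² (⟦ [] ⟧ ⊗ d) (⟦ [] ⟧ ⊗ e) Φ) (trans (e₂ d λ a → ∫ (⟦ [] ⟧ ⊗ e) λ b → ∫ (sh² a b) Φ)
            (∫-cong d λ v → trans (e₂ e λ b → ∫ (sh² ([] , v) b) Φ) (∫-cong e λ w → trans (∫-sh² ([] , v) ([] , w) Φ)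
              (S-[]ˡ [] λ z → S v w λ z′ → Φ (z , z′))))))))
      ; map-0 = λ _ → refl
      ; map-1 = λ Φ → trans (e₂ ⟦ [] ⟧ Φ) (trans (∫-single [] λ v → Φ ([] , v)) (sym (∫-single ([] , []) Φ))) }
      where
      e₂ : ∀ d Φ → ∫ (⟦ [] ⟧ ⊗ d) Φ ≡ ∫ d (λ v → Φ ([] , v))
      e₂ d Φ = trans (∫-⊗ ⟦ [] ⟧ d Φ) (∫-single [] λ v → ∫ d λ w → Φ (v , w))

    module CB = Antidiagonal B.commutativeRing

    ∫-pure : ∀ d e Φ → ∫ ((d ⊗ ⟦ [] ⟧) ⧢² (⟦ [] ⟧ ⊗ e)) Φ ≡ ∫ d (λ p → ∫ e (λ r → Φ (p , r)))
    ∫-pure d e Φ = trans (∫-⧢² (d ⊗ ⟦ [] ⟧) (⟦ [] ⟧ ⊗ e) Φ)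
      (trans (trans (∫-⊗ d ⟦ [] ⟧ F) (∫-cong d λ v → ∫-single [] λ w → F (v , w)))
        (∫-cong d λ v → trans (∫-⊗ ⟦ [] ⟧ e λ b → ∫ (sh² (v , []) b) Φ) (trans (∫-single [] λ z → ∫ e λ w → ∫ (sh² (v , []) (z , w)) Φ)
          (∫-cong e λ w → trans (∫-sh² (v , []) ([] , w) Φ) (trans (S-[]ʳ v λ z → S [] w λ z′ → Φ (z , z′)) (S-[]ˡ w λ z′ → Φ (v , z′)))))))
      where
      F : Word × Word → K
      F a = ∫ (⟦ [] ⟧ ⊗ e) λ b → ∫ (sh² a b) Φ

    ∫-convB : ∀ n f Φ → ∫ (CB.conv n f) Φ ≡ conv n (λ i j → ∫ (f i j) Φ)
    ∫-convB zero    f Φ = refl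
    ∫-convB (suc n) f Φ = trans (∫-++ (f 0 (suc n)) _ Φ) (cong (_+_ (∫ (f 0 (suc n)) Φ)) (∫-convB n (λ i j → f (suc i) j) Φ))

    tensors : ∀ n (f g : ℕ → ℕ → 𝔇) Φ → ∫ (CB.conv n (λ l h → (f l h ⊗ ⟦ [] ⟧) ⧢² (⟦ [] ⟧ ⊗ g l h))) Φ ≡ conv n (λ l h → ∫ (f l h) (λ p → ∫ (g l h) (λ r → Φ (p , r))))
    tensors n f g Φ = trans (∫-convB n (λ l h → (f l h ⊗ ⟦ [] ⟧) ⧢² (⟦ [] ⟧ ⊗ g l h)) Φ) (conv-ext n λ l h → ∫-pure (f l h) (g l h) Φ)

    P′ = CompositionSeries.P q 𝔽 algebra-𝔇 Y

    Δ-P′ : ∀ j → Δ (P′ j) ≋ CB.conv j (λ l h → (P′ l ⊗ ⟦ [] ⟧) ⧢² (⟦ [] ⟧ ⊗ H l h))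
    Δ-P′ j Φ = trans (∫-Δ (P′ j) Φ) (trans (P≋ j λ w → Δ-S w Φ) (trans (Δ-P j Φ) (sym (trans (tensors j (λ l _ → P′ l) H Φ)
      (conv-ext j λ l h → P≋ l λ p → ∫ (H l h) λ r → Φ (p , r))))))

  Δ-G : ∀ k n Φ → ∫ (G k n) (λ w → Δ-S w Φ) ≡ conv n (λ l h → ∫ (G k l) (λ p → ∫ (G (l ℕ.+ k) h) (λ r → Φ (p , r))))
  Δ-G k n Φ = trans (sym (∫-Δ (G k n) Φ)) (trans (CoproductPowers.Δ-G q 𝔽 algebra-𝔇 algebra-𝔇² Y Δ-map i₁ i₂ Δ-P′ k n Φ)
    (tensors n (λ l _ → G k l) (λ l h → G (l ℕ.+ k) h) Φ))

  -- Each side is a sum over three indices of total n, and `Δ-G` gives the right side the summand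
  -- that two applications of `δ` produce.
  δ-coassoc : ∀ x (Ψ : Letter → Word → Word → K) →
    δ x (λ l e → δ l (λ l′ e′ → Ψ l′ e′ e)) ≡ δ x (λ l e → Δ-S e (λ E → Ψ l (proj₁ E) (proj₂ E)))
  δ-coassoc (letter n ε hε) Ψ = begin
    conv n (λ k d → ∫ (G k d) (λ e → conv k (λ k′ d′ → ∫ (G k′ d′) (λ e′ → Ψₖ k′ e′ e))))
      ≡⟨ conv-ext n (λ k d → ∫-conv (G k d) k λ k′ d′ e → ∫ (G k′ d′) (λ e′ → Ψₖ k′ e′ e)) ⟩
    conv n (λ k d → conv k (λ k′ d′ → ∫ (G k d) (λ e → ∫ (G k′ d′) (λ e′ → Ψₖ k′ e′ e))))
      ≡⟨ conv-ext n (λ k d → conv-cong k λ k′ d′ e → trans (∫-swap (G k d) (G k′ d′) λ e e′ → Ψₖ k′ e′ e)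
           (cong (λ k → ∫ (G k′ d′) (λ p → ∫ (G k d) (λ r → Ψₖ k′ p r))) (trans (sym e) (ℕₚ.+-comm k′ d′)))) ⟩
    conv n (λ k d → conv k (λ k′ d′ → ∫ (G k′ d′) (λ p → ∫ (G (d′ ℕ.+ k′) d) (λ r → Ψₖ k′ p r))))
      ≡⟨ conv-assoc n (λ k′ d′ d → ∫ (G k′ d′) (λ p → ∫ (G (d′ ℕ.+ k′) d) (λ r → Ψₖ k′ p r))) ⟨
    conv n (λ k q → conv q (λ l h → ∫ (G k l) (λ p → ∫ (G (l ℕ.+ k) h) (λ r → Ψₖ k p r))))
      ≡⟨ conv-ext n (λ k q → Δ-G k q λ E → Ψₖ k (proj₁ E) (proj₂ E)) ⟨
    conv n (λ k q → ∫ (G k q) (λ e → Δ-S e (λ E → Ψₖ k (proj₁ E) (proj₂ E)))) ∎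
    where
    Ψₖ : ℕ → Word → Word → K
    Ψₖ k = Ψ (letter k ε hε)

  -- Induction on the word. On the right the coproduct of a shuffle e ⧢ r appears, which
  -- multiplicativity splits; then `δ-coassoc` treats the first letter and the induction hypothesis
  -- the remaining word.
  Δ-coassociative : ∀ w (Φ : Word → Word → Word → K) →
    Δ-S w (λ W → Δ-S (proj₁ W) (λ V → Φ (proj₁ V) (proj₂ V) (proj₂ W))) ≡ Δ-S w (λ W → Δ-S (proj₂ W) (λ V → Φ (proj₁ W) (proj₁ V) (proj₂ V)))
  Δ-coassociative []      Φ = trans (Δ-[] λ W → Δ-S (proj₁ W) (λ V → Φ (proj₁ V) (proj₂ V) (proj₂ W)))
    (trans (Δ-[] λ V → Φ (proj₁ V) (proj₂ V) []) (sym (trans (Δ-[] λ W → Δ-S (proj₂ W) (λ V → Φ (proj₁ W) (proj₁ V) (proj₂ V))) (Δ-[] λ V → Φ [] (proj₁ V) (proj₂ V)))))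
  Δ-coassociative (x ∷ v) Φ = begin
    Δ-S (x ∷ v) F
      ≡⟨ Δ-∷′ x v F ⟩
    Δ-S [] (λ V → Φ (proj₁ V) (proj₂ V) (x ∷ v)) + ∫ ξ (λ p → Δ-S v (proj₁ p ∣ proj₂ p ▷ F))
      ≡⟨ cong₂ _+_ (Δ-[] λ V → Φ (proj₁ V) (proj₂ V) (x ∷ v)) left ⟩
    Φ [] [] (x ∷ v) + (A₁ + A₂)
      ≡⟨ sym (+-assoc _ _ _) ⟩
    (Φ [] [] (x ∷ v) + A₁) + A₂
      ≡⟨ cong₂ _+_ (Δ-∷′ x v λ V → Φ [] (proj₁ V) (proj₂ V)) right ⟨
    Δ-S (x ∷ v) (λ V → Φ [] (proj₁ V) (proj₂ V)) + ∫ ξ (λ p → Δ-S v (proj₁ p ∣ proj₂ p ▷ F′))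
      ≡⟨ Δ-∷′ x v F′ ⟨
    Δ-S (x ∷ v) F′ ∎
    where
    ξ = δL x
    F F′ : Word × Word → K
    F  W = Δ-S (proj₁ W) (λ V → Φ (proj₁ V) (proj₂ V) (proj₂ W))
    F′ W = Δ-S (proj₂ W) (λ V → Φ (proj₁ W) (proj₁ V) (proj₂ V))
    Ψ : Letter → Word → Word → K
    Ψ l′ e′ e = Δ-S v (λ W → Δ-S (proj₁ W) (λ V → S e′ (proj₂ V) (λ y → S e (proj₂ W) (λ z → Φ (l′ ∷ proj₁ V) y z))))
    A₁ A₂ : K
    A₁ = ∫ ξ (λ p → Δ-S v (proj₁ p ∣ proj₂ p ▷ λ V → Φ [] (proj₁ V) (proj₂ V)))
    A₂ = δ x (λ l e → δ l (λ l′ e′ → Ψ l′ e′ e))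
    tail : Letter → Word → Word → K
    tail l t z = ∫ (δL l) (λ p → Δ-S t (λ V → S (proj₂ p) (proj₂ V) (λ y → Φ (proj₁ p ∷ proj₁ V) y z)))
    left : ∫ ξ (λ p → Δ-S v (proj₁ p ∣ proj₂ p ▷ F)) ≡ A₁ + A₂
    left = trans (∫-cong ξ λ p → trans (∫-cong (Δw v) λ W → trans (S-cong (proj₂ p) (proj₂ W) λ z → Δ-∷′ (proj₁ p) (proj₁ W) λ V → Φ (proj₁ V) (proj₂ V) z)
          (∫-+ (sh (proj₂ p) (proj₂ W)) (λ z → Φ [] (proj₁ p ∷ proj₁ W) z) (tail (proj₁ p) (proj₁ W))))
        (∫-+ (Δw v) (λ W → S (proj₂ p) (proj₂ W) (λ z → Φ [] (proj₁ p ∷ proj₁ W) z)) (λ W → S (proj₂ p) (proj₂ W) (tail (proj₁ p) (proj₁ W)))))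
      (trans (∫-+ ξ (λ p → Δ-S v (λ W → S (proj₂ p) (proj₂ W) (λ z → Φ [] (proj₁ p ∷ proj₁ W) z))) (λ p → Δ-S v (λ W → S (proj₂ p) (proj₂ W) (tail (proj₁ p) (proj₁ W)))))
        (cong (_+_ A₁) (trans (∫-cong ξ second) (∫-δL x λ l e → δ l (λ l′ e′ → Ψ l′ e′ e)))))
      where
      second : ∀ p → Δ-S v (λ W → S (proj₂ p) (proj₂ W) (tail (proj₁ p) (proj₁ W))) ≡ δ (proj₁ p) (λ l′ e′ → Ψ l′ e′ (proj₂ p))
      second (l , e) = begin
        Δ-S v (λ W → S e (proj₂ W) (λ z → ∫ (δL l) (λ p → Δ-S (proj₁ W) (λ V → S (proj₂ p) (proj₂ V) (λ y → Φ (proj₁ p ∷ proj₁ V) y z)))))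
          ≡⟨ (∫-cong (Δw v) λ W → trans (∫-swap (sh e (proj₂ W)) (δL l) λ z p → Δ-S (proj₁ W) (λ V → S (proj₂ p) (proj₂ V) (λ y → Φ (proj₁ p ∷ proj₁ V) y z)))
               (∫-cong (δL l) λ p → trans (∫-swap (sh e (proj₂ W)) (Δw (proj₁ W)) λ z V → S (proj₂ p) (proj₂ V) (λ y → Φ (proj₁ p ∷ proj₁ V) y z))
                 (∫-cong (Δw (proj₁ W)) λ V → ∫-swap (sh e (proj₂ W)) (sh (proj₂ p) (proj₂ V)) λ z y → Φ (proj₁ p ∷ proj₁ V) y z))) ⟩
        Δ-S v (λ W → ∫ (δL l) (λ p → Δ-S (proj₁ W) (λ V → S (proj₂ p) (proj₂ V) (λ y → S e (proj₂ W) (λ z → Φ (proj₁ p ∷ proj₁ V) y z)))))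
          ≡⟨ ∫-swap (Δw v) (δL l) (λ W p → Δ-S (proj₁ W) (λ V → S (proj₂ p) (proj₂ V) (λ y → S e (proj₂ W) (λ z → Φ (proj₁ p ∷ proj₁ V) y z)))) ⟩
        ∫ (δL l) (λ p → Ψ (proj₁ p) (proj₂ p) e)
          ≡⟨ ∫-δL l (λ l′ e′ → Ψ l′ e′ e) ⟩
        δ l (λ l′ e′ → Ψ l′ e′ e) ∎
    right : ∫ ξ (λ p → Δ-S v (proj₁ p ∣ proj₂ p ▷ F′)) ≡ A₂
    right = trans (∫-cong ξ λ p → each (proj₁ p) (proj₂ p)) (trans (∫-δL x λ l e → Δ-S e (λ E → Ψ l (proj₁ E) (proj₂ E))) (sym (δ-coassoc x Ψ)))
      where
      each : ∀ l e → Δ-S v (l ∣ e ▷ F′) ≡ Δ-S e (λ E → Ψ l (proj₁ E) (proj₂ E))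
      each l e = begin
        Δ-S v (λ W → S e (proj₂ W) (λ z → Δ-S z (λ V → Φ (l ∷ proj₁ W) (proj₁ V) (proj₂ V))))
          ≡⟨ (∫-cong (Δw v) λ W → Δ-multiplicative e (proj₂ W) λ V → Φ (l ∷ proj₁ W) (proj₁ V) (proj₂ V)) ⟩
        Δ-S v (λ W → Δ-S e (λ E → Δ-S (proj₂ W) (λ V → body E (proj₁ W) (proj₁ V) (proj₂ V))))
          ≡⟨ ∫-swap (Δw v) (Δw e) (λ W E → Δ-S (proj₂ W) (λ V → body E (proj₁ W) (proj₁ V) (proj₂ V))) ⟩
        Δ-S e (λ E → Δ-S v (λ W → Δ-S (proj₂ W) (λ V → body E (proj₁ W) (proj₁ V) (proj₂ V))))
          ≡⟨ (∫-cong (Δw e) λ E → Δ-coassociative v (body E)) ⟨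
        Δ-S e (λ E → Ψ l (proj₁ E) (proj₂ E)) ∎
        where
        body : Word × Word → Word → Word → Word → K
        body E p r₁ r₂ = S (proj₁ E) r₁ (λ y → S (proj₂ E) r₂ (λ z → Φ (l ∷ p) y z))

-- Grading, counit and antipode.

module GradingAndAntipode (q : ℕ) (𝔽 : FiniteField q) where
  open Construction q 𝔽 using (Letter; letter; Word; weight; lwt; pw; xₛ; 𝔇; ⟦_⟧; scale; _⧢_; εw; Δw)
  open FieldFacts q 𝔽 using (𝔽-ring; m)
  open CommutativeRing 𝔽-ring hiding (refl; sym; trans) renaming (Carrier to K)
  open Antidiagonal 𝔽-ring
  open Algebra.Properties.Ring ring using (-1*x≈-x)
  open Pairing q 𝔽
  open Shuffle q 𝔽
  open LetterProducts q 𝔽 using (P; P-∤; P-∣; _≋_; ∫-⧢-[]ˡ)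
  open ShuffleAlgebra q 𝔽 using (algebra-𝔇)
  open Coproduct q 𝔽
  open CompositionSeries q 𝔽 algebra-𝔇 Y using (G; W; W-suc; W-zero; negBinomial; negBinomial-0)
  open CoproductMultiplicative q 𝔽 using (δL; Δ-∷′)
  open Coassociativity q 𝔽 using (Δ-coassociative)
  open ≡-Reasoning
  private
    module A = 𝔽-Algebra algebra-𝔇
    module CA = Antidiagonal A.commutativeRing

  ∫-convA : ∀ n f φ → ∫ (CA.conv n f) φ ≡ conv n (λ i j → ∫ (f i j) φ)
  ∫-convA zero    f φ = refl
  ∫-convA (suc n) f φ = trans (∫-++ (f 0 (suc n)) _ φ) (cong (_+_ (∫ (f 0 (suc n)) φ)) (∫-convA n (λ i j → f (suc i) j) φ))

  -- Homogeneity is expressed through functionals: their values off the expected weight do not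
  -- matter. The grading, the counit and the recursion for the antipode all draw on this form.
  S-congWeight : ∀ v w {φ ψ} → (∀ z → weight z ≡ weight v ℕ.+ weight w → φ z ≡ ψ z) → S v w φ ≡ S v w ψ
  S-congWeight v w h = ∫-congAll (sh v w) (sh-homogeneous v w) λ z (_ , e) → h z e

  P-congWeight : ∀ j {φ ψ : Word → K} → (∀ z → weight z ≡ suc j → φ z ≡ ψ z) → ∫ (P (suc j)) φ ≡ ∫ (P (suc j)) ψ
  P-congWeight j {φ} {ψ} h = by-cases (m ∣? suc j)
    where
    by-cases : Dec (m ∣ suc j) → ∫ (P (suc j)) φ ≡ ∫ (P (suc j)) ψ
    by-cases (yes d) = trans (cong (λ d → ∫ d φ) (P-∣ d)) (trans (cong (λ s → 1# * s + 0#) (h (xₛ j ∷ []) (cong suc (ℕₚ.+-identityʳ j)))) (sym (cong (λ d → ∫ d ψ) (P-∣ d))))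
    by-cases (no ¬d) = trans (cong (λ d → ∫ d φ) (P-∤ ¬d)) (sym (cong (λ d → ∫ d ψ) (P-∤ ¬d)))

  ∫-W-suc : ∀ c n φ → ∫ (W c (suc n)) φ ≡ conv n (λ i j → ∫ (P (suc i)) (λ v → ∫ (W (c ∘ suc) j) (λ w → S v w φ)))
  ∫-W-suc c n φ = trans (W-suc c n φ) (trans (∫-convA n (λ i j → P (suc i) ⧢ W (c ∘ suc) j) φ)
    (conv-ext n λ i j → ∫-⧢ (P (suc i)) (W (c ∘ suc) j) φ))

  -- The bound `b` carries the recursion, because the weight j left after the first part is known
  -- only through i + j = n.
  W-congWeight : ∀ b n → n ℕ.≤ b → ∀ c {φ ψ : Word → K} → (∀ z → weight z ≡ n → φ z ≡ ψ z) → ∫ (W c n) φ ≡ ∫ (W c n) ψ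
  W-congWeight b       zero    _         c {φ} {ψ} h = trans (W-zero c φ) (trans (cong (λ s → c 0 * s + 0#) (h [] refl)) (sym (W-zero c ψ)))
  W-congWeight (suc b) (suc n) (ℕ.s≤s l) c {φ} {ψ} h = trans (∫-W-suc c n φ) (trans (conv-cong n λ i j e →
      P-congWeight i λ v ev → W-congWeight b j (ℕₚ.≤-trans (subst (j ℕ.≤_) e (ℕₚ.m≤n+m j i)) l) (c ∘ suc) λ w ew →
        S-congWeight v w λ z ez → h z (trans ez (trans (cong₂ ℕ._+_ ev ew) (cong suc e))))
    (sym (∫-W-suc c n ψ)))

  G-congWeight : ∀ k d {φ ψ : Word → K} → (∀ z → weight z ≡ d → φ z ≡ ψ z) → ∫ (G k d) φ ≡ ∫ (G k d) ψ
  G-congWeight k d = W-congWeight d d ℕₚ.≤-refl (negBinomial k)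

  δ-congWeight : ∀ x {ψ χ : Letter → Word → K} → (∀ l b → lwt l ℕ.+ weight b ≡ lwt x → ψ l b ≡ χ l b) → δ x ψ ≡ δ x χ
  δ-congWeight (letter n ε hε) h = conv-cong n λ k d e → G-congWeight k d λ b eb → h (letter k ε hε) b (cong suc (trans (cong (k ℕ.+_) eb) e))

  mutual
    Δ-congWeight : ∀ w {Φ Ψ : Word × Word → K} → (∀ p r → weight p ℕ.+ weight r ≡ weight w → Φ (p , r) ≡ Ψ (p , r)) → Δ-S w Φ ≡ Δ-S w Ψ
    Δ-congWeight []      {Φ} {Ψ} h = trans (Δ-[] Φ) (trans (h [] [] refl) (sym (Δ-[] Ψ)))
    Δ-congWeight (x ∷ v) {Φ} {Ψ} h = trans (Δ-∷ x v Φ) (trans (cong₂ _+_ (h [] (x ∷ v) refl)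
      (Δ-tail-congWeight x v {Φ} {Ψ} λ l p r e → h (l ∷ p) r e)) (sym (Δ-∷ x v Ψ)))

    -- Separated from the term 1 ⊗ x v because here the left factor is nonempty and the right one
    -- has smaller weight, which is what lets the antipode be computed by recursion.
    Δ-tail-congWeight : ∀ x v {Φ Ψ : Word × Word → K} → (∀ l p r → weight (l ∷ p) ℕ.+ weight r ≡ weight (x ∷ v) → Φ (l ∷ p , r) ≡ Ψ (l ∷ p , r)) →
      δ x (λ l b → Δ-S v (l ∣ b ▷ Φ)) ≡ δ x (λ l b → Δ-S v (l ∣ b ▷ Ψ))
    Δ-tail-congWeight x v h = δ-congWeight x λ l b e → Δ-congWeight v λ p r e′ → S-congWeight b r λ z ez → h l p z
      (trans (cong (weight (l ∷ p) ℕ.+_) ez) (trans (regroup (lwt l) (weight p) (weight b) (weight r)) (cong₂ ℕ._+_ e e′)))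
      where
      open +-*-Solver renaming (solve to solveℕ; _:=_ to _≔_; _:+_ to _⊞_)
      regroup : ∀ l p b r → (l ℕ.+ p) ℕ.+ (b ℕ.+ r) ≡ (l ℕ.+ b) ℕ.+ (p ℕ.+ r)
      regroup = solveℕ 4 (λ l p b r → (l ⊞ p) ⊞ (b ⊞ r) ≔ (l ⊞ b) ⊞ (p ⊞ r)) refl

  εw-positive : ∀ z → 0 ℕ.< weight z → εw z ≡ 0#
  εw-positive (_ ∷ _) _ = refl

  S-εw : ∀ v w → S v w εw ≡ εw v * εw w
  S-εw []      w       = trans (S-[]ˡ w εw) (sym (*-identityˡ _))
  S-εw (x ∷ v) w       = trans (S-congWeight (x ∷ v) w {ψ = λ _ → 0#} λ z e → εw-positive z (subst (0 ℕ.<_) (sym e) (ℕ.s≤s ℕ.z≤n)))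
    (trans (∫-zero (sh (x ∷ v) w) λ _ → refl) (sym (zeroˡ _)))

  G-εw : ∀ k d → ∫ (G k (suc d)) εw ≡ 0#
  G-εw k d = trans (G-congWeight k (suc d) {ψ = λ _ → 0#} λ z e → εw-positive z (subst (0 ℕ.<_) (sym e) (ℕ.s≤s ℕ.z≤n)))
    (∫-zero (G k (suc d)) λ _ → refl)

  G-zero : ∀ k φ → ∫ (G k 0) φ ≡ φ []
  G-zero k φ = trans (W-zero (negBinomial k) φ) (trans (+-identityʳ _) (trans (cong (_* φ []) (negBinomial-0 k)) (*-identityˡ _)))

  Δ-counitˡ : ∀ w (φ : Word → K) → Δ-S w (λ W → εw (proj₁ W) * φ (proj₂ W)) ≡ φ w
  Δ-counitˡ []      φ = trans (Δ-[] λ W → εw (proj₁ W) * φ (proj₂ W)) (*-identityˡ _)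
  Δ-counitˡ (x ∷ v) φ = trans (Δ-∷′ x v λ W → εw (proj₁ W) * φ (proj₂ W)) (trans (cong₂ _+_ (*-identityˡ _)
    (∫-zero (δL x) λ p → ∫-zero (Δw v) λ W → ∫-zero (sh (proj₂ p) (proj₂ W)) λ z → zeroˡ _)) (+-identityʳ _))

  -- Applied to the right factor, ε keeps only the constant coefficient 1 of P^(-k), so x itself is
  -- the only surviving first letter.
  Δ-counitʳ : ∀ w (φ : Word → K) → Δ-S w (λ W → εw (proj₂ W) * φ (proj₁ W)) ≡ φ w
  Δ-counitʳ []      φ = trans (Δ-[] λ W → εw (proj₂ W) * φ (proj₁ W)) (*-identityˡ _)
  Δ-counitʳ (x@(letter n ε hε) ∷ v) φ = begin
    Δ-S (x ∷ v) (λ W → εw (proj₂ W) * φ (proj₁ W))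
      ≡⟨ Δ-∷ x v (λ W → εw (proj₂ W) * φ (proj₁ W)) ⟩
    0# * φ [] + δ x (λ l b → Δ-S v (l ∣ b ▷ λ W → εw (proj₂ W) * φ (proj₁ W)))
      ≡⟨ trans (cong₂ _+_ (zeroˡ _) (δ-cong x λ l b → tail l b)) (+-identityˡ _) ⟩
    δ x (λ l b → εw b * φ (l ∷ v))
      ≡⟨ conv-ext n (λ k d → ∫-*ʳ (G k d) (φ (letter k ε hε ∷ v)) εw) ⟩
    conv n (λ k d → ∫ (G k d) εw * φ (letter k ε hε ∷ v))
      ≡⟨ conv-comm n (λ k d → ∫ (G k d) εw * φ (letter k ε hε ∷ v)) ⟩
    conv n (λ d k → ∫ (G k d) εw * φ (letter k ε hε ∷ v))
      ≡⟨ conv-single n 0 n (λ d k → ∫ (G k d) εw * φ (letter k ε hε ∷ v)) refl off ⟩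
    ∫ (G n 0) εw * φ (x ∷ v)
      ≡⟨ trans (cong (_* φ (x ∷ v)) (G-zero n εw)) (*-identityˡ _) ⟩
    φ (x ∷ v) ∎
    where
    off : ∀ d k → d ≢ 0 → ∫ (G k d) εw * φ (letter k ε hε ∷ v) ≡ 0#
    off zero    k ne = contradiction refl ne
    off (suc d) k ne = trans (cong (_* φ (letter k ε hε ∷ v)) (G-εw k d)) (zeroˡ _)
    tail : ∀ l b → Δ-S v (l ∣ b ▷ λ W → εw (proj₂ W) * φ (proj₁ W)) ≡ εw b * φ (l ∷ v)
    tail l b = trans (∫-cong (Δw v) λ W → trans (∫-*ʳ (sh b (proj₂ W)) (φ (l ∷ proj₁ W)) εw)
        (trans (cong (_* φ (l ∷ proj₁ W)) (S-εw b (proj₂ W))) (*-assoc _ _ _)))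
      (trans (∫-* (Δw v) (εw b) λ W → εw (proj₂ W) * φ (l ∷ proj₁ W)) (cong (εw b *_) (Δ-counitʳ v (l ◁ φ))))

  _⋆_ : (Word → 𝔇) → (Word → 𝔇) → Word → (Word → K) → K
  (f ⋆ g) w φ = Δ-S w (λ W → ∫ (f (proj₁ W) ⧢ g (proj₂ W)) φ)

  -- f ⋆ g = η ∘ ε is solved for g by recursion on the weight, since the term 1 ⊗ w
  -- of Δ(w) contributes f(1) ⧢ g(w) = g(w).
  module RightInverse (f : Word → 𝔇) (f-[] : f [] ≋ ⟦ [] ⟧) where
    drop1 : ∀ {X : Set} → List X → List X
    drop1 []       = []
    drop1 (_ ∷ xs) = xs

    inverseN : ℕ → Word → 𝔇
    inverseN n       []      = ⟦ [] ⟧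
    inverseN zero    (x ∷ v) = []
    inverseN (suc n) (x ∷ v) = concatMap (λ p → scale (- proj₁ p) (f (proj₁ (proj₂ p)) ⧢ inverseN n (proj₂ (proj₂ p)))) (drop1 (Δw (x ∷ v)))

    tail : ∀ x v → (Word × Word → K) → K
    tail x v Φ = δ x (λ l b → Δ-S v (l ∣ b ▷ Φ))

    ∫-drop1 : ∀ x v Φ → ∫ (drop1 (Δw (x ∷ v))) Φ ≡ tail x v Φ
    ∫-drop1 x v Φ = begin
      ∫ (drop1 (Δw (x ∷ v))) Φ                                      ≡⟨ cancel (Φ ([] , x ∷ v)) (∫ (drop1 (Δw (x ∷ v))) Φ) ⟩
      (Φ ([] , x ∷ v) + ∫ (drop1 (Δw (x ∷ v))) Φ) - Φ ([] , x ∷ v)  ≡⟨ cong (λ s → (s + ∫ (drop1 (Δw (x ∷ v))) Φ) - Φ ([] , x ∷ v)) (*-identityˡ _) ⟨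
      Δ-S (x ∷ v) Φ - Φ ([] , x ∷ v)                                ≡⟨ cong (_- Φ ([] , x ∷ v)) (Δ-∷ x v Φ) ⟩
      (Φ ([] , x ∷ v) + tail x v Φ) - Φ ([] , x ∷ v)                ≡⟨ cancel (Φ ([] , x ∷ v)) (tail x v Φ) ⟨
      tail x v Φ ∎
      where
      open IntegerSolver 𝔽-ring
      cancel : ∀ a t → t ≡ (a + t) - a
      cancel = solve 2 (λ a t → t := (a :+ t) :- a) refl

    inverseN-suc : ∀ n x v φ → ∫ (inverseN (suc n) (x ∷ v)) φ ≡ - tail x v (λ W → ∫ (f (proj₁ W) ⧢ inverseN n (proj₂ W)) φ)
    inverseN-suc n x v φ = trans
      (∫-concatMap (λ p → scale (- proj₁ p) (f (proj₁ (proj₂ p)) ⧢ inverseN n (proj₂ (proj₂ p)))) (λ W → - 1# * F W) φ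
        (λ c W → trans (∫-scale (- c) (f (proj₁ W) ⧢ inverseN n (proj₂ W)) φ) (signs c (F W))) (drop1 (Δw (x ∷ v))))
      (trans (∫-* (drop1 (Δw (x ∷ v))) (- 1#) F) (trans (-1*x≈-x _) (cong -_ (∫-drop1 x v F))))
      where
      F : Word × Word → K
      F W = ∫ (f (proj₁ W) ⧢ inverseN n (proj₂ W)) φ
      open IntegerSolver 𝔽-ring
      signs : ∀ c s → (- c) * s ≡ c * (- 1# * s)
      signs = solve 2 (λ c s → (:- c) :* s := c :* ((:- :1) :* s)) refl

    inverseN-fuel : ∀ n n′ w → weight w ℕ.≤ n → weight w ℕ.≤ n′ → ∀ φ → ∫ (inverseN n w) φ ≡ ∫ (inverseN n′ w) φ
    inverseN-fuel n       n′       []      _         _          φ = refl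
    inverseN-fuel (suc n) (suc n′) (x ∷ v) (ℕ.s≤s l) (ℕ.s≤s l′) φ = trans (inverseN-suc n x v φ) (trans (cong -_
      (Δ-tail-congWeight x v {λ W → ∫ (f (proj₁ W) ⧢ inverseN n (proj₂ W)) φ} {λ W → ∫ (f (proj₁ W) ⧢ inverseN n′ (proj₂ W)) φ} λ l₁ p r e → trans (∫-⧢ (f (l₁ ∷ p)) (inverseN n r) φ) (trans (∫-cong (f (l₁ ∷ p)) λ a →
          inverseN-fuel n n′ r (ℕₚ.≤-trans (smaller l₁ p r e) l) (ℕₚ.≤-trans (smaller l₁ p r e) l′) λ b → S a b φ)
        (sym (∫-⧢ (f (l₁ ∷ p)) (inverseN n′ r) φ)))))
      (sym (inverseN-suc n′ x v φ)))
      where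
      smaller : ∀ l p r → weight (l ∷ p) ℕ.+ weight r ≡ weight (x ∷ v) → weight r ℕ.≤ pw x ℕ.+ weight v
      smaller l p r e = subst (weight r ℕ.≤_) (ℕₚ.suc-injective e) (ℕₚ.m≤n+m (weight r) (pw l ℕ.+ weight p))

    inverse : Word → 𝔇
    inverse w = inverseN (weight w) w

    inverse-∷ : ∀ x v φ → ∫ (inverse (x ∷ v)) φ ≡ - tail x v (λ W → ∫ (f (proj₁ W) ⧢ inverse (proj₂ W)) φ)
    inverse-∷ x v φ = trans (inverseN-suc (pw x ℕ.+ weight v) x v φ) (cong -_ (Δ-tail-congWeight x v {λ W → ∫ (f (proj₁ W) ⧢ inverseN (pw x ℕ.+ weight v) (proj₂ W)) φ} {λ W → ∫ (f (proj₁ W) ⧢ inverse (proj₂ W)) φ} λ l p r e →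
      trans (∫-⧢ (f (l ∷ p)) (inverseN (pw x ℕ.+ weight v) r) φ) (trans (∫-cong (f (l ∷ p)) λ a →
          inverseN-fuel (pw x ℕ.+ weight v) (weight r) r (subst (weight r ℕ.≤_) (ℕₚ.suc-injective e) (ℕₚ.m≤n+m (weight r) (pw l ℕ.+ weight p))) ℕₚ.≤-refl λ b → S a b φ)
        (sym (∫-⧢ (f (l ∷ p)) (inverse r) φ)))))

    ∫-f[]-⧢ : ∀ d φ → ∫ (f [] ⧢ d) φ ≡ ∫ d φ
    ∫-f[]-⧢ d φ = trans (∫-⧢ (f []) d φ) (trans (f-[] λ v → ∫ d (λ w → S v w φ)) (trans (sym (∫-⧢ ⟦ [] ⟧ d φ)) (∫-⧢-[]ˡ d φ)))

    right-inverse : ∀ w φ → (f ⋆ inverse) w φ ≡ εw w * φ []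
    right-inverse []      φ = trans (Δ-[] λ W → ∫ (f (proj₁ W) ⧢ inverse (proj₂ W)) φ) (trans (∫-f[]-⧢ ⟦ [] ⟧ φ) (+-identityʳ _))
    right-inverse (x ∷ v) φ = trans (Δ-∷ x v λ W → ∫ (f (proj₁ W) ⧢ inverse (proj₂ W)) φ)
      (trans (cong (_+ tail x v (λ W → ∫ (f (proj₁ W) ⧢ inverse (proj₂ W)) φ)) (trans (∫-f[]-⧢ (inverse (x ∷ v)) φ) (inverse-∷ x v φ)))
        (trans (-‿inverseˡ _) (sym (zeroˡ _))))

  ⟦⟧-inverse : Word → 𝔇
  ⟦⟧-inverse = RightInverse.inverse ⟦_⟧ (λ _ → refl)

  private
    I : Word → 𝔇
    I = ⟦_⟧
    Inv : Word → 𝔇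
    Inv = ⟦⟧-inverse
    II : Word → 𝔇
    II = RightInverse.inverse Inv (λ _ → refl)

  ⟦⟧-⋆-inverse : ∀ w φ → (I ⋆ Inv) w φ ≡ εw w * φ []
  ⟦⟧-⋆-inverse = RightInverse.right-inverse ⟦_⟧ (λ _ → refl)

  -- A right inverse Inv of I that has a right inverse II itself satisfies II = I ⋆ Inv ⋆ II = I.
  double-inverse : ∀ w φ → ∫ (II w) φ ≡ ∫ (I w) φ
  double-inverse w φ = begin
    ∫ (II w) φ
      ≡⟨ Δ-counitˡ w (λ v → ∫ (II v) φ) ⟨
    Δ-S w (λ W → εw (proj₁ W) * ∫ (II (proj₂ W)) φ)
      ≡⟨ (∫-cong (Δw w) λ W → sym (left W)) ⟩
    Δ-S w (λ W → Δ-S (proj₁ W) (λ V → F (proj₁ V) (proj₂ V) (proj₂ W)))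
      ≡⟨ Δ-coassociative w F ⟩
    Δ-S w (λ W → Δ-S (proj₂ W) (λ V → F (proj₁ W) (proj₁ V) (proj₂ V)))
      ≡⟨ (∫-cong (Δw w) λ W → right W) ⟩
    Δ-S w (λ W → εw (proj₂ W) * ∫ (I (proj₁ W)) φ)
      ≡⟨ Δ-counitʳ w (λ v → ∫ (I v) φ) ⟩
    ∫ (I w) φ ∎
    where
    F : Word → Word → Word → K
    F a b c = ∫ ((I a ⧢ Inv b) ⧢ II c) φ
    left : ∀ W → Δ-S (proj₁ W) (λ V → F (proj₁ V) (proj₂ V) (proj₂ W)) ≡ εw (proj₁ W) * ∫ (II (proj₂ W)) φ
    left W = trans (∫-cong (Δw (proj₁ W)) λ V → ∫-⧢ (I (proj₁ V) ⧢ Inv (proj₂ V)) (II (proj₂ W)) φ)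
      (trans (⟦⟧-⋆-inverse (proj₁ W) λ v → ∫ (II (proj₂ W)) λ z → S v z φ)
        (cong (εw (proj₁ W) *_) (∫-cong (II (proj₂ W)) λ z → S-[]ˡ z φ)))
    right : ∀ W → Δ-S (proj₂ W) (λ V → F (proj₁ W) (proj₁ V) (proj₂ V)) ≡ εw (proj₂ W) * ∫ (I (proj₁ W)) φ
    right W = begin
      Δ-S (proj₂ W) (λ V → ∫ ((I (proj₁ W) ⧢ Inv (proj₁ V)) ⧢ II (proj₂ V)) φ)
        ≡⟨ (∫-cong (Δw (proj₂ W)) λ V → trans (A.*-assoc (I (proj₁ W)) (Inv (proj₁ V)) (II (proj₂ V)) φ) (∫-⧢ (I (proj₁ W)) (Inv (proj₁ V) ⧢ II (proj₂ V)) φ)) ⟩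
      Δ-S (proj₂ W) (λ V → ∫ (I (proj₁ W)) (λ v → ∫ (Inv (proj₁ V) ⧢ II (proj₂ V)) (λ z → S v z φ)))
        ≡⟨ ∫-swap (Δw (proj₂ W)) (I (proj₁ W)) (λ V v → ∫ (Inv (proj₁ V) ⧢ II (proj₂ V)) (λ z → S v z φ)) ⟩
      ∫ (I (proj₁ W)) (λ v → (Inv ⋆ II) (proj₂ W) (λ z → S v z φ))
        ≡⟨ (∫-cong (I (proj₁ W)) λ v → trans (RightInverse.right-inverse Inv (λ _ → refl) (proj₂ W) λ z → S v z φ) (cong (εw (proj₂ W) *_) (S-[]ʳ v φ))) ⟩
      ∫ (I (proj₁ W)) (λ v → εw (proj₂ W) * φ v)
        ≡⟨ ∫-* (I (proj₁ W)) (εw (proj₂ W)) φ ⟩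
      εw (proj₂ W) * ∫ (I (proj₁ W)) φ ∎

  inverse-⋆-⟦⟧ : ∀ w φ → (Inv ⋆ I) w φ ≡ εw w * φ []
  inverse-⋆-⟦⟧ w φ = trans (∫-cong (Δw w) λ W → trans (∫-⧢ (Inv (proj₁ W)) (I (proj₂ W)) φ)
      (trans (∫-cong (Inv (proj₁ W)) λ v → sym (double-inverse (proj₂ W) λ z → S v z φ)) (sym (∫-⧢ (Inv (proj₁ W)) (II (proj₂ W)) φ))))
    (RightInverse.right-inverse Inv (λ _ → refl) w φ)

-- The Hopf algebra axioms in terms of coefficients.

module HopfAlgebra (q : ℕ) (𝔽 : FiniteField q) where
  open Construction q 𝔽 hiding (_+_; _*_; -_; 0#; 1#; Carrier; _≟_; card)
  open FiniteField 𝔽 using (_≟_; card)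
  open Inverse card using (to; from; strictlyInverseˡ)
  open FieldFacts q 𝔽 using (𝔽-ring)
  open CommutativeRing 𝔽-ring hiding (refl; sym; trans; _≈_) renaming (Carrier to K)
  open IntegerSolver 𝔽-ring
  open Pairing q 𝔽
  open Shuffle q 𝔽
  open LetterProducts q 𝔽 using (_≋_; ∫-⧢-[]ʳ; ∫-⧢-[]ˡ)
  open ShuffleAlgebra q 𝔽 using (algebra-𝔇; S-⟦⟧; ∫-⊗)
  open Coproduct q 𝔽 using (Δ-S; Δ-[])
  open Coassociativity q 𝔽 using (∫-Δ; Δ-coassociative) renaming (Δ-⧢ to Δ-⧢≋)
  open GradingAndAntipode q 𝔽
  open ≡-Reasoning
  private module A = 𝔽-Algebra algebra-𝔇

  indicator : Word → Word → K
  indicator w v with v ≟W w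
  ... | yes _ = 1#
  ... | no  _ = 0#

  indicator-≢ : ∀ {w v} → v ≢ w → indicator w v ≡ 0#
  indicator-≢ {w} {v} ne with v ≟W w
  ... | yes e = contradiction e ne
  ... | no  _ = refl

  coeff-∫ : ∀ w d → coeff w d ≡ ∫ d (indicator w)
  coeff-∫ w []            = refl
  coeff-∫ w ((c , v) ∷ d) with v ≟W w
  ... | yes _ = cong₂ _+_ (sym (*-identityʳ c)) (coeff-∫ w d)
  ... | no  _ = cong₂ _+_ (sym (zeroʳ c)) (coeff-∫ w d)

  indicator² : Word → Word → Word × Word → K
  indicator² w₁ w₂ (v₁ , v₂) = indicator w₁ v₁ * indicator w₂ v₂

  coeff²-∫ : ∀ w₁ w₂ d → coeff² w₁ w₂ d ≡ ∫ d (indicator² w₁ w₂)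
  coeff²-∫ w₁ w₂ []                  = refl
  coeff²-∫ w₁ w₂ ((c , v₁ , v₂) ∷ d) with v₁ ≟W w₁ | v₂ ≟W w₂
  ... | yes _ | yes _ = cong₂ _+_ (solve 1 (λ c → c := c :* (:1 :* :1)) refl c) (coeff²-∫ w₁ w₂ d)
  ... | yes _ | no  _ = cong₂ _+_ (solve 1 (λ c → :0 := c :* (:1 :* :0)) refl c) (coeff²-∫ w₁ w₂ d)
  ... | no  _ | yes _ = cong₂ _+_ (solve 1 (λ c → :0 := c :* (:0 :* :1)) refl c) (coeff²-∫ w₁ w₂ d)
  ... | no  _ | no  _ = cong₂ _+_ (solve 1 (λ c → :0 := c :* (:0 :* :0)) refl c) (coeff²-∫ w₁ w₂ d)

  indicator³ : Word → Word → Word → Word × Word × Word → K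
  indicator³ w₁ w₂ w₃ (v₁ , v₂ , v₃) = indicator w₁ v₁ * (indicator w₂ v₂ * indicator w₃ v₃)

  coeff³-∫ : ∀ w₁ w₂ w₃ d → coeff³ w₁ w₂ w₃ d ≡ ∫ d (indicator³ w₁ w₂ w₃)
  coeff³-∫ w₁ w₂ w₃ []                       = refl
  coeff³-∫ w₁ w₂ w₃ ((c , v₁ , v₂ , v₃) ∷ d) with v₁ ≟W w₁ | v₂ ≟W w₂ | v₃ ≟W w₃
  ... | yes _ | yes _ | yes _ = cong₂ _+_ (solve 1 (λ c → c := c :* (:1 :* (:1 :* :1))) refl c) (coeff³-∫ w₁ w₂ w₃ d)
  ... | yes _ | yes _ | no  _ = cong₂ _+_ (solve 1 (λ c → :0 := c :* (:1 :* (:1 :* :0))) refl c) (coeff³-∫ w₁ w₂ w₃ d)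
  ... | yes _ | no  _ | yes _ = cong₂ _+_ (solve 1 (λ c → :0 := c :* (:1 :* (:0 :* :1))) refl c) (coeff³-∫ w₁ w₂ w₃ d)
  ... | yes _ | no  _ | no  _ = cong₂ _+_ (solve 1 (λ c → :0 := c :* (:1 :* (:0 :* :0))) refl c) (coeff³-∫ w₁ w₂ w₃ d)
  ... | no  _ | yes _ | yes _ = cong₂ _+_ (solve 1 (λ c → :0 := c :* (:0 :* (:1 :* :1))) refl c) (coeff³-∫ w₁ w₂ w₃ d)
  ... | no  _ | yes _ | no  _ = cong₂ _+_ (solve 1 (λ c → :0 := c :* (:0 :* (:1 :* :0))) refl c) (coeff³-∫ w₁ w₂ w₃ d)
  ... | no  _ | no  _ | yes _ = cong₂ _+_ (solve 1 (λ c → :0 := c :* (:0 :* (:0 :* :1))) refl c) (coeff³-∫ w₁ w₂ w₃ d)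
  ... | no  _ | no  _ | no  _ = cong₂ _+_ (solve 1 (λ c → :0 := c :* (:0 :* (:0 :* :0))) refl c) (coeff³-∫ w₁ w₂ w₃ d)

  -- A coefficient is the value on the indicator functional of a word.
  ≋⇒≈ : ∀ {a b} → a ≋ b → a ≈ b
  ≋⇒≈ {a} {b} h w = trans (coeff-∫ w a) (trans (h (indicator w)) (sym (coeff-∫ w b)))

  ≋⇒≈² : ∀ {a b} → a ≋ b → a ≈² b
  ≋⇒≈² {a} {b} h w₁ w₂ = trans (coeff²-∫ w₁ w₂ a) (trans (h (indicator² w₁ w₂)) (sym (coeff²-∫ w₁ w₂ b)))

  ≋⇒≈³ : ∀ {a b} → a ≋ b → a ≈³ b
  ≋⇒≈³ {a} {b} h w₁ w₂ w₃ = trans (coeff³-∫ w₁ w₂ w₃ a) (trans (h (indicator³ w₁ w₂ w₃)) (sym (coeff³-∫ w₁ w₂ w₃ b)))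

  ∫-map-weighted : ∀ {B C : Set} (k : B → K) (f : B → C) (g : K × B → K × C) → (∀ p → g p ≡ (proj₁ p * k (proj₂ p) , f (proj₂ p))) →
    ∀ d φ → ∫ (map g d) φ ≡ ∫ d (λ b → k b * φ (f b))
  ∫-map-weighted k f g h []            φ = refl
  ∫-map-weighted k f g h ((c , b) ∷ d) φ rewrite h (c , b) = cong₂ _+_ (*-assoc c (k b) _) (∫-map-weighted k f g h d φ)

  ∫-ε⊗id : ∀ d φ → ∫ (ε⊗id d) φ ≡ ∫ d (λ W → εw (proj₁ W) * φ (proj₂ W))
  ∫-ε⊗id d φ = ∫-map-weighted (εw ∘ proj₁) proj₂ _ (λ _ → refl) d φ

  ∫-id⊗ε : ∀ d φ → ∫ (id⊗ε d) φ ≡ ∫ d (λ W → εw (proj₂ W) * φ (proj₁ W))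
  ∫-id⊗ε d φ = ∫-map-weighted (εw ∘ proj₂) proj₁ _ (λ _ → refl) d φ

  ∫-Δ⊗id : ∀ d Φ → ∫ (Δ⊗id d) Φ ≡ ∫ d (λ W → Δ-S (proj₁ W) (λ V → Φ (proj₁ V , proj₂ V , proj₂ W)))
  ∫-Δ⊗id d Φ = ∫-concatMap _ (λ W → Δ-S (proj₁ W) (λ V → Φ (proj₁ V , proj₂ V , proj₂ W))) Φ
    (λ c W → ∫-map-scale c (λ V → proj₁ V , proj₂ V , proj₂ W) _ (λ _ → refl) (Δw (proj₁ W)) Φ) d

  ∫-id⊗Δ : ∀ d Φ → ∫ (id⊗Δ d) Φ ≡ ∫ d (λ W → Δ-S (proj₂ W) (λ V → Φ (proj₁ W , proj₁ V , proj₂ V)))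
  ∫-id⊗Δ d Φ = ∫-concatMap _ (λ W → Δ-S (proj₂ W) (λ V → Φ (proj₁ W , proj₁ V , proj₂ V))) Φ
    (λ c W → ∫-map-scale c (λ V → proj₁ W , proj₁ V , proj₂ V) _ (λ _ → refl) (Δw (proj₂ W)) Φ) d

  ∫-mult∘⊗ : ∀ f g d φ → ∫ (mult∘⊗ f g d) φ ≡ ∫ d (λ W → ∫ (f (proj₁ W) ⧢ g (proj₂ W)) φ)
  ∫-mult∘⊗ f g d φ = ∫-concatMap _ (λ W → ∫ (f (proj₁ W) ⧢ g (proj₂ W)) φ) φ
    (λ c W → ∫-scale c (f (proj₁ W) ⧢ g (proj₂ W)) φ) d

  ε-∫ : ∀ d → ε d ≡ ∫ d εw
  ε-∫ []            = refl
  ε-∫ ((c , w) ∷ d) = cong (_+_ (c * εw w)) (ε-∫ d)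

  coassociative : ∀ a → Δ⊗id (Δ a) ≋ id⊗Δ (Δ a)
  coassociative a Φ = begin
    ∫ (Δ⊗id (Δ a)) Φ
      ≡⟨ trans (∫-Δ⊗id (Δ a) Φ) (∫-Δ a λ W → Δ-S (proj₁ W) (λ V → Φ (proj₁ V , proj₂ V , proj₂ W))) ⟩
    ∫ a (λ w → Δ-S w (λ W → Δ-S (proj₁ W) (λ V → Φ (proj₁ V , proj₂ V , proj₂ W))))
      ≡⟨ (∫-cong a λ w → Δ-coassociative w λ p r s → Φ (p , r , s)) ⟩
    ∫ a (λ w → Δ-S w (λ W → Δ-S (proj₂ W) (λ V → Φ (proj₁ W , proj₁ V , proj₂ V))))
      ≡⟨ trans (∫-id⊗Δ (Δ a) Φ) (∫-Δ a λ W → Δ-S (proj₂ W) (λ V → Φ (proj₁ W , proj₁ V , proj₂ V))) ⟨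
    ∫ (id⊗Δ (Δ a)) Φ ∎

  counitˡ : ∀ a → ε⊗id (Δ a) ≋ a
  counitˡ a φ = trans (∫-ε⊗id (Δ a) φ) (trans (∫-Δ a λ W → εw (proj₁ W) * φ (proj₂ W)) (∫-cong a λ w → Δ-counitˡ w φ))

  counitʳ : ∀ a → id⊗ε (Δ a) ≋ a
  counitʳ a φ = trans (∫-id⊗ε (Δ a) φ) (trans (∫-Δ a λ W → εw (proj₂ W) * φ (proj₁ W)) (∫-cong a λ w → Δ-counitʳ w φ))

  unital : Δ (u 1#) ≋ u 1# ⊗ u 1#
  unital Φ = trans (∫-Δ (u 1#) Φ) (trans (∫-single [] λ w → Δ-S w Φ) (trans (Δ-[] Φ)
    (sym (trans (∫-⊗ (u 1#) (u 1#) Φ) (trans (∫-single [] λ v → ∫ (u 1#) λ w → Φ (v , w)) (∫-single [] λ w → Φ ([] , w)))))))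

  ε-multiplicative : ∀ a b → ε (a ⧢ b) ≡ ε a * ε b
  ε-multiplicative a b = begin
    ε (a ⧢ b)                                    ≡⟨ trans (ε-∫ (a ⧢ b)) (∫-⧢ a b εw) ⟩
    ∫ a (λ v → ∫ b (λ w → S v w εw))             ≡⟨ (∫-cong a λ v → trans (∫-cong b λ w → S-εw v w) (∫-* b (εw v) εw)) ⟩
    ∫ a (λ v → εw v * ∫ b εw)                    ≡⟨ ∫-*ʳ a (∫ b εw) εw ⟩
    ∫ a εw * ∫ b εw                              ≡⟨ cong₂ _*_ (ε-∫ a) (ε-∫ b) ⟨
    ε a * ε b ∎

  convolution : ∀ f g → (∀ w φ → (f ⋆ g) w φ ≡ εw w * φ []) → ∀ a → mult∘⊗ f g (Δ a) ≋ u (ε a)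
  convolution f g h a φ = begin
    ∫ (mult∘⊗ f g (Δ a)) φ                ≡⟨ trans (∫-mult∘⊗ f g (Δ a) φ) (∫-Δ a λ W → ∫ (f (proj₁ W) ⧢ g (proj₂ W)) φ) ⟩
    ∫ a (λ w → (f ⋆ g) w φ)               ≡⟨ (∫-cong a λ w → h w φ) ⟩
    ∫ a (λ w → εw w * φ [])               ≡⟨ ∫-*ʳ a (φ []) εw ⟩
    ∫ a εw * φ []                         ≡⟨ cong (_* φ []) (ε-∫ a) ⟨
    ε a * φ []                            ≡⟨ +-identityʳ _ ⟨
    ∫ (u (ε a)) φ ∎

  product-graded : ∀ v w x → coeff x (⟦ v ⟧ ⧢ ⟦ w ⟧) ≢ 0# → weight x ≡ weight v ℕ.+ weight w
  product-graded v w x ne with weight x ℕ.≟ weight v ℕ.+ weight w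
  ... | yes e = e
  ... | no ¬e = contradiction (trans (coeff-∫ x (⟦ v ⟧ ⧢ ⟦ w ⟧)) (trans (S-⟦⟧ v w (indicator x))
    (trans (S-congWeight v w {ψ = λ _ → 0#} λ z ez → indicator-≢ {x} {z} λ z≡x → ¬e (trans (cong weight (sym z≡x)) ez)) (∫-zero (sh v w) λ _ → refl)))) ne

  coproduct-graded : ∀ w x₁ x₂ → coeff² x₁ x₂ (Δw w) ≢ 0# → weight x₁ ℕ.+ weight x₂ ≡ weight w
  coproduct-graded w x₁ x₂ ne with weight x₁ ℕ.+ weight x₂ ℕ.≟ weight w
  ... | yes e = e
  ... | no ¬e = contradiction (trans (coeff²-∫ x₁ x₂ (Δw w)) (trans (Δ-congWeight w {indicator² x₁ x₂} {λ _ → 0#} off) (∫-zero (Δw w) λ _ → refl))) ne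
    where
    off : ∀ p r → weight p ℕ.+ weight r ≡ weight w → indicator x₁ p * indicator x₂ r ≡ 0#
    off p r e with p ≟W x₁
    ... | no  _    = zeroˡ _
    ... | yes refl = trans (*-identityˡ _) (indicator-≢ {x₂} {r} λ { refl → ¬e e })

  nonzero : ℕ → (x : K) → List Letter
  nonzero i x with x ≟ 0#
  ... | yes _ = []
  ... | no  h = letter i x h ∷ []

  letters : ℕ → List Letter
  letters i = concatMap (λ j → nonzero i (to j)) (allFin q)

  -- One argument bounds both the letters and the depth, so words of larger weight are listed too;
  -- finite type only asks for a list that contains all words of the given weight.
  words : ℕ → List Word
  words zero    = [] ∷ []
  words (suc n) = [] ∷ concatMap (λ i → concatMap (λ l → map (l ∷_) (words n)) (letters i)) (upTo (suc n))

  ∈-concatMap : ∀ {X Z : Set} (f : X → List Z) {x : X} {xs z} → x ∈ xs → z ∈ f x → z ∈ concatMap f xs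
  ∈-concatMap f (here refl) h = ∈-++⁺ˡ h
  ∈-concatMap f (there {y} p) h = ∈-++⁺ʳ (f y) (∈-concatMap f p h)

  ∈-letters : ∀ i x .(h : x ≢ 0#) → letter i x h ∈ letters i
  ∈-letters i x h = ∈-concatMap (λ j → nonzero i (to j)) (∈-allFin (from x)) (subst (λ y → letter i x h ∈ nonzero i y) (sym (strictlyInverseˡ x)) found)
    where
    found : letter i x h ∈ nonzero i x
    found with x ≟ 0#
    ... | yes e = ⊥-elim-irr (h e)
    ... | no  _ = here refl

  ∈-words : ∀ n w → weight w ℕ.≤ n → w ∈ words n
  ∈-words zero    []               _         = here refl
  ∈-words (suc n) []               _         = here refl
  ∈-words (suc n) (letter i x h ∷ w) (ℕ.s≤s l) = there (∈-concatMap (λ i → concatMap (λ l → map (l ∷_) (words n)) (letters i))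
    (∈-upTo⁺ (ℕ.s≤s (ℕₚ.≤-trans (ℕₚ.m≤m+n i (weight w)) l)))
    (∈-concatMap (λ l → map (l ∷_) (words n)) (∈-letters i x h) (∈-map⁺ (letter i x h ∷_) (∈-words n w (ℕₚ.≤-trans (ℕₚ.m≤n+m (weight w) i) l)))))

  isHopfAlgebra : IsConnectedGradedHopfAlgebraOfFiniteType
  isHopfAlgebra = record
    { ⧢-assoc     = λ a b c → ≋⇒≈ {(a ⧢ b) ⧢ c} {a ⧢ (b ⧢ c)} (A.*-assoc a b c)
    ; ⧢-identityˡ = λ a → ≋⇒≈ {u 1# ⧢ a} {a} (∫-⧢-[]ˡ a)
    ; ⧢-identityʳ = λ a → ≋⇒≈ {a ⧢ u 1#} {a} (∫-⧢-[]ʳ a)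
    ; Δ-coassoc   = λ a → ≋⇒≈³ {Δ⊗id (Δ a)} {id⊗Δ (Δ a)} (coassociative a)
    ; ε-counitˡ   = λ a → ≋⇒≈ {ε⊗id (Δ a)} {a} (counitˡ a)
    ; ε-counitʳ   = λ a → ≋⇒≈ {id⊗ε (Δ a)} {a} (counitʳ a)
    ; Δ-⧢         = λ a b → ≋⇒≈² {Δ (a ⧢ b)} {Δ a ⧢² Δ b} (Δ-⧢≋ a b)
    ; Δ-unit      = ≋⇒≈² {Δ (u 1#)} {u 1# ⊗ u 1#} unital
    ; ε-⧢         = ε-multiplicative
    ; ε-unit      = trans (+-identityʳ _) (*-identityˡ 1#)
    ; antipode    = ⟦⟧-inverse
                  , (λ a → ≋⇒≈ {mult∘⊗ ⟦⟧-inverse ⟦_⟧ (Δ a)} {u (ε a)} (convolution ⟦⟧-inverse ⟦_⟧ inverse-⋆-⟦⟧ a))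
                  , (λ a → ≋⇒≈ {mult∘⊗ ⟦_⟧ ⟦⟧-inverse (Δ a)} {u (ε a)} (convolution ⟦_⟧ ⟦⟧-inverse ⟦⟧-⋆-inverse a))
    ; ⧢-graded    = product-graded
    ; Δ-graded    = coproduct-graded
    ; ε-graded    = λ { [] _ → refl ; (_ ∷ _) ne → contradiction refl ne }
    ; connected   = λ { [] _ → refl }
    ; finiteType  = λ n → words n , λ w e → ∈-words n w (ℕₚ.≤-reflexive e)
    }

theorem6p9 : (q : ℕ) → IsPrimePower q → (𝔽 : FiniteField q)
    → Construction.IsConnectedGradedHopfAlgebraOfFiniteType q 𝔽
theorem6p9 q _ 𝔽 = HopfAlgebra.isHopfAlgebra q 𝔽
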